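{- For every integer $r\geq 3$, the limit $\lim_{n\to\infty} n^{ -2} f^{(r)}(n;5r-8,5)$ exists and equals $\frac{1}{r^2-r-1}$.
   Context: An $r$-graph is an $r$-uniform hypergraph. For positive integers $s,k$, an $(s,k)$-configuration is an $r$-graph with exactly $k$ edges and at most $s$ vertices; an $r$-graph is $(s,k)$-free if it contains no $(s,k)$-configuration as a subgraph. For integers $r,n,s,k$, $f^{(r)}(n;s,k)$ denotes the maximum number of edges in an $n$-vertex $r$-graph that is $(s,k)$-free. -}

module Defs where

open import Data.Bool.Properties using () renaming (_≟_ to _≟ᵇ_)
open import Data.Fin.Base using (Fin; zero; suc; funToFin; finToFun)
open import Data.Fin.Properties using (injective⇒≤; finToFun-funToFin; 2↔Bool)
open import Data.Fin.Subset using (Subset; ∣_∣; _⊆_; ⊤)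
open import Data.Fin.Subset.Properties using (anySubset?; _⊆?_; ∣⊤∣≡n)
open import Data.Integer.Base using (+_)
open import Data.List.Base as List using (List; []; _∷_; length)
open import Data.List.Membership.Propositional.Properties using (∈-lookup)
open import Data.List.Relation.Binary.Subset.Propositional renaming (_⊆_ to _⊆ᴸ_)
import Data.List.Relation.Binary.Subset.DecPropositional as ListSubset
open import Data.List.Relation.Unary.All as All using (All; []; all?)
open import Data.List.Relation.Unary.Any using (here)
open import Data.List.Relation.Unary.AllPairs using ([]; _∷_)
open import Data.List.Relation.Unary.Unique.Propositional using (Unique)
open import Data.List.Relation.Unary.Unique.DecPropositional using (unique?)
open import Data.Nat.Base
  using (ℕ; zero; suc; _+_; _*_; _∸_; _^_; _≤_; _≥_; NonZero; >-nonZero)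
open import Data.Nat.Properties as ℕ using (_≟_; _≤?_)
open import Data.Product.Base using (∃; ∃-syntax; _×_; _,_; proj₁; proj₂)
open import Data.Rational.Base as ℚ using (ℚ; 0ℚ; _/_)
open import Data.Vec.Base as Vec using ()
import Data.Vec.Properties as Vec
open import Function.Base using (_∘_)
open import Function.Bundles using (Inverse)
open import Function.Definitions using (Injective)
open import Level using (0ℓ)
open import Relation.Binary.Definitions using (DecidableEquality)
open import Relation.Binary.PropositionalEquality
  using (_≡_; refl; sym; trans; cong; subst; module ≡-Reasoning)
open import Relation.Nullary using (¬_; Dec; yes; no; ¬?; contradiction)
open import Relation.Nullary.Decidable using (_×-dec_; map′)
open import Relation.Unary using (Pred; Decidable)

-- Vertices are drawn from Fin n but need not exhaust it, so that a graph
-- and its subgraphs have the same type.  Edges form a duplicate-free list,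
-- whose order plays no role.
record RGraph (r n : ℕ) : Set where
  field
    vertices : Subset n
    edges    : List (Subset n)
    distinct : Unique edges
    uniform  : All (λ e → ∣ e ∣ ≡ r) edges
    within   : All (_⊆ vertices) edges

  numVertices : ℕ
  numVertices = ∣ vertices ∣

  numEdges : ℕ
  numEdges = length edges

open RGraph public

module _ {r n : ℕ} where

  _isSubgraphOf_ : RGraph r n → RGraph r n → Set
  H isSubgraphOf G = vertices H ⊆ vertices G × edges H ⊆ᴸ edges G

  IsConfiguration : (s k : ℕ) → RGraph r n → Set
  IsConfiguration s k H = numEdges H ≡ k × numVertices H ≤ s

  Free : (s k : ℕ) → RGraph r n → Set
  Free s k G = ∀ H → H isSubgraphOf G → ¬ IsConfiguration s k H

IsMaximum : Pred ℕ 0ℓ → ℕ → Set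
IsMaximum P m = P m × (∀ {l} → P l → l ≤ m)

-- m is the number of edges of some (s , k)-free r-graph with n vertices;
-- the vertices may be labelled so that the vertex set is all of Fin n.
FreeGraphSize : (r n s k : ℕ) → Pred ℕ 0ℓ
FreeGraphSize r n s k m =
  ∃[ G ] numVertices {r} {n} G ≡ n × Free s k G × numEdges G ≡ m

private

  _≟ˢ_ : ∀ {n} → DecidableEquality (Subset n)
  _≟ˢ_ = Vec.≡-dec _≟ᵇ_

  anyList? : ∀ {n} m {P : Pred (List (Subset n)) 0ℓ} → Decidable P →
             Dec (∃[ xs ] length xs ≡ m × P xs)
  anyList? zero P? =
    map′ (λ p → [] , refl , p) (λ { ([] , _ , p) → p }) (P? [])
  anyList? (suc m) P? =
    map′ (λ { (x , xs , eq , p) → x ∷ xs , cong suc eq , p })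
         (λ { (x ∷ xs , eq , p) → x , xs , ℕ.suc-injective eq , p })
         (anySubset? λ x → anyList? m λ xs → P? (x ∷ xs))

  module _ {r n : ℕ} where

    anyGraph? : ∀ m {P : Subset n → List (Subset n) → Set} →
                (∀ V E → Dec (P V E)) →
                Dec (∃[ G ] numEdges {r} {n} G ≡ m × P (vertices G) (edges G))
    anyGraph? m P? =
      map′ (λ { (V , E , eq , u , c , w , p) → record
                  { vertices = V ; edges = E ; distinct = u ; uniform = c ; within = w }
                  , eq , p })
           (λ { (G , eq , p) → vertices G , edges G , eq
                             , distinct G , uniform G , within G , p })
           (anySubset? λ V → anyList? m λ E →
              unique? _≟ˢ_ E ×-dec all? (λ e → ∣ e ∣ ≟ r) E
                ×-dec all? (_⊆? V) E ×-dec P? V E)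

    Avoids : (s k : ℕ) → Subset n → List (Subset n) → Set
    Avoids s k V E = ∀ (H : RGraph r n) → vertices H ⊆ V × edges H ⊆ᴸ E →
                     ¬ IsConfiguration s k H

    avoids? : ∀ s k V E → Dec (Avoids s k V E)
    avoids? s k V E =
      map′ (λ ¬any H sub (eq , le) → ¬any (H , eq , sub , le))
           (λ av (H , eq , sub , le) → av H sub (eq , le))
           (¬? (anyGraph? k λ V′ E′ →
              (V′ ⊆? V ×-dec ListSubset._⊆?_ _≟ˢ_ E′ E) ×-dec ∣ V′ ∣ ≤? s))

  freeGraphSize? : ∀ r n s k → Decidable (FreeGraphSize r n s k)
  freeGraphSize? r n s k m =
    map′ (λ { (G , eq , nv , fr) → G , nv , fr , eq })
         (λ { (G , nv , fr , eq) → G , eq , nv , fr })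
         (anyGraph? m λ V E → ∣ V ∣ ≟ n ×-dec avoids? {r} s k V E)

  lookup-injective : ∀ {A : Set} {xs : List A} → Unique xs →
                     Injective _≡_ _≡_ (List.lookup xs)
  lookup-injective (x∉ ∷ u) {zero}  {zero}  eq = refl
  lookup-injective (x∉ ∷ u) {zero}  {suc j} eq =
    contradiction eq (All.lookup x∉ (∈-lookup j))
  lookup-injective (x∉ ∷ u) {suc i} {zero}  eq =
    contradiction (sym eq) (All.lookup x∉ (∈-lookup i))
  lookup-injective (x∉ ∷ u) {suc i} {suc j} eq = cong suc (lookup-injective u eq)

  code : ∀ {n} → Subset n → Fin (2 ^ n)
  code p = funToFin (Inverse.from 2↔Bool ∘ Vec.lookup p)

  code-injective : ∀ {n} → Injective _≡_ _≡_ (code {n})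
  code-injective {n} {p} {q} eq = begin
    p                          ≡⟨ Vec.tabulate∘lookup p ⟨
    Vec.tabulate (Vec.lookup p) ≡⟨ Vec.tabulate-cong same ⟩
    Vec.tabulate (Vec.lookup q) ≡⟨ Vec.tabulate∘lookup q ⟩
    q                          ∎
    where
    open ≡-Reasoning
    same : ∀ i → Vec.lookup p i ≡ Vec.lookup q i
    same i = begin
      Vec.lookup p i                                ≡⟨ decode p ⟨
      Inverse.to 2↔Bool (finToFun (code p) i)       ≡⟨ cong (λ c → Inverse.to 2↔Bool (finToFun c i)) eq ⟩
      Inverse.to 2↔Bool (finToFun (code q) i)       ≡⟨ decode q ⟩
      Vec.lookup q i                                ∎
      where
      decode : ∀ s → Inverse.to 2↔Bool (finToFun (code s) i) ≡ Vec.lookup s i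
      decode s = trans
        (cong (Inverse.to 2↔Bool) (finToFun-funToFin (Inverse.from 2↔Bool ∘ Vec.lookup s) i))
        (Inverse.strictlyInverseˡ 2↔Bool (Vec.lookup s i))

  numEdges≤2^n : ∀ {r n} (G : RGraph r n) → numEdges G ≤ 2 ^ n
  numEdges≤2^n G = injective⇒≤ (lookup-injective (distinct G) ∘ code-injective)

  maximum : ∀ {P : Pred ℕ 0ℓ} → Decidable P → P 0 →
            ∀ b → (∀ {l} → P l → l ≤ b) → ∃ (IsMaximum P)
  maximum P? p₀ zero    bound = 0 , p₀ , bound
  maximum {P} P? p₀ (suc b) bound with P? (suc b)
  ... | yes p = suc b , p , bound
  ... | no ¬p = maximum P? p₀ b λ {l} pl →
    ℕ.≤-pred (ℕ.≤∧≢⇒< (bound pl) λ l≡ → ¬p (subst P l≡ pl))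

  emptyGraph : ∀ r n → RGraph r n
  emptyGraph r n = record
    { vertices = ⊤ ; edges = [] ; distinct = [] ; uniform = [] ; within = [] }

  emptyGraph-free : ∀ r n s k .{{_ : NonZero k}} → Free s k (emptyGraph r n)
  emptyGraph-free r n s (suc k) H (_ , E⊆[]) (eq , _) with edges H
  emptyGraph-free r n s (suc k) H (_ , E⊆[]) (() , _) | []
  ... | e ∷ _ with () ← E⊆[] (here refl)

-- For k = 0 there is no maximum: the empty graph is then a configuration.
maxFreeGraphSize : ∀ r n s k .{{_ : NonZero k}} → ∃ (IsMaximum (FreeGraphSize r n s k))
maxFreeGraphSize r n s k = maximum (freeGraphSize? r n s k)
  (emptyGraph r n , ∣⊤∣≡n n , emptyGraph-free r n s k , refl)
  (2 ^ n) (λ { (G , _ , _ , refl) → numEdges≤2^n G })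

f⁽_⁾ : (r n s k : ℕ) .{{_ : NonZero k}} → ℕ
f⁽ r ⁾ n s k = proj₁ (maxFreeGraphSize r n s k)

-- Convergence of a rational sequence indexed by the positive integers,
-- to a rational limit; it suffices to let ε range over the positive rationals.
_ConvergesTo_ : ((n : ℕ) .{{_ : NonZero n}} → ℚ) → ℚ → Set
a ConvergesTo L = ∀ ε → 0ℚ ℚ.< ε →
  ∃[ N ] (∀ n .{{_ : NonZero n}} → n ≥ N → ℚ.∣ a n ℚ.- L ∣ ℚ.< ε)

_/[_]² : (m n : ℕ) .{{_ : NonZero n}} → ℚ
m /[ n ]² = (+ m / (n ^ 2)) {{ℕ.m^n≢0 n 2}}

r²-r-1≢0 : ∀ {r} → r ≥ 3 → NonZero (r ^ 2 ∸ r ∸ 1)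
r²-r-1≢0 {r} r≥3 = >-nonZero (ℕ.m<n⇒0<n∸m (ℕ.m+n≤o⇒m≤o∸n 2 (begin
  2 + r        ≤⟨ ℕ.+-monoˡ-≤ r (ℕ.≤-trans (ℕ.n≤1+n 2) r≥3) ⟩
  r + r        ≤⟨ ℕ.+-monoʳ-≤ r (ℕ.m≤m+n r (r + 0)) ⟩
  3 * r        ≤⟨ ℕ.*-monoˡ-≤ r r≥3 ⟩
  r * r        ≡⟨ cong (r *_) (ℕ.*-identityʳ r) ⟨
  r ^ 2        ∎)))
  where open ℕ.≤-Reasoning

{-# OPTIONS --safe #-}
-- Put ρ = r² − r − 1.
--
-- Upper bound.  Edge-disjoint (4r−7,4)-configurations are vertex-disjoint, and once these are gone the same
-- holds for (2r−3,2)- and then for (3r−5,3)-configurations, so deleting O(n) edges destroys all of them.  In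
-- what remains call two edges adjacent if they share two vertices.  Five edges connected by adjacency would
-- span 5r−8 vertices.  A component of one or two edges covers at least ρ ordered pairs of vertices per edge.
-- A larger one contains a path e, f, g, and a pair of one vertex of e ∖ f and one of f ∖ e is either covered
-- by no edge, and makes up for the loss, or lies in a single further edge, which joins the group.  No pair is
-- charged to two groups, so ρ |G| ≤ n² + O(n).
--
-- Lower bound.  A diamond is a pair of edges sharing two vertices.  The pattern has a diamond for every d × d
-- matrix over Fin ℓ, where d = r − 2: two private vertices, and one vertex for each row (on the left edge) and
-- each column (on the right edge), which forgets the entries of that line.  Pairs inside diamonds are then
-- shared so rarely that a pattern has about 1/ρ edges for each claimed ordered pair, and no three edges of
-- different diamonds form a triangle.  Copies of the pattern are packed so that a claimed pair lies in one copy
-- only and almost all pairs of vertices are claimed; extra coordinates modulo a large N, linear in generic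
-- slopes, destroy the Pasch, mitre and grid systems that involve distinct copies.  Five edges on 5r − 8
-- vertices would contain such a system, or two diamonds that share two vertices and are joined by an edge of a
-- third one, which the pattern excludes.
module Submission where

-- The constant: a diamond covers 2 r (r - 1) - 2 ordered pairs with two edges, that is ρ per edge.
-- The obstacle in the lower bound is that the pattern must be packed almost perfectly and yet
-- without short cyclic systems of copies. The answer is algebraic throughout: a copy is a tuple of
-- lines modulo N, two parameters per coordinate, and a vertex is a tuple of residues, one per
-- coordinate. T further coordinates multiply the vertices by N^T and the copies by N^(2T), which
-- leaves the number of copies over the square of the number of vertices unchanged. Any number of
-- coordinates may therefore be spent on bad systems at no cost in density. A system of copies over
-- distinct blocks is refuted by one coordinate in which its incidences add up to 1 ≡ 0. A system
-- over a single block is forced to be a single copy, because a determinant in the slopes is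
-- invertible modulo N. Only boundedly many integers have to be invertible, so moduli of the form 1
-- + K! s suffice and no primes occur.

-- Cancellation modulo N, and residues.

module Residues where

  open import Data.Fin.Base using (Fin; toℕ; fromℕ<)
  open import Data.Fin.Properties using (toℕ-injective; toℕ<n; toℕ-fromℕ<)
  open import Data.Integer.Base using (ℤ; +_; _+_; _*_; _-_; -_; ∣_∣; _%ℕ_; _/ℕ_; 0ℤ; 1ℤ)
  import Data.Integer.Properties as ℤ
  open import Data.Integer.DivMod using (n%ℕd<d; a≡a%ℕn+[a/ℕn]*n)
  open import Data.Integer.Divisibility.Signed as ℤ∣ using (_∣_; divides; ∣ᵤ⇒∣; ∣⇒∣ᵤ)
  open import Data.Integer.Tactic.RingSolver using (solve-∀)
  open import Data.Nat.Base as ℕ using (ℕ; zero; suc; _!)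
  import Data.Nat.Properties as ℕ
  import Data.Nat.Divisibility as ℕ∣
  open import Data.Sum.Base using (inj₁; inj₂)
  open import Function.Base using (_∘_)
  open import Relation.Binary.PropositionalEquality
  open import Relation.Nullary using (contradiction)

  -- Coprimality of `d` and `N` in the form in which it is applied; it passes to products and to
  -- congruent integers without a gcd.
  record Cancels (N d : ℤ) : Set where
    constructor cancelling
    field cancel : ∀ x → N ∣ d * x → N ∣ x

  open Cancels public

  -- The inverse is explicit: x = x N - (N - 1) x, and (N - 1) x is a multiple of d x, hence of N.
  cancels-divisor : ∀ {N d} → d ∣ N - 1ℤ → Cancels N d
  cancels-divisor {N} {d} (divides q eq) .cancel x (divides k eq′) = divides (x - q * k) (begin
    x                         ≡⟨ lemma₁ x N ⟩
    x * N - (N - 1ℤ) * x      ≡⟨ cong (λ y → x * N - y * x) eq ⟩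
    x * N - (q * d) * x       ≡⟨ cong (λ y → x * N - y) (ℤ.*-assoc q d x) ⟩
    x * N - q * (d * x)       ≡⟨ cong (λ y → x * N - q * y) eq′ ⟩
    x * N - q * (k * N)       ≡⟨ lemma₂ x q k N ⟩
    (x - q * k) * N           ∎)
    where
    open ≡-Reasoning
    lemma₁ : ∀ x N → x ≡ x * N - (N - 1ℤ) * x
    lemma₁ = solve-∀
    lemma₂ : ∀ x q k N → x * N - q * (k * N) ≡ (x - q * k) * N
    lemma₂ = solve-∀

  cancels-resp : ∀ {N d d′} → N ∣ d - d′ → Cancels N d′ → Cancels N d
  cancels-resp {N} {d} {d′} N∣ c .cancel x N∣dx = c .cancel x (subst (N ∣_) (lemma d d′ x)
    (ℤ∣.∣m∣n⇒∣m-n N∣dx (ℤ∣.∣m⇒∣m*n x N∣)))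
    where
    lemma : ∀ d d′ x → d * x - (d - d′) * x ≡ d′ * x
    lemma = solve-∀

  cancels-* : ∀ {N a b} → Cancels N a → Cancels N b → Cancels N (a * b)
  cancels-* {N} {a} {b} ca cb .cancel x N∣ = cb .cancel x (ca .cancel (b * x) (subst (N ∣_) (ℤ.*-assoc a b x) N∣))

  small∣! : ∀ {d K} → d ≢ 0ℤ → ∣ d ∣ ℕ.≤ K → d ∣ + (K !)
  small∣! {d} {K} d≢0 d≤K = ∣ᵤ⇒∣ (aux ∣ d ∣ (λ eq → d≢0 (ℤ.∣i∣≡0⇒i≡0 eq)) d≤K)
    where
    aux : ∀ m → m ≢ 0 → m ℕ.≤ K → m ℕ∣.∣ K !
    aux zero    m≢0 _ = contradiction refl m≢0
    aux (suc m) _  le = ℕ∣.∣-trans (ℕ∣.m∣m*n (m !)) (ℕ∣.m≤n⇒m!∣n! le)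

  -- Coprime to every nonzero integer of absolute value at most `K`, whatever `s` is; varying `s`
  -- makes such moduli unbounded.
  modulus : ℕ → ℕ → ℕ
  modulus K s = suc (K ! ℕ.* s)

  cancels-small : ∀ {d} K s → d ≢ 0ℤ → ∣ d ∣ ℕ.≤ K → Cancels (+ modulus K s) d
  cancels-small {d} K s d≢0 d≤K = cancels-divisor (subst (d ∣_) (sym lemma)
    (ℤ∣.∣m⇒∣m*n (+ s) (small∣! d≢0 d≤K)))
    where
    lemma : + modulus K s - 1ℤ ≡ + (K !) * + s
    lemma = trans (cong (λ y → y - 1ℤ) (ℤ.pos-+ 1 (K ! ℕ.* s)))
           (trans (solve1 (+ (K ! ℕ.* s))) (ℤ.pos-* (K !) s))
      where
      solve1 : ∀ x → 1ℤ + x - 1ℤ ≡ x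
      solve1 = solve-∀

  ∣-small⇒≡0 : ∀ {n x} → + n ∣ x → ∣ x ∣ ℕ.< n → x ≡ 0ℤ
  ∣-small⇒≡0 {n} {x} n∣x x<n with ∣ x ∣ in eq
  ... | zero  = ℤ.∣i∣≡0⇒i≡0 eq
  ... | suc m = contradiction (ℕ∣.∣⇒≤ (subst (n ℕ∣.∣_) eq (∣⇒∣ᵤ n∣x))) (ℕ.<⇒≱ x<n)

  ∣m-n∣<k : ∀ {m n k} → m ℕ.< k → n ℕ.< k → ∣ + m - + n ∣ ℕ.< k
  ∣m-n∣<k {m} {n} {k} m<k n<k rewrite ℤ.m-n≡m⊖n m n with ℕ.≤-total m n
  ... | inj₁ m≤n rewrite ℤ.∣⊖∣-≤ m≤n = ℕ.≤-<-trans (ℕ.m∸n≤m n m) n<k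
  ... | inj₂ n≤m rewrite ℤ.∣m⊖n∣≡∣n⊖m∣ m n | ℤ.∣⊖∣-≤ n≤m = ℕ.≤-<-trans (ℕ.m∸n≤m m n) m<k

  ⟦_⟧ : ∀ {n} → Fin n → ℤ
  ⟦ i ⟧ = + toℕ i

  ⟦⟧-injective : ∀ {n} {i j : Fin n} → ⟦ i ⟧ ≡ ⟦ j ⟧ → i ≡ j
  ⟦⟧-injective = toℕ-injective ∘ ℤ.+-injective

  diff≢0 : ∀ {n} {i j : Fin n} → i ≢ j → ⟦ i ⟧ - ⟦ j ⟧ ≢ 0ℤ
  diff≢0 i≢j eq = i≢j (⟦⟧-injective (ℤ.i-j≡0⇒i≡j _ _ eq))

  diff< : ∀ {n} (i j : Fin n) → ∣ ⟦ i ⟧ - ⟦ j ⟧ ∣ ℕ.< n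
  diff< i j = ∣m-n∣<k (toℕ<n i) (toℕ<n j)

  ∣diff⇒≡ : ∀ {n} {i j : Fin n} → + n ∣ ⟦ i ⟧ - ⟦ j ⟧ → i ≡ j
  ∣diff⇒≡ {i = i} {j} n∣ = ⟦⟧-injective (ℤ.i-j≡0⇒i≡j _ _ (∣-small⇒≡0 n∣ (diff< i j)))

  module _ {n} .{{_ : ℕ.NonZero n}} where

    red : ℤ → Fin n
    red x = fromℕ< (n%ℕd<d x n)

    red-≡⇒∣ : ∀ {x y} → red x ≡ red y → + n ∣ x - y
    red-≡⇒∣ {x} {y} eq = divides (x /ℕ n - y /ℕ n) (begin
      x - y                                   ≡⟨ cong₂ _-_ (a≡a%ℕn+[a/ℕn]*n x n) (a≡a%ℕn+[a/ℕn]*n y n) ⟩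
      (+ (x %ℕ n) + (x /ℕ n) * + n) - (+ (y %ℕ n) + (y /ℕ n) * + n)
        ≡⟨ cong (λ k → (+ k + (x /ℕ n) * + n) - (+ (y %ℕ n) + (y /ℕ n) * + n)) same ⟩
      (+ (y %ℕ n) + (x /ℕ n) * + n) - (+ (y %ℕ n) + (y /ℕ n) * + n) ≡⟨ lemma (+ (y %ℕ n)) (x /ℕ n) (y /ℕ n) (+ n) ⟩
      (x /ℕ n - y /ℕ n) * + n                 ∎)
      where
      open ≡-Reasoning
      same : x %ℕ n ≡ y %ℕ n
      same = trans (sym (toℕ-fromℕ< _)) (trans (cong toℕ eq) (toℕ-fromℕ< _))
      lemma : ∀ a p q m → (a + p * m) - (a + q * m) ≡ (p - q) * m
      lemma = solve-∀

-- Generic integer slopes and nonvanishing determinants.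

module Slopes where

  open Residues
  open import Data.Fin.Base using (Fin)
  open import Data.Fin.Properties using (_≟_)
  open import Data.Integer.Base using (ℤ; +_; _+_; _*_; _-_; -_; ∣_∣; 0ℤ; 1ℤ)
  import Data.Integer.Properties as ℤ
  open import Data.Integer.Divisibility.Signed as ℤ∣ using (_∣_; divides; ∣⇒∣ᵤ)
  open import Data.Integer.Tactic.RingSolver using (solve-∀)
  open import Data.Nat.Base as ℕ using (ℕ; suc; _!)
  import Data.Nat.Properties as ℕ
  import Data.Nat.Divisibility as ℕ∣
  open import Data.Product.Base using (∃-syntax; _×_; _,_; proj₁; proj₂)
  open import Data.Sum.Base using (_⊎_; inj₁; inj₂)
  open import Data.List.Base using (List; []; _∷_; cartesianProduct; allFin)
  open import Data.List.Membership.Propositional using (_∈_)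
  open import Data.List.Membership.Propositional.Properties using (∈-cartesianProduct⁺; ∈-allFin)
  open import Data.List.Relation.Unary.Any using (here; there)
  open import Function.Base using (_∘_)
  open import Relation.Binary.PropositionalEquality
  open import Relation.Nullary using (¬_; yes; no; contradiction)

  SamePair : ∀ {A : Set} → A → A → A → A → Set
  SamePair a b x y = (a ≡ x × b ≡ y) ⊎ (a ≡ y × b ≡ x)

  module _ {v : ℕ} where

    -- Plays the role of a prime that divides z x - z y and no other difference. It shows that two
    -- products of differences are unequal as soon as some pair occurs on one side only.
    record PrivateFactor (z : Fin v → ℤ) (p : ℤ) (x y : Fin v) : Set where
      field
        nonunit : ¬ p ∣ 1ℤ
        divisor : p ∣ z x - z y
        foreign : ∀ {a b} → a ≢ b → ¬ SamePair a b x y → Cancels p (z a - z b)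

    open PrivateFactor public

    SeparatedMod : ℤ → (Fin v → ℤ) → Set
    SeparatedMod p z = ∀ {a b} → a ≢ b → Cancels p (z a - z b)

    private

      shift : ∀ {p} (z z′ : Fin v → ℤ) → (∀ a → p ∣ z′ a - z a) →
              ∀ a b → p ∣ (z′ a - z′ b) - (z a - z b)
      shift {p} z z′ d a b = subst (p ∣_) (lemma (z′ a) (z a) (z′ b) (z b)) (ℤ∣.∣m∣n⇒∣m-n (d a) (d b))
        where
        lemma : ∀ a a′ b b′ → (a - a′) - (b - b′) ≡ (a - b) - (a′ - b′)
        lemma = solve-∀

      transfer : ∀ {p x y} z z′ → (∀ a → p ∣ z′ a - z a) → PrivateFactor z p x y → PrivateFactor z′ p x y
      transfer {p} {x} {y} z z′ d P .nonunit = P .nonunit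
      transfer {p} {x} {y} z z′ d P .divisor =
        ℤ∣.∣m+n∣m⇒∣n (subst (p ∣_) (lemma (z′ x - z′ y) (z x - z y))
          (ℤ∣.∣m∣n⇒∣m+n (shift z z′ d x y) (P .divisor))) (divides 0ℤ refl)
        where
        lemma : ∀ a b → (a - b) + b ≡ 0ℤ + a
        lemma = solve-∀
      transfer {p} z z′ d P .foreign {a} {b} a≢b ¬same = cancels-resp (shift z z′ d a b) (P .foreign a≢b ¬same)

      separated-transfer : ∀ {p} z z′ → (∀ a → p ∣ z′ a - z a) → SeparatedMod p z → SeparatedMod p z′
      separated-transfer z z′ d s {a} {b} a≢b = cancels-resp (shift z z′ d a b) (s a≢b)

      merge : Fin v → Fin v → Fin v → Fin v
      merge x y a with a ≟ y
      ... | yes _ = x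
      ... | no  _ = a

      merge-self : ∀ x y → merge x y y ≡ x
      merge-self x y with y ≟ y
      ... | yes _  = refl
      ... | no y≢y = contradiction refl y≢y

      merge-other : ∀ {x y a} → a ≢ y → merge x y a ≡ a
      merge-other {y = y} {a} a≢y with a ≟ y
      ... | yes a≡y = contradiction a≡y a≢y
      ... | no  _   = refl

      merge-injective : ∀ {x y a b} → a ≢ b → ¬ SamePair a b x y → merge x y a ≢ merge x y b
      merge-injective {x} {y} {a} {b} a≢b ¬same eq with a ≟ y | b ≟ y
      ... | yes a≡y | yes b≡y = a≢b (trans a≡y (sym b≡y))
      ... | yes a≡y | no  _   = ¬same (inj₂ (a≡y , sym eq))
      ... | no  _   | yes b≡y = ¬same (inj₁ (eq , b≡y))
      ... | no  _   | no  _   = a≢b eq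

      F = + (v !)

      -- Labels are less than `v` apart, so their differences divide v!, which divides p - 1.
      F-cancels : ∀ {p} {i j : Fin v} → F ∣ p - 1ℤ → i ≢ j → Cancels p (⟦ i ⟧ - ⟦ j ⟧)
      F-cancels {p} {i} {j} F∣ i≢j =
        cancels-divisor (ℤ∣.∣-trans (small∣! (diff≢0 i≢j) (ℕ.<⇒≤ (diff< i j))) F∣)

    -- The base modulus keeps all z distinct; each listed pair gets a fresh modulus
    -- 1 + Π v!, coprime to everything used so far, modulo which exactly this pair is
    -- merged.  As Π v! ≡ -1, the Chinese remainder step is explicit.
    record Stage (cs : List (Fin v × Fin v)) : Set where
      field
        z         : Fin v → ℤ
        Π         : ℕ
        base      : ℤ
        base∣Π    : base ∣ + Π
        nonunit₀  : ¬ base ∣ 1ℤ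
        separated : SeparatedMod base z
        private-  : ∀ {x y} → (x , y) ∈ cs → x ≢ y → ∃[ p ] p ∣ + Π × PrivateFactor z p x y
        Π≢0       : Π ≢ 0

    private

      >1⇒∤1 : ∀ {k} → k ≢ 0 → ¬ + suc k ∣ 1ℤ
      >1⇒∤1 {k} k≢0 d = k≢0 (ℕ.suc-injective (ℕ∣.∣1⇒≡1 (∣⇒∣ᵤ d)))

      !≢0 : ∀ k → k ! ≢ 0
      !≢0 k = ℕ.≢-nonZero⁻¹ (k !) {{ℕ._!≢0 k}}

      suc-1 : ∀ k → + suc k - 1ℤ ≡ + k
      suc-1 k = trans (cong (λ y → y - 1ℤ) (ℤ.pos-+ 1 k)) (lemma (+ k))
        where
        lemma : ∀ x → 1ℤ + x - 1ℤ ≡ x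
        lemma = solve-∀

      stage₀ : Stage []
      stage₀ = record
        { z = ⟦_⟧ ; Π = suc (v !) ; base = + suc (v !)
        ; base∣Π = ℤ∣.∣-refl
        ; nonunit₀ = >1⇒∤1 (!≢0 v)
        ; separated = F-cancels (subst (F ∣_) (sym (suc-1 (v !))) ℤ∣.∣-refl)
        ; private- = λ ()
        ; Π≢0 = λ () }

      stage₊ : ∀ x y {cs} → Stage cs → Stage ((x , y) ∷ cs)
      stage₊ x y {cs} st = record
        { z = z′ ; Π = Π ℕ.* p ; base = base
        ; base∣Π = ∣Π′ base∣Π
        ; nonunit₀ = nonunit₀
        ; separated = separated-transfer z z′ (λ a → ≡Π base∣Π a) separated
        ; private- = λ { (here refl) x≢y → + p , p∣Π′ , transfer ρ z′ ≡ρ (ρ-private x≢y)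
                       ; (there m) x≢y → let q , q∣ , P = private- m x≢y in q , ∣Π′ q∣ , transfer z z′ (≡Π q∣) P }
        ; Π≢0 = Π′≢0 }
        where
        open Stage st
        k = Π ℕ.* v !
        p = suc k
        k≢0 : k ≢ 0
        k≢0 eq with ℕ.m*n≡0⇒m≡0∨n≡0 Π eq
        ... | inj₁ e = Π≢0 e
        ... | inj₂ e = !≢0 v e
        Π′≢0 : Π ℕ.* p ≢ 0
        Π′≢0 eq with ℕ.m*n≡0⇒m≡0∨n≡0 Π eq
        ... | inj₁ e = Π≢0 e
        ... | inj₂ ()
        ρ : Fin v → ℤ
        ρ a = ⟦ merge x y a ⟧
        -- `k` is 0 modulo every divisor of Π and -1 modulo `p`: all earlier residues are kept, and
        -- modulo `p` the new values become `ρ`.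
        z′ : Fin v → ℤ
        z′ a = z a + + k * (z a - ρ a)
        ∣Π′ : ∀ {q} → q ∣ + Π → q ∣ + (Π ℕ.* p)
        ∣Π′ {q} q∣ = subst (q ∣_) (sym (ℤ.pos-* Π p)) (ℤ∣.∣m⇒∣m*n (+ p) q∣)
        p∣Π′ : + p ∣ + (Π ℕ.* p)
        p∣Π′ = subst (+ p ∣_) (sym (ℤ.pos-* Π p)) (ℤ∣.∣n⇒∣m*n (+ Π) ℤ∣.∣-refl)
        ≡Π : ∀ {q} → q ∣ + Π → ∀ a → q ∣ z′ a - z a
        ≡Π {q} q∣ a = subst (q ∣_) (lemma (z a) (+ k) (z a - ρ a))
          (ℤ∣.∣m⇒∣m*n (z a - ρ a) (subst (q ∣_) (sym (ℤ.pos-* Π (v !))) (ℤ∣.∣m⇒∣m*n F q∣)))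
          where
          lemma : ∀ a k d → k * d ≡ (a + k * d) - a
          lemma = solve-∀
        ≡ρ : ∀ a → + p ∣ z′ a - ρ a
        ≡ρ a = divides (z a - ρ a) (trans (lemma (z a) (+ k) (ρ a)) (cong ((z a - ρ a) *_) (sym (ℤ.pos-+ 1 k))))
          where
          lemma : ∀ a k r → (a + k * (a - r)) - r ≡ (a - r) * (1ℤ + k)
          lemma = solve-∀
        F∣p-1 : F ∣ + p - 1ℤ
        F∣p-1 = subst (F ∣_) (sym (trans (suc-1 k) (ℤ.pos-* Π (v !)))) (ℤ∣.∣n⇒∣m*n (+ Π) ℤ∣.∣-refl)
        ρ-private : x ≢ y → PrivateFactor ρ (+ p) x y
        ρ-private x≢y .nonunit = >1⇒∤1 k≢0
        ρ-private x≢y .divisor = subst (+ p ∣_) (sym (trans (cong₂ (λ i j → ⟦ i ⟧ - ⟦ j ⟧) (merge-other x≢y) (merge-self x y)) (ℤ.i≡j⇒i-j≡0 {⟦ x ⟧} refl))) (divides 0ℤ refl)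
        ρ-private x≢y .foreign a≢b ¬same = F-cancels F∣p-1 (merge-injective a≢b ¬same)

      stages : ∀ cs → Stage cs
      stages []             = stage₀
      stages ((x , y) ∷ cs) = stage₊ x y (stages cs)

    private

      pairs : List (Fin v × Fin v)
      pairs = cartesianProduct (allFin v) (allFin v)

      final = stages pairs

    abstract

      -- The values grow doubly exponentially in the number of pairs; they stay hidden, and
      -- everything later rests on the two properties below.
      slope : Fin v → ℤ
      slope = Stage.z final

      slope-private : ∀ {x y} → x ≢ y → ∃[ p ] PrivateFactor slope p x y
      slope-private {x} {y} x≢y =
        let p , _ , P = Stage.private- final (∈-cartesianProduct⁺ (∈-allFin x) (∈-allFin y)) x≢y in p , P

      slope-injective : ∀ {a b} → a ≢ b → slope a - slope b ≢ 0ℤ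
      slope-injective a≢b eq = Stage.nonunit₀ final (Stage.separated final a≢b .cancel 1ℤ
        (divides 0ℤ (cong (_* 1ℤ) eq)))

    infixl 6 _⊝_
    _⊝_ : Fin v → Fin v → ℤ
    a ⊝ b = slope a - slope b

    ⊝≢0 : ∀ {a b} → a ≢ b → a ⊝ b ≢ 0ℤ
    ⊝≢0 = slope-injective

    private

      *≢0 : ∀ x y → x ≢ 0ℤ → y ≢ 0ℤ → x * y ≢ 0ℤ
      *≢0 x y x≢0 y≢0 eq with ℤ.i*j≡0⇒i≡0∨j≡0 x eq
      ... | inj₁ e = x≢0 e
      ... | inj₂ e = y≢0 e

      -- The private factor of a pair of vertices occurring only on one side of an
      -- equation between products of differences refutes it.
      unbalanced : ∀ {p} a b c → p ∣ a → Cancels p c → ¬ p ∣ 1ℤ → a * b - c ≢ 0ℤ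
      unbalanced {p} a b c p∣a ca p∤1 eq = p∤1 (ca .cancel 1ℤ (subst (p ∣_)
        (trans (ℤ.i-j≡0⇒i≡j (a * b) c eq) (sym (ℤ.*-identityʳ c))) (ℤ∣.∣m⇒∣m*n b p∣a)))

    -- The determinant of the linear system for slope differences that arises in `pasch-rigid`.
    det₄ : (x₁₂ x₁₃ x₁₄ x₂₃ x₂₄ x₃₄ : Fin v) → ℤ
    det₄ x₁₂ x₁₃ x₁₄ x₂₃ x₂₄ x₃₄ =
      (x₂₃ ⊝ x₃₄) * ((x₁₂ ⊝ x₂₄) * (x₁₃ ⊝ x₁₄)) - (x₁₃ ⊝ x₃₄) * ((x₁₂ ⊝ x₁₄) * (x₂₃ ⊝ x₂₄))

    private

      fold₁ : ∀ a b c → (c - a) * ((a - b) * (b - c)) - (b - a) * ((a - c) * (c - b)) ≡ + 2 * ((c - a) * ((a - b) * (b - c)))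
      fold₁ = solve-∀

      fold₂ : ∀ a b c d → (c - a) * ((a - d) * (b - c)) - (b - a) * ((a - c) * (c - d))
                        ≡ (c - a) * ((a - d) * (b - c) - (a - b) * (c - d))
      fold₂ = solve-∀

    -- Points of one line differ, but the opposite points (x₁₂, x₃₄), (x₁₃, x₂₄), (x₁₄, x₂₃) may
    -- coincide. Unless the first and the third pair both do, the pair (x₂₃, x₃₄) occurs in the
    -- first product only.
    det₄≢0 : ∀ {x₁₂ x₁₃ x₁₄ x₂₃ x₂₄ x₃₄} →
      x₁₂ ≢ x₁₃ → x₁₂ ≢ x₁₄ → x₁₃ ≢ x₁₄ → x₁₂ ≢ x₂₃ → x₁₂ ≢ x₂₄ → x₂₃ ≢ x₂₄ →
      x₁₃ ≢ x₂₃ → x₁₃ ≢ x₃₄ → x₂₃ ≢ x₃₄ → x₁₄ ≢ x₂₄ → x₁₄ ≢ x₃₄ → x₂₄ ≢ x₃₄ →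
      det₄ x₁₂ x₁₃ x₁₄ x₂₃ x₂₄ x₃₄ ≢ 0ℤ
    det₄≢0 {x₁₂} {x₁₃} {x₁₄} {x₂₃} {x₂₄} {x₃₄} d₁₂ d₁₃ d₁₄ d₂₁ d₂₃ d₂₄ d₃₁ d₃₂ d₃₄ d₄₁ d₄₂ d₄₃
      with x₂₃ ≟ x₁₄ | x₃₄ ≟ x₁₂
    ... | no x₂₃≢x₁₄ | _ = let p , P = slope-private d₃₄ in
      unbalanced (x₂₃ ⊝ x₃₄) ((x₁₂ ⊝ x₂₄) * (x₁₃ ⊝ x₁₄)) ((x₁₃ ⊝ x₃₄) * ((x₁₂ ⊝ x₁₄) * (x₂₃ ⊝ x₂₄))) (P .divisor)
        (cancels-* (P .foreign d₃₂ λ { (inj₁ (e , _)) → d₃₁ e ; (inj₂ (e , _)) → d₃₂ e })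
        (cancels-* (P .foreign d₁₃ λ { (inj₁ (e , _)) → d₂₁ e ; (inj₂ (_ , e)) → x₂₃≢x₁₄ (sym e) })
                   (P .foreign d₂₄ λ { (inj₁ (_ , e)) → d₄₃ e ; (inj₂ (e , _)) → d₃₄ e })))
        (P .nonunit)
    ... | yes _ | no x₃₄≢x₁₂ = let p , P = slope-private d₃₄ in
      unbalanced (x₂₃ ⊝ x₃₄) ((x₁₂ ⊝ x₂₄) * (x₁₃ ⊝ x₁₄)) ((x₁₃ ⊝ x₃₄) * ((x₁₂ ⊝ x₁₄) * (x₂₃ ⊝ x₂₄))) (P .divisor)
        (cancels-* (P .foreign d₃₂ λ { (inj₁ (e , _)) → d₃₁ e ; (inj₂ (e , _)) → d₃₂ e })
        (cancels-* (P .foreign d₁₃ λ { (inj₁ (e , _)) → d₂₁ e ; (inj₂ (e , _)) → x₃₄≢x₁₂ (sym e) })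
                   (P .foreign d₂₄ λ { (inj₁ (_ , e)) → d₄₃ e ; (inj₂ (e , _)) → d₃₄ e })))
        (P .nonunit)
    ... | yes refl | yes refl with x₁₃ ≟ x₂₄
    -- With all three coincidences the products are negatives of each other, so their difference is
    -- twice a product of nonzero differences.
    ...   | yes refl = λ det≡0 →
      *≢0 (+ 2) _ (λ ()) (*≢0 (x₁₄ ⊝ x₁₂) _ (⊝≢0 (d₁₃ ∘ sym)) (*≢0 (x₁₂ ⊝ x₁₃) (x₁₃ ⊝ x₁₄) (⊝≢0 d₁₂) (⊝≢0 d₁₄)))
        (trans (sym (fold₁ (slope x₁₂) (slope x₁₃) (slope x₁₄))) det≡0)
    -- Both products now contain x₁₄ - x₁₂; once it is factored out, the pair (x₁₂, x₂₄) occurs in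
    -- the first product only.
    ...   | no x₁₃≢x₂₄ = λ det≡0 → let p , P = slope-private d₂₃ in
      *≢0 (x₁₄ ⊝ x₁₂) ((x₁₂ ⊝ x₂₄) * (x₁₃ ⊝ x₁₄) - (x₁₂ ⊝ x₁₃) * (x₁₄ ⊝ x₂₄)) (⊝≢0 (d₁₃ ∘ sym))
        (unbalanced (x₁₂ ⊝ x₂₄) (x₁₃ ⊝ x₁₄) ((x₁₂ ⊝ x₁₃) * (x₁₄ ⊝ x₂₄)) (P .divisor)
          (cancels-* (P .foreign d₁₂ λ { (inj₁ (_ , e)) → x₁₃≢x₂₄ e ; (inj₂ (e , _)) → d₂₃ e })
                     (P .foreign d₂₄ λ { (inj₁ (e , _)) → d₁₃ (sym e) ; (inj₂ (_ , e)) → d₂₃ (sym e) }))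
          (P .nonunit))
        (trans (sym (fold₂ (slope x₁₂) (slope x₁₃) (slope x₁₄) (slope x₂₄))) det≡0)

    det₅ : (q a₁ a₂ a₃ b₁ b₂ b₃ : Fin v) → ℤ
    det₅ q a₁ a₂ a₃ b₁ b₂ b₃ =
      (a₁ ⊝ q) * ((a₂ ⊝ a₃) * ((b₂ ⊝ q) * (b₁ ⊝ b₃))) - (a₂ ⊝ q) * ((a₁ ⊝ a₃) * ((b₁ ⊝ q) * (b₂ ⊝ b₃)))

    -- The pair (a₁, q) does not return in the second product: its factors with `q` have a₂ or b₁ at
    -- the other end, and the other two factors avoid `q`.
    det₅≢0 : ∀ {q a₁ a₂ a₃ b₁ b₂ b₃} →
      a₁ ≢ q → a₂ ≢ q → a₃ ≢ q → b₁ ≢ q → b₂ ≢ q → b₃ ≢ q → a₁ ≢ a₂ → a₁ ≢ a₃ → b₂ ≢ b₃ → a₁ ≢ b₁ →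
      det₅ q a₁ a₂ a₃ b₁ b₂ b₃ ≢ 0ℤ
    det₅≢0 {q} {a₁} {a₂} {a₃} {b₁} {b₂} {b₃} a₁q a₂q a₃q b₁q b₂q b₃q a₁₂ a₁₃ b₂₃ a₁b₁ = let p , P = slope-private a₁q in
      unbalanced (a₁ ⊝ q) ((a₂ ⊝ a₃) * ((b₂ ⊝ q) * (b₁ ⊝ b₃))) ((a₂ ⊝ q) * ((a₁ ⊝ a₃) * ((b₁ ⊝ q) * (b₂ ⊝ b₃)))) (P .divisor)
        (cancels-* (P .foreign a₂q λ { (inj₁ (e , _)) → a₁₂ (sym e) ; (inj₂ (e , _)) → a₂q e })
        (cancels-* (P .foreign a₁₃ λ { (inj₁ (_ , e)) → a₃q e ; (inj₂ (e , _)) → a₁q e })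
        (cancels-* (P .foreign b₁q λ { (inj₁ (e , _)) → a₁b₁ (sym e) ; (inj₂ (e , _)) → b₁q e })
                   (P .foreign b₂₃ λ { (inj₁ (_ , e)) → b₃q e ; (inj₂ (e , _)) → b₂q e }))))
        (P .nonunit)

    private

      unbalanced′ : ∀ {p} x y → p ∣ x → Cancels p y → ¬ p ∣ 1ℤ → x - y ≢ 0ℤ
      unbalanced′ {p} x y p∣x ca p∤1 eq = p∤1 (ca .cancel 1ℤ (subst (p ∣_)
        (trans (ℤ.i-j≡0⇒i≡j x y eq) (sym (ℤ.*-identityʳ y))) p∣x))

    det₆ : (xᵃ xᵇ xᶜ xᵈ yᵃᶜ yᵃᵈ yᵇᶜ yᵇᵈ : Fin v) → ℤ
    det₆ xᵃ xᵇ xᶜ xᵈ yᵃᶜ yᵃᵈ yᵇᶜ yᵇᵈ =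
      (yᵃᶜ ⊝ xᵃ) * ((yᵇᶜ ⊝ xᶜ) * ((yᵇᵈ ⊝ xᵇ) * (yᵃᵈ ⊝ xᵈ))) - (yᵃᶜ ⊝ xᶜ) * ((yᵇᶜ ⊝ xᵇ) * ((yᵇᵈ ⊝ xᵈ) * (yᵃᵈ ⊝ xᵃ)))

    -- The pair (yᵃᵈ, xᵈ) settles the generic case. It returns on the other side only as (xᶜ, yᵃᶜ)
    -- or (xᵇ, yᵇᶜ); then (yᵇᵈ, xᵇ) or (yᵃᶜ, xᵃ) takes over.
    det₆≢0 : ∀ {xᵃ xᵇ xᶜ xᵈ yᵃᶜ yᵃᵈ yᵇᶜ yᵇᵈ} →
      yᵃᶜ ≢ yᵃᵈ → yᵃᶜ ≢ xᵃ → yᵃᵈ ≢ xᵃ → yᵇᶜ ≢ yᵇᵈ → yᵇᶜ ≢ xᵇ → yᵇᵈ ≢ xᵇ →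
      yᵃᶜ ≢ yᵇᶜ → yᵃᶜ ≢ xᶜ → yᵃᵈ ≢ yᵇᵈ → yᵃᵈ ≢ xᵈ → yᵇᵈ ≢ xᵈ →
      xᵃ ≢ xᵇ → xᵃ ≢ xᶜ → xᵃ ≢ xᵈ → xᵇ ≢ xᶜ → xᵇ ≢ xᵈ →
      det₆ xᵃ xᵇ xᶜ xᵈ yᵃᶜ yᵃᵈ yᵇᶜ yᵇᵈ ≢ 0ℤ
    det₆≢0 {xᵃ} {xᵇ} {xᶜ} {xᵈ} {yᵃᶜ} {yᵃᵈ} {yᵇᶜ} {yᵇᵈ} a₁ a₂ a₃ b₁ b₂ b₃ c₁ c₂ d₁ d₂ d₃ ab ac ad bc bd = choose
      where
      L₁ = yᵃᶜ ⊝ xᵃ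
      L₂ = yᵇᶜ ⊝ xᶜ
      L₃ = yᵇᵈ ⊝ xᵇ
      L₄ = yᵃᵈ ⊝ xᵈ
      R = (yᵃᶜ ⊝ xᶜ) * ((yᵇᶜ ⊝ xᵇ) * ((yᵇᵈ ⊝ xᵈ) * (yᵃᵈ ⊝ xᵃ)))
      all-foreign : ∀ {p x y} (P : PrivateFactor slope p x y) → ¬ SamePair yᵃᶜ xᶜ x y → ¬ SamePair yᵇᶜ xᵇ x y →
                    ¬ SamePair yᵇᵈ xᵈ x y → ¬ SamePair yᵃᵈ xᵃ x y → Cancels p R
      all-foreign P n₁ n₂ n₃ n₄ = cancels-* (P .foreign c₂ n₁) (cancels-* (P .foreign b₂ n₂) (cancels-* (P .foreign d₃ n₃) (P .foreign a₃ n₄)))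
      by-first : xᵈ ≡ yᵇᶜ → L₁ * (L₂ * (L₃ * L₄)) - R ≢ 0ℤ
      by-first e = let p , P = slope-private a₂ in
        unbalanced′ (L₁ * (L₂ * (L₃ * L₄))) R (ℤ∣.∣m⇒∣m*n (L₂ * (L₃ * L₄)) (P .divisor))
          (all-foreign P (λ { (inj₁ (_ , f)) → ac (sym f) ; (inj₂ (f , _)) → a₂ f })
                         (λ { (inj₁ (_ , f)) → ab (sym f) ; (inj₂ (f , _)) → ad (trans (sym f) (sym e)) })
                         (λ { (inj₁ (_ , f)) → ad (sym f) ; (inj₂ (_ , f)) → c₁ (trans (sym f) e) })
                         (λ { (inj₁ (f , _)) → a₁ (sym f) ; (inj₂ (f , _)) → a₃ f }))
          (P .nonunit)
      by-third : yᵃᵈ ≡ xᶜ → xᵈ ≡ yᵃᶜ → L₁ * (L₂ * (L₃ * L₄)) - R ≢ 0ℤ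
      by-third e f = let p , P = slope-private b₃ in
        unbalanced′ (L₁ * (L₂ * (L₃ * L₄))) R (ℤ∣.∣n⇒∣m*n L₁ (ℤ∣.∣n⇒∣m*n L₂ (ℤ∣.∣m⇒∣m*n L₄ (P .divisor))))
          (all-foreign P (λ { (inj₁ (_ , g)) → bc (sym g) ; (inj₂ (g , _)) → bd (trans (sym g) (sym f)) })
                         (λ { (inj₁ (g , _)) → b₁ g ; (inj₂ (g , _)) → b₂ g })
                         (λ { (inj₁ (_ , g)) → bd (sym g) ; (inj₂ (g , _)) → b₃ g })
                         (λ { (inj₁ (_ , g)) → ab g ; (inj₂ (g , _)) → bc (trans (sym g) e) }))
          (P .nonunit)
      by-fourth : ¬ (yᵃᵈ ≡ xᶜ × xᵈ ≡ yᵃᶜ) → ¬ (yᵃᵈ ≡ xᵇ × xᵈ ≡ yᵇᶜ) → L₁ * (L₂ * (L₃ * L₄)) - R ≢ 0ℤ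
      by-fourth n₁ n₂ = let p , P = slope-private d₂ in
        unbalanced′ (L₁ * (L₂ * (L₃ * L₄))) R (ℤ∣.∣n⇒∣m*n L₁ (ℤ∣.∣n⇒∣m*n L₂ (ℤ∣.∣n⇒∣m*n L₃ (P .divisor))))
          (all-foreign P (λ { (inj₁ (f , _)) → a₁ f ; (inj₂ (f , g)) → n₁ (sym g , sym f) })
                         (λ { (inj₁ (_ , g)) → bd g ; (inj₂ (f , g)) → n₂ (sym g , sym f) })
                         (λ { (inj₁ (f , _)) → d₁ (sym f) ; (inj₂ (f , _)) → d₃ f })
                         (λ { (inj₁ (_ , g)) → ad g ; (inj₂ (_ , g)) → a₃ (sym g) }))
          (P .nonunit)
      choose : L₁ * (L₂ * (L₃ * L₄)) - R ≢ 0ℤ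
      choose with yᵃᵈ ≟ xᶜ | xᵈ ≟ yᵃᶜ | xᵈ ≟ yᵇᶜ
      ... | yes e | yes f | _     = by-third e f
      ... | _     | _     | yes e = by-first e
      ... | no ne | _     | no nf = by-fourth (ne ∘ proj₁) (nf ∘ proj₂)
      ... | _     | no ne | no nf = by-fourth (ne ∘ proj₂) (nf ∘ proj₂)

-- Rigidity of Pasch, mitre and grid systems of lines modulo N.

module Lines where

  open Residues
  open Slopes
  open import Data.Fin.Base using (Fin; zero; suc)
  open import Data.Integer.Base using (ℤ; +_; _+_; _*_; _-_; -_; ∣_∣; 0ℤ)
  import Data.Integer.Properties as ℤ
  open import Data.Integer.Divisibility.Signed as ℤ∣ using (_∣_)
  open import Data.Integer.Tactic.RingSolver using (solve-∀)
  open import Data.Nat.Base as ℕ using (ℕ; zero; suc; _⊔_; _≤_)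
  import Data.Nat.Properties as ℕ
  open import Data.Product.Base using (∃-syntax; _×_; _,_; proj₁; proj₂)
  open import Function.Base using (_∘_)
  open import Relation.Binary.PropositionalEquality

  bounded : ∀ {v} (f : Fin v → ℕ) → ∃[ B ] ∀ a → f a ≤ B
  bounded {zero}  f = 0 , λ ()
  bounded {suc v} f = let B , le = bounded (f ∘ suc) in
    f zero ⊔ B , λ { zero → ℕ.m≤m⊔n (f zero) B ; (suc a) → ℕ.≤-trans (le a) (ℕ.m≤n⊔m (f zero) B) }

  module _ (v : ℕ) where

    private

      sb = bounded (∣_∣ ∘ slope {v})

      C : ℕ
      C = suc (proj₁ sb ℕ.+ proj₁ sb)

      ⊝≤C : ∀ (a b : Fin v) → ∣ a ⊝ b ∣ ≤ C
      ⊝≤C a b = ℕ.≤-trans (ℤ.∣i-j∣≤∣i∣+∣j∣ (slope a) (slope b)) (ℕ.m≤n⇒m≤1+n (ℕ.+-mono-≤ (proj₂ sb a) (proj₂ sb b)))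

      *-≤ : ∀ {x y a b} → ∣ x ∣ ≤ a → ∣ y ∣ ≤ b → ∣ x * y ∣ ≤ a ℕ.* b
      *-≤ {x} {y} p q = ℕ.≤-trans (ℕ.≤-reflexive (ℤ.abs-* x y)) (ℕ.*-mono-≤ p q)

      -≤- : ∀ {x y a b} → ∣ x ∣ ≤ a → ∣ y ∣ ≤ b → ∣ x - y ∣ ≤ a ℕ.+ b
      -≤- {x} {y} p q = ℕ.≤-trans (ℤ.∣i-j∣≤∣i∣+∣j∣ x y) (ℕ.+-mono-≤ p q)

      C³ C⁴ : ℕ
      C³ = C ℕ.* (C ℕ.* C)
      C⁴ = C ℕ.* C³

    -- Large enough to bound twice a difference of slopes, and the three determinants.
    slopeBound : ℕ
    slopeBound = (C ℕ.+ C) ℕ.+ ((C³ ℕ.+ C³) ℕ.+ (C⁴ ℕ.+ C⁴))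

    private

      le₁ : C ℕ.+ C ≤ slopeBound
      le₁ = ℕ.m≤m+n _ _

      le₃ : C³ ℕ.+ C³ ≤ slopeBound
      le₃ = ℕ.≤-trans (ℕ.m≤m+n (C³ ℕ.+ C³) (C⁴ ℕ.+ C⁴)) (ℕ.m≤n+m _ (C ℕ.+ C))

      le₄ : C⁴ ℕ.+ C⁴ ≤ slopeBound
      le₄ = ℕ.≤-trans (ℕ.m≤n+m (C⁴ ℕ.+ C⁴) (C³ ℕ.+ C³)) (ℕ.m≤n+m _ (C ℕ.+ C))

    ⊝-bound : ∀ (a b : Fin v) → ∣ a ⊝ b ∣ ≤ slopeBound
    ⊝-bound a b = ℕ.≤-trans (⊝≤C a b) (ℕ.≤-trans (ℕ.m≤m+n C C) le₁)

    2⊝-bound : ∀ k (a b : Fin v) → ∣ k ∣ ≤ 2 → ∣ k * (a ⊝ b) ∣ ≤ slopeBound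
    2⊝-bound k a b k≤2 = ℕ.≤-trans (*-≤ {k} {a ⊝ b} k≤2 (⊝≤C a b)) (ℕ.≤-trans (ℕ.≤-reflexive (cong (C ℕ.+_) (ℕ.+-identityʳ C))) le₁)

    2⊝³-bound : ∀ k (a b c d e f : Fin v) → ∣ k ∣ ≤ 2 → ∣ k * ((a ⊝ b) * ((c ⊝ d) * (e ⊝ f))) ∣ ≤ slopeBound
    2⊝³-bound k a b c d e f k≤2 = ℕ.≤-trans (*-≤ {k} {(a ⊝ b) * ((c ⊝ d) * (e ⊝ f))} k≤2
      (*-≤ {a ⊝ b} {(c ⊝ d) * (e ⊝ f)} (⊝≤C a b) (*-≤ {c ⊝ d} {e ⊝ f} (⊝≤C c d) (⊝≤C e f))))
      (ℕ.≤-trans (ℕ.≤-reflexive (cong (C³ ℕ.+_) (ℕ.+-identityʳ C³))) le₃)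

    det₄-bound : ∀ (a b c d e f : Fin v) → ∣ det₄ a b c d e f ∣ ≤ slopeBound
    det₄-bound a b c d e f = ℕ.≤-trans
      (-≤- {(d ⊝ f) * ((a ⊝ e) * (b ⊝ c))} {(b ⊝ f) * ((a ⊝ c) * (d ⊝ e))}
        (*-≤ {d ⊝ f} {(a ⊝ e) * (b ⊝ c)} (⊝≤C d f) (*-≤ {a ⊝ e} {b ⊝ c} (⊝≤C a e) (⊝≤C b c)))
        (*-≤ {b ⊝ f} {(a ⊝ c) * (d ⊝ e)} (⊝≤C b f) (*-≤ {a ⊝ c} {d ⊝ e} (⊝≤C a c) (⊝≤C d e)))) le₃

    private

      quad : ∀ x y z w → ∣ x ∣ ≤ C → ∣ y ∣ ≤ C → ∣ z ∣ ≤ C → ∣ w ∣ ≤ C → ∣ x * (y * (z * w)) ∣ ≤ C⁴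
      quad x y z w p q r s = *-≤ {x} {y * (z * w)} p (*-≤ {y} {z * w} q (*-≤ {z} {w} r s))

    det₅-bound : ∀ (q a₁ a₂ a₃ b₁ b₂ b₃ : Fin v) → ∣ det₅ q a₁ a₂ a₃ b₁ b₂ b₃ ∣ ≤ slopeBound
    det₅-bound q a₁ a₂ a₃ b₁ b₂ b₃ = ℕ.≤-trans
      (-≤- {(a₁ ⊝ q) * ((a₂ ⊝ a₃) * ((b₂ ⊝ q) * (b₁ ⊝ b₃)))} {(a₂ ⊝ q) * ((a₁ ⊝ a₃) * ((b₁ ⊝ q) * (b₂ ⊝ b₃)))}
        (quad (a₁ ⊝ q) (a₂ ⊝ a₃) (b₂ ⊝ q) (b₁ ⊝ b₃) (⊝≤C a₁ q) (⊝≤C a₂ a₃) (⊝≤C b₂ q) (⊝≤C b₁ b₃))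
        (quad (a₂ ⊝ q) (a₁ ⊝ a₃) (b₁ ⊝ q) (b₂ ⊝ b₃) (⊝≤C a₂ q) (⊝≤C a₁ a₃) (⊝≤C b₁ q) (⊝≤C b₂ b₃))) le₄

    det₆-bound : ∀ (xᵃ xᵇ xᶜ xᵈ yᵃᶜ yᵃᵈ yᵇᶜ yᵇᵈ : Fin v) → ∣ det₆ xᵃ xᵇ xᶜ xᵈ yᵃᶜ yᵃᵈ yᵇᶜ yᵇᵈ ∣ ≤ slopeBound
    det₆-bound xᵃ xᵇ xᶜ xᵈ yᵃᶜ yᵃᵈ yᵇᶜ yᵇᵈ = ℕ.≤-trans
      (-≤- {(yᵃᶜ ⊝ xᵃ) * ((yᵇᶜ ⊝ xᶜ) * ((yᵇᵈ ⊝ xᵇ) * (yᵃᵈ ⊝ xᵈ)))} {(yᵃᶜ ⊝ xᶜ) * ((yᵇᶜ ⊝ xᵇ) * ((yᵇᵈ ⊝ xᵈ) * (yᵃᵈ ⊝ xᵃ)))}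
        (quad (yᵃᶜ ⊝ xᵃ) (yᵇᶜ ⊝ xᶜ) (yᵇᵈ ⊝ xᵇ) (yᵃᵈ ⊝ xᵈ) (⊝≤C yᵃᶜ xᵃ) (⊝≤C yᵇᶜ xᶜ) (⊝≤C yᵇᵈ xᵇ) (⊝≤C yᵃᵈ xᵈ))
        (quad (yᵃᶜ ⊝ xᶜ) (yᵇᶜ ⊝ xᵇ) (yᵇᵈ ⊝ xᵈ) (yᵃᵈ ⊝ xᵃ) (⊝≤C yᵃᶜ xᶜ) (⊝≤C yᵇᶜ xᵇ) (⊝≤C yᵇᵈ xᵈ) (⊝≤C yᵃᵈ xᵃ))) le₄

    record Unramified (N : ℤ) : Set where
      field cancels : ∀ {d} → d ≢ 0ℤ → ∣ d ∣ ≤ slopeBound → Cancels N d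

    open Unramified public

    modulus-unramified : ∀ s → Unramified (+ modulus slopeBound s)
    modulus-unramified s .cancels = cancels-small slopeBound s

  module _ {v : ℕ} {N : ℤ} (U : Unramified v N) where

    ⊝-cancel : ∀ {a b : Fin v} → a ≢ b → ∀ x → N ∣ (a ⊝ b) * x → N ∣ x
    ⊝-cancel {a} {b} a≢b = U .cancels (⊝≢0 a≢b) (⊝-bound v a b) .cancel

    infix 4 _≈_
    record _≈_ (x y : ℤ) : Set where
      constructor cong-mod
      field ∣difference : N ∣ x - y

    open _≈_ public

    private

      ∣-resp : ∀ {x y} → x ≡ y → N ∣ x → N ∣ y
      ∣-resp refl d = d

    record Line : Set where
      constructor _,_
      field τ θ : ℤ

      at : Fin v → ℤ
      at x = τ + θ * slope x

    open Line

    infix 4 _∥_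
    record _∥_ (k l : Line) : Set where
      constructor _,_
      field
        ≈τ : τ k ≈ τ l
        ≈θ : θ k ≈ θ l

    open _∥_ public

    from-θ : ∀ {x} k l → at k x ≈ at l x → N ∣ θ k - θ l → k ∥ l
    from-θ {x} k l (cong-mod e) d = cong-mod (∣-resp (lemma (τ k) (θ k) (τ l) (θ l) (slope x))
        (ℤ∣.∣m∣n⇒∣m-n e (ℤ∣.∣m⇒∣m*n (slope x) d))) , cong-mod d
      where
      lemma : ∀ t h t′ h′ x → (t + h * x) - (t′ + h′ * x) - (h - h′) * x ≡ t - t′
      lemma = solve-∀

    two-points : ∀ {x y} → x ≢ y → ∀ k l → at k x ≈ at l x → at k y ≈ at l y → k ∥ l
    two-points {x} {y} x≢y k l ex ey = from-θ k l ex (⊝-cancel x≢y (θ k - θ l)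
        (∣-resp (lemma (τ k) (θ k) (τ l) (θ l) (slope x) (slope y)) (ℤ∣.∣m∣n⇒∣m-n (∣difference ex) (∣difference ey))))
      where
      lemma : ∀ t h t′ h′ x y → ((t + h * x) - (t′ + h′ * x)) - ((t + h * y) - (t′ + h′ * y)) ≡ (x - y) * (h - h′)
      lemma = solve-∀

    private

      -- The signed sum of the three incidences cancels every intercept, so a triangle of lines
      -- leaves one relation between the `θ`.
      triangle : ∀ k l m {x y z} → at k x ≈ at l x → at k y ≈ at m y → at l z ≈ at m z →
                 N ∣ (θ k - θ m) * (x ⊝ y) - (θ l - θ m) * (x ⊝ z)
      triangle k l m {x} {y} {z} e f g = ∣-resp
        (lemma (τ k) (θ k) (τ l) (θ l) (τ m) (θ m) (slope x) (slope y) (slope z))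
        (ℤ∣.∣m∣n⇒∣m+n (ℤ∣.∣m∣n⇒∣m-n (∣difference e) (∣difference f)) (∣difference g))
        where
        lemma : ∀ a a′ b b′ c c′ x y z →
          ((a + a′ * x) - (b + b′ * x)) - ((a + a′ * y) - (c + c′ * y)) + ((b + b′ * z) - (c + c′ * z))
          ≡ (a′ - c′) * (x - y) - (b′ - c′) * (x - z)
        lemma = solve-∀

    -- The three triangles through `k₄` give three linear relations between three differences of
    -- `θ`; eliminating two of these leaves `det₄` times the third.
    pasch-rigid : ∀ k₁ k₂ k₃ k₄ {x₁₂ x₁₃ x₁₄ x₂₃ x₂₄ x₃₄} →
      x₁₂ ≢ x₁₃ → x₁₂ ≢ x₁₄ → x₁₃ ≢ x₁₄ → x₁₂ ≢ x₂₃ → x₁₂ ≢ x₂₄ → x₂₃ ≢ x₂₄ →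
      x₁₃ ≢ x₂₃ → x₁₃ ≢ x₃₄ → x₂₃ ≢ x₃₄ → x₁₄ ≢ x₂₄ → x₁₄ ≢ x₃₄ → x₂₄ ≢ x₃₄ →
      at k₁ x₁₂ ≈ at k₂ x₁₂ → at k₁ x₁₃ ≈ at k₃ x₁₃ → at k₁ x₁₄ ≈ at k₄ x₁₄ →
      at k₂ x₂₃ ≈ at k₃ x₂₃ → at k₂ x₂₄ ≈ at k₄ x₂₄ → at k₃ x₃₄ ≈ at k₄ x₃₄ →
      k₁ ∥ k₄ × k₂ ∥ k₄ × k₃ ∥ k₄
    pasch-rigid k₁ k₂ k₃ k₄ {x₁₂} {x₁₃} {x₁₄} {x₂₃} {x₂₄} {x₃₄}
      d₁₂ d₁₃ d₁₄ d₂₁ d₂₃ d₂₄ d₃₁ d₃₂ d₃₄ d₄₁ d₄₂ d₄₃ e₁₂ e₁₃ e₁₄ e₂₃ e₂₄ e₃₄ =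
        from-θ k₁ k₄ e₁₄ t₁≡0 , from-θ k₂ k₄ e₂₄ t₂≡0 , from-θ k₃ k₄ e₃₄ t₃≡0
      where
      t₁ = θ k₁ - θ k₄
      t₂ = θ k₂ - θ k₄
      t₃ = θ k₃ - θ k₄
      T₁₂ : N ∣ t₁ * (x₁₂ ⊝ x₁₄) - t₂ * (x₁₂ ⊝ x₂₄)
      T₁₂ = triangle k₁ k₂ k₄ e₁₂ e₁₄ e₂₄
      T₁₃ : N ∣ t₁ * (x₁₃ ⊝ x₁₄) - t₃ * (x₁₃ ⊝ x₃₄)
      T₁₃ = triangle k₁ k₃ k₄ e₁₃ e₁₄ e₃₄
      T₂₃ : N ∣ t₂ * (x₂₃ ⊝ x₂₄) - t₃ * (x₂₃ ⊝ x₃₄)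
      T₂₃ = triangle k₂ k₃ k₄ e₂₃ e₂₄ e₃₄
      combine : ∀ t₁ t₂ t₃ p q r s m n →
        (m * r) * (- (t₁ * p - t₂ * q)) + (p * m) * (t₁ * r - t₃ * s) - (q * r) * (t₂ * m - t₃ * n)
        ≡ (n * (q * r) - s * (p * m)) * t₃
      combine = solve-∀
      t₃≡0 : N ∣ t₃
      t₃≡0 = U .cancels (det₄≢0 d₁₂ d₁₃ d₁₄ d₂₁ d₂₃ d₂₄ d₃₁ d₃₂ d₃₄ d₄₁ d₄₂ d₄₃)
                        (det₄-bound v x₁₂ x₁₃ x₁₄ x₂₃ x₂₄ x₃₄) .cancel t₃
        (∣-resp (combine t₁ t₂ t₃ (x₁₂ ⊝ x₁₄) (x₁₂ ⊝ x₂₄) (x₁₃ ⊝ x₁₄) (x₁₃ ⊝ x₃₄) (x₂₃ ⊝ x₂₄) (x₂₃ ⊝ x₃₄))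
          (ℤ∣.∣m∣n⇒∣m-n (ℤ∣.∣m∣n⇒∣m+n (ℤ∣.∣n⇒∣m*n ((x₂₃ ⊝ x₂₄) * (x₁₃ ⊝ x₁₄)) (ℤ∣.∣m⇒∣-m T₁₂)) (ℤ∣.∣n⇒∣m*n ((x₁₂ ⊝ x₁₄) * (x₂₃ ⊝ x₂₄)) T₁₃)) (ℤ∣.∣n⇒∣m*n ((x₁₂ ⊝ x₂₄) * (x₁₃ ⊝ x₁₄)) T₂₃)))
      back : ∀ t t′ a b → t * a - t′ * b + t′ * b ≡ a * t
      back = solve-∀
      t₁≡0 : N ∣ t₁
      t₁≡0 = ⊝-cancel d₁₄ t₁ (∣-resp (back t₁ t₃ (x₁₃ ⊝ x₁₄) (x₁₃ ⊝ x₃₄)) (ℤ∣.∣m∣n⇒∣m+n T₁₃ (ℤ∣.∣m⇒∣m*n (x₁₃ ⊝ x₃₄) t₃≡0)))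
      t₂≡0 : N ∣ t₂
      t₂≡0 = ⊝-cancel d₂₄ t₂ (∣-resp (back t₂ t₃ (x₂₃ ⊝ x₂₄) (x₂₃ ⊝ x₃₄)) (ℤ∣.∣m∣n⇒∣m+n T₂₃ (ℤ∣.∣m⇒∣m*n (x₂₃ ⊝ x₃₄) t₃≡0)))

    -- Eliminating a transversal, `k₄` or `k₅`, leaves one relation between the three concurrent
    -- lines; the two relations have determinant `det₅`. Each transversal then agrees with `k₃` at
    -- two points.
    mitre-rigid : ∀ k₁ k₂ k₃ k₄ k₅ {q a₁ a₂ a₃ b₁ b₂ b₃} →
      a₁ ≢ q → a₂ ≢ q → a₃ ≢ q → b₁ ≢ q → b₂ ≢ q → b₃ ≢ q →
      a₁ ≢ a₂ → a₁ ≢ a₃ → b₁ ≢ b₃ → b₂ ≢ b₃ → a₁ ≢ b₁ →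
      at k₁ q ≈ at k₃ q → at k₂ q ≈ at k₃ q →
      at k₁ a₁ ≈ at k₄ a₁ → at k₂ a₂ ≈ at k₄ a₂ → at k₃ a₃ ≈ at k₄ a₃ →
      at k₁ b₁ ≈ at k₅ b₁ → at k₂ b₂ ≈ at k₅ b₂ → at k₃ b₃ ≈ at k₅ b₃ →
      k₁ ∥ k₃ × k₂ ∥ k₃ × k₄ ∥ k₃ × k₅ ∥ k₃
    mitre-rigid k₁ k₂ k₃ k₄ k₅ {q} {a₁} {a₂} {a₃} {b₁} {b₂} {b₃}
      a₁q a₂q a₃q b₁q b₂q b₃q a₁₂ a₁₃ b₁₃ b₂₃ a₁b₁ e₁ e₂ f₁ f₂ f₃ g₁ g₂ g₃ =
        from-θ k₁ k₃ e₁ x≡0 , from-θ k₂ k₃ e₂ y≡0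
        , third k₄ f₁ f₃ a₁₃ , third k₅ g₁ g₃ b₁₃
      where
      x = θ k₁ - θ k₃
      y = θ k₂ - θ k₃
      relation : ∀ m {c₁ c₂ c₃} → at k₁ c₁ ≈ at m c₁ → at k₂ c₂ ≈ at m c₂ → at k₃ c₃ ≈ at m c₃ →
                 N ∣ (c₁ ⊝ q) * (c₂ ⊝ c₃) * x - (c₂ ⊝ q) * (c₁ ⊝ c₃) * y
      relation m {c₁} {c₂} {c₃} h₁ h₂ h₃ = ∣-resp
        (lemma (τ k₁) (θ k₁) (τ k₂) (θ k₂) (τ k₃) (θ k₃) (τ m) (θ m) (slope q) (slope c₁) (slope c₂) (slope c₃))
        (ℤ∣.∣m∣n⇒∣m-n
          (ℤ∣.∣n⇒∣m*n (c₂ ⊝ c₃) (ℤ∣.∣m∣n⇒∣m-n (ℤ∣.∣m∣n⇒∣m-n (∣difference h₁) (∣difference h₃)) (∣difference e₁)))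
          (ℤ∣.∣n⇒∣m*n (c₁ ⊝ c₃) (ℤ∣.∣m∣n⇒∣m-n (ℤ∣.∣m∣n⇒∣m-n (∣difference h₂) (∣difference h₃)) (∣difference e₂))))
        where
        lemma : ∀ s₁ t₁ s₂ t₂ s₃ t₃ s t q c₁ c₂ c₃ →
          (c₂ - c₃) * (((s₁ + t₁ * c₁) - (s + t * c₁)) - ((s₃ + t₃ * c₃) - (s + t * c₃)) - ((s₁ + t₁ * q) - (s₃ + t₃ * q)))
          - (c₁ - c₃) * (((s₂ + t₂ * c₂) - (s + t * c₂)) - ((s₃ + t₃ * c₃) - (s + t * c₃)) - ((s₂ + t₂ * q) - (s₃ + t₃ * q)))
          ≡ (c₁ - q) * (c₂ - c₃) * (t₁ - t₃) - (c₂ - q) * (c₁ - c₃) * (t₂ - t₃)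
        lemma = solve-∀
      A = relation k₄ f₁ f₂ f₃
      B = relation k₅ g₁ g₂ g₃
      D-cancel = U .cancels (det₅≢0 a₁q a₂q a₃q b₁q b₂q b₃q a₁₂ a₁₃ b₂₃ a₁b₁)
                            (det₅-bound v q a₁ a₂ a₃ b₁ b₂ b₃) .cancel
      x≡0 : N ∣ x
      x≡0 = D-cancel x (∣-resp (lemma x y (a₁ ⊝ q) (a₂ ⊝ a₃) (a₂ ⊝ q) (a₁ ⊝ a₃) (b₁ ⊝ q) (b₂ ⊝ b₃) (b₂ ⊝ q) (b₁ ⊝ b₃))
          (ℤ∣.∣m∣n⇒∣m-n (ℤ∣.∣n⇒∣m*n ((b₂ ⊝ q) * (b₁ ⊝ b₃)) A) (ℤ∣.∣n⇒∣m*n ((a₂ ⊝ q) * (a₁ ⊝ a₃)) B)))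
        where
        lemma : ∀ x y p₁ p₂ q₁ q₂ r₁ r₂ s₁ s₂ →
          (s₁ * s₂) * (p₁ * p₂ * x - q₁ * q₂ * y) - (q₁ * q₂) * (r₁ * r₂ * x - s₁ * s₂ * y)
          ≡ (p₁ * (p₂ * (s₁ * s₂)) - q₁ * (q₂ * (r₁ * r₂))) * x
        lemma = solve-∀
      y≡0 : N ∣ y
      y≡0 = D-cancel y (∣-resp (lemma x y (a₁ ⊝ q) (a₂ ⊝ a₃) (a₂ ⊝ q) (a₁ ⊝ a₃) (b₁ ⊝ q) (b₂ ⊝ b₃) (b₂ ⊝ q) (b₁ ⊝ b₃))
          (ℤ∣.∣m∣n⇒∣m-n (ℤ∣.∣n⇒∣m*n ((b₁ ⊝ q) * (b₂ ⊝ b₃)) A) (ℤ∣.∣n⇒∣m*n ((a₁ ⊝ q) * (a₂ ⊝ a₃)) B)))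
        where
        lemma : ∀ x y p₁ p₂ q₁ q₂ r₁ r₂ s₁ s₂ →
          (r₁ * r₂) * (p₁ * p₂ * x - q₁ * q₂ * y) - (p₁ * p₂) * (r₁ * r₂ * x - s₁ * s₂ * y)
          ≡ (p₁ * (p₂ * (s₁ * s₂)) - q₁ * (q₂ * (r₁ * r₂))) * y
        lemma = solve-∀
      ≈-trans : ∀ {a b c} → a ≈ b → b ≈ c → a ≈ c
      ≈-trans {a} {b} {c} (cong-mod e) (cong-mod f) = cong-mod (∣-resp (lemma a b c) (ℤ∣.∣m∣n⇒∣m+n e f))
        where
        lemma : ∀ a b c → (a - b) + (b - c) ≡ a - c
        lemma = solve-∀
      ≈-sym : ∀ {a b} → a ≈ b → b ≈ a
      ≈-sym {a} {b} (cong-mod e) = cong-mod (∣-resp (lemma a b) (ℤ∣.∣m⇒∣-m e))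
        where
        lemma : ∀ a b → - (a - b) ≡ b - a
        lemma = solve-∀
      k₁≈k₃ : ∀ c → at k₁ c ≈ at k₃ c
      k₁≈k₃ c = cong-mod (∣-resp (lemma (τ k₁) (θ k₁) (τ k₃) (θ k₃) (slope c) (slope q)) 
         (ℤ∣.∣m∣n⇒∣m+n (∣difference e₁) (ℤ∣.∣m⇒∣m*n (c ⊝ q) x≡0)))
        where
        lemma : ∀ s t s′ t′ c q → ((s + t * q) - (s′ + t′ * q)) + (t - t′) * (c - q) ≡ (s + t * c) - (s′ + t′ * c)
        lemma = solve-∀
      third : ∀ m {c₁ c₃} → at k₁ c₁ ≈ at m c₁ → at k₃ c₃ ≈ at m c₃ → c₁ ≢ c₃ → m ∥ k₃
      third m {c₁} h₁ h₃ c₁≢c₃ = two-points c₁≢c₃ m k₃ (≈-trans (≈-sym h₁) (k₁≈k₃ c₁)) (≈-sym h₃)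

    -- Each crossing of the 2 × 2 grid forms a triangle with `kᵉ`. The four relations run round the
    -- cycle a, c, b, d and close up with determinant `det₆`.
    grid-rigid : ∀ kᵃ kᵇ kᶜ kᵈ kᵉ {xᵃ xᵇ xᶜ xᵈ yᵃᶜ yᵃᵈ yᵇᶜ yᵇᵈ} →
      yᵃᶜ ≢ yᵃᵈ → yᵃᶜ ≢ xᵃ → yᵃᵈ ≢ xᵃ → yᵇᶜ ≢ yᵇᵈ → yᵇᶜ ≢ xᵇ → yᵇᵈ ≢ xᵇ →
      yᵃᶜ ≢ yᵇᶜ → yᵃᶜ ≢ xᶜ → yᵃᵈ ≢ yᵇᵈ → yᵃᵈ ≢ xᵈ → yᵇᵈ ≢ xᵈ →
      xᵃ ≢ xᵇ → xᵃ ≢ xᶜ → xᵃ ≢ xᵈ → xᵇ ≢ xᶜ → xᵇ ≢ xᵈ →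
      at kᵃ xᵃ ≈ at kᵉ xᵃ → at kᵇ xᵇ ≈ at kᵉ xᵇ → at kᶜ xᶜ ≈ at kᵉ xᶜ → at kᵈ xᵈ ≈ at kᵉ xᵈ →
      at kᵃ yᵃᶜ ≈ at kᶜ yᵃᶜ → at kᵃ yᵃᵈ ≈ at kᵈ yᵃᵈ → at kᵇ yᵇᶜ ≈ at kᶜ yᵇᶜ → at kᵇ yᵇᵈ ≈ at kᵈ yᵇᵈ →
      kᵃ ∥ kᵉ × kᵇ ∥ kᵉ × kᶜ ∥ kᵉ × kᵈ ∥ kᵉ
    grid-rigid kᵃ kᵇ kᶜ kᵈ kᵉ {xᵃ} {xᵇ} {xᶜ} {xᵈ} {yᵃᶜ} {yᵃᵈ} {yᵇᶜ} {yᵇᵈ}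
      a₁ a₂ a₃ b₁ b₂ b₃ c₁ c₂ d₁ d₂ d₃ ab ac ad bc bd eᵃ eᵇ eᶜ eᵈ eᵃᶜ eᵃᵈ eᵇᶜ eᵇᵈ =
        from-θ kᵃ kᵉ eᵃ α≡0 , from-θ kᵇ kᵉ eᵇ β≡0 , from-θ kᶜ kᵉ eᶜ γ≡0 , from-θ kᵈ kᵉ eᵈ δ≡0
      where
      α = θ kᵃ - θ kᵉ
      β = θ kᵇ - θ kᵉ
      γ = θ kᶜ - θ kᵉ
      δ = θ kᵈ - θ kᵉ
      relation : ∀ k l {x x′ y} → at k x ≈ at kᵉ x → at l x′ ≈ at kᵉ x′ → at k y ≈ at l y →
                 N ∣ (θ k - θ kᵉ) * (y ⊝ x) - (θ l - θ kᵉ) * (y ⊝ x′)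
      relation k l {x} {x′} {y} e e′ f = ∣-resp
        (lemma (τ k) (θ k) (τ l) (θ l) (τ kᵉ) (θ kᵉ) (slope x) (slope x′) (slope y))
        (ℤ∣.∣m∣n⇒∣m+n (ℤ∣.∣m∣n⇒∣m-n (∣difference f) (∣difference e)) (∣difference e′))
        where
        lemma : ∀ s t s′ t′ s″ t″ x x′ y →
          ((s + t * y) - (s′ + t′ * y)) - ((s + t * x) - (s″ + t″ * x)) + ((s′ + t′ * x′) - (s″ + t″ * x′))
          ≡ (t - t″) * (y - x) - (t′ - t″) * (y - x′)
        lemma = solve-∀
      E₁ : N ∣ α * (yᵃᶜ ⊝ xᵃ) - γ * (yᵃᶜ ⊝ xᶜ)
      E₁ = relation kᵃ kᶜ eᵃ eᶜ eᵃᶜ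
      E₂ : N ∣ β * (yᵇᶜ ⊝ xᵇ) - γ * (yᵇᶜ ⊝ xᶜ)
      E₂ = relation kᵇ kᶜ eᵇ eᶜ eᵇᶜ
      E₃ : N ∣ β * (yᵇᵈ ⊝ xᵇ) - δ * (yᵇᵈ ⊝ xᵈ)
      E₃ = relation kᵇ kᵈ eᵇ eᵈ eᵇᵈ
      E₄ : N ∣ α * (yᵃᵈ ⊝ xᵃ) - δ * (yᵃᵈ ⊝ xᵈ)
      E₄ = relation kᵃ kᵈ eᵃ eᵈ eᵃᵈ
      A₁ = yᵃᶜ ⊝ xᵃ
      A₂ = yᵃᵈ ⊝ xᵃ
      B₁ = yᵇᶜ ⊝ xᵇ
      B₂ = yᵇᵈ ⊝ xᵇ
      C₁ = yᵃᶜ ⊝ xᶜ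
      C₂ = yᵇᶜ ⊝ xᶜ
      D₁ = yᵇᵈ ⊝ xᵈ
      D₂ = yᵃᵈ ⊝ xᵈ
      combine : ∀ α β γ δ A₁ A₂ B₁ B₂ C₁ C₂ D₁ D₂ →
        ((C₂ * (B₂ * D₂)) * (α * A₁ - γ * C₁) - (C₁ * (B₂ * D₂)) * (β * B₁ - γ * C₂))
        + ((C₁ * (B₁ * D₂)) * (β * B₂ - δ * D₁) - (C₁ * (B₁ * D₁)) * (α * A₂ - δ * D₂))
        ≡ (A₁ * (C₂ * (B₂ * D₂)) - C₁ * (B₁ * (D₁ * A₂))) * α
      combine = solve-∀
      α≡0 : N ∣ α
      α≡0 = U .cancels (det₆≢0 a₁ a₂ a₃ b₁ b₂ b₃ c₁ c₂ d₁ d₂ d₃ ab ac ad bc bd)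
                       (det₆-bound v xᵃ xᵇ xᶜ xᵈ yᵃᶜ yᵃᵈ yᵇᶜ yᵇᵈ) .cancel α
        (∣-resp (combine α β γ δ A₁ A₂ B₁ B₂ C₁ C₂ D₁ D₂)
          (ℤ∣.∣m∣n⇒∣m+n (ℤ∣.∣m∣n⇒∣m-n (ℤ∣.∣n⇒∣m*n (C₂ * (B₂ * D₂)) E₁) (ℤ∣.∣n⇒∣m*n (C₁ * (B₂ * D₂)) E₂))
                          (ℤ∣.∣m∣n⇒∣m-n (ℤ∣.∣n⇒∣m*n (C₁ * (B₁ * D₂)) E₃) (ℤ∣.∣n⇒∣m*n (C₁ * (B₁ * D₁)) E₄))))
      right-zero : ∀ t t′ a b → N ∣ t * a - t′ * b → N ∣ t → N ∣ b * t′
      right-zero t t′ a b d z = ∣-resp (lemma t t′ a b) (ℤ∣.∣m∣n⇒∣m-n (ℤ∣.∣m⇒∣m*n a z) d)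
        where
        lemma : ∀ t t′ a b → t * a - (t * a - t′ * b) ≡ b * t′
        lemma = solve-∀
      left-zero : ∀ t t′ a b → N ∣ t * a - t′ * b → N ∣ t′ → N ∣ a * t
      left-zero t t′ a b d z = ∣-resp (lemma t t′ a b) (ℤ∣.∣m∣n⇒∣m+n (ℤ∣.∣m⇒∣m*n b z) d)
        where
        lemma : ∀ t t′ a b → t′ * b + (t * a - t′ * b) ≡ a * t
        lemma = solve-∀
      γ≡0 : N ∣ γ
      γ≡0 = ⊝-cancel c₂ γ (right-zero α γ A₁ C₁ E₁ α≡0)
      β≡0 : N ∣ β
      β≡0 = ⊝-cancel b₂ β (left-zero β γ B₁ C₂ E₂ γ≡0)
      δ≡0 : N ∣ δ
      δ≡0 = ⊝-cancel d₂ δ (right-zero α δ A₂ D₂ E₄ α≡0)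

-- Packings of copies of a pattern, and what it means for them to be rigid.

module Packings where

  open import Data.Fin.Base using (Fin; zero; suc; combine; remQuot; funToFin; finToFun)
  open import Data.Fin.Properties using (combine-remQuot; funToFin-finToFin; finToFun-funToFin)
  open import Data.Nat.Base as ℕ using (ℕ; zero; suc)
  open import Data.Product.Base using (_×_; proj₁; proj₂)
  open import Function.Base using (_∘_)
  open import Relation.Binary.PropositionalEquality hiding (J)

  remQuot-injective : ∀ {m} n {i j : Fin (m ℕ.* n)} → remQuot {m} n i ≡ remQuot {m} n j → i ≡ j
  remQuot-injective {m} n {i} {j} eq =
    trans (sym (combine-remQuot {m} n i)) (trans (cong (λ p → combine (proj₁ p) (proj₂ p)) eq) (combine-remQuot {m} n j))

  funToFin-cong : ∀ {m n} {f g : Fin m → Fin n} → (∀ i → f i ≡ g i) → funToFin f ≡ funToFin g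
  funToFin-cong {zero}  f≗g = refl
  funToFin-cong {suc m} f≗g = cong₂ combine (f≗g zero) (funToFin-cong (f≗g ∘ suc))

  finToFun-injective : ∀ {m n} {i j : Fin (n ℕ.^ m)} → (∀ k → finToFun {n} {m} i k ≡ finToFun j k) → i ≡ j
  finToFun-injective {m} {n} {i} {j} eq =
    trans (sym (funToFin-finToFin {m} {n} i)) (trans (funToFin-cong eq) (funToFin-finToFin {m} {n} j))

  funToFin-injective : ∀ {m n} {f g : Fin m → Fin n} → funToFin f ≡ funToFin g → ∀ i → f i ≡ g i
  funToFin-injective {m} {n} {f} {g} eq i =
    trans (sym (finToFun-funToFin f i)) (trans (cong (λ c → finToFun c i) eq) (finToFun-funToFin g i))

  record Claim (v : ℕ) : Set₁ where
    field
      J        : Fin v → Fin v → Set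
      J-sym    : ∀ {u u′} → J u u′ → J u′ u
      J-irrefl : ∀ {u u′} → J u u′ → u ≢ u′

  -- M copies on n vertices of a pattern with vertices Fin v: a pair claimed (J) by one
  -- copy has both ends in no other copy.
  record Packing {v : ℕ} (C : Claim v) (n M : ℕ) : Set where
    open Claim C
    field
      place     : Fin M → Fin v → Fin n
      injective : ∀ B {u u′} → place B u ≡ place B u′ → u ≡ u′
      exclusive : ∀ {B B′ u₁ u₂ u₁′ u₂′} → J u₁ u₂ →
                  place B u₁ ≡ place B′ u₁′ → place B u₂ ≡ place B′ u₂′ → B ≡ B′

  module _ {v : ℕ} (C : Claim v) where

    open Claim C

    record Clique₃ (a b c : Fin v) : Set where
      constructor clique₃
      field
        J₁₂ : J a b
        J₁₃ : J a c
        J₂₃ : J b c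

    record Clique₄ (a b c d : Fin v) : Set where
      constructor clique₄
      field
        J₁₂ : J a b
        J₁₃ : J a c
        J₁₄ : J a d
        J₂₃ : J b c
        J₂₄ : J b d
        J₃₄ : J c d

    module _ {n M : ℕ} (P : Packing C n M) where

      open Packing P

      -- Rigid systems are not absent: they are confined to a single copy, where the pattern itself
      -- has to exclude them.
      PaschRigid : Set
      PaschRigid = ∀ {B₁ B₂ B₃ B₄ p₁₂ p₁₃ p₁₄ p₂₁ p₂₃ p₂₄ p₃₁ p₃₂ p₃₄ p₄₁ p₄₂ p₄₃} →
        Clique₃ p₁₂ p₁₃ p₁₄ → Clique₃ p₂₁ p₂₃ p₂₄ → Clique₃ p₃₁ p₃₂ p₃₄ → Clique₃ p₄₁ p₄₂ p₄₃ →
        place B₁ p₁₂ ≡ place B₂ p₂₁ → place B₁ p₁₃ ≡ place B₃ p₃₁ → place B₁ p₁₄ ≡ place B₄ p₄₁ →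
        place B₂ p₂₃ ≡ place B₃ p₃₂ → place B₂ p₂₄ ≡ place B₄ p₄₂ → place B₃ p₃₄ ≡ place B₄ p₄₃ →
        B₁ ≡ B₄ × B₂ ≡ B₄ × B₃ ≡ B₄

      MitreRigid : Set
      MitreRigid = ∀ {B₁ B₂ B₃ B₄ B₅ q₁ q₂ q₃ a₁ a₂ a₃ b₁ b₂ b₃ c₁ c₂ c₃ d₁ d₂ d₃} →
        Clique₃ q₁ a₁ b₁ → Clique₃ q₂ a₂ b₂ → Clique₃ q₃ a₃ b₃ → Clique₃ c₁ c₂ c₃ → Clique₃ d₁ d₂ d₃ →
        place B₁ q₁ ≡ place B₃ q₃ → place B₂ q₂ ≡ place B₃ q₃ →
        place B₁ a₁ ≡ place B₄ c₁ → place B₂ a₂ ≡ place B₄ c₂ → place B₃ a₃ ≡ place B₄ c₃ →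
        place B₁ b₁ ≡ place B₅ d₁ → place B₂ b₂ ≡ place B₅ d₂ → place B₃ b₃ ≡ place B₅ d₃ →
        B₁ ≡ B₃ × B₂ ≡ B₃ × B₄ ≡ B₃ × B₅ ≡ B₃

      GridRigid : Set
      GridRigid = ∀ {Bᵃ Bᵇ Bᶜ Bᵈ Bᵉ aᶜ aᵈ aᵉ bᶜ bᵈ bᵉ cᵃ cᵇ cᵉ dᵃ dᵇ dᵉ eᵃ eᵇ eᶜ eᵈ} →
        Clique₃ aᶜ aᵈ aᵉ → Clique₃ bᶜ bᵈ bᵉ → Clique₃ cᵃ cᵇ cᵉ → Clique₃ dᵃ dᵇ dᵉ → Clique₄ eᵃ eᵇ eᶜ eᵈ →
        place Bᵃ aᶜ ≡ place Bᶜ cᵃ → place Bᵃ aᵈ ≡ place Bᵈ dᵃ → place Bᵇ bᶜ ≡ place Bᶜ cᵇ → place Bᵇ bᵈ ≡ place Bᵈ dᵇ →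
        place Bᵃ aᵉ ≡ place Bᵉ eᵃ → place Bᵇ bᵉ ≡ place Bᵉ eᵇ → place Bᶜ cᵉ ≡ place Bᵉ eᶜ → place Bᵈ dᵉ ≡ place Bᵉ eᵈ →
        Bᵃ ≡ Bᵉ × Bᵇ ≡ Bᵉ × Bᶜ ≡ Bᵉ × Bᵈ ≡ Bᵉ

-- Linear relations that hold for the values of every line at three or four points.

module Relations where

  open Residues
  open Slopes
  open Lines
  open import Data.Fin.Base using (Fin)
  open import Data.Fin.Properties using (_≟_)
  open import Data.Integer.Base using (ℤ; +_; -[1+_]; _+_; _*_; _-_; -_; ∣_∣; 0ℤ; 1ℤ)
  import Data.Integer.Properties as ℤ
  open import Data.Integer.Divisibility.Signed using (_∣_)
  open import Data.Integer.Tactic.RingSolver using (solve-∀)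
  open import Data.List.Base using (List; []; _∷_)
  open import Data.List.Relation.Unary.Any using (here; there)
  open import Data.Nat.Base using (ℕ; _≤_; s≤s; z≤n)
  open import Data.Product.Base using (_×_; _,_; proj₁)
  open import Data.Sum.Base using (inj₁; inj₂)
  open import Function.Base using (_∘_)
  open import Relation.Binary.PropositionalEquality
  open import Relation.Nullary using (yes; no; contradiction)

  -- `a` is the coefficient of a value in a relation, and `b` = 2 / a scales the multiplier to make
  -- up for it; 2 is a common multiple of the coefficients 1, -1 and -2 that occur.
  record Coeff : Set where
    field
      a b  : ℤ
      ab≡2 : a * b ≡ + 2
      b≢0  : b ≢ 0ℤ
      b≤2  : ∣ b ∣ ≤ 2

  open Coeff

  one -one -two : Coeff
  one  = record { a = 1ℤ         ; b = + 2      ; ab≡2 = refl ; b≢0 = λ () ; b≤2 = s≤s (s≤s z≤n) }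
  -one = record { a = -[1+ 0 ] ; b = -[1+ 1 ] ; ab≡2 = refl ; b≢0 = λ () ; b≤2 = s≤s (s≤s z≤n) }
  -two = record { a = -[1+ 1 ] ; b = -[1+ 0 ] ; ab≡2 = refl ; b≢0 = λ () ; b≤2 = s≤s z≤n }

  module _ {v : ℕ} where

    private

      good : ℤ → Set
      good x = x ≢ 0ℤ × ∣ x ∣ ≤ slopeBound v

      *≢0 : ∀ x y → x ≢ 0ℤ → y ≢ 0ℤ → x * y ≢ 0ℤ
      *≢0 x y x≢0 y≢0 eq with ℤ.i*j≡0⇒i≡0∨j≡0 x eq
      ... | inj₁ e = x≢0 e
      ... | inj₂ e = y≢0 e

    -- a nonzero integer invertible modulo the moduli in use
    record Multiplier : Set where
      field
        factor    : ℤ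
        factor≢0 : factor ≢ 0ℤ
        factor≤   : ∣ factor ∣ ≤ slopeBound v

    open Multiplier public

    private

      trivial : Multiplier
      trivial = record { factor = 1ℤ ; factor≢0 = λ () ; factor≤ = s≤s z≤n }

      scale : Coeff → Fin v → Fin v → Multiplier
      scale α x y with x ≟ y
      ... | yes _  = trivial
      ... | no x≢y = record
        { factor = b α * (x ⊝ y) ; factor≢0 = *≢0 (b α) (x ⊝ y) (b≢0 α) (⊝≢0 x≢y) ; factor≤ = 2⊝-bound v (b α) x y (b≤2 α) }

      vandermonde : Fin v → Fin v → Fin v → ℤ
      vandermonde x y z = (x ⊝ y) * ((x ⊝ z) * (y ⊝ z))

      scale₃ : Coeff → Fin v → Fin v → Fin v → Multiplier
      scale₃ α x y z with x ≟ y | x ≟ z | y ≟ z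
      ... | no x≢y | no x≢z | no y≢z = record
        { factor = b α * vandermonde x y z
        ; factor≢0 = *≢0 (b α) _ (b≢0 α) (*≢0 (x ⊝ y) _ (⊝≢0 x≢y) (*≢0 (x ⊝ z) (y ⊝ z) (⊝≢0 x≢z) (⊝≢0 y≢z)))
        ; factor≤ = 2⊝³-bound v (b α) x y x z y z (b≤2 α) }
      ... | _ | _ | _ = trivial

      scale-≢ : ∀ α {x y} → x ≢ y → factor (scale α x y) ≡ b α * (x ⊝ y)
      scale-≢ α {x} {y} x≢y with x ≟ y
      ... | yes x≡y = contradiction x≡y x≢y
      ... | no  _   = refl

      scale₃-≢ : ∀ α {x y z} → x ≢ y → x ≢ z → y ≢ z → factor (scale₃ α x y z) ≡ b α * vandermonde x y z
      scale₃-≢ α {x} {y} {z} x≢y x≢z y≢z with x ≟ y | x ≟ z | y ≟ z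
      ... | yes e | _     | _     = contradiction e x≢y
      ... | no _  | yes e | _     = contradiction e x≢z
      ... | no _  | no _  | yes e = contradiction e y≢z
      ... | no _  | no _  | no _  = refl

    Local : Set
    Local = List (Fin v × Multiplier × ℤ)

    local : Local → Fin v → Multiplier × ℤ
    local [] u = trivial , 0ℤ
    local ((p , x) ∷ ps) u with u ≟ p
    ... | yes _ = x
    ... | no  _ = local ps u

    private

      local-here : ∀ p x ps → local ((p , x) ∷ ps) p ≡ x
      local-here p x ps with p ≟ p
      ... | yes _ = refl
      ... | no ne = contradiction refl ne

      local-there : ∀ p x ps u → p ≢ u → local ((p , x) ∷ ps) u ≡ local ps u
      local-there p x ps u p≢u with u ≟ p
      ... | yes e = contradiction (sym e) p≢u
      ... | no  _ = refl

    -- Every affine f satisfies (p₁ - p₂) f(p₀) + (p₂ - p₀) f(p₁) + (p₀ - p₁) f(p₂) = 0. The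
    -- multipliers are twice these weights, divided by the prescribed coefficients; the offset `w`
    -- sits on the first point alone.
    triple : (α₀ α₁ α₂ : Coeff) (w : ℤ) → Fin v × Fin v × Fin v → Local
    triple α₀ α₁ α₂ w (p₀ , p₁ , p₂) =
      (p₀ , scale α₀ p₁ p₂ , w) ∷ (p₁ , scale α₁ p₂ p₀ , 0ℤ) ∷ (p₂ , scale α₂ p₀ p₁ , 0ℤ) ∷ []

    -- For four points the weights are Vandermonde minors. Their alternating signs go into the
    -- multipliers, so that the relation is a plain sum.
    quadruple : Fin v × Fin v × Fin v × Fin v → Local
    quadruple (p₀ , p₁ , p₂ , p₃) =
        (p₀ , scale₃ -one p₁ p₂ p₃ , 0ℤ) ∷ (p₁ , scale₃ one p₀ p₂ p₃ , 0ℤ)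
      ∷ (p₂ , scale₃ -one p₀ p₁ p₃ , 0ℤ) ∷ (p₃ , scale₃ one p₀ p₁ p₂ , 0ℤ) ∷ []

    valueˡ : Multiplier × ℤ → ℤ → ℤ → Fin v → ℤ
    valueˡ (m , w) τ θ u = factor m * (τ + θ * slope u) + w

    triple-identity : ∀ {p₀ p₁ p₂ α₀ α₁ α₂ w} → p₀ ≢ p₁ → p₀ ≢ p₂ → p₁ ≢ p₂ → ∀ τ θ →
      let V = λ p → valueˡ (local (triple α₀ α₁ α₂ w (p₀ , p₁ , p₂)) p) τ θ p in
      a α₀ * V p₀ + a α₁ * V p₁ + a α₂ * V p₂ ≡ a α₀ * w
    triple-identity {p₀} {p₁} {p₂} {α₀} {α₁} {α₂} {w} p₀₁ p₀₂ p₁₂ τ θ = begin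
        a α₀ * V p₀ + a α₁ * V p₁ + a α₂ * V p₂
            ≡⟨ cong₂ _+_ (cong₂ _+_ (cong (a α₀ *_) v₀) (cong (a α₁ *_) v₁)) (cong (a α₂ *_) v₂) ⟩
        a α₀ * (b α₀ * (p₁ ⊝ p₂) * (τ + θ * slope p₀) + w)
          + a α₁ * (b α₁ * (p₂ ⊝ p₀) * (τ + θ * slope p₁) + 0ℤ)
          + a α₂ * (b α₂ * (p₀ ⊝ p₁) * (τ + θ * slope p₂) + 0ℤ)
            ≡⟨ expand (a α₀) (b α₀) (a α₁) (b α₁) (a α₂) (b α₂) w τ θ (slope p₀) (slope p₁) (slope p₂) ⟩
        (a α₀ * b α₀) * ((p₁ ⊝ p₂) * (τ + θ * slope p₀)) + (a α₁ * b α₁) * ((p₂ ⊝ p₀) * (τ + θ * slope p₁))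
          + (a α₂ * b α₂) * ((p₀ ⊝ p₁) * (τ + θ * slope p₂)) + a α₀ * w
            ≡⟨ cong (_+ a α₀ * w) (cong₂ _+_ (cong₂ _+_
                 (cong (_* ((p₁ ⊝ p₂) * (τ + θ * slope p₀))) (ab≡2 α₀))
                 (cong (_* ((p₂ ⊝ p₀) * (τ + θ * slope p₁))) (ab≡2 α₁)))
                 (cong (_* ((p₀ ⊝ p₁) * (τ + θ * slope p₂))) (ab≡2 α₂))) ⟩
        + 2 * ((p₁ ⊝ p₂) * (τ + θ * slope p₀)) + + 2 * ((p₂ ⊝ p₀) * (τ + θ * slope p₁))
          + + 2 * ((p₀ ⊝ p₁) * (τ + θ * slope p₂)) + a α₀ * w
            ≡⟨ vanish (a α₀ * w) τ θ (slope p₀) (slope p₁) (slope p₂) ⟩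
        a α₀ * w ∎
      where
      open ≡-Reasoning
      V : Fin v → ℤ
      V p = valueˡ (local (triple α₀ α₁ α₂ w (p₀ , p₁ , p₂)) p) τ θ p
      m₀ m₁ m₂ : Multiplier × ℤ
      m₀ = scale α₀ p₁ p₂ , w
      m₁ = scale α₁ p₂ p₀ , 0ℤ
      m₂ = scale α₂ p₀ p₁ , 0ℤ
      at : ∀ x y p → x ≡ y → valueˡ x τ θ p ≡ valueˡ y τ θ p
      at x y p = cong (λ x → valueˡ x τ θ p)
      e₂ e₁ : Local
      e₂ = (p₂ , m₂) ∷ []
      e₁ = (p₁ , m₁) ∷ e₂
      v₀ : V p₀ ≡ b α₀ * (p₁ ⊝ p₂) * (τ + θ * slope p₀) + w
      v₀ = trans (at _ m₀ p₀ (local-here p₀ m₀ e₁)) (cong (λ l → l * (τ + θ * slope p₀) + w) (scale-≢ α₀ p₁₂))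
      v₁ : V p₁ ≡ b α₁ * (p₂ ⊝ p₀) * (τ + θ * slope p₁) + 0ℤ
      v₁ = trans (at _ m₁ p₁ (trans (local-there p₀ m₀ e₁ p₁ p₀₁) (local-here p₁ m₁ e₂)))
                 (cong (λ l → l * (τ + θ * slope p₁) + 0ℤ) (scale-≢ α₁ (p₀₂ ∘ sym)))
      v₂ : V p₂ ≡ b α₂ * (p₀ ⊝ p₁) * (τ + θ * slope p₂) + 0ℤ
      v₂ = trans (at _ m₂ p₂ (trans (local-there p₀ m₀ e₁ p₂ p₀₂) (trans (local-there p₁ m₁ e₂ p₂ p₁₂) (local-here p₂ m₂ []))))
                 (cong (λ l → l * (τ + θ * slope p₂) + 0ℤ) (scale-≢ α₂ p₀₁))
      expand : ∀ a₀ b₀ a₁ b₁ a₂ b₂ w τ θ x y z →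
        a₀ * (b₀ * (y - z) * (τ + θ * x) + w) + a₁ * (b₁ * (z - x) * (τ + θ * y) + 0ℤ) + a₂ * (b₂ * (x - y) * (τ + θ * z) + 0ℤ)
        ≡ (a₀ * b₀) * ((y - z) * (τ + θ * x)) + (a₁ * b₁) * ((z - x) * (τ + θ * y)) + (a₂ * b₂) * ((x - y) * (τ + θ * z)) + a₀ * w
      expand = solve-∀
      vanish : ∀ w τ θ x y z →
        + 2 * ((y - z) * (τ + θ * x)) + + 2 * ((z - x) * (τ + θ * y)) + + 2 * ((x - y) * (τ + θ * z)) + w ≡ w
      vanish = solve-∀

    quadruple-identity : ∀ {p₀ p₁ p₂ p₃} → p₀ ≢ p₁ → p₀ ≢ p₂ → p₀ ≢ p₃ → p₁ ≢ p₂ → p₁ ≢ p₃ → p₂ ≢ p₃ → ∀ τ θ →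
      let V = λ p → valueˡ (local (quadruple (p₀ , p₁ , p₂ , p₃)) p) τ θ p in
      V p₀ + V p₁ + V p₂ + V p₃ ≡ 0ℤ
    quadruple-identity {p₀} {p₁} {p₂} {p₃} p₀₁ p₀₂ p₀₃ p₁₂ p₁₃ p₂₃ τ θ =
      trans (cong₂ _+_ (cong₂ _+_ (cong₂ _+_ v₀ v₁) v₂) v₃) (vanish τ θ (slope p₀) (slope p₁) (slope p₂) (slope p₃))
      where
      V : Fin v → ℤ
      V p = valueˡ (local (quadruple (p₀ , p₁ , p₂ , p₃)) p) τ θ p
      m₀ m₁ m₂ m₃ : Multiplier × ℤ
      m₀ = scale₃ -one p₁ p₂ p₃ , 0ℤ
      m₁ = scale₃ one p₀ p₂ p₃ , 0ℤ
      m₂ = scale₃ -one p₀ p₁ p₃ , 0ℤ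
      m₃ = scale₃ one p₀ p₁ p₂ , 0ℤ
      e₃ e₂ e₁ : Local
      e₃ = (p₃ , m₃) ∷ []
      e₂ = (p₂ , m₂) ∷ e₃
      e₁ = (p₁ , m₁) ∷ e₂
      at : ∀ x y p → x ≡ y → valueˡ x τ θ p ≡ valueˡ y τ θ p
      at x y p = cong (λ x → valueˡ x τ θ p)
      scaled : ∀ p {l l′ : ℤ} → l ≡ l′ → l * (τ + θ * slope p) + 0ℤ ≡ l′ * (τ + θ * slope p) + 0ℤ
      scaled p = cong (λ l → l * (τ + θ * slope p) + 0ℤ)
      v₀ : V p₀ ≡ -[1+ 1 ] * vandermonde p₁ p₂ p₃ * (τ + θ * slope p₀) + 0ℤ
      v₀ = trans (at _ m₀ p₀ (local-here p₀ m₀ e₁)) (scaled p₀ (scale₃-≢ -one p₁₂ p₁₃ p₂₃))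
      v₁ : V p₁ ≡ + 2 * vandermonde p₀ p₂ p₃ * (τ + θ * slope p₁) + 0ℤ
      v₁ = trans (at _ m₁ p₁ (trans (local-there p₀ m₀ e₁ p₁ p₀₁) (local-here p₁ m₁ e₂))) (scaled p₁ (scale₃-≢ one p₀₂ p₀₃ p₂₃))
      v₂ : V p₂ ≡ -[1+ 1 ] * vandermonde p₀ p₁ p₃ * (τ + θ * slope p₂) + 0ℤ
      v₂ = trans (at _ m₂ p₂ (trans (local-there p₀ m₀ e₁ p₂ p₀₂) (trans (local-there p₁ m₁ e₂ p₂ p₁₂) (local-here p₂ m₂ e₃)))) (scaled p₂ (scale₃-≢ -one p₀₁ p₀₃ p₁₃))
      v₃ : V p₃ ≡ + 2 * vandermonde p₀ p₁ p₂ * (τ + θ * slope p₃) + 0ℤ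
      v₃ = trans (at _ m₃ p₃ (trans (local-there p₀ m₀ e₁ p₃ p₀₃) (trans (local-there p₁ m₁ e₂ p₃ p₁₃) (trans (local-there p₂ m₂ e₃ p₃ p₂₃) (local-here p₃ m₃ [])))))
                 (scaled p₃ (scale₃-≢ one p₀₁ p₀₂ p₁₂))
      vanish : ∀ τ θ x y z t →
        -[1+ 1 ] * ((y - z) * ((y - t) * (z - t))) * (τ + θ * x) + 0ℤ + (+ 2 * ((x - z) * ((x - t) * (z - t))) * (τ + θ * y) + 0ℤ)
        + (-[1+ 1 ] * ((x - y) * ((x - t) * (y - t))) * (τ + θ * z) + 0ℤ) + (+ 2 * ((x - y) * ((x - z) * (y - z))) * (τ + θ * t) + 0ℤ) ≡ 0ℤ
      vanish = solve-∀

  module _ {v M : ℕ} where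

    Relabel : Set
    Relabel = Fin M → Fin v → Multiplier {v} × ℤ

    Entry : Set
    Entry = Fin M × Local {v}

    relabel : List Entry → Relabel
    relabel [] P = local []
    relabel ((Q , ps) ∷ es) P with P ≟ Q
    ... | yes _ = local ps
    ... | no  _ = relabel es P

    -- `relabel` obeys the first entry for a block, so a row takes effect only if no earlier row has
    -- the same block. This is why distinct blocks are assumed when a system is refuted.
    data Selects : List Entry → Entry → Set where
      here  : ∀ {e es} → Selects (e ∷ es) e
      there : ∀ {e e′ es} → proj₁ e ≢ proj₁ e′ → Selects es e → Selects (e′ ∷ es) e

    selects-local : ∀ {es P ps} → Selects es (P , ps) → relabel es P ≡ local ps
    selects-local {P = P} here with P ≟ P
    ... | yes _  = refl
    ... | no P≢P = contradiction refl P≢P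
    selects-local {P = P} (there {e′ = e′} P≢Q s) with P ≟ proj₁ e′
    ... | yes P≡Q = contradiction P≡Q P≢Q
    ... | no  _   = selects-local s

    value : Relabel → Fin M → ℤ → ℤ → Fin v → ℤ
    value ρ P τ θ u = valueˡ (ρ P u) τ θ u

    selects-triple : ∀ {es P p₀ p₁ p₂ α₀ α₁ α₂ w} → Selects es (P , triple α₀ α₁ α₂ w (p₀ , p₁ , p₂)) →
      p₀ ≢ p₁ → p₀ ≢ p₂ → p₁ ≢ p₂ → ∀ τ θ →
      a α₀ * value (relabel es) P τ θ p₀ + a α₁ * value (relabel es) P τ θ p₁ + a α₂ * value (relabel es) P τ θ p₂ ≡ a α₀ * w
    selects-triple {α₀ = α₀} {α₁} {α₂} {w} s p₀₁ p₀₂ p₁₂ τ θ rewrite selects-local s = triple-identity {α₀ = α₀} {α₁} {α₂} {w} p₀₁ p₀₂ p₁₂ τ θ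

    selects-quadruple : ∀ {es P p₀ p₁ p₂ p₃} → Selects es (P , quadruple (p₀ , p₁ , p₂ , p₃)) →
      p₀ ≢ p₁ → p₀ ≢ p₂ → p₀ ≢ p₃ → p₁ ≢ p₂ → p₁ ≢ p₃ → p₂ ≢ p₃ → ∀ τ θ →
      value (relabel es) P τ θ p₀ + value (relabel es) P τ θ p₁ + value (relabel es) P τ θ p₂ + value (relabel es) P τ θ p₃ ≡ 0ℤ
    selects-quadruple s p₀₁ p₀₂ p₀₃ p₁₂ p₁₃ p₂₃ τ θ rewrite selects-local s = quadruple-identity p₀₁ p₀₂ p₀₃ p₁₂ p₁₃ p₂₃ τ θ

-- Lifting a packing so that Pasch, mitre and grid systems become rigid.

module Lifting where

  open Residues
  open Slopes
  open Lines
  open Packings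
  open Relations
  open import Data.Fin.Base using (Fin; suc; combine; remQuot; funToFin; finToFun)
  open import Data.Fin.Properties using (_≟_; combine-injective)
  open import Data.Integer.Base using (ℤ; +_; -[1+_]; _+_; _*_; _-_; -_; ∣_∣; 0ℤ; 1ℤ)
  open import Data.Integer.Divisibility.Signed as ℤ∣ using (_∣_)
  open import Data.Integer.Tactic.RingSolver using (solve-∀)
  open import Data.List.Base using (List; []; _∷_; _++_; map; length; lookup; cartesianProduct; allFin)
  open import Data.List.Membership.Propositional using (_∈_)
  open import Data.List.Membership.Propositional.Properties
    using (∈-cartesianProduct⁺; ∈-allFin; ∈-map⁺; ∈-++⁺ˡ; ∈-++⁺ʳ)
  open import Data.List.Relation.Unary.Any as Any using (here; there)
  open import Data.List.Relation.Unary.Any.Properties using (lookup-index)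
  open import Data.Nat.Base as ℕ using (ℕ; suc)
  import Data.Nat.Properties as ℕ
  open import Data.Product.Base using (∃-syntax; _×_; _,_; proj₁; proj₂)
  open import Function.Base using (_∘_)
  open import Relation.Binary.PropositionalEquality hiding (J)
  open import Relation.Nullary using (¬_; yes; no; contradiction)

  module _ {v M : ℕ} where

    private

      Row₃ Row₄ : Set
      Row₃ = Fin M × (Fin v × Fin v × Fin v)
      Row₄ = Fin M × (Fin v × Fin v × Fin v × Fin v)

      rows₃ : List Row₃
      rows₃ = cartesianProduct (allFin M) (cartesianProduct (allFin v) (cartesianProduct (allFin v) (allFin v)))

      rows₄ : List Row₄
      rows₄ = cartesianProduct (allFin M) (cartesianProduct (allFin v) (cartesianProduct (allFin v) (cartesianProduct (allFin v) (allFin v))))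

      ∈-rows₃ : ∀ r → r ∈ rows₃
      ∈-rows₃ (P , a , b , c) = ∈-cartesianProduct⁺ (∈-allFin P) (∈-cartesianProduct⁺ (∈-allFin a) (∈-cartesianProduct⁺ (∈-allFin b) (∈-allFin c)))

      ∈-rows₄ : ∀ r → r ∈ rows₄
      ∈-rows₄ (P , a , b , c , d) = ∈-cartesianProduct⁺ (∈-allFin P)
        (∈-cartesianProduct⁺ (∈-allFin a) (∈-cartesianProduct⁺ (∈-allFin b) (∈-cartesianProduct⁺ (∈-allFin c) (∈-allFin d))))

      row : (α₀ α₁ α₂ : Coeff) → ℤ → Row₃ → Entry {v} {M}
      row α₀ α₁ α₂ w (P , ps) = P , triple α₀ α₁ α₂ w ps

    -- In each of these systems the coefficients at a common point cancel, while the
    -- single offset 1 makes the sum of all rows equal to 1.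
    paschEntries : Row₃ × Row₃ × Row₃ × Row₃ → List Entry
    paschEntries (r₁ , r₂ , r₃ , r₄) =
      row one one one 1ℤ r₁ ∷ row -one one one 0ℤ r₂ ∷ row -one -one one 0ℤ r₃ ∷ row -one -one -one 0ℤ r₄ ∷ []

    mitreEntries : Row₃ × Row₃ × Row₃ × Row₃ × Row₃ → List Entry
    mitreEntries (r₁ , r₂ , r₃ , r₄ , r₅) =
      row one one one 1ℤ r₁ ∷ row one one one 0ℤ r₂ ∷ row -two one one 0ℤ r₃ ∷ row -one -one -one 0ℤ r₄ ∷ row -one -one -one 0ℤ r₅ ∷ []

    gridEntries : Row₃ × Row₃ × Row₃ × Row₃ × Row₄ → List Entry
    gridEntries (a , b , c , d , (P , e)) =
      row one one one 1ℤ a ∷ row one one one 0ℤ b ∷ row -one -one one 0ℤ c ∷ row -one -one one 0ℤ d ∷ (P , quadruple e) ∷ []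

    private

      paschs mitres grids : List (List (Entry {v} {M}))
      paschs = map paschEntries (cartesianProduct rows₃ (cartesianProduct rows₃ (cartesianProduct rows₃ rows₃)))
      mitres = map mitreEntries (cartesianProduct rows₃ (cartesianProduct rows₃ (cartesianProduct rows₃ (cartesianProduct rows₃ rows₃))))
      grids  = map gridEntries (cartesianProduct rows₃ (cartesianProduct rows₃ (cartesianProduct rows₃ (cartesianProduct rows₃ rows₄))))

      ∈-pasch : ∀ r₁ r₂ r₃ r₄ → paschEntries (r₁ , r₂ , r₃ , r₄) ∈ [] ∷ paschs ++ mitres ++ grids
      ∈-pasch r₁ r₂ r₃ r₄ = there (∈-++⁺ˡ (∈-map⁺ paschEntries
        (∈-cartesianProduct⁺ (∈-rows₃ r₁) (∈-cartesianProduct⁺ (∈-rows₃ r₂) (∈-cartesianProduct⁺ (∈-rows₃ r₃) (∈-rows₃ r₄))))))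

      ∈-mitre : ∀ r₁ r₂ r₃ r₄ r₅ → mitreEntries (r₁ , r₂ , r₃ , r₄ , r₅) ∈ [] ∷ paschs ++ mitres ++ grids
      ∈-mitre r₁ r₂ r₃ r₄ r₅ = there (∈-++⁺ʳ paschs (∈-++⁺ˡ (∈-map⁺ mitreEntries
        (∈-cartesianProduct⁺ (∈-rows₃ r₁) (∈-cartesianProduct⁺ (∈-rows₃ r₂) (∈-cartesianProduct⁺ (∈-rows₃ r₃)
          (∈-cartesianProduct⁺ (∈-rows₃ r₄) (∈-rows₃ r₅))))))))

      ∈-grid : ∀ a b c d e → gridEntries (a , b , c , d , e) ∈ [] ∷ paschs ++ mitres ++ grids
      ∈-grid a b c d e = there (∈-++⁺ʳ paschs (∈-++⁺ʳ mitres (∈-map⁺ gridEntries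
        (∈-cartesianProduct⁺ (∈-rows₃ a) (∈-cartesianProduct⁺ (∈-rows₃ b) (∈-cartesianProduct⁺ (∈-rows₃ c)
          (∈-cartesianProduct⁺ (∈-rows₃ d) (∈-rows₄ e))))))))

    abstract

      coordinates⁻ : ℕ
      coordinates⁻ = length (paschs ++ mitres ++ grids)

      coordinate : Fin (suc coordinates⁻) → List (Entry {v} {M})
      coordinate = lookup ([] ∷ paschs ++ mitres ++ grids)

      coordinate-pasch : ∀ r₁ r₂ r₃ r₄ → ∃[ t ] coordinate t ≡ paschEntries (r₁ , r₂ , r₃ , r₄)
      coordinate-pasch r₁ r₂ r₃ r₄ = Any.index (∈-pasch r₁ r₂ r₃ r₄) , sym (lookup-index (∈-pasch r₁ r₂ r₃ r₄))

      coordinate-mitre : ∀ r₁ r₂ r₃ r₄ r₅ → ∃[ t ] coordinate t ≡ mitreEntries (r₁ , r₂ , r₃ , r₄ , r₅)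
      coordinate-mitre r₁ r₂ r₃ r₄ r₅ = Any.index (∈-mitre r₁ r₂ r₃ r₄ r₅) , sym (lookup-index (∈-mitre r₁ r₂ r₃ r₄ r₅))

      coordinate-grid : ∀ a b c d e → ∃[ t ] coordinate t ≡ gridEntries (a , b , c , d , e)
      coordinate-grid a b c d e = Any.index (∈-grid a b c d e) , sym (lookup-index (∈-grid a b c d e))

    -- The successor stems from the empty system in front of the list: with at least one coordinate
    -- the number of lifted vertices tends to infinity with the modulus.
    coordinates : ℕ
    coordinates = suc coordinates⁻

  module _ {v : ℕ} {C : Claim v} {n M : ℕ} (P : Packing C n M) (N : ℕ) where

    private module P = Packing P

    relabelling : Fin (coordinates {v} {M}) → Relabel {v} {M}
    relabelling t = relabel (coordinate t)

    -- Copies over the blocks of P, with one line for every coordinate.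
    record Lifting (n′ M′ : ℕ) : Set where
      field
        base       : Fin M′ → Fin M
        τ# θ#      : Fin M′ → Fin (coordinates {v} {M}) → Fin N
        place′     : Fin M′ → Fin v → Fin n′
        same-block : ∀ {B B′} → base B ≡ base B′ → (∀ t → τ# B t ≡ τ# B′ t) → (∀ t → θ# B t ≡ θ# B′ t) → B ≡ B′

      coord : Fin M′ → Fin v → Fin (coordinates {v} {M}) → ℤ
      coord B u t = value (relabelling t) (base B) ⟦ τ# B t ⟧ ⟦ θ# B t ⟧ u

      field
        place′-base  : ∀ {B B′ u u′} → place′ B u ≡ place′ B′ u′ → P.place (base B) u ≡ P.place (base B′) u′
        place′-coord : ∀ {B B′ u u′} → place′ B u ≡ place′ B′ u′ → ∀ t → + N ∣ coord B u t - coord B′ u′ t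

  module _ {v : ℕ} {C : Claim v} {n M : ℕ} {P : Packing C n M} {N : ℕ}
           (1<N : 1 ℕ.< N) (U : Unramified v (+ N)) {n′ M′ : ℕ} (L : Lifting P N n′ M′) where

    open Claim C
    open Packing P
    open Lifting L

    private

      T : ℕ
      T = coordinates {v} {M}

      line : Fin M′ → Fin T → Line U
      line B t = ⟦ τ# B t ⟧ , ⟦ θ# B t ⟧

      same-lines : ∀ {B B′} → base B ≡ base B′ → (∀ t → _∥_ U (line B t) (line B′ t)) → B ≡ B′
      same-lines b≡ l∥ = same-block b≡ (λ t → ∣diff⇒≡ (∣difference (≈τ (l∥ t)))) (λ t → ∣diff⇒≡ (∣difference (≈θ (l∥ t))))

      -- Over one block, multiplier and offset at a vertex are the same for both copies: the offset
      -- drops out of the difference and the multiplier cancels.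
      meet : ∀ {B B′ u u′} x → u ≡ x → u′ ≡ x → base B ≡ base B′ → place′ B u ≡ place′ B′ u′ →
             ∀ t → _≈_ U (Line.at (line B t) x) (Line.at (line B′ t) x)
      meet {B} {B′} u refl refl b≡ eq t = cong-mod (U .cancels (factor≢0 μ) (factor≤ μ) .cancel _
          (subst (+ N ∣_) (trans (cong (λ Q → coord B u t - value (relabelling P N t) Q ⟦ τ# B′ t ⟧ ⟦ θ# B′ t ⟧ u) (sym b≡)) 
             (lemma (factor μ) (⟦ τ# B t ⟧ + ⟦ θ# B t ⟧ * slope u) (⟦ τ# B′ t ⟧ + ⟦ θ# B′ t ⟧ * slope u) w)) (place′-coord eq t)))
        where
        μ = proj₁ (relabelling P N t (base B) u)
        w = proj₂ (relabelling P N t (base B) u)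
        lemma : ∀ l x y w → (l * x + w) - (l * y + w) ≡ l * (x - y)
        lemma = solve-∀

      base-eq : ∀ {B B′ u u′} → base B ≡ base B′ → place′ B u ≡ place′ B′ u′ → u ≡ u′
      base-eq {B} {B′} {u} {u′} b≡ eq = injective (base B) (trans (place′-base {B} {B′} eq) (cong (λ Q → place Q u′) (sym b≡)))

    -- Copies that share a claimed pair lie over one block, and in each coordinate their lines agree
    -- at two distinct points.
    lift : Packing C n′ M′
    lift = record
      { place = place′
      ; injective = λ B eq → base-eq refl eq
      ; exclusive = λ {B} {B′} j e₁ e₂ →
          let b≡ = exclusive j (place′-base {B} {B′} e₁) (place′-base {B} {B′} e₂) in
          same-lines b≡ (λ t → two-points U (J-irrefl j) (line B t) (line B′ t)
            (meet _ refl (sym (base-eq b≡ e₁)) b≡ e₁ t) (meet _ refl (sym (base-eq b≡ e₂)) b≡ e₂ t))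
      }

    private

      absurd-mod : ∀ {x} → x ≡ 1ℤ → ¬ + N ∣ x
      absurd-mod refl d with ∣-small⇒≡0 d 1<N
      ... | ()

      -- In the coordinate made for this very system, the six incidences, all 0 modulo N, add up to
      -- the four row relations, whose total is 1.
      no-pasch : ∀ {B₁ B₂ B₃ B₄ p₁₂ p₁₃ p₁₄ p₂₁ p₂₃ p₂₄ p₃₁ p₃₂ p₃₄ p₄₁ p₄₂ p₄₃} →
        base B₁ ≢ base B₂ → base B₁ ≢ base B₃ → base B₁ ≢ base B₄ → base B₂ ≢ base B₃ → base B₂ ≢ base B₄ → base B₃ ≢ base B₄ →
        Clique₃ C p₁₂ p₁₃ p₁₄ → Clique₃ C p₂₁ p₂₃ p₂₄ → Clique₃ C p₃₁ p₃₂ p₃₄ → Clique₃ C p₄₁ p₄₂ p₄₃ →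
        place′ B₁ p₁₂ ≡ place′ B₂ p₂₁ → place′ B₁ p₁₃ ≡ place′ B₃ p₃₁ → place′ B₁ p₁₄ ≡ place′ B₄ p₄₁ →
        place′ B₂ p₂₃ ≡ place′ B₃ p₃₂ → place′ B₂ p₂₄ ≡ place′ B₄ p₄₂ → ¬ place′ B₃ p₃₄ ≡ place′ B₄ p₄₃
      no-pasch {B₁} {B₂} {B₃} {B₄} {p₁₂} {p₁₃} {p₁₄} {p₂₁} {p₂₃} {p₂₄} {p₃₁} {p₃₂} {p₃₄} {p₄₁} {p₄₂} {p₄₃}
        n₁₂ n₁₃ n₁₄ n₂₃ n₂₄ n₃₄ (clique₃ j₁ j₁′ j₁″) (clique₃ j₂ j₂′ j₂″) (clique₃ j₃ j₃′ j₃″) (clique₃ j₄ j₄′ j₄″)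
        e₁₂ e₁₃ e₁₄ e₂₃ e₂₄ e₃₄ = absurd-mod total divisible
        where
        r₁ = base B₁ , (p₁₂ , p₁₃ , p₁₄)
        r₂ = base B₂ , p₂₁ , p₂₃ , p₂₄
        r₃ = base B₃ , p₃₁ , p₃₂ , p₃₄
        r₄ = base B₄ , p₄₁ , p₄₂ , p₄₃
        found = coordinate-pasch r₁ r₂ r₃ r₄
        t = proj₁ found
        es = coordinate t
        sel : ∀ {e} → Selects (paschEntries (r₁ , r₂ , r₃ , r₄)) e → Selects es e
        sel {e} = subst (λ l → Selects l e) (sym (proj₂ found))
        X : Fin M′ → Fin v → ℤ
        X B u = coord B u t
        R₁ = selects-triple {es = es} (sel here) (J-irrefl j₁) (J-irrefl j₁′) (J-irrefl j₁″) ⟦ τ# B₁ t ⟧ ⟦ θ# B₁ t ⟧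
        R₂ = selects-triple {es = es} (sel (there (n₁₂ ∘ sym) here)) (J-irrefl j₂) (J-irrefl j₂′) (J-irrefl j₂″) ⟦ τ# B₂ t ⟧ ⟦ θ# B₂ t ⟧
        R₃ = selects-triple {es = es} (sel (there (n₁₃ ∘ sym) (there (n₂₃ ∘ sym) here))) (J-irrefl j₃) (J-irrefl j₃′) (J-irrefl j₃″) ⟦ τ# B₃ t ⟧ ⟦ θ# B₃ t ⟧
        R₄ = selects-triple {es = es} (sel (there (n₁₄ ∘ sym) (there (n₂₄ ∘ sym) (there (n₃₄ ∘ sym) here)))) (J-irrefl j₄) (J-irrefl j₄′) (J-irrefl j₄″) ⟦ τ# B₄ t ⟧ ⟦ θ# B₄ t ⟧
        total : (X B₁ p₁₂ - X B₂ p₂₁) + (X B₁ p₁₃ - X B₃ p₃₁) + (X B₁ p₁₄ - X B₄ p₄₁)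
              + (X B₂ p₂₃ - X B₃ p₃₂) + (X B₂ p₂₄ - X B₄ p₄₂) + (X B₃ p₃₄ - X B₄ p₄₃) ≡ 1ℤ
        total = trans (rearrange (X B₁ p₁₂) (X B₁ p₁₃) (X B₁ p₁₄) (X B₂ p₂₁) (X B₂ p₂₃) (X B₂ p₂₄)
                                 (X B₃ p₃₁) (X B₃ p₃₂) (X B₃ p₃₄) (X B₄ p₄₁) (X B₄ p₄₂) (X B₄ p₄₃))
                      (cong₂ _+_ (cong₂ _+_ (cong₂ _+_ R₁ R₂) R₃) R₄)
          where
          rearrange : ∀ a b c a′ b′ c′ a″ b″ c″ a‴ b‴ c‴ →
            (a - a′) + (b - a″) + (c - a‴) + (b′ - b″) + (c′ - b‴) + (c″ - c‴)
            ≡ (1ℤ * a + 1ℤ * b + 1ℤ * c) + (-[1+ 0 ] * a′ + 1ℤ * b′ + 1ℤ * c′)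
              + (-[1+ 0 ] * a″ + -[1+ 0 ] * b″ + 1ℤ * c″) + (-[1+ 0 ] * a‴ + -[1+ 0 ] * b‴ + -[1+ 0 ] * c‴)
          rearrange = solve-∀
        divisible : + N ∣ (X B₁ p₁₂ - X B₂ p₂₁) + (X B₁ p₁₃ - X B₃ p₃₁) + (X B₁ p₁₄ - X B₄ p₄₁)
                        + (X B₂ p₂₃ - X B₃ p₃₂) + (X B₂ p₂₄ - X B₄ p₄₂) + (X B₃ p₃₄ - X B₄ p₄₃)
        divisible = ℤ∣.∣m∣n⇒∣m+n (ℤ∣.∣m∣n⇒∣m+n (ℤ∣.∣m∣n⇒∣m+n (ℤ∣.∣m∣n⇒∣m+n (ℤ∣.∣m∣n⇒∣m+n
          (place′-coord e₁₂ t) (place′-coord e₁₃ t)) (place′-coord e₁₄ t)) (place′-coord e₂₃ t)) (place′-coord e₂₄ t)) (place′-coord e₃₄ t)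

      -- The common point lies on three lines, hence its coefficients 1, 1 and -2; every other point
      -- lies on two lines and gets 1 and -1.
      no-mitre : ∀ {B₁ B₂ B₃ B₄ B₅ q₁ q₂ q₃ a₁ a₂ a₃ b₁ b₂ b₃ c₁ c₂ c₃ d₁ d₂ d₃} →
        base B₁ ≢ base B₂ → base B₁ ≢ base B₃ → base B₁ ≢ base B₄ → base B₁ ≢ base B₅ → base B₂ ≢ base B₃ →
        base B₂ ≢ base B₄ → base B₂ ≢ base B₅ → base B₃ ≢ base B₄ → base B₃ ≢ base B₅ → base B₄ ≢ base B₅ →
        Clique₃ C q₁ a₁ b₁ → Clique₃ C q₂ a₂ b₂ → Clique₃ C q₃ a₃ b₃ → Clique₃ C c₁ c₂ c₃ → Clique₃ C d₁ d₂ d₃ →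
        place′ B₁ q₁ ≡ place′ B₃ q₃ → place′ B₂ q₂ ≡ place′ B₃ q₃ →
        place′ B₁ a₁ ≡ place′ B₄ c₁ → place′ B₂ a₂ ≡ place′ B₄ c₂ → place′ B₃ a₃ ≡ place′ B₄ c₃ →
        place′ B₁ b₁ ≡ place′ B₅ d₁ → place′ B₂ b₂ ≡ place′ B₅ d₂ → ¬ place′ B₃ b₃ ≡ place′ B₅ d₃
      no-mitre {B₁} {B₂} {B₃} {B₄} {B₅} {q₁} {q₂} {q₃} {a₁} {a₂} {a₃} {b₁} {b₂} {b₃} {c₁} {c₂} {c₃} {d₁} {d₂} {d₃}
        n₁₂ n₁₃ n₁₄ n₁₅ n₂₃ n₂₄ n₂₅ n₃₄ n₃₅ n₄₅
        (clique₃ j₁ j₁′ j₁″) (clique₃ j₂ j₂′ j₂″) (clique₃ j₃ j₃′ j₃″) (clique₃ j₄ j₄′ j₄″) (clique₃ j₅ j₅′ j₅″)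
        e₁ e₂ f₁ f₂ f₃ g₁ g₂ g₃ = absurd-mod total divisible
        where
        r₁ = base B₁ , q₁ , a₁ , b₁
        r₂ = base B₂ , q₂ , a₂ , b₂
        r₃ = base B₃ , q₃ , a₃ , b₃
        r₄ = base B₄ , c₁ , c₂ , c₃
        r₅ = base B₅ , d₁ , d₂ , d₃
        found = coordinate-mitre r₁ r₂ r₃ r₄ r₅
        t = proj₁ found
        es = coordinate t
        sel : ∀ {e} → Selects (mitreEntries (r₁ , r₂ , r₃ , r₄ , r₅)) e → Selects es e
        sel {e} = subst (λ l → Selects l e) (sym (proj₂ found))
        X : Fin M′ → Fin v → ℤ
        X B u = coord B u t
        R₁ = selects-triple {es = es} (sel here) (J-irrefl j₁) (J-irrefl j₁′) (J-irrefl j₁″) ⟦ τ# B₁ t ⟧ ⟦ θ# B₁ t ⟧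
        R₂ = selects-triple {es = es} (sel (there (n₁₂ ∘ sym) here)) (J-irrefl j₂) (J-irrefl j₂′) (J-irrefl j₂″) ⟦ τ# B₂ t ⟧ ⟦ θ# B₂ t ⟧
        R₃ = selects-triple {es = es} (sel (there (n₁₃ ∘ sym) (there (n₂₃ ∘ sym) here))) (J-irrefl j₃) (J-irrefl j₃′) (J-irrefl j₃″) ⟦ τ# B₃ t ⟧ ⟦ θ# B₃ t ⟧
        R₄ = selects-triple {es = es} (sel (there (n₁₄ ∘ sym) (there (n₂₄ ∘ sym) (there (n₃₄ ∘ sym) here)))) (J-irrefl j₄) (J-irrefl j₄′) (J-irrefl j₄″) ⟦ τ# B₄ t ⟧ ⟦ θ# B₄ t ⟧
        R₅ = selects-triple {es = es} (sel (there (n₁₅ ∘ sym) (there (n₂₅ ∘ sym) (there (n₃₅ ∘ sym) (there (n₄₅ ∘ sym) here))))) (J-irrefl j₅) (J-irrefl j₅′) (J-irrefl j₅″) ⟦ τ# B₅ t ⟧ ⟦ θ# B₅ t ⟧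
        total : (X B₁ q₁ - X B₃ q₃) + (X B₂ q₂ - X B₃ q₃)
              + (X B₁ a₁ - X B₄ c₁) + (X B₂ a₂ - X B₄ c₂) + (X B₃ a₃ - X B₄ c₃)
              + (X B₁ b₁ - X B₅ d₁) + (X B₂ b₂ - X B₅ d₂) + (X B₃ b₃ - X B₅ d₃) ≡ 1ℤ
        total = trans (rearrange (X B₁ q₁) (X B₁ a₁) (X B₁ b₁) (X B₂ q₂) (X B₂ a₂) (X B₂ b₂) (X B₃ q₃) (X B₃ a₃) (X B₃ b₃)
                                 (X B₄ c₁) (X B₄ c₂) (X B₄ c₃) (X B₅ d₁) (X B₅ d₂) (X B₅ d₃))
                      (cong₂ _+_ (cong₂ _+_ (cong₂ _+_ (cong₂ _+_ R₁ R₂) R₃) R₄) R₅)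
          where
          rearrange : ∀ q₁ a₁ b₁ q₂ a₂ b₂ q₃ a₃ b₃ c₁ c₂ c₃ d₁ d₂ d₃ →
            (q₁ - q₃) + (q₂ - q₃) + (a₁ - c₁) + (a₂ - c₂) + (a₃ - c₃) + (b₁ - d₁) + (b₂ - d₂) + (b₃ - d₃)
            ≡ (1ℤ * q₁ + 1ℤ * a₁ + 1ℤ * b₁) + (1ℤ * q₂ + 1ℤ * a₂ + 1ℤ * b₂)
              + (-[1+ 1 ] * q₃ + 1ℤ * a₃ + 1ℤ * b₃)
              + (-[1+ 0 ] * c₁ + -[1+ 0 ] * c₂ + -[1+ 0 ] * c₃) + (-[1+ 0 ] * d₁ + -[1+ 0 ] * d₂ + -[1+ 0 ] * d₃)
          rearrange = solve-∀
        divisible : + N ∣ (X B₁ q₁ - X B₃ q₃) + (X B₂ q₂ - X B₃ q₃)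
              + (X B₁ a₁ - X B₄ c₁) + (X B₂ a₂ - X B₄ c₂) + (X B₃ a₃ - X B₄ c₃)
              + (X B₁ b₁ - X B₅ d₁) + (X B₂ b₂ - X B₅ d₂) + (X B₃ b₃ - X B₅ d₃)
        divisible = ℤ∣.∣m∣n⇒∣m+n (ℤ∣.∣m∣n⇒∣m+n (ℤ∣.∣m∣n⇒∣m+n (ℤ∣.∣m∣n⇒∣m+n (ℤ∣.∣m∣n⇒∣m+n (ℤ∣.∣m∣n⇒∣m+n (ℤ∣.∣m∣n⇒∣m+n
          (place′-coord e₁ t) (place′-coord e₂ t)) (place′-coord f₁ t)) (place′-coord f₂ t)) (place′-coord f₃ t))
          (place′-coord g₁ t)) (place′-coord g₂ t)) (place′-coord g₃ t)

      -- The crossing line carries four of the points, so its row is a `quadruple`, and it is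
      -- subtracted from the other rows.
      no-grid : ∀ {Bᵃ Bᵇ Bᶜ Bᵈ Bᵉ aᶜ aᵈ aᵉ bᶜ bᵈ bᵉ cᵃ cᵇ cᵉ dᵃ dᵇ dᵉ eᵃ eᵇ eᶜ eᵈ} →
        base Bᵃ ≢ base Bᵇ → base Bᵃ ≢ base Bᶜ → base Bᵃ ≢ base Bᵈ → base Bᵃ ≢ base Bᵉ → base Bᵇ ≢ base Bᶜ →
        base Bᵇ ≢ base Bᵈ → base Bᵇ ≢ base Bᵉ → base Bᶜ ≢ base Bᵈ → base Bᶜ ≢ base Bᵉ → base Bᵈ ≢ base Bᵉ →
        Clique₃ C aᶜ aᵈ aᵉ → Clique₃ C bᶜ bᵈ bᵉ → Clique₃ C cᵃ cᵇ cᵉ → Clique₃ C dᵃ dᵇ dᵉ → Clique₄ C eᵃ eᵇ eᶜ eᵈ →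
        place′ Bᵃ aᶜ ≡ place′ Bᶜ cᵃ → place′ Bᵃ aᵈ ≡ place′ Bᵈ dᵃ → place′ Bᵇ bᶜ ≡ place′ Bᶜ cᵇ → place′ Bᵇ bᵈ ≡ place′ Bᵈ dᵇ →
        place′ Bᵃ aᵉ ≡ place′ Bᵉ eᵃ → place′ Bᵇ bᵉ ≡ place′ Bᵉ eᵇ → place′ Bᶜ cᵉ ≡ place′ Bᵉ eᶜ → ¬ place′ Bᵈ dᵉ ≡ place′ Bᵉ eᵈ
      no-grid {Bᵃ} {Bᵇ} {Bᶜ} {Bᵈ} {Bᵉ} {aᶜ} {aᵈ} {aᵉ} {bᶜ} {bᵈ} {bᵉ} {cᵃ} {cᵇ} {cᵉ} {dᵃ} {dᵇ} {dᵉ} {eᵃ} {eᵇ} {eᶜ} {eᵈ}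
        nᵃᵇ nᵃᶜ nᵃᵈ nᵃᵉ nᵇᶜ nᵇᵈ nᵇᵉ nᶜᵈ nᶜᵉ nᵈᵉ
        (clique₃ jᵃ jᵃ′ jᵃ″) (clique₃ jᵇ jᵇ′ jᵇ″) (clique₃ jᶜ jᶜ′ jᶜ″) (clique₃ jᵈ jᵈ′ jᵈ″) (clique₄ j₁ j₂ j₃ j₄ j₅ j₆)
        ac ad bc bd ae be ce de = absurd-mod total divisible
        where
        rᵃ = base Bᵃ , aᶜ , aᵈ , aᵉ
        rᵇ = base Bᵇ , bᶜ , bᵈ , bᵉ
        rᶜ = base Bᶜ , cᵃ , cᵇ , cᵉ
        rᵈ = base Bᵈ , dᵃ , dᵇ , dᵉ
        rᵉ = base Bᵉ , eᵃ , eᵇ , eᶜ , eᵈ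
        found = coordinate-grid rᵃ rᵇ rᶜ rᵈ rᵉ
        t = proj₁ found
        es = coordinate t
        sel : ∀ {e} → Selects (gridEntries (rᵃ , rᵇ , rᶜ , rᵈ , rᵉ)) e → Selects es e
        sel {e} = subst (λ l → Selects l e) (sym (proj₂ found))
        X : Fin M′ → Fin v → ℤ
        X B u = coord B u t
        Rᵃ = selects-triple {es = es} (sel here) (J-irrefl jᵃ) (J-irrefl jᵃ′) (J-irrefl jᵃ″) ⟦ τ# Bᵃ t ⟧ ⟦ θ# Bᵃ t ⟧
        Rᵇ = selects-triple {es = es} (sel (there (nᵃᵇ ∘ sym) here)) (J-irrefl jᵇ) (J-irrefl jᵇ′) (J-irrefl jᵇ″) ⟦ τ# Bᵇ t ⟧ ⟦ θ# Bᵇ t ⟧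
        Rᶜ = selects-triple {es = es} (sel (there (nᵃᶜ ∘ sym) (there (nᵇᶜ ∘ sym) here))) (J-irrefl jᶜ) (J-irrefl jᶜ′) (J-irrefl jᶜ″) ⟦ τ# Bᶜ t ⟧ ⟦ θ# Bᶜ t ⟧
        Rᵈ = selects-triple {es = es} (sel (there (nᵃᵈ ∘ sym) (there (nᵇᵈ ∘ sym) (there (nᶜᵈ ∘ sym) here)))) (J-irrefl jᵈ) (J-irrefl jᵈ′) (J-irrefl jᵈ″) ⟦ τ# Bᵈ t ⟧ ⟦ θ# Bᵈ t ⟧
        Rᵉ = selects-quadruple {es = es} (sel (there (nᵃᵉ ∘ sym) (there (nᵇᵉ ∘ sym) (there (nᶜᵉ ∘ sym) (there (nᵈᵉ ∘ sym) here)))))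
               (J-irrefl j₁) (J-irrefl j₂) (J-irrefl j₃) (J-irrefl j₄) (J-irrefl j₅) (J-irrefl j₆) ⟦ τ# Bᵉ t ⟧ ⟦ θ# Bᵉ t ⟧
        total : (X Bᵃ aᶜ - X Bᶜ cᵃ) + (X Bᵃ aᵈ - X Bᵈ dᵃ) + (X Bᵇ bᶜ - X Bᶜ cᵇ) + (X Bᵇ bᵈ - X Bᵈ dᵇ)
              + (X Bᵃ aᵉ - X Bᵉ eᵃ) + (X Bᵇ bᵉ - X Bᵉ eᵇ) + (X Bᶜ cᵉ - X Bᵉ eᶜ) + (X Bᵈ dᵉ - X Bᵉ eᵈ) ≡ 1ℤ
        total = trans (rearrange (X Bᵃ aᶜ) (X Bᵃ aᵈ) (X Bᵃ aᵉ) (X Bᵇ bᶜ) (X Bᵇ bᵈ) (X Bᵇ bᵉ) (X Bᶜ cᵃ) (X Bᶜ cᵇ) (X Bᶜ cᵉ)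
                                 (X Bᵈ dᵃ) (X Bᵈ dᵇ) (X Bᵈ dᵉ) (X Bᵉ eᵃ) (X Bᵉ eᵇ) (X Bᵉ eᶜ) (X Bᵉ eᵈ))
                      (cong₂ _-_ (cong₂ _+_ (cong₂ _+_ (cong₂ _+_ Rᵃ Rᵇ) Rᶜ) Rᵈ) Rᵉ)
          where
          rearrange : ∀ aᶜ aᵈ aᵉ bᶜ bᵈ bᵉ cᵃ cᵇ cᵉ dᵃ dᵇ dᵉ eᵃ eᵇ eᶜ eᵈ →
            (aᶜ - cᵃ) + (aᵈ - dᵃ) + (bᶜ - cᵇ) + (bᵈ - dᵇ) + (aᵉ - eᵃ) + (bᵉ - eᵇ) + (cᵉ - eᶜ) + (dᵉ - eᵈ)
            ≡ ((1ℤ * aᶜ + 1ℤ * aᵈ + 1ℤ * aᵉ) + (1ℤ * bᶜ + 1ℤ * bᵈ + 1ℤ * bᵉ)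
              + (-[1+ 0 ] * cᵃ + -[1+ 0 ] * cᵇ + 1ℤ * cᵉ) + (-[1+ 0 ] * dᵃ + -[1+ 0 ] * dᵇ + 1ℤ * dᵉ)) - (eᵃ + eᵇ + eᶜ + eᵈ)
          rearrange = solve-∀
        divisible : + N ∣ (X Bᵃ aᶜ - X Bᶜ cᵃ) + (X Bᵃ aᵈ - X Bᵈ dᵃ) + (X Bᵇ bᶜ - X Bᶜ cᵇ) + (X Bᵇ bᵈ - X Bᵈ dᵇ)
              + (X Bᵃ aᵉ - X Bᵉ eᵃ) + (X Bᵇ bᵉ - X Bᵉ eᵇ) + (X Bᶜ cᵉ - X Bᵉ eᶜ) + (X Bᵈ dᵉ - X Bᵉ eᵈ)
        divisible = ℤ∣.∣m∣n⇒∣m+n (ℤ∣.∣m∣n⇒∣m+n (ℤ∣.∣m∣n⇒∣m+n (ℤ∣.∣m∣n⇒∣m+n (ℤ∣.∣m∣n⇒∣m+n (ℤ∣.∣m∣n⇒∣m+n (ℤ∣.∣m∣n⇒∣m+n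
          (place′-coord ac t) (place′-coord ad t)) (place′-coord bc t)) (place′-coord bd t)) (place′-coord ae t))
          (place′-coord be t)) (place′-coord ce t)) (place′-coord de t)

      -- A copy that meets two copies over one block at the ends of a claimed pair lies over that
      -- block. Hence the blocks of a system are either all distinct or all equal.
      absorb : ∀ {B A A′ u u′ x x′} → J u u′ → place′ B u ≡ place′ A x → place′ B u′ ≡ place′ A′ x′ →
               base A ≡ base A′ → base B ≡ base A
      absorb {B} {A} {A′} {x′ = x′} j e e′ a≡ = exclusive j (place′-base {B} {A} e)
        (trans (place′-base {B} {A′} e′) (cong (λ Q → place Q x′) (sym a≡)))

    -- Distinct blocks fall to `no-pasch`. If two blocks agree, `absorb` makes all four agree, and
    -- `pasch-rigid` applies in every coordinate.
    lift-pasch : PaschRigid C lift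
    lift-pasch {B₁} {B₂} {B₃} {B₄} {p₁₂} {p₁₃} {p₁₄} {p₂₁} {p₂₃} {p₂₄} {p₃₁} {p₃₂} {p₃₄} {p₄₁} {p₄₂} {p₄₃} K₁@(clique₃ j₁ j₁′ j₁″) K₂@(clique₃ j₂ j₂′ j₂″) K₃@(clique₃ j₃ j₃′ j₃″) K₄@(clique₃ j₄ j₄′ j₄″)
      e₁₂ e₁₃ e₁₄ e₂₃ e₂₄ e₃₄ with base B₁ ≟ base B₂
    ... | no ne = contradiction e₃₄ (no-pasch ne
          (λ e → ne (sym (absorb {B₂} j₂ (sym e₁₂) e₂₃ e)))
          (λ e → ne (sym (absorb {B₂} j₂′ (sym e₁₂) e₂₄ e)))
          (λ e → ne (absorb {B₁} j₁ e₁₂ e₁₃ e))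
          (λ e → ne (absorb {B₁} j₁′ e₁₂ e₁₄ e))
          (λ e → let b₁₃ = absorb {B₁} j₁″ e₁₃ e₁₄ e ; b₂₃ = absorb {B₂} j₂″ e₂₃ e₂₄ e in ne (trans b₁₃ (sym b₂₃)))
          K₁ K₂ K₃ K₄ e₁₂ e₁₃ e₁₄ e₂₃ e₂₄)
    ... | yes b₁₂ = all-same
      where
      b₃ : base B₃ ≡ base B₁
      b₃ = absorb {B₃} j₃ (sym e₁₃) (sym e₂₃) b₁₂
      b₄ : base B₄ ≡ base B₁
      b₄ = absorb {B₄} j₄ (sym e₁₄) (sym e₂₄) b₁₂
      b₁₃ = sym b₃
      b₁₄ = sym b₄
      b₂₃ = trans (sym b₁₂) b₁₃
      b₂₄ = trans (sym b₁₂) b₁₄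
      b₃₄ = trans b₃ b₁₄
      u₁₂ = base-eq {B₁} {B₂} {p₁₂} {p₂₁} b₁₂ e₁₂
      u₁₃ = base-eq {B₁} {B₃} {p₁₃} {p₃₁} b₁₃ e₁₃
      u₁₄ = base-eq {B₁} {B₄} {p₁₄} {p₄₁} b₁₄ e₁₄
      u₂₃ = base-eq {B₂} {B₃} {p₂₃} {p₃₂} b₂₃ e₂₃
      u₂₄ = base-eq {B₂} {B₄} {p₂₄} {p₄₂} b₂₄ e₂₄
      u₃₄ = base-eq {B₃} {B₄} {p₃₄} {p₄₃} b₃₄ e₃₄
      rigid : ∀ t → _∥_ U (line B₁ t) (line B₄ t) × _∥_ U (line B₂ t) (line B₄ t) × _∥_ U (line B₃ t) (line B₄ t)
      rigid t = pasch-rigid U (line B₁ t) (line B₂ t) (line B₃ t) (line B₄ t)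
          (J-irrefl j₁) (J-irrefl j₁′) (J-irrefl j₁″)
          (λ e → J-irrefl j₂ (trans (sym u₁₂) e)) (λ e → J-irrefl j₂′ (trans (sym u₁₂) e)) (J-irrefl j₂″)
          (λ e → J-irrefl j₃ (trans (sym u₁₃) (trans e u₂₃))) (λ e → J-irrefl j₃′ (trans (sym u₁₃) e)) (λ e → J-irrefl j₃″ (trans (sym u₂₃) e))
          (λ e → J-irrefl j₄ (trans (sym u₁₄) (trans e u₂₄))) (λ e → J-irrefl j₄′ (trans (sym u₁₄) (trans e u₃₄))) (λ e → J-irrefl j₄″ (trans (sym u₂₄) (trans e u₃₄)))
          (meet p₁₂ refl (sym u₁₂) b₁₂ e₁₂ t) (meet p₁₃ refl (sym u₁₃) b₁₃ e₁₃ t) (meet p₁₄ refl (sym u₁₄) b₁₄ e₁₄ t)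
          (meet p₂₃ refl (sym u₂₃) b₂₃ e₂₃ t) (meet p₂₄ refl (sym u₂₄) b₂₄ e₂₄ t) (meet p₃₄ refl (sym u₃₄) b₃₄ e₃₄ t)
      all-same : B₁ ≡ B₄ × B₂ ≡ B₄ × B₃ ≡ B₄
      all-same = same-lines b₁₄ (λ t → proj₁ (rigid t))
               , same-lines b₂₄ (λ t → proj₁ (proj₂ (rigid t)))
               , same-lines b₃₄ (λ t → proj₂ (proj₂ (rigid t)))

    lift-mitre : MitreRigid C lift
    lift-mitre {B₁} {B₂} {B₃} {B₄} {B₅} {q₁} {q₂} {q₃} {a₁} {a₂} {a₃} {b₁} {b₂} {b₃} {c₁} {c₂} {c₃} {d₁} {d₂} {d₃} K₁@(clique₃ j₁ j₁′ j₁″) K₂@(clique₃ j₂ j₂′ j₂″) K₃@(clique₃ j₃ j₃′ j₃″) K₄@(clique₃ j₄ j₄′ j₄″) K₅@(clique₃ j₅ j₅′ j₅″)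
      e₁ e₂ f₁ f₂ f₃ g₁ g₂ g₃ with base B₁ ≟ base B₂
    ... | no ne = contradiction g₃ (no-mitre ne from₁₃
          (λ e → ne (sym (absorb {B₂} j₂ e₂₁ f₂ e)))
          (λ e → ne (sym (absorb {B₂} j₂′ e₂₁ g₂ e)))
          from₂₃
          (λ e → ne (absorb {B₁} j₁ e₁₂ f₁ e))
          (λ e → ne (absorb {B₁} j₁′ e₁₂ g₁ e))
          (λ e → from₁₃ (absorb {B₁} j₁ e₁ f₁ e))
          (λ e → from₁₃ (absorb {B₁} j₁′ e₁ g₁ e))
          (λ e → ne (trans (absorb {B₁} j₁″ f₁ g₁ e) (sym (absorb {B₂} j₂″ f₂ g₂ e))))
          K₁ K₂ K₃ K₄ K₅ e₁ e₂ f₁ f₂ f₃ g₁ g₂)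
      where
      e₁₂ = trans e₁ (sym e₂)
      e₂₁ = sym e₁₂
      from₁₃ : base B₁ ≢ base B₃
      from₁₃ e = ne (sym (trans (absorb {B₂} j₂″ f₂ g₂ (trans b₄ (sym b₅))) b₄))
        where
        b₄ : base B₄ ≡ base B₁
        b₄ = absorb {B₄} j₄′ (sym f₁) (sym f₃) e
        b₅ : base B₅ ≡ base B₁
        b₅ = absorb {B₅} j₅′ (sym g₁) (sym g₃) e
      from₂₃ : base B₂ ≢ base B₃
      from₂₃ e = ne (trans (absorb {B₁} j₁″ f₁ g₁ (trans b₄ (sym b₅))) b₄)
        where
        b₄ : base B₄ ≡ base B₂
        b₄ = absorb {B₄} j₄″ (sym f₂) (sym f₃) e
        b₅ : base B₅ ≡ base B₂
        b₅ = absorb {B₅} j₅″ (sym g₂) (sym g₃) e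
    ... | yes b₁₂ = all-same
      where
      β₄ : base B₄ ≡ base B₁
      β₄ = absorb {B₄} j₄ (sym f₁) (sym f₂) b₁₂
      β₅ : base B₅ ≡ base B₁
      β₅ = absorb {B₅} j₅ (sym g₁) (sym g₂) b₁₂
      β₃ : base B₃ ≡ base B₁
      β₃ = trans (absorb {B₃} j₃″ f₃ g₃ (trans β₄ (sym β₅))) β₄
      b₁₃ = sym β₃
      b₂₃ = trans (sym b₁₂) b₁₃
      b₁₄ = sym β₄
      b₁₅ = sym β₅
      b₂₄ = trans (sym b₁₂) b₁₄
      b₂₅ = trans (sym b₁₂) b₁₅
      b₃₄ = trans β₃ b₁₄
      b₃₅ = trans β₃ b₁₅
      u₁ = base-eq {B₁} {B₃} {q₁} {q₃} b₁₃ e₁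
      u₂ = base-eq {B₂} {B₃} {q₂} {q₃} b₂₃ e₂
      v₁ = base-eq {B₁} {B₄} {a₁} {c₁} b₁₄ f₁
      v₂ = base-eq {B₂} {B₄} {a₂} {c₂} b₂₄ f₂
      v₃ = base-eq {B₃} {B₄} {a₃} {c₃} b₃₄ f₃
      w₁ = base-eq {B₁} {B₅} {b₁} {d₁} b₁₅ g₁
      w₂ = base-eq {B₂} {B₅} {b₂} {d₂} b₂₅ g₂
      w₃ = base-eq {B₃} {B₅} {b₃} {d₃} b₃₅ g₃
      rigid : ∀ t → _∥_ U (line B₁ t) (line B₃ t) × _∥_ U (line B₂ t) (line B₃ t) × _∥_ U (line B₄ t) (line B₃ t) × _∥_ U (line B₅ t) (line B₃ t)
      rigid t = mitre-rigid U (line B₁ t) (line B₂ t) (line B₃ t) (line B₄ t) (line B₅ t)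
          (λ e → J-irrefl j₁ (trans u₁ (sym e))) (λ e → J-irrefl j₂ (trans u₂ (sym e))) (J-irrefl j₃ ∘ sym)
          (λ e → J-irrefl j₁′ (trans u₁ (sym e))) (λ e → J-irrefl j₂′ (trans u₂ (sym e))) (J-irrefl j₃′ ∘ sym)
          (λ e → J-irrefl j₄ (trans (sym v₁) (trans e v₂))) (λ e → J-irrefl j₄′ (trans (sym v₁) (trans e v₃)))
          (λ e → J-irrefl j₅′ (trans (sym w₁) (trans e w₃))) (λ e → J-irrefl j₅″ (trans (sym w₂) (trans e w₃))) (J-irrefl j₁″)
          (meet q₃ u₁ refl b₁₃ e₁ t) (meet q₃ u₂ refl b₂₃ e₂ t)
          (meet a₁ refl (sym v₁) b₁₄ f₁ t) (meet a₂ refl (sym v₂) b₂₄ f₂ t) (meet a₃ refl (sym v₃) b₃₄ f₃ t)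
          (meet b₁ refl (sym w₁) b₁₅ g₁ t) (meet b₂ refl (sym w₂) b₂₅ g₂ t) (meet b₃ refl (sym w₃) b₃₅ g₃ t)
      all-same : B₁ ≡ B₃ × B₂ ≡ B₃ × B₄ ≡ B₃ × B₅ ≡ B₃
      all-same = same-lines b₁₃ (λ t → proj₁ (rigid t))
               , same-lines b₂₃ (λ t → proj₁ (proj₂ (rigid t)))
               , same-lines (sym b₃₄) (λ t → proj₁ (proj₂ (proj₂ (rigid t))))
               , same-lines (sym b₃₅) (λ t → proj₂ (proj₂ (proj₂ (rigid t))))

    lift-grid : GridRigid C lift
    lift-grid {Bᵃ} {Bᵇ} {Bᶜ} {Bᵈ} {Bᵉ} {aᶜ} {aᵈ} {aᵉ} {bᶜ} {bᵈ} {bᵉ} {cᵃ} {cᵇ} {cᵉ} {dᵃ} {dᵇ} {dᵉ} {eᵃ} {eᵇ} {eᶜ} {eᵈ}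
      Kᵃ@(clique₃ jᵃ jᵃ′ jᵃ″) Kᵇ@(clique₃ jᵇ jᵇ′ jᵇ″) Kᶜ@(clique₃ jᶜ jᶜ′ jᶜ″) Kᵈ@(clique₃ jᵈ jᵈ′ jᵈ″) Kᵉ@(clique₄ j₁ j₂ j₃ j₄ j₅ j₆)
      ac ad bc bd ae be ce de with base Bᵃ ≟ base Bᵇ
    ... | no ne = contradiction de (no-grid ne
          (λ e → let Pᵉ = absorb {Bᵉ} j₂ (sym ae) (sym ce) e in ne (trans e (sym (absorb {Bᵇ} jᵇ′ bc be (trans (sym e) (sym Pᵉ))))))
          (λ e → let Pᵉ = absorb {Bᵉ} j₃ (sym ae) (sym de) e in ne (trans e (sym (absorb {Bᵇ} jᵇ″ bd be (trans (sym e) (sym Pᵉ))))))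
          (λ e → let Pᶜ = absorb {Bᶜ} jᶜ′ (sym ac) ce e in ne (trans (sym Pᶜ) (sym (absorb {Bᵇ} jᵇ′ bc be (trans Pᶜ e)))))
          (λ e → let Pᵉ = absorb {Bᵉ} j₄ (sym be) (sym ce) e in ne (trans (absorb {Bᵃ} jᵃ′ ac ae (trans (sym e) (sym Pᵉ))) (sym e)))
          (λ e → let Pᵉ = absorb {Bᵉ} j₅ (sym be) (sym de) e in ne (trans (absorb {Bᵃ} jᵃ″ ad ae (trans (sym e) (sym Pᵉ))) (sym e)))
          (λ e → let Pᶜ = absorb {Bᶜ} jᶜ″ (sym bc) ce e in ne (trans (absorb {Bᵃ} jᵃ′ ac ae (trans Pᶜ e)) Pᶜ))
          (λ e → ne (trans (absorb {Bᵃ} jᵃ ac ad e) (sym (absorb {Bᵇ} jᵇ bc bd e))))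
          (λ e → ne (trans (absorb {Bᵃ} jᵃ′ ac ae e) (sym (absorb {Bᵇ} jᵇ′ bc be e))))
          (λ e → ne (trans (absorb {Bᵃ} jᵃ″ ad ae e) (sym (absorb {Bᵇ} jᵇ″ bd be e))))
          Kᵃ Kᵇ Kᶜ Kᵈ Kᵉ ac ad bc bd ae be ce)
    ... | yes pᵃᵇ = all-same
      where
      pᵃᶜ = sym (absorb {Bᶜ} jᶜ (sym ac) (sym bc) pᵃᵇ)
      pᵃᵈ = sym (absorb {Bᵈ} jᵈ (sym ad) (sym bd) pᵃᵇ)
      pᵃᵉ = sym (absorb {Bᵉ} j₁ (sym ae) (sym be) pᵃᵇ)
      pᵇᶜ = trans (sym pᵃᵇ) pᵃᶜ
      pᵇᵈ = trans (sym pᵃᵇ) pᵃᵈ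
      pᵇᵉ = trans (sym pᵃᵇ) pᵃᵉ
      pᶜᵉ = trans (sym pᵃᶜ) pᵃᵉ
      pᵈᵉ = trans (sym pᵃᵈ) pᵃᵉ
      uᵃᶜ = base-eq {Bᵃ} {Bᶜ} {aᶜ} {cᵃ} pᵃᶜ ac
      uᵃᵈ = base-eq {Bᵃ} {Bᵈ} {aᵈ} {dᵃ} pᵃᵈ ad
      uᵇᶜ = base-eq {Bᵇ} {Bᶜ} {bᶜ} {cᵇ} pᵇᶜ bc
      uᵇᵈ = base-eq {Bᵇ} {Bᵈ} {bᵈ} {dᵇ} pᵇᵈ bd
      uᵃᵉ = base-eq {Bᵃ} {Bᵉ} {aᵉ} {eᵃ} pᵃᵉ ae
      uᵇᵉ = base-eq {Bᵇ} {Bᵉ} {bᵉ} {eᵇ} pᵇᵉ be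
      uᶜᵉ = base-eq {Bᶜ} {Bᵉ} {cᵉ} {eᶜ} pᶜᵉ ce
      uᵈᵉ = base-eq {Bᵈ} {Bᵉ} {dᵉ} {eᵈ} pᵈᵉ de
      rigid : ∀ t → _∥_ U (line Bᵃ t) (line Bᵉ t) × _∥_ U (line Bᵇ t) (line Bᵉ t) × _∥_ U (line Bᶜ t) (line Bᵉ t) × _∥_ U (line Bᵈ t) (line Bᵉ t)
      rigid t = grid-rigid U (line Bᵃ t) (line Bᵇ t) (line Bᶜ t) (line Bᵈ t) (line Bᵉ t)
        (J-irrefl jᵃ) (J-irrefl jᵃ′) (J-irrefl jᵃ″) (J-irrefl jᵇ) (J-irrefl jᵇ′) (J-irrefl jᵇ″)
        (λ e → J-irrefl jᶜ (trans (sym uᵃᶜ) (trans e uᵇᶜ))) (λ e → J-irrefl jᶜ′ (trans (sym uᵃᶜ) e))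
        (λ e → J-irrefl jᵈ (trans (sym uᵃᵈ) (trans e uᵇᵈ))) (λ e → J-irrefl jᵈ′ (trans (sym uᵃᵈ) e)) (λ e → J-irrefl jᵈ″ (trans (sym uᵇᵈ) e))
        (λ e → J-irrefl j₁ (trans (sym uᵃᵉ) (trans e uᵇᵉ))) (λ e → J-irrefl j₂ (trans (sym uᵃᵉ) (trans e uᶜᵉ)))
        (λ e → J-irrefl j₃ (trans (sym uᵃᵉ) (trans e uᵈᵉ))) (λ e → J-irrefl j₄ (trans (sym uᵇᵉ) (trans e uᶜᵉ)))
        (λ e → J-irrefl j₅ (trans (sym uᵇᵉ) (trans e uᵈᵉ)))
        (meet aᵉ refl (sym uᵃᵉ) pᵃᵉ ae t) (meet bᵉ refl (sym uᵇᵉ) pᵇᵉ be t) (meet cᵉ refl (sym uᶜᵉ) pᶜᵉ ce t) (meet dᵉ refl (sym uᵈᵉ) pᵈᵉ de t)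
        (meet aᶜ refl (sym uᵃᶜ) pᵃᶜ ac t) (meet aᵈ refl (sym uᵃᵈ) pᵃᵈ ad t) (meet bᶜ refl (sym uᵇᶜ) pᵇᶜ bc t) (meet bᵈ refl (sym uᵇᵈ) pᵇᵈ bd t)
      all-same : Bᵃ ≡ Bᵉ × Bᵇ ≡ Bᵉ × Bᶜ ≡ Bᵉ × Bᵈ ≡ Bᵉ
      all-same = same-lines pᵃᵉ (λ t → proj₁ (rigid t))
               , same-lines pᵇᵉ (λ t → proj₁ (proj₂ (rigid t)))
               , same-lines pᶜᵉ (λ t → proj₁ (proj₂ (proj₂ (rigid t))))
               , same-lines pᵈᵉ (λ t → proj₂ (proj₂ (proj₂ (rigid t))))

  module _ {v : ℕ} {C : Claim v} {n M : ℕ} (P : Packing C n M) (N : ℕ) .{{_ : ℕ.NonZero N}} where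

    open Packing P

    private

      T : ℕ
      T = coordinates {v} {M}

    -- One residue per coordinate for a vertex, two parameters per coordinate for a copy: the ratio
    -- of copies to squared vertices is that of the original packing.
    liftedVertices liftedCopies : ℕ
    liftedVertices = n ℕ.* N ℕ.^ T
    liftedCopies   = M ℕ.* (N ℕ.^ T ℕ.* N ℕ.^ T)

    private

      base : Fin liftedCopies → Fin M
      base B = proj₁ (remQuot {M} (N ℕ.^ T ℕ.* N ℕ.^ T) B)

      params : Fin liftedCopies → Fin (N ℕ.^ T) × Fin (N ℕ.^ T)
      params B = remQuot {N ℕ.^ T} (N ℕ.^ T) (proj₂ (remQuot {M} (N ℕ.^ T ℕ.* N ℕ.^ T) B))

      τ# θ# : Fin liftedCopies → Fin T → Fin N
      τ# B = finToFun (proj₁ (params B))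
      θ# B = finToFun (proj₂ (params B))

      coord : Fin liftedCopies → Fin v → Fin T → ℤ
      coord B u t = value (relabelling P N t) (base B) ⟦ τ# B t ⟧ ⟦ θ# B t ⟧ u

      residue : Fin liftedCopies → Fin v → Fin T → Fin N
      residue B u t = red (coord B u t)

      residues : Fin liftedCopies → Fin v → Fin (N ℕ.^ T)
      residues B u = funToFin (residue B u)

    lifting : Lifting P N liftedVertices liftedCopies
    lifting = record
      { base = base ; τ# = τ# ; θ# = θ#
      ; place′ = λ B u → combine (place (base B) u) (residues B u)
      ; same-block = λ b≡ τ≡ θ≡ → remQuot-injective {M} (N ℕ.^ T ℕ.* N ℕ.^ T) (cong₂ _,_ b≡
          (remQuot-injective {N ℕ.^ T} (N ℕ.^ T) (cong₂ _,_ (finToFun-injective {T} {N} τ≡) (finToFun-injective {T} {N} θ≡))))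
      ; place′-base = λ {B} {B′} {u} {u′} eq → proj₁ (combine-injective (place (base B) u) (residues B u) (place (base B′) u′) (residues B′ u′) eq)
      ; place′-coord = λ {B} {B′} {u} {u′} eq t → red-≡⇒∣ {x = coord B u t} {coord B′ u′ t}
          (funToFin-injective {T} {N} {residue B u} {residue B′ u′}
            (proj₂ (combine-injective (place (base B) u) (residues B u) (place (base B′) u′) (residues B′ u′) eq)) t)
      }

-- A packing in which almost every ordered pair of vertices is claimed.

module Framing where

  open Residues
  open Packings
  open import Data.Fin.Base as Fin using (Fin; zero; suc; toℕ; combine; remQuot; funToFin; finToFun)
  open import Data.Fin.Properties as Fin
    using (_≟_; any?; combine-injective; remQuot-combine; combine-remQuot; toℕ-injective; toℕ<n)
  open import Data.Integer.Base using (ℤ; +_; _+_; _*_; _-_; -_; ∣_∣; 0ℤ; 1ℤ)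
  import Data.Integer.Properties as ℤ
  open import Data.Integer.Divisibility.Signed as ℤ∣ using (_∣_; divides)
  open import Data.Integer.Tactic.RingSolver using (solve-∀)
  open import Data.List.Base using (List; length; lookup)
  open import Data.List.Membership.Propositional using (_∈_)
  import Data.List.Membership.DecPropositional as Dec∈
  import Data.List.Relation.Unary.Any as Any
  open import Data.List.Relation.Unary.Any.Properties using (lookup-index)
  open import Data.Nat.Base as ℕ using (ℕ; zero; suc; _<_; s≤s; z≤n; _!)
  open import Data.Nat.Properties as ℕ using (_<?_)
  open import Data.Product.Base using (_×_; _,_; proj₁; proj₂)
  open import Data.Product.Properties using (≡-dec)
  open import Function.Base using (_∘_)
  open import Relation.Binary.PropositionalEquality hiding (J)
  open import Relation.Binary.Definitions using (tri<; tri≈; tri>)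
  open import Relation.Nullary using (¬_; yes; no; contradiction)

  sumFin : ∀ {k} → (Fin k → ℤ) → ℤ
  sumFin {zero}  f = 0ℤ
  sumFin {suc k} f = f zero + sumFin (f ∘ suc)

  sumFin-cong : ∀ {k} {f g : Fin k → ℤ} → (∀ i → f i ≡ g i) → sumFin f ≡ sumFin g
  sumFin-cong {zero}  eq = refl
  sumFin-cong {suc k} eq = cong₂ _+_ (eq zero) (sumFin-cong (eq ∘ suc))

  sumFin-except : ∀ {k} (f g : Fin k → ℤ) i → (∀ j → j ≢ i → f j ≡ g j) → sumFin f - sumFin g ≡ f i - g i
  sumFin-except {suc k} f g zero eq = trans
    (cong (λ s → (f zero + s) - (g zero + sumFin (g ∘ suc))) (sumFin-cong (λ j → eq (suc j) λ ())))
    (lemma (f zero) (g zero) (sumFin (g ∘ suc)))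
    where
    lemma : ∀ a b s → (a + s) - (b + s) ≡ a - b
    lemma = solve-∀
  sumFin-except {suc k} f g (suc i) eq = trans
    (cong (λ s → (s + sumFin (f ∘ suc)) - (g zero + sumFin (g ∘ suc))) (eq zero λ ()))
    (trans (lemma (g zero) (sumFin (f ∘ suc)) (sumFin (g ∘ suc)))
           (sumFin-except (f ∘ suc) (g ∘ suc) i (λ j j≢i → eq (suc j) (j≢i ∘ Fin.suc-injective))))
    where
    lemma : ∀ a s t → (a + s) - (a + t) ≡ s - t
    lemma = solve-∀

  module _ {v : ℕ} (Js : List (Fin v × Fin v))
           (J-sym : ∀ {u u′} → (u , u′) ∈ Js → (u′ , u) ∈ Js)
           (J-irrefl : ∀ {u u′} → (u , u′) ∈ Js → u ≢ u′) where

    claim : Claim v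
    claim = record { J = λ u u′ → (u , u′) ∈ Js ; J-sym = J-sym ; J-irrefl = J-irrefl }

    private

      m : ℕ
      m = length Js

      _∈?_ = Dec∈._∈?_ (≡-dec (_≟_ {v}) (_≟_ {v}))

    module _ (γ r : ℕ) where

      -- g - 1 is a multiple of v!, so differences of pattern vertices are invertible modulo `g`; E
      -- - 1 is a multiple of g!, so differences of groups are invertible modulo `E`. The shifts 1,
      -- ..., R m encode a label below `R` together with a claimed pair, and 0 is left for unclaimed
      -- pairs. `K` counts the ordered pairs of groups.
      g⁻ g R E K : ℕ
      g⁻ = v ! ℕ.* γ
      g = suc g⁻
      R = g ! ℕ.* r
      E = suc (R ℕ.* m)
      K = g ℕ.* g

      private

        position : Fin v → Fin v → Fin R → ℕ
        position u u′ κ with (u , u′) ∈? Js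
        ... | yes j = suc (toℕ (combine κ (Any.index j)))
        ... | no  _ = 0

        position<E : ∀ u u′ κ → position u u′ κ < E
        position<E u u′ κ with (u , u′) ∈? Js
        ... | yes j = s≤s (toℕ<n (combine κ (Any.index j)))
        ... | no  _ = s≤s z≤n

        position-injective : ∀ {u₁ u₂ κ u₁′ u₂′ κ′} → (u₁ , u₂) ∈ Js →
          position u₁ u₂ κ ≡ position u₁′ u₂′ κ′ → u₁ ≡ u₁′ × u₂ ≡ u₂′ × κ ≡ κ′
        position-injective {u₁} {u₂} {κ} {u₁′} {u₂′} {κ′} j eq with (u₁ , u₂) ∈? Js | (u₁′ , u₂′) ∈? Js
        ... | no ¬j | _ = contradiction j ¬j
        position-injective {κ = κ} {κ′ = κ′} j eq | yes i | yes i′ =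
          let κ≡ , i≡ = combine-injective κ (Any.index i) κ′ (Any.index i′) (toℕ-injective (ℕ.suc-injective eq))
              p≡ = trans (lookup-index i) (trans (cong (lookup Js) i≡) (sym (lookup-index i′)))
          in cong proj₁ p≡ , cong proj₂ p≡ , κ≡
        position-injective j () | yes i | no _

        -- The affine maps modulo `g` of nonzero slope: each is injective on the pattern, and its
        -- values at two vertices determine it.
        ψ : Fin g⁻ → Fin g → Fin v → Fin g
        ψ a b u = red (+ suc (toℕ a) * ⟦ u ⟧ + ⟦ b ⟧)

        v-cancels : ∀ {u u′ : Fin v} → u ≢ u′ → Cancels (+ g) (⟦ u ⟧ - ⟦ u′ ⟧)
        v-cancels {u} {u′} u≢u′ = cancels-small v γ (diff≢0 u≢u′) (ℕ.<⇒≤ (diff< u u′))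

        E-cancels : ∀ {x y : Fin g} → x ≢ y → Cancels (+ E) (⟦ x ⟧ - ⟦ y ⟧)
        E-cancels {x} {y} x≢y = cancels-divisor (subst (⟦ x ⟧ - ⟦ y ⟧ ∣_) (sym eq)
          (ℤ∣.∣m⇒∣m*n (+ (r ℕ.* m)) (small∣! (diff≢0 x≢y) (ℕ.<⇒≤ (diff< x y)))))
          where
          lemma : ∀ x → 1ℤ + x - 1ℤ ≡ x
          lemma = solve-∀
          eq : + E - 1ℤ ≡ + (g !) * + (r ℕ.* m)
          eq = trans (cong (_- 1ℤ) (ℤ.pos-+ 1 (R ℕ.* m))) (trans (lemma (+ (R ℕ.* m)))
                 (trans (cong +_ (ℕ.*-assoc (g !) r m)) (ℤ.pos-* (g !) (r ℕ.* m))))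

        ψ-injective : ∀ a b {u u′} → ψ a b u ≡ ψ a b u′ → u ≡ u′
        ψ-injective a b {u} {u′} eq with u ≟ u′
        ... | yes u≡u′ = u≡u′
        ... | no  u≢u′ = contradiction (∣-small⇒≡0 (v-cancels u≢u′ .cancel (+ suc (toℕ a))
                (subst (+ g ∣_) (lemma (+ suc (toℕ a)) ⟦ u ⟧ ⟦ u′ ⟧ ⟦ b ⟧)
                  (red-≡⇒∣ {x = + suc (toℕ a) * ⟦ u ⟧ + ⟦ b ⟧} {+ suc (toℕ a) * ⟦ u′ ⟧ + ⟦ b ⟧} eq))) (s≤s (toℕ<n a))) λ ()
          where
          lemma : ∀ a u u′ b → (a * u + b) - (a * u′ + b) ≡ (u - u′) * a
          lemma = solve-∀

        ψ-labels : ∀ {a b a′ b′ u₁ u₂} → u₁ ≢ u₂ → ψ a b u₁ ≡ ψ a′ b′ u₁ → ψ a b u₂ ≡ ψ a′ b′ u₂ → a ≡ a′ × b ≡ b′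
        ψ-labels {a} {b} {a′} {b′} {u₁} {u₂} u₁≢u₂ e₁ e₂ = a≡ , b≡ a≡
          where
          A = + suc (toℕ a)
          A′ = + suc (toℕ a′)
          D₁ : + g ∣ (A * ⟦ u₁ ⟧ + ⟦ b ⟧) - (A′ * ⟦ u₁ ⟧ + ⟦ b′ ⟧)
          D₁ = red-≡⇒∣ {x = A * ⟦ u₁ ⟧ + ⟦ b ⟧} {A′ * ⟦ u₁ ⟧ + ⟦ b′ ⟧} e₁
          D₂ : + g ∣ (A * ⟦ u₂ ⟧ + ⟦ b ⟧) - (A′ * ⟦ u₂ ⟧ + ⟦ b′ ⟧)
          D₂ = red-≡⇒∣ {x = A * ⟦ u₂ ⟧ + ⟦ b ⟧} {A′ * ⟦ u₂ ⟧ + ⟦ b′ ⟧} e₂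
          lemma : ∀ a b a′ b′ u u′ → ((a * u + b) - (a′ * u + b′)) - ((a * u′ + b) - (a′ * u′ + b′)) ≡ (u - u′) * (a - a′)
          lemma = solve-∀
          A≡ : A ≡ A′
          A≡ = ℤ.i-j≡0⇒i≡j A A′ (∣-small⇒≡0 (v-cancels u₁≢u₂ .cancel (A - A′)
            (subst (+ g ∣_) (lemma A ⟦ b ⟧ A′ ⟦ b′ ⟧ ⟦ u₁ ⟧ ⟦ u₂ ⟧) (ℤ∣.∣m∣n⇒∣m-n D₁ D₂)))
            (∣m-n∣<k (s≤s (toℕ<n a)) (s≤s (toℕ<n a′))))
          a≡ : a ≡ a′
          a≡ = toℕ-injective (ℕ.suc-injective (ℤ.+-injective A≡))
          lemma₂ : ∀ a b b′ u → (a * u + b) - (a * u + b′) ≡ b - b′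
          lemma₂ = solve-∀
          b≡ : a ≡ a′ → b ≡ b′
          b≡ refl = ∣diff⇒≡ (subst (+ g ∣_) (lemma₂ A ⟦ b ⟧ ⟦ b′ ⟧ ⟦ u₁ ⟧) D₁)

        abstract

          left right : Fin K → Fin g
          left  c = proj₁ (remQuot {g} g c)
          right c = proj₂ (remQuot {g} g c)

          left-combine : ∀ (x y : Fin g) → left (combine x y) ≡ x
          left-combine x y = cong proj₁ (remQuot-combine {g} {g} x y)

          right-combine : ∀ (x y : Fin g) → right (combine x y) ≡ y
          right-combine x y = cong proj₂ (remQuot-combine {g} {g} x y)

          combine-left-right : ∀ c → combine (left c) (right c) ≡ c
          combine-left-right c = combine-remQuot {g} g c

        -- in coordinate (x₀ , y₀) with x₀ < y₀ the groups x₀ and y₀ get the same slope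
        mergeᶜ : Fin g → Fin g → Fin g → Fin g
        mergeᶜ x₀ y₀ x with toℕ x₀ <? toℕ y₀ | x ≟ y₀
        ... | yes _ | yes _ = x₀
        ... | yes _ | no  _ = x
        ... | no  _ | _     = x

        Z : Fin K → Fin g → Fin g
        Z c = mergeᶜ (left c) (right c)

        mergeᶜ-≢ : ∀ {x₀ y₀ x y} → toℕ x < toℕ y → ¬ (x₀ ≡ x × y₀ ≡ y) → mergeᶜ x₀ y₀ x ≢ mergeᶜ x₀ y₀ y
        mergeᶜ-≢ {x₀} {y₀} {x} {y} x<y ne eq with toℕ x₀ <? toℕ y₀ | x ≟ y₀ | y ≟ y₀
        ... | yes _   | yes refl | yes refl = ℕ.<-irrefl refl x<y
        ... | yes x₀< | yes refl | no _     = ℕ.<-asym x₀< (subst (λ z → toℕ x < toℕ z) (sym eq) x<y)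
        ... | yes _   | no _     | yes refl = ne (sym eq , refl)
        ... | yes _   | no _     | no _     = ℕ.<-irrefl (cong toℕ eq) x<y
        ... | no  _   | _        | _        = ℕ.<-irrefl (cong toℕ eq) x<y

        -- Merging identifies only the two groups that index the coordinate, so `x` and `y` are
        -- separated in every coordinate but their own.
        Z-≢ : ∀ {c x y} → toℕ x < toℕ y → c ≢ combine x y → Z c x ≢ Z c y
        Z-≢ {c} {x} {y} x<y c≢ = mergeᶜ-≢ {left c} {right c} x<y
          λ { (refl , refl) → c≢ (sym (combine-left-right c)) }

        mergeᶜ-left : ∀ {x y} → toℕ x < toℕ y → mergeᶜ x y x ≡ x
        mergeᶜ-left {x} {y} x<y with toℕ x <? toℕ y | x ≟ y
        ... | yes _ | yes refl = refl
        ... | yes _ | no  _    = refl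
        ... | no  _ | _        = refl

        mergeᶜ-right : ∀ {x y} → toℕ x < toℕ y → mergeᶜ x y y ≡ x
        mergeᶜ-right {x} {y} x<y with toℕ x <? toℕ y | y ≟ y
        ... | yes _ | yes _  = refl
        ... | yes _ | no ne  = contradiction refl ne
        ... | no ¬< | _      = contradiction x<y ¬<

        -- the shift at x₀ in coordinate (x₀ , y₀): the position of the pair over (x₀ , y₀)
        shiftᶜ : Fin g → Fin g → (Fin v → Fin g) → Fin R → Fin v → ℕ
        shiftᶜ x₀ y₀ f κ u with f u ≟ x₀ | any? (λ u′ → f u′ ≟ y₀)
        ... | yes _ | yes (u′ , _) = position u u′ κ
        ... | yes _ | no  _        = 0
        ... | no  _ | _            = 0

        shiftᶜ-left : ∀ {x y} a b κ {u u′} → ψ a b u ≡ x → ψ a b u′ ≡ y → shiftᶜ x y (ψ a b) κ u ≡ position u u′ κ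
        shiftᶜ-left {x} {y} a b κ {u} {u′} ex ey with ψ a b u ≟ x | any? (λ u′ → ψ a b u′ ≟ y)
        ... | no ne | _ = contradiction ex ne
        ... | yes _ | no ¬∃ = contradiction (u′ , ey) ¬∃
        ... | yes _ | yes (w , ew) = cong (λ z → position u z κ) (ψ-injective a b (trans ew (sym ey)))

        shiftᶜ-right : ∀ {x y} f κ {u} → x ≢ y → f u ≡ y → shiftᶜ x y f κ u ≡ 0
        shiftᶜ-right {x} {y} f κ {u} x≢y ey with f u ≟ x | any? (λ u′ → f u′ ≟ y)
        ... | yes ex | _ = contradiction (trans (sym ex) ey) x≢y
        ... | no _   | _ = refl

        W : Fin K → (Fin v → Fin g) → Fin R → Fin v → ℕ
        W c = shiftᶜ (left c) (right c)

      -- A copy has a line for each pair of groups. In coordinate (x, y) the groups `x` and `y` have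
      -- equal slopes, so the difference of the two values there is independent of the line and is
      -- free to carry the shift. The price is that `θ` cannot be read off in that coordinate; the
      -- sum `θ*` in the additional coordinate restores it.
      record Framing (n′ M′ : ℕ) : Set where
        field
          a     : Fin M′ → Fin g⁻
          b     : Fin M′ → Fin g
          κ     : Fin M′ → Fin R
          τ θ   : Fin M′ → Fin K → Fin E
          τ*    : Fin M′ → Fin E
          place : Fin M′ → Fin v → Fin n′
          same  : ∀ {B B′} → a B ≡ a B′ → b B ≡ b B′ → κ B ≡ κ B′ →
                  (∀ c → τ B c ≡ τ B′ c) → (∀ c → θ B c ≡ θ B′ c) → τ* B ≡ τ* B′ → B ≡ B′

        group : Fin M′ → Fin v → Fin g
        group B = ψ (a B) (b B)

        coord : Fin M′ → Fin v → Fin K → ℤ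
        coord B u c = ⟦ τ B c ⟧ + ⟦ θ B c ⟧ * ⟦ Z c (group B u) ⟧ + + W c (group B) (κ B) u

        θ* : Fin M′ → ℤ
        θ* B = sumFin (λ c → ⟦ θ B c ⟧)

        coord* : Fin M′ → Fin v → ℤ
        coord* B u = ⟦ τ* B ⟧ + θ* B * ⟦ group B u ⟧

        field
          place-group  : ∀ {B B′ u u′} → place B u ≡ place B′ u′ → group B u ≡ group B′ u′
          place-coord  : ∀ {B B′ u u′} → place B u ≡ place B′ u′ → ∀ c → + E ∣ coord B u c - coord B′ u′ c
          place-coord* : ∀ {B B′ u u′} → place B u ≡ place B′ u′ → + E ∣ coord* B u - coord* B′ u′

      module _ {n′ M′ : ℕ} (F : Framing n′ M′) where

        open Framing F

        private

          difference : ∀ t t′ h h′ x w → (t + h * x + w) - (t′ + h′ * x + w) ≡ (t - t′) + (h - h′) * x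
          difference = solve-∀

          difference* : ∀ t t′ h h′ x → (t + h * x) - (t′ + h′ * x) ≡ (t - t′) + (h - h′) * x
          difference* = solve-∀

          subtract : ∀ d h x y → (d + h * x) - (d + h * y) ≡ (x - y) * h
          subtract = solve-∀

          drop : ∀ d h x → (d + h * x) - h * x ≡ d
          drop = solve-∀

          -- Coordinate (x, y) reveals the pattern pair and `κ`; the two groups then determine `a`
          -- and `b`; every other coordinate determines its line, and subtracting the known slopes
          -- from `θ*` leaves the missing one.
          exclusive-< : ∀ {B B′ u₁ u₂ u₁′ u₂′} → toℕ (group B u₁) < toℕ (group B u₂) → (u₁ , u₂) ∈ Js →
                        place B u₁ ≡ place B′ u₁′ → place B u₂ ≡ place B′ u₂′ → B ≡ B′
          exclusive-< {B} {B′} {u₁} {u₂} {u₁′} {u₂′} x<y j e₁ e₂ = same a≡ b≡ κ≡ τ≡ θ≡ τ*≡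
            where
            x = group B u₁
            y = group B u₂
            x≢y : x ≢ y
            x≢y eq = ℕ.<-irrefl (cong toℕ eq) x<y
            x′ : group B′ u₁′ ≡ x
            x′ = sym (place-group e₁)
            y′ : group B′ u₂′ ≡ y
            y′ = sym (place-group e₂)
            c₀ : Fin K
            c₀ = combine x y
            at-left : ∀ B u κ′ → κ B ≡ κ′ → group B u ≡ x → ∀ u′ → group B u′ ≡ y →
                      coord B u c₀ - coord B u′ c₀ ≡ + position u u′ κ′
            at-left B u κ′ refl ex u′ ey = begin
              coord B u c₀ - coord B u′ c₀
                ≡⟨ cong₂ (λ p q → (t + h * ⟦ Z c₀ (group B u) ⟧ + + p) - (t + h * ⟦ Z c₀ (group B u′) ⟧ + + q)) w₁ w₂ ⟩
              (t + h * ⟦ Z c₀ (group B u) ⟧ + + position u u′ κ′) - (t + h * ⟦ Z c₀ (group B u′) ⟧ + 0ℤ)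
                ≡⟨ cong₂ (λ p q → (t + h * ⟦ p ⟧ + + position u u′ κ′) - (t + h * ⟦ q ⟧ + 0ℤ)) z₁ z₂ ⟩
              (t + h * ⟦ x ⟧ + + position u u′ κ′) - (t + h * ⟦ x ⟧ + 0ℤ)
                ≡⟨ cancel-line t h ⟦ x ⟧ (+ position u u′ κ′) ⟩
              + position u u′ κ′ ∎
              where
              open ≡-Reasoning
              t = ⟦ τ B c₀ ⟧
              h = ⟦ θ B c₀ ⟧
              cancel-line : ∀ t h x p → (t + h * x + p) - (t + h * x + 0ℤ) ≡ p
              cancel-line = solve-∀
              at-c₀ : ∀ {A : Set} (f : Fin g → Fin g → A) → f (left c₀) (right c₀) ≡ f x y
              at-c₀ f = cong₂ f (left-combine x y) (right-combine x y)
              z₁ : Z c₀ (group B u) ≡ x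
              z₁ = trans (at-c₀ (λ p q → mergeᶜ p q (group B u))) (trans (cong (mergeᶜ x y) ex) (mergeᶜ-left x<y))
              z₂ : Z c₀ (group B u′) ≡ x
              z₂ = trans (at-c₀ (λ p q → mergeᶜ p q (group B u′))) (trans (cong (mergeᶜ x y) ey) (mergeᶜ-right x<y))
              w₁ : W c₀ (group B) (κ B) u ≡ position u u′ κ′
              w₁ = trans (at-c₀ (λ p q → shiftᶜ p q (group B) (κ B) u)) (shiftᶜ-left (a B) (b B) (κ B) {u} {u′} ex ey)
              w₂ : W c₀ (group B) (κ B) u′ ≡ 0
              w₂ = trans (at-c₀ (λ p q → shiftᶜ p q (group B) (κ B) u′)) (shiftᶜ-right (group B) (κ B) {u′} x≢y ey)
            regroup : ∀ p p′ q q′ → (p - p′) - (q - q′) ≡ (p - q) - (p′ - q′)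
            regroup = solve-∀
            positions≡ : position u₁ u₂ (κ B) ≡ position u₁′ u₂′ (κ B′)
            positions≡ = ℤ.+-injective (ℤ.i-j≡0⇒i≡j _ _ (∣-small⇒≡0 (subst (+ E ∣_)
                (trans (regroup (coord B u₁ c₀) (coord B′ u₁′ c₀) (coord B u₂ c₀) (coord B′ u₂′ c₀))
                  (cong₂ _-_ (at-left B u₁ (κ B) refl refl u₂ refl) (at-left B′ u₁′ (κ B′) refl x′ u₂′ y′)))
                (ℤ∣.∣m∣n⇒∣m-n (place-coord e₁ c₀) (place-coord e₂ c₀)))
              (∣m-n∣<k (position<E u₁ u₂ (κ B)) (position<E u₁′ u₂′ (κ B′)))))
            labels = position-injective j positions≡
            κ≡ : κ B ≡ κ B′
            κ≡ = proj₂ (proj₂ labels)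
            at-x : group B u₁ ≡ group B′ u₁
            at-x = trans (sym x′) (cong (group B′) (sym (proj₁ labels)))
            at-y : group B u₂ ≡ group B′ u₂
            at-y = trans (sym y′) (cong (group B′) (sym (proj₁ (proj₂ labels))))
            ab≡ = ψ-labels {a B} {b B} {a B′} {b B′} (J-irrefl j) at-x at-y
            a≡ = proj₁ ab≡
            b≡ = proj₂ ab≡
            same-group : ∀ u → group B′ u ≡ group B u
            same-group u = cong₂ (λ p q → ψ p q u) (sym a≡) (sym b≡)
            same-shift : ∀ c u → W c (group B′) (κ B′) u ≡ W c (group B) (κ B) u
            same-shift c u = cong₂ (λ f k → W c f k u) (cong₂ ψ (sym a≡) (sym b≡)) (sym κ≡)
            coordinates-of : ∀ {u u′} → u ≡ u′ → place B u ≡ place B′ u′ → ∀ c →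
              + E ∣ (⟦ τ B c ⟧ - ⟦ τ B′ c ⟧) + (⟦ θ B c ⟧ - ⟦ θ B′ c ⟧) * ⟦ Z c (group B u) ⟧
            coordinates-of {u} refl e c = subst (+ E ∣_)
              (trans (cong₂ (λ p q → coord B u c - (⟦ τ B′ c ⟧ + ⟦ θ B′ c ⟧ * ⟦ Z c p ⟧ + + q)) (same-group u) (same-shift c u))
                (difference ⟦ τ B c ⟧ ⟦ τ B′ c ⟧ ⟦ θ B c ⟧ ⟦ θ B′ c ⟧ ⟦ Z c (group B u) ⟧ (+ W c (group B) (κ B) u)))
              (place-coord e c)
            coordinates-of* : ∀ {u u′} → u ≡ u′ → place B u ≡ place B′ u′ →
              + E ∣ (⟦ τ* B ⟧ - ⟦ τ* B′ ⟧) + (θ* B - θ* B′) * ⟦ group B u ⟧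
            coordinates-of* {u} refl e = subst (+ E ∣_)
              (trans (cong (λ p → coord* B u - (⟦ τ* B′ ⟧ + θ* B′ * ⟦ p ⟧)) (same-group u))
                (difference* ⟦ τ* B ⟧ ⟦ τ* B′ ⟧ (θ* B) (θ* B′) ⟦ group B u ⟧))
              (place-coord* e)
            C₁ = coordinates-of (proj₁ labels) e₁
            C₂ = coordinates-of (proj₁ (proj₂ labels)) e₂
            θ≡-other : ∀ c → c ≢ c₀ → θ B c ≡ θ B′ c
            θ≡-other c c≢ = ∣diff⇒≡ (E-cancels (Z-≢ {c} x<y c≢) .cancel _
              (subst (+ E ∣_) (subtract (⟦ τ B c ⟧ - ⟦ τ B′ c ⟧) (⟦ θ B c ⟧ - ⟦ θ B′ c ⟧) ⟦ Z c x ⟧ ⟦ Z c y ⟧)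
                (ℤ∣.∣m∣n⇒∣m-n (C₁ c) (C₂ c))))
            C₁* = coordinates-of* (proj₁ labels) e₁
            θ*≡ : + E ∣ θ* B - θ* B′
            θ*≡ = E-cancels x≢y .cancel _
              (subst (+ E ∣_) (subtract (⟦ τ* B ⟧ - ⟦ τ* B′ ⟧) (θ* B - θ* B′) ⟦ x ⟧ ⟦ y ⟧)
                (ℤ∣.∣m∣n⇒∣m-n C₁* (coordinates-of* (proj₁ (proj₂ labels)) e₂)))
            θ≡-c₀ : θ B c₀ ≡ θ B′ c₀
            θ≡-c₀ = ∣diff⇒≡ (subst (+ E ∣_) (sumFin-except (λ c → ⟦ θ B c ⟧) (λ c → ⟦ θ B′ c ⟧) c₀
              (λ c c≢ → cong ⟦_⟧ (θ≡-other c c≢))) θ*≡)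
            θ≡ : ∀ c → θ B c ≡ θ B′ c
            θ≡ c with c ≟ c₀
            ... | yes refl = θ≡-c₀
            ... | no  c≢   = θ≡-other c c≢
            τ≡ : ∀ c → τ B c ≡ τ B′ c
            τ≡ c = ∣diff⇒≡ (subst (+ E ∣_) (drop (⟦ τ B c ⟧ - ⟦ τ B′ c ⟧) (⟦ θ B c ⟧ - ⟦ θ B′ c ⟧) ⟦ Z c x ⟧)
              (ℤ∣.∣m∣n⇒∣m-n (C₁ c) (ℤ∣.∣m⇒∣m*n ⟦ Z c x ⟧
                (subst (λ t → + E ∣ ⟦ t ⟧ - ⟦ θ B′ c ⟧) (sym (θ≡ c)) (divides 0ℤ (ℤ.i≡j⇒i-j≡0 {⟦ θ B′ c ⟧} refl))))))
            τ*≡ : τ* B ≡ τ* B′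
            τ*≡ = ∣diff⇒≡ (subst (+ E ∣_) (drop (⟦ τ* B ⟧ - ⟦ τ* B′ ⟧) (θ* B - θ* B′) ⟦ x ⟧)
              (ℤ∣.∣m∣n⇒∣m-n C₁* (ℤ∣.∣m⇒∣m*n ⟦ x ⟧ θ*≡)))

        framed : Packing claim n′ M′
        framed = record
          { place = place
          ; injective = λ B e → ψ-injective (a B) (b B) (place-group e)
          ; exclusive = λ {B} {B′} {u₁} {u₂} j e₁ e₂ → split {B} {B′} {u₁} {u₂} j e₁ e₂ }
          where
          split : ∀ {B B′ u₁ u₂ u₁′ u₂′} → (u₁ , u₂) ∈ Js → place B u₁ ≡ place B′ u₁′ → place B u₂ ≡ place B′ u₂′ → B ≡ B′
          split {B} {B′} {u₁} {u₂} j e₁ e₂ with ℕ.<-cmp (toℕ (group B u₁)) (toℕ (group B u₂))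
          ... | tri< x<y _ _ = exclusive-< x<y j e₁ e₂
          ... | tri> _ _ y<x = exclusive-< y<x (J-sym j) e₂ e₁
          ... | tri≈ _ x≡y _ = contradiction (ψ-injective (a B) (b B) {u₁} {u₂} (toℕ-injective x≡y)) (J-irrefl j)

      -- With M copies, n vertices and m claimed pairs, M m / n² = (g⁻ / g) (R m / E), and both
      -- quotients are close to 1.
      framedVertices framedCopies : ℕ
      framedVertices = g ℕ.* (E ℕ.^ K ℕ.* E)
      framedCopies   = ((g⁻ ℕ.* g) ℕ.* R) ℕ.* ((E ℕ.^ K ℕ.* E ℕ.^ K) ℕ.* E)

      private

        module Coding (B : Fin framedCopies) where

          labels = remQuot {(g⁻ ℕ.* g) ℕ.* R} ((E ℕ.^ K ℕ.* E ℕ.^ K) ℕ.* E) B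
          abκ    = remQuot {g⁻ ℕ.* g} R (proj₁ labels)
          ab     = remQuot {g⁻} g (proj₁ abκ)
          τθ*    = remQuot {E ℕ.^ K ℕ.* E ℕ.^ K} E (proj₂ labels)
          τθ     = remQuot {E ℕ.^ K} (E ℕ.^ K) (proj₁ τθ*)
          τᶜ θᶜ  : Fin K → Fin E
          τᶜ     = finToFun (proj₁ τθ)
          θᶜ     = finToFun (proj₂ τθ)

          groupᶜ : Fin v → Fin g
          groupᶜ = ψ (proj₁ ab) (proj₂ ab)

          coordᶜ : Fin v → Fin K → ℤ
          coordᶜ u c = ⟦ τᶜ c ⟧ + ⟦ θᶜ c ⟧ * ⟦ Z c (groupᶜ u) ⟧ + + W c groupᶜ (proj₂ abκ) u

          coordᶜ* : Fin v → ℤ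
          coordᶜ* u = ⟦ proj₂ τθ* ⟧ + sumFin (λ c → ⟦ θᶜ c ⟧) * ⟦ groupᶜ u ⟧

          residue : Fin v → Fin K → Fin E
          residue u c = red (coordᶜ u c)

          rest : Fin v → Fin (E ℕ.^ K ℕ.* E)
          rest u = combine (funToFin (residue u)) (red {E} (coordᶜ* u))

          placeᶜ : Fin v → Fin framedVertices
          placeᶜ u = combine (groupᶜ u) (rest u)

      framing : Framing framedVertices framedCopies
      framing = record
        { a = λ B → proj₁ (Coding.ab B)
        ; b = λ B → proj₂ (Coding.ab B)
        ; κ = λ B → proj₂ (Coding.abκ B)
        ; τ = Coding.τᶜ
        ; θ = Coding.θᶜ
        ; τ* = λ B → proj₂ (Coding.τθ* B)
        ; place = Coding.placeᶜ
        ; same = λ a≡ b≡ κ≡ τ≡ θ≡ τ*≡ →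
            remQuot-injective {(g⁻ ℕ.* g) ℕ.* R} ((E ℕ.^ K ℕ.* E ℕ.^ K) ℕ.* E) (cong₂ _,_
              (remQuot-injective {g⁻ ℕ.* g} R (cong₂ _,_ (remQuot-injective {g⁻} g (cong₂ _,_ a≡ b≡)) κ≡))
              (remQuot-injective {E ℕ.^ K ℕ.* E ℕ.^ K} E (cong₂ _,_
                (remQuot-injective {E ℕ.^ K} (E ℕ.^ K) (cong₂ _,_ (finToFun-injective {K} {E} τ≡) (finToFun-injective {K} {E} θ≡)))
                τ*≡)))
        ; place-group = λ {B} {B′} {u} {u′} e →
            proj₁ (combine-injective (Coding.groupᶜ B u) (Coding.rest B u) (Coding.groupᶜ B′ u′) (Coding.rest B′ u′) e)
        ; place-coord = λ {B} {B′} {u} {u′} e c →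
            red-≡⇒∣ {x = Coding.coordᶜ B u c} {Coding.coordᶜ B′ u′ c}
              (funToFin-injective {K} {E} {Coding.residue B u} {Coding.residue B′ u′} (proj₁ (rest≡ {B} {B′} {u} {u′} e)) c)
        ; place-coord* = λ {B} {B′} {u} {u′} e →
            red-≡⇒∣ {x = Coding.coordᶜ* B u} {Coding.coordᶜ* B′ u′} (proj₂ (rest≡ {B} {B′} {u} {u′} e))
        }
        where
        rest≡ : ∀ {B B′ u u′} → Coding.placeᶜ B u ≡ Coding.placeᶜ B′ u′ →
                funToFin (Coding.residue B u) ≡ funToFin (Coding.residue B′ u′) × red {E} (Coding.coordᶜ* B u) ≡ red {E} (Coding.coordᶜ* B′ u′)
        rest≡ {B} {B′} {u} {u′} e = combine-injective (funToFin (Coding.residue B u)) _ (funToFin (Coding.residue B′ u′)) _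
          (proj₂ (combine-injective (Coding.groupᶜ B u) (Coding.rest B u) (Coding.groupᶜ B′ u′) (Coding.rest B′ u′) e))

-- The pattern of diamonds indexed by matrices.

module Pattern where

  open Packings
  open import Data.Fin.Base
    using (Fin; zero; suc; combine; remQuot; funToFin; finToFun; _↑ˡ_; _↑ʳ_; punchIn; punchOut; splitAt)
  open import Data.Fin.Properties
    using (_≟_; combine-injective; remQuot-combine; finToFun-funToFin; punchIn-punchOut; splitAt-↑ˡ;
           splitAt-↑ʳ; punchInᵢ≢i)
  open import Data.List.Base
    using (List; []; _∷_; _++_; map; length; cartesianProduct; cartesianProductWith; allFin)
  open import Data.List.Properties using (length-++; length-map; length-tabulate)
  open import Data.List.Membership.Propositional using (_∈_)
  open import Data.List.Membership.Propositional.Properties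
    using (∈-cartesianProduct⁺; ∈-cartesianProductWith⁺; ∈-cartesianProductWith⁻; ∈-allFin; ∈-map⁺; ∈-map⁻;
           ∈-++⁺ˡ; ∈-++⁺ʳ; ∈-++⁻)
  open import Data.List.Relation.Unary.Any using (here; there)
  open import Data.Nat.Base using (ℕ; zero; suc; _+_; _*_; _^_)
  open import Data.Product.Base using (∃-syntax; _×_; _,_; proj₁; proj₂; swap)
  open import Data.Sum.Base using (_⊎_; inj₁; inj₂)
  open import Function.Base using (_∘_)
  open import Relation.Binary.PropositionalEquality
  open import Relation.Nullary using (¬_; yes; no; contradiction)

  length-cartesianProductWith : ∀ {A B C : Set} (f : A → B → C) xs ys →
    length (cartesianProductWith f xs ys) ≡ length xs * length ys
  length-cartesianProductWith f []       ys = refl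
  length-cartesianProductWith f (x ∷ xs) ys = trans (length-++ (map (f x) ys))
    (cong₂ _+_ (length-map (f x) ys) (length-cartesianProductWith f xs ys))

  length-allFin : ∀ n → length (allFin n) ≡ n
  length-allFin n = length-tabulate {n = n} _

  data Side : Set where
    left right : Side

  module _ (d⁻ ℓ⁻ : ℕ) where

    private

      d ℓ cells⁻ cells : ℕ
      d = suc d⁻
      ℓ = suc ℓ⁻
      cells⁻ = d⁻ + d⁻ * d
      cells = d * d

    -- The diamonds are indexed by the d × d matrices over Fin ℓ.
    S : ℕ
    S = ℓ ^ cells

    data Kind : Set where
      private-end : Fin 2 → Kind
      arm         : Side → Fin d → Kind

    private

      entry : Fin S → Fin cells → Fin ℓ
      entry = finToFun

      -- rows for left arms, columns for right arms
      line : Side → Fin cells → Fin d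
      line left  c = proj₁ (remQuot {d} d c)
      line right c = proj₂ (remQuot {d} d c)

      mask : Side → Fin d → (Fin cells → Fin ℓ) → Fin cells → Fin ℓ
      mask σ i f c with line σ c ≟ i
      ... | yes _ = zero
      ... | no  _ = f c

      mask-off : ∀ σ i f c → line σ c ≢ i → mask σ i f c ≡ f c
      mask-off σ i f c ne with line σ c ≟ i
      ... | yes e = contradiction e ne
      ... | no  _ = refl

      mask-cong : ∀ σ i {f g} → (∀ c → line σ c ≢ i → f c ≡ g c) → ∀ c → mask σ i f c ≡ mask σ i g c
      mask-cong σ i eq c with line σ c ≟ i
      ... | yes _ = refl
      ... | no ne = eq c ne

      erase : Side → Fin d → Fin S → Fin S
      erase σ i s = funToFin (mask σ i (entry s))

      Agree : Side → Fin d → Fin S → Fin S → Set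
      Agree σ i s t = ∀ c → line σ c ≢ i → entry s c ≡ entry t c

      erase⇒Agree : ∀ σ i {s t} → erase σ i s ≡ erase σ i t → Agree σ i s t
      erase⇒Agree σ i {s} {t} eq c ne = trans (sym (mask-off σ i (entry s) c ne))
        (trans (funToFin-injective {cells} {ℓ} {mask σ i (entry s)} {mask σ i (entry t)} eq c) (mask-off σ i (entry t) c ne))

      Agree⇒erase : ∀ σ i {s t} → Agree σ i s t → erase σ i s ≡ erase σ i t
      Agree⇒erase σ i a = funToFin-cong (mask-cong σ i a)

      everywhere : ∀ {s t : Fin S} → (∀ c → entry s c ≡ entry t c) → s ≡ t
      everywhere = finToFun-injective {cells} {ℓ}

      join-agree : ∀ σ {i s t} → Agree σ i s t → (∀ c → line σ c ≡ i → entry s c ≡ entry t c) → s ≡ t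
      join-agree σ {i} {s} {t} off on = everywhere λ c → decide c
        where
        decide : ∀ c → entry s c ≡ entry t c
        decide c with line σ c ≟ i
        ... | yes e = on c e
        ... | no ne = off c ne

      -- An entry on line `i` lies off the lines `j` and `k`, so there `s` and `t` agree through
      -- `q`.
      triangle-free : ∀ σ {i j k s t q} → i ≢ j → i ≢ k → Agree σ i s t → Agree σ j t q → Agree σ k s q → s ≡ t
      triangle-free σ i≢j i≢k st tq sq = join-agree σ st λ { c refl → trans (sq c i≢k) (sym (tq c i≢j)) }

      -- If `i` is neither `i₁` nor `i₂`, then `q` equates `s` and `t` on line `i` as well. If it is
      -- one of them, the two agreements off line `i` combine to equate `q` with `s` or `t` on its
      -- other line.
      no-bridge : ∀ σ {i i₁ i₂ s t q} → i₁ ≢ i₂ → Agree σ i s t → Agree σ i₁ q s → Agree σ i₂ q t → s ≡ t ⊎ q ≡ s ⊎ q ≡ t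
      no-bridge σ {i} {i₁} {i₂} i₁≢i₂ st qs qt with i ≟ i₁ | i ≟ i₂
      ... | yes refl | _        = inj₂ (inj₂ (join-agree σ qt λ { c refl → trans (qs c (i₁≢i₂ ∘ sym)) (st c (i₁≢i₂ ∘ sym)) }))
      ... | no _     | yes refl = inj₂ (inj₁ (join-agree σ qs λ { c refl → trans (qt c i₁≢i₂) (sym (st c i₁≢i₂)) }))
      ... | no ne₁   | no ne₂   = inj₁ (join-agree σ st λ { c refl → trans (sym (qs c ne₁)) (qt c ne₂) })

      code : Kind → Fin (2 + (d + d))
      code (private-end p) = p ↑ˡ (d + d)
      code (arm left i)    = 2 ↑ʳ (i ↑ˡ d)
      code (arm right i)   = 2 ↑ʳ (d ↑ʳ i)

      decode : Fin (2 + (d + d)) → Kind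
      decode c with splitAt 2 c
      ... | inj₁ p = private-end p
      ... | inj₂ a with splitAt d a
      ...   | inj₁ i = arm left i
      ...   | inj₂ i = arm right i

      decode-code : ∀ k → decode (code k) ≡ k
      decode-code (private-end p) rewrite splitAt-↑ˡ 2 p (d + d) = refl
      decode-code (arm left i) rewrite splitAt-↑ʳ 2 (d + d) (i ↑ˡ d) | splitAt-↑ˡ d i d = refl
      decode-code (arm right i) rewrite splitAt-↑ʳ 2 (d + d) (d ↑ʳ i) | splitAt-↑ʳ d d i = refl

      code-injective : ∀ {k k′} → code k ≡ code k′ → k ≡ k′
      code-injective {k} {k′} eq = trans (sym (decode-code k)) (trans (cong decode eq) (decode-code k′))

      trace : Fin S → Kind → Fin S
      trace s (private-end _) = s
      trace s (arm σ i)       = erase σ i s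

    patternSize : ℕ
    patternSize = (2 + (d + d)) * S

    abstract

      vertex : Fin S → Kind → Fin patternSize
      vertex s k = combine (code k) (trace s k)

      vertex-≡ : ∀ {s t k k′} → vertex s k ≡ vertex t k′ → k ≡ k′ × trace s k ≡ trace t k′
      vertex-≡ {s} {t} {k} {k′} eq = let c , e = combine-injective (code k) (trace s k) (code k′) (trace t k′) eq in code-injective c , e

      vertex-cong : ∀ {s t} k → trace s k ≡ trace t k → vertex s k ≡ vertex t k
      vertex-cong k = cong (combine (code k))

    vertex-kind : ∀ {s t k k′} → vertex s k ≡ vertex t k′ → k ≡ k′
    vertex-kind eq = proj₁ (vertex-≡ eq)

    data OnSide (σ : Side) : Kind → Set where
      end : ∀ {p} → OnSide σ (private-end p)
      arm : ∀ {i} → OnSide σ (arm σ i)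

    private

      shared-arm : ∀ {s t σ k k′} → s ≢ t → OnSide σ k → vertex s k ≡ vertex t k′ → ∃[ i ] k ≡ arm σ i × Agree σ i s t
      shared-arm s≢t o eq with vertex-≡ eq
      shared-arm s≢t end eq | refl , e = contradiction e s≢t
      shared-arm {σ = σ} s≢t (arm {i}) eq | refl , e = i , refl , erase⇒Agree σ i e

    -- Two arms of one side forget disjoint sets of entries and a private end forgets nothing, so
    -- two vertices of an edge see the whole matrix.
    edge∩diamond : ∀ {s t σ k₁ k₂ l₁ l₂} → s ≢ t → OnSide σ k₁ → OnSide σ k₂ → k₁ ≢ k₂ →
                   vertex s k₁ ≡ vertex t l₁ → ¬ vertex s k₂ ≡ vertex t l₂
    edge∩diamond {σ = σ} s≢t o₁ o₂ k₁≢k₂ e₁ e₂ with shared-arm s≢t o₁ e₁ | shared-arm s≢t o₂ e₂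
    ... | i₁ , refl , a₁ | i₂ , refl , a₂ = s≢t (join-agree σ a₁ λ { c refl → a₂ c (k₁≢k₂ ∘ cong (arm σ)) })

    -- Private ends are never shared, and a shared arm has the same side in both edges. So all three
    -- edges lie on one side, where `triangle-free` applies.
    no-triangle : ∀ {s t q σ₁ σ₂ σ₃ k₁ k₂ l₁ l₃ m₂ m₃} → s ≢ t → t ≢ q → s ≢ q →
      OnSide σ₁ k₁ → OnSide σ₁ k₂ → OnSide σ₂ l₁ → OnSide σ₂ l₃ → OnSide σ₃ m₂ → OnSide σ₃ m₃ →
      k₁ ≢ k₂ → l₁ ≢ l₃ → vertex s k₁ ≡ vertex t l₁ → vertex s k₂ ≡ vertex q m₂ → ¬ vertex t l₃ ≡ vertex q m₃
    no-triangle s≢t t≢q s≢q o₁ o₂ p₁ p₃ r₂ r₃ k≢ l≢ e₁ e₂ e₃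
      with shared-arm s≢t o₁ e₁ | shared-arm s≢q o₂ e₂ | shared-arm t≢q p₃ e₃
    ... | i , refl , a | k , refl , b | j , refl , c with vertex-kind e₁
    no-triangle {σ₁ = σ} s≢t t≢q s≢q o₁ o₂ arm p₃ r₂ r₃ k≢ l≢ e₁ e₂ e₃ | i , refl , a | k , refl , b | j , refl , c | refl =
      s≢t (triangle-free σ (l≢ ∘ cong (arm σ)) (k≢ ∘ cong (arm σ)) a c b)

    -- By `edge∩diamond` the two common vertices of `s` and `t` are arms of opposite sides; the one
    -- on the side of the third edge contradicts `no-bridge`.
    no-bridging : ∀ {s t q σ k₁ k₂ l₁ l₂ x₁ x₂ y₁ y₂} → s ≢ t → q ≢ s → q ≢ t →
      k₁ ≢ k₂ → vertex s k₁ ≡ vertex t l₁ → vertex s k₂ ≡ vertex t l₂ →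
      OnSide σ x₁ → OnSide σ x₂ → x₁ ≢ x₂ → vertex q x₁ ≡ vertex s y₁ → ¬ vertex q x₂ ≡ vertex t y₂
    no-bridging {s} {t} {q} {σ} {k₁} {k₂} s≢t q≢s q≢t k₁≢k₂ e₁ e₂ o₁ o₂ x₁≢x₂ f₁ f₂
      with shared-arm q≢s o₁ f₁ | shared-arm q≢t o₂ f₂
    ... | i₁ , refl , a₁ | i₂ , refl , a₂ = finish (common k₁ k₂ k₁≢k₂ e₁ e₂)
      where
      agree : ∀ σ′ i {l} → vertex s (arm σ′ i) ≡ vertex t l → Agree σ′ i s t
      agree σ′ i e with vertex-≡ e
      ... | refl , e′ = erase⇒Agree σ′ i e′
      private-⊥ : ∀ {p l} {A : Set} → vertex s (private-end p) ≡ vertex t l → A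
      private-⊥ e with vertex-≡ e
      ... | refl , e′ = contradiction e′ s≢t
      common : ∀ k₁ k₂ {l₁ l₂} → k₁ ≢ k₂ → vertex s k₁ ≡ vertex t l₁ → vertex s k₂ ≡ vertex t l₂ → ∃[ i ] Agree σ i s t
      common (private-end p) k₂ ne e₁ e₂ = private-⊥ e₁
      common (arm σ₁ i) (private-end p) ne e₁ e₂ = private-⊥ e₂
      common (arm left i) (arm left j) ne e₁ e₂ = contradiction e₂ (edge∩diamond s≢t arm arm ne e₁)
      common (arm right i) (arm right j) ne e₁ e₂ = contradiction e₂ (edge∩diamond s≢t arm arm ne e₁)
      common (arm left i) (arm right j) ne e₁ e₂ = pick σ (agree left i e₁) (agree right j e₂)
        where
        pick : ∀ σ → Agree left i s t → Agree right j s t → ∃[ i ] Agree σ i s t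
        pick left  a b = i , a
        pick right a b = j , b
      common (arm right i) (arm left j) ne e₁ e₂ = pick σ (agree right i e₁) (agree left j e₂)
        where
        pick : ∀ σ → Agree right i s t → Agree left j s t → ∃[ i ] Agree σ i s t
        pick left  a b = j , b
        pick right a b = i , a
      finish : ¬ (∃[ i ] Agree σ i s t)
      finish (i , a) with no-bridge σ (x₁≢x₂ ∘ cong (arm σ)) a a₁ a₂
      ... | inj₁ e        = s≢t e
      ... | inj₂ (inj₁ e) = q≢s e
      ... | inj₂ (inj₂ e) = q≢t e

    private

      arms : List Kind
      arms = map (arm left) (allFin d) ++ map (arm right) (allFin d)

      end-arm : List (Kind × Kind)
      end-arm = cartesianProduct (map private-end (allFin 2)) arms

      same-side : Side → List (Kind × Kind)
      same-side σ = cartesianProductWith (λ i x → arm σ i , arm σ (punchIn i x)) (allFin d) (allFin d⁻)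

      end₀ end₁ : Kind
      end₀ = private-end zero
      end₁ = private-end (suc zero)

      edge-pairs : List (Kind × Kind)
      edge-pairs = (end₀ , end₁) ∷ (end₁ , end₀) ∷ end-arm ++ map swap end-arm ++ same-side left ++ same-side right

      fill : Fin cells → Fin (ℓ ^ cells⁻) → Fin cells → Fin ℓ
      fill c e c′ with c ≟ c′
      ... | yes _ = zero
      ... | no ne = finToFun {ℓ} {cells⁻} e (punchOut ne)

      -- The representative, with entry 0 at cell `c`, of the ℓ diamonds that differ only there and
      -- therefore share the cross pair of `c`.
      crossing : Fin cells → Fin (ℓ ^ cells⁻) → Fin S
      crossing c e = funToFin (fill c e)

      cross-pair : Fin cells → Fin (ℓ ^ cells⁻) → Fin patternSize × Fin patternSize
      cross-pair c e = vertex (crossing c e) (arm left (line left c)) , vertex (crossing c e) (arm right (line right c))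

      -- A cross pair does not determine its diamond: it is blind to one matrix entry.
      cross-pairs : List (Fin patternSize × Fin patternSize)
      cross-pairs = cartesianProductWith cross-pair (allFin cells) (allFin (ℓ ^ cells⁻))

      edge-pair : Fin S → Kind × Kind → Fin patternSize × Fin patternSize
      edge-pair s (k , k′) = vertex s k , vertex s k′

    -- The pairs of a left and a right arm lie in no edge but are claimed too, because distinct
    -- copies must not share them either: whole diamonds enter the final count.
    claimed : List (Fin patternSize × Fin patternSize)
    claimed = cartesianProductWith edge-pair (allFin S) edge-pairs ++ cross-pairs ++ map swap cross-pairs

    private

      end≢arm : ∀ {p σ i} → private-end p ≢ arm σ i
      end≢arm ()

      ∈-arms : ∀ σ i → arm σ i ∈ arms
      ∈-arms left  i = ∈-++⁺ˡ (∈-map⁺ (arm left) (∈-allFin i))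
      ∈-arms right i = ∈-++⁺ʳ (map (arm left) (allFin d)) (∈-map⁺ (arm right) (∈-allFin i))

      ∈-end-arm : ∀ p σ i → (private-end p , arm σ i) ∈ end-arm
      ∈-end-arm p σ i = ∈-cartesianProduct⁺ (∈-map⁺ private-end (∈-allFin p)) (∈-arms σ i)

      ∈-same-side : ∀ σ {i j} → i ≢ j → (arm σ i , arm σ j) ∈ same-side σ
      ∈-same-side σ {i} {j} i≢j = subst (λ z → (arm σ i , arm σ z) ∈ same-side σ) (punchIn-punchOut i≢j)
        (∈-cartesianProductWith⁺ (λ i x → arm σ i , arm σ (punchIn i x)) (∈-allFin i) (∈-allFin (punchOut i≢j)))

      in-edge : ∀ s {k k′} → (k , k′) ∈ edge-pairs → (vertex s k , vertex s k′) ∈ claimed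
      in-edge s m = ∈-++⁺ˡ (∈-cartesianProductWith⁺ edge-pair (∈-allFin s) m)

      restriction : Fin cells → Fin S → Fin (ℓ ^ cells⁻)
      restriction c s = funToFin (λ x → entry s (punchIn c x))

      crossing-restriction : ∀ c s c′ → c ≢ c′ → entry (crossing c (restriction c s)) c′ ≡ entry s c′
      crossing-restriction c s c′ c≢c′ = trans (finToFun-funToFin {cells} {ℓ} (fill c (restriction c s)) c′) value
        where
        value : fill c (restriction c s) c′ ≡ entry s c′
        value with c ≟ c′
        ... | yes e = contradiction e c≢c′
        ... | no ne = trans (finToFun-funToFin {cells⁻} {ℓ} (λ x → entry s (punchIn c x)) (punchOut ne))
                            (cong (entry s) (punchIn-punchOut ne))

      blind : ∀ σ c s → vertex (crossing c (restriction c s)) (arm σ (line σ c)) ≡ vertex s (arm σ (line σ c))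
      blind σ c s = vertex-cong (arm σ (line σ c)) (Agree⇒erase σ (line σ c)
        (λ c′ ne → crossing-restriction c s c′ (ne ∘ cong (line σ) ∘ sym)))

      in-cross : ∀ s i j → (vertex s (arm left i) , vertex s (arm right j)) ∈ cross-pairs
      in-cross s i j = subst₂ (λ i j → (vertex s (arm left i) , vertex s (arm right j)) ∈ cross-pairs)
        (cong proj₁ (remQuot-combine {d} {d} i j)) (cong proj₂ (remQuot-combine {d} {d} i j))
        (subst (_∈ cross-pairs) (cong₂ _,_ (blind left c s) (blind right c s))
          (∈-cartesianProductWith⁺ cross-pair (∈-allFin c) (∈-allFin (restriction c s))))
        where c = combine i j

    claimed⁺ : ∀ s {k k′} → k ≢ k′ → (vertex s k , vertex s k′) ∈ claimed
    claimed⁺ s {private-end zero}       {private-end zero}       ne = contradiction refl ne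
    claimed⁺ s {private-end zero}       {private-end (suc zero)} ne = in-edge s (here refl)
    claimed⁺ s {private-end (suc zero)} {private-end zero}       ne = in-edge s (there (here refl))
    claimed⁺ s {private-end (suc zero)} {private-end (suc zero)} ne = contradiction refl ne
    claimed⁺ s {private-end p} {arm σ i} ne = in-edge s (there (there (∈-++⁺ˡ (∈-end-arm p σ i))))
    claimed⁺ s {arm σ i} {private-end p} ne = in-edge s (there (there (∈-++⁺ʳ end-arm (∈-++⁺ˡ (∈-map⁺ swap (∈-end-arm p σ i))))))
    claimed⁺ s {arm left i}  {arm left j}  ne = in-edge s (there (there (∈-++⁺ʳ end-arm (∈-++⁺ʳ (map swap end-arm)
      (∈-++⁺ˡ (∈-same-side left (ne ∘ cong (arm left))))))))
    claimed⁺ s {arm right i} {arm right j} ne = in-edge s (there (there (∈-++⁺ʳ end-arm (∈-++⁺ʳ (map swap end-arm)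
      (∈-++⁺ʳ (same-side left) (∈-same-side right (ne ∘ cong (arm right))))))))
    claimed⁺ s {arm left i}  {arm right j} ne = ∈-++⁺ʳ (cartesianProductWith edge-pair (allFin S) edge-pairs) (∈-++⁺ˡ (in-cross s i j))
    claimed⁺ s {arm right i} {arm left j}  ne = ∈-++⁺ʳ (cartesianProductWith edge-pair (allFin S) edge-pairs)
      (∈-++⁺ʳ cross-pairs (∈-map⁺ swap (in-cross s j i)))

    private

      Distinct : Kind × Kind → Set
      Distinct (k , k′) = k ≢ k′

      end-arm-distinct : ∀ {p} → p ∈ end-arm → Distinct p
      end-arm-distinct m with ∈-cartesianProductWith⁻ _,_ (map private-end (allFin 2)) arms m
      ... | a , b , a∈ , b∈ , refl with ∈-map⁻ private-end a∈ | ∈-++⁻ (map (arm left) (allFin d)) b∈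
      ... | _ , _ , refl | inj₁ b∈ˡ with ∈-map⁻ (arm left) b∈ˡ
      ...   | _ , _ , refl = end≢arm
      end-arm-distinct m | a , b , a∈ , b∈ , refl | _ , _ , refl | inj₂ b∈ʳ with ∈-map⁻ (arm right) b∈ʳ
      ...   | _ , _ , refl = end≢arm

      arm-injective : ∀ {σ i j} → arm σ i ≡ arm σ j → i ≡ j
      arm-injective refl = refl

      same-side-distinct : ∀ σ {p} → p ∈ same-side σ → Distinct p
      same-side-distinct σ m with ∈-cartesianProductWith⁻ (λ i x → arm σ i , arm σ (punchIn i x)) (allFin d) (allFin d⁻) m
      ... | i , x , _ , _ , refl = λ e → punchInᵢ≢i i x (sym (arm-injective e))

      edge-pairs-distinct : ∀ {p} → p ∈ edge-pairs → Distinct p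
      edge-pairs-distinct (here refl) = λ ()
      edge-pairs-distinct (there (here refl)) = λ ()
      edge-pairs-distinct (there (there m)) with ∈-++⁻ end-arm m
      ... | inj₁ m₁ = end-arm-distinct m₁
      ... | inj₂ m₂ with ∈-++⁻ (map swap end-arm) m₂
      ...   | inj₁ m₃ with ∈-map⁻ swap m₃
      ...     | p , p∈ , refl = end-arm-distinct p∈ ∘ sym
      edge-pairs-distinct (there (there m)) | inj₂ m₂ | inj₂ m₄ with ∈-++⁻ (same-side left) m₄
      ...     | inj₁ m₅ = same-side-distinct left m₅
      ...     | inj₂ m₅ = same-side-distinct right m₅

    claimed⁻ : ∀ {u u′} → (u , u′) ∈ claimed → ∃[ s ] ∃[ k ] ∃[ k′ ] k ≢ k′ × u ≡ vertex s k × u′ ≡ vertex s k′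
    claimed⁻ m with ∈-++⁻ (cartesianProductWith edge-pair (allFin S) edge-pairs) m
    ... | inj₁ m₁ with ∈-cartesianProductWith⁻ edge-pair (allFin S) edge-pairs m₁
    ...   | s , (k , k′) , _ , kk∈ , refl = s , k , k′ , edge-pairs-distinct kk∈ , refl , refl
    claimed⁻ m | inj₂ m₂ with ∈-++⁻ cross-pairs m₂
    ...   | inj₁ m₃ with ∈-cartesianProductWith⁻ cross-pair (allFin cells) (allFin (ℓ ^ cells⁻)) m₃
    ...     | c , e , _ , _ , refl = crossing c e , arm left (line left c) , arm right (line right c) , (λ ()) , refl , refl
    claimed⁻ m | inj₂ m₂ | inj₂ m₃ with ∈-map⁻ swap m₃
    ...     | p , p∈ , eq with ∈-cartesianProductWith⁻ cross-pair (allFin cells) (allFin (ℓ ^ cells⁻)) p∈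
    ...       | c , e , _ , _ , refl with refl ← eq = crossing c e , arm right (line right c) , arm left (line left c) , (λ ()) , refl , refl

    claimed-sym : ∀ {u u′} → (u , u′) ∈ claimed → (u′ , u) ∈ claimed
    claimed-sym m with claimed⁻ m
    ... | s , k , k′ , k≢k′ , refl , refl = claimed⁺ s (k≢k′ ∘ sym)

    claimed-irrefl : ∀ {u u′} → (u , u′) ∈ claimed → u ≢ u′
    claimed-irrefl m eq with claimed⁻ m
    ... | s , k , k′ , k≢k′ , refl , refl = k≢k′ (vertex-kind eq)

    private

      length-end-arm : length end-arm ≡ 2 * (d + d)
      length-end-arm = trans (length-cartesianProductWith _,_ (map private-end (allFin 2)) arms)
        (cong (2 *_) (trans (length-++ (map (arm left) (allFin d))) (cong₂ _+_
          (trans (length-map (arm left) (allFin d)) (length-allFin d)) (trans (length-map (arm right) (allFin d)) (length-allFin d)))))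

      length-same-side : ∀ σ → length (same-side σ) ≡ d * d⁻
      length-same-side σ = trans (length-cartesianProductWith _ (allFin d) (allFin d⁻)) (cong₂ _*_ (length-allFin d) (length-allFin d⁻))

      length-edge-pairs : length edge-pairs ≡ 2 + (2 * (d + d) + (2 * (d + d) + (d * d⁻ + d * d⁻)))
      length-edge-pairs = cong (2 +_) (trans (length-++ end-arm) (cong₂ _+_ length-end-arm
        (trans (length-++ (map swap end-arm)) (cong₂ _+_ (trans (length-map swap end-arm) length-end-arm)
          (trans (length-++ (same-side left)) (cong₂ _+_ (length-same-side left) (length-same-side right)))))))

      length-cross : length cross-pairs ≡ cells * ℓ ^ cells⁻
      length-cross = trans (length-cartesianProductWith cross-pair (allFin cells) (allFin (ℓ ^ cells⁻)))
        (cong₂ _*_ (length-allFin cells) (length-allFin (ℓ ^ cells⁻)))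

    -- With r = d + 2 the factor of `S` is 2 r (r - 1) - 2 = 2 ρ. The cross pairs come with ℓ^(cells
    -- - 1) in place of ℓ^cells, hence are negligible for large ℓ.
    length-claimed : length claimed ≡ S * (2 + (2 * (d + d) + (2 * (d + d) + (d * d⁻ + d * d⁻)))) + (cells * ℓ ^ cells⁻ + cells * ℓ ^ cells⁻)
    length-claimed = trans (length-++ (cartesianProductWith edge-pair (allFin S) edge-pairs)) (cong₂ _+_
      (trans (length-cartesianProductWith edge-pair (allFin S) edge-pairs) (cong₂ _*_ (length-allFin S) length-edge-pairs))
      (trans (length-++ cross-pairs) (cong₂ _+_ length-cross (trans (length-map swap cross-pairs) length-cross))))

-- Five sets that pairwise share at most one vertex.

module FiveSets where

  open import Data.Fin.Base using (Fin; zero; suc)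
  open import Data.Fin.Patterns using (0F; 1F)
  open import Data.Fin.Properties using (_≟_; any?; all?)
  open import Data.Fin.Subset using (Subset; inside; outside; ∣_∣; _∈_; _∉_; _⊆_; _∪_; _∩_; _-_; ⁅_⁆; Nonempty)
  open import Data.Fin.Subset.Properties
    using (nonempty?; Empty-unique; ∣⊥∣≡0; p⊆q⇒∣p∣≤∣q∣; x∈p⇒∣p-x∣<∣p∣; x∈p∧x≢y⇒x∈p-y; x∈p∪q⁺; x∈p∪q⁻;
           x∈p∩q⁺; x∈p∩q⁻; x∈⁅x⁆; ∣⁅x⁆∣≡1; p─q⊆p; _∈?_)
  open import Data.Nat.Base as ℕ using (ℕ; zero; suc; _+_; _≤_; _<_; z≤n)
  open import Data.Nat.Properties as ℕ using (module ≤-Reasoning)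
  open import Data.Nat.Tactic.RingSolver using (solve-∀)
  open import Data.Product.Base using (∃-syntax; _×_; _,_; proj₁; proj₂)
  open import Data.Sum.Base using (_⊎_; inj₁; inj₂; map₁)
  open import Data.Vec.Base using ([]; _∷_; there)
  open import Function.Base using (_∘_)
  open import Relation.Binary.PropositionalEquality
  open import Relation.Nullary using (¬_; Dec; yes; no; contradiction)
  open import Relation.Nullary.Decidable using (from-yes; ¬?; _×-dec_)

  ∣∪∣+∣∩∣ : ∀ {n} (p q : Subset n) → ∣ p ∪ q ∣ + ∣ p ∩ q ∣ ≡ ∣ p ∣ + ∣ q ∣
  ∣∪∣+∣∩∣ [] [] = refl
  ∣∪∣+∣∩∣ (outside ∷ p) (outside ∷ q) = ∣∪∣+∣∩∣ p q
  ∣∪∣+∣∩∣ (outside ∷ p) (inside  ∷ q) = trans (cong suc (∣∪∣+∣∩∣ p q)) (sym (ℕ.+-suc ∣ p ∣ ∣ q ∣))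
  ∣∪∣+∣∩∣ (inside  ∷ p) (outside ∷ q) = cong suc (∣∪∣+∣∩∣ p q)
  ∣∪∣+∣∩∣ (inside  ∷ p) (inside  ∷ q) = cong suc (trans (ℕ.+-suc ∣ p ∪ q ∣ ∣ p ∩ q ∣)
    (trans (cong suc (∣∪∣+∣∩∣ p q)) (sym (ℕ.+-suc ∣ p ∣ ∣ q ∣))))

  x∉p-x : ∀ {n} (p : Subset n) {x} → x ∉ p - x
  x∉p-x (_ ∷ p) {zero} ()
  x∉p-x (_ ∷ p) {suc x} (there x∈) = x∉p-x p x∈

  module _ {n : ℕ} where

    ∣∪∣≤ : ∀ (p q : Subset n) → ∣ p ∪ q ∣ ≤ ∣ p ∣ + ∣ q ∣
    ∣∪∣≤ p q = ℕ.≤-trans (ℕ.m≤m+n ∣ p ∪ q ∣ ∣ p ∩ q ∣) (ℕ.≤-reflexive (∣∪∣+∣∩∣ p q))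

    pick : ∀ {p : Subset n} → 0 < ∣ p ∣ → Nonempty p
    pick {p} 0<p with nonempty? p
    ... | yes ne = ne
    ... | no ¬ne = contradiction (trans (cong ∣_∣ (Empty-unique ¬ne)) (∣⊥∣≡0 n)) (ℕ.<⇒≢ 0<p ∘ sym)

    nonempty⇒0< : ∀ {p : Subset n} {x} → x ∈ p → 0 < ∣ p ∣
    nonempty⇒0< x∈p = ℕ.≤-<-trans z≤n (x∈p⇒∣p-x∣<∣p∣ x∈p)

    ∣p∣≤1+∣p-x∣ : ∀ (p : Subset n) x → ∣ p ∣ ≤ suc ∣ p - x ∣
    ∣p∣≤1+∣p-x∣ p x = begin
      ∣ p ∣                   ≤⟨ p⊆q⇒∣p∣≤∣q∣ cover ⟩
      ∣ ⁅ x ⁆ ∪ (p - x) ∣     ≤⟨ ∣∪∣≤ ⁅ x ⁆ (p - x) ⟩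
      ∣ ⁅ x ⁆ ∣ + ∣ p - x ∣   ≡⟨ cong (_+ ∣ p - x ∣) (∣⁅x⁆∣≡1 x) ⟩
      suc ∣ p - x ∣           ∎
      where
      open ≤-Reasoning
      cover : p ⊆ ⁅ x ⁆ ∪ (p - x)
      cover {y} y∈p with y ≟ x
      ... | yes refl = x∈p∪q⁺ (inj₁ (x∈⁅x⁆ x))
      ... | no  y≢x  = x∈p∪q⁺ (inj₂ (x∈p∧x≢y⇒x∈p-y y∈p y≢x))

    AtMostOne : Subset n → Set
    AtMostOne p = ∀ {x y} → x ∈ p → y ∈ p → x ≡ y

    ≤1⇒AtMostOne : ∀ {p} → ∣ p ∣ ≤ 1 → AtMostOne p
    ≤1⇒AtMostOne {p} p≤1 {x} {y} x∈p y∈p with y ≟ x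
    ... | yes y≡x = sym y≡x
    ... | no  y≢x = contradiction p≤1 (ℕ.<⇒≱ (ℕ.≤-<-trans (nonempty⇒0< (x∈p∧x≢y⇒x∈p-y y∈p y≢x)) (x∈p⇒∣p-x∣<∣p∣ x∈p)))

    AtMostOne⇒≤1 : ∀ {p} → AtMostOne p → ∣ p ∣ ≤ 1
    AtMostOne⇒≤1 {p} one with nonempty? p
    ... | yes (x , x∈p) = ℕ.≤-trans (p⊆q⇒∣p∣≤∣q∣ (λ y∈p → subst (_∈ ⁅ x ⁆) (one x∈p y∈p) (x∈⁅x⁆ x))) (ℕ.≤-reflexive (∣⁅x⁆∣≡1 x))
    ... | no ¬ne = ℕ.≤-trans (ℕ.≤-reflexive (trans (cong ∣_∣ (Empty-unique ¬ne)) (∣⊥∣≡0 n))) z≤n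

    Linear : Subset n → Subset n → Set
    Linear p q = ∀ {x y} → x ∈ p → x ∈ q → y ∈ p → y ∈ q → x ≡ y

    linear⇒≤1 : ∀ {p q} → Linear p q → ∣ p ∩ q ∣ ≤ 1
    linear⇒≤1 {p} {q} lin = AtMostOne⇒≤1 λ x∈ y∈ →
      let x∈p , x∈q = x∈p∩q⁻ p q x∈ ; y∈p , y∈q = x∈p∩q⁻ p q y∈ in lin x∈p x∈q y∈p y∈q

    ≤1⇒linear : ∀ {p q} → ∣ p ∩ q ∣ ≤ 1 → Linear p q
    ≤1⇒linear le x∈p x∈q y∈p y∈q = ≤1⇒AtMostOne le (x∈p∩q⁺ (x∈p , x∈q)) (x∈p∩q⁺ (y∈p , y∈q))

    linear-sym : ∀ {p q} → Linear p q → Linear q p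
    linear-sym lin x∈q x∈p y∈q y∈p = lin x∈p x∈q y∈p y∈q

    covered-by-two : ∀ {p : Subset n} x y → (∀ {z} → z ∈ p → z ≡ x ⊎ z ≡ y) → ∣ p ∣ ≤ 2
    covered-by-two {p} x y cover = ℕ.≤-trans (p⊆q⇒∣p∣≤∣q∣ (λ z∈p → x∈p∪q⁺ (into (cover z∈p))))
      (ℕ.≤-trans (∣∪∣≤ ⁅ x ⁆ ⁅ y ⁆) (ℕ.≤-reflexive (cong₂ _+_ (∣⁅x⁆∣≡1 x) (∣⁅x⁆∣≡1 y))))
      where
      into : ∀ {z} → z ≡ x ⊎ z ≡ y → z ∈ ⁅ x ⁆ ⊎ z ∈ ⁅ y ⁆
      into (inj₁ refl) = inj₁ (x∈⁅x⁆ x)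
      into (inj₂ refl) = inj₂ (x∈⁅x⁆ y)

    ∪-least : ∀ {p q s : Subset n} → p ⊆ s → q ⊆ s → p ∪ q ⊆ s
    ∪-least {p} {q} p⊆s q⊆s x∈ with x∈p∪q⁻ p q x∈
    ... | inj₁ x∈p = p⊆s x∈p
    ... | inj₂ x∈q = q⊆s x∈q

    another : ∀ {p : Subset n} x → 2 ≤ ∣ p ∣ → ∃[ y ] y ∈ p × y ≢ x
    another {p} x 2≤ with pick {p - x} (ℕ.≤-pred (ℕ.≤-trans 2≤ (∣p∣≤1+∣p-x∣ p x)))
    ... | y , y∈ = y , p─q⊆p p ⁅ x ⁆ y∈ , λ { refl → x∉p-x p y∈ }

    a-third : ∀ {p : Subset n} x y → 3 ≤ ∣ p ∣ → ∃[ z ] z ∈ p × z ≢ x × z ≢ y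
    a-third {p} x y 3≤ with another {p - x} y (ℕ.≤-pred (ℕ.≤-trans 3≤ (∣p∣≤1+∣p-x∣ p x)))
    ... | z , z∈ , z≢y = z , p─q⊆p p ⁅ x ⁆ z∈ , (λ { refl → x∉p-x p z∈ }) , z≢y

    module _ {d a b : Subset n} (da : Linear d a) (db : Linear d b) where

      TwoMeets : Set
      TwoMeets = ∃[ x ] ∃[ y ] x ∈ d × x ∈ a × y ∈ d × y ∈ b × x ≢ y

      abstract

        two-meets : 2 ≤ ∣ d ∩ (a ∪ b) ∣ → TwoMeets
        two-meets big with pick {d ∩ (a ∪ b)} (ℕ.≤-trans (ℕ.n≤1+n 1) big)
        ... | u , u∈ with another u big
        ...   | v , v∈ , v≢u = sort (x∈p∪q⁻ a b (proj₂ u∈′)) (x∈p∪q⁻ a b (proj₂ v∈′))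
          where
          u∈′ : u ∈ d × u ∈ a ∪ b
          u∈′ = x∈p∩q⁻ d (a ∪ b) u∈
          v∈′ : v ∈ d × v ∈ a ∪ b
          v∈′ = x∈p∩q⁻ d (a ∪ b) v∈
          sort : u ∈ a ⊎ u ∈ b → v ∈ a ⊎ v ∈ b → TwoMeets
          sort (inj₁ ua) (inj₁ va) = contradiction (da (proj₁ v∈′) va (proj₁ u∈′) ua) v≢u
          sort (inj₁ ua) (inj₂ vb) = u , v , proj₁ u∈′ , ua , proj₁ v∈′ , vb , v≢u ∘ sym
          sort (inj₂ ub) (inj₁ va) = v , u , proj₁ v∈′ , va , proj₁ u∈′ , ub , v≢u
          sort (inj₂ ub) (inj₂ vb) = contradiction (db (proj₁ v∈′) vb (proj₁ u∈′) ub) v≢u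

    module _ {d a b c : Subset n} (da : Linear d a) (db : Linear d b) (dc : Linear d c) where

      ThreeMeets : Set
      ThreeMeets = ∃[ x ] ∃[ y ] ∃[ z ] x ∈ d × x ∈ a × y ∈ d × y ∈ b × z ∈ d × z ∈ c × x ≢ y × x ≢ z × y ≢ z

      abstract

        -- Each of `a`, `b`, `c` accounts for at most one point of `d`, so three points come from
        -- three different sets.
        three-meets : 3 ≤ ∣ d ∩ ((a ∪ b) ∪ c) ∣ → ThreeMeets
        three-meets big = extend (two-meets da db two)
          where
          sub : d ∩ ((a ∪ b) ∪ c) ⊆ (d ∩ c) ∪ (d ∩ (a ∪ b))
          sub t∈ with x∈p∩q⁻ d ((a ∪ b) ∪ c) t∈
          ... | t∈d , t∈abc with x∈p∪q⁻ (a ∪ b) c t∈abc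
          ...   | inj₁ t∈ab = x∈p∪q⁺ (inj₂ (x∈p∩q⁺ (t∈d , t∈ab)))
          ...   | inj₂ t∈c  = x∈p∪q⁺ (inj₁ (x∈p∩q⁺ (t∈d , t∈c)))
          two : 2 ≤ ∣ d ∩ (a ∪ b) ∣
          two = ℕ.≤-pred (ℕ.≤-trans big (ℕ.≤-trans (p⊆q⇒∣p∣≤∣q∣ sub) (ℕ.≤-trans (∣∪∣≤ (d ∩ c) (d ∩ (a ∪ b)))
                  (ℕ.+-monoˡ-≤ (∣ d ∩ (a ∪ b) ∣) (linear⇒≤1 dc)))))
          finish : ∀ {x y z} → x ∈ d → x ∈ a → y ∈ d → y ∈ b → x ≢ y → z ≢ x → z ≢ y → z ∈ d →
                   (z ∈ a ⊎ z ∈ b) ⊎ z ∈ c → ThreeMeets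
          finish xd xa yd yb x≢y z≢x z≢y zd (inj₂ zc) = _ , _ , _ , xd , xa , yd , yb , zd , zc , x≢y , z≢x ∘ sym , z≢y ∘ sym
          finish xd xa yd yb x≢y z≢x z≢y zd (inj₁ (inj₁ za)) = contradiction (da zd za xd xa) z≢x
          finish xd xa yd yb x≢y z≢x z≢y zd (inj₁ (inj₂ zb)) = contradiction (db zd zb yd yb) z≢y
          extend : TwoMeets da db → ThreeMeets
          extend (x , y , xd , xa , yd , yb , x≢y) =
            let z , z∈ , z≢x , z≢y = a-third x y big
                zd , zabc = x∈p∩q⁻ d ((a ∪ b) ∪ c) z∈
            in finish xd xa yd yb x≢y z≢x z≢y zd (map₁ (x∈p∪q⁻ a b) (x∈p∪q⁻ (a ∪ b) c zabc))

    record Pasch (A B C D : Subset n) : Set where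
      field
        {ab ac ad bc bd cd} : Fin n
        ab∈A : ab ∈ A ; ab∈B : ab ∈ B
        ac∈A : ac ∈ A ; ac∈C : ac ∈ C
        ad∈A : ad ∈ A ; ad∈D : ad ∈ D
        bc∈B : bc ∈ B ; bc∈C : bc ∈ C
        bd∈B : bd ∈ B ; bd∈D : bd ∈ D
        cd∈C : cd ∈ C ; cd∈D : cd ∈ D
        A₁ : ab ≢ ac ; A₂ : ab ≢ ad ; A₃ : ac ≢ ad
        B₁ : ab ≢ bc ; B₂ : ab ≢ bd ; B₃ : bc ≢ bd
        C₁ : ac ≢ bc ; C₂ : ac ≢ cd ; C₃ : bc ≢ cd
        D₁ : ad ≢ bd ; D₂ : ad ≢ cd ; D₃ : bd ≢ cd

    -- the lines A, B and C pass through q, and D and E meet each of them elsewhere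
    record Mitre (A B C D E : Subset n) : Set where
      field
        {q a b c a′ b′ c′} : Fin n
        q∈A : q ∈ A ; q∈B : q ∈ B ; q∈C : q ∈ C
        a∈A : a ∈ A ; a∈D : a ∈ D ; b∈B : b ∈ B ; b∈D : b ∈ D ; c∈C : c ∈ C ; c∈D : c ∈ D
        a′∈A : a′ ∈ A ; a′∈E : a′ ∈ E ; b′∈B : b′ ∈ B ; b′∈E : b′ ∈ E ; c′∈C : c′ ∈ C ; c′∈E : c′ ∈ E
        A₁ : q ≢ a ; A₂ : q ≢ a′ ; A₃ : a ≢ a′
        B₁ : q ≢ b ; B₂ : q ≢ b′ ; B₃ : b ≢ b′
        C₁ : q ≢ c ; C₂ : q ≢ c′ ; C₃ : c ≢ c′
        D₁ : a ≢ b ; D₂ : a ≢ c ; D₃ : b ≢ c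
        E₁ : a′ ≢ b′ ; E₂ : a′ ≢ c′ ; E₃ : b′ ≢ c′

    -- a 2 × 2 grid of the lines A, B against C, D, all four crossed by E
    record Grid (A B C D E : Subset n) : Set where
      field
        {ac ad bc bd ae be ce de} : Fin n
        ac∈A : ac ∈ A ; ac∈C : ac ∈ C ; ad∈A : ad ∈ A ; ad∈D : ad ∈ D
        bc∈B : bc ∈ B ; bc∈C : bc ∈ C ; bd∈B : bd ∈ B ; bd∈D : bd ∈ D
        ae∈A : ae ∈ A ; ae∈E : ae ∈ E ; be∈B : be ∈ B ; be∈E : be ∈ E
        ce∈C : ce ∈ C ; ce∈E : ce ∈ E ; de∈D : de ∈ D ; de∈E : de ∈ E
        A₁ : ac ≢ ad ; A₂ : ac ≢ ae ; A₃ : ad ≢ ae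
        B₁ : bc ≢ bd ; B₂ : bc ≢ be ; B₃ : bd ≢ be
        C₁ : ac ≢ bc ; C₂ : ac ≢ ce ; C₃ : bc ≢ ce
        D₁ : ad ≢ bd ; D₂ : ad ≢ de ; D₃ : bd ≢ de
        E₁ : ae ≢ be ; E₂ : ae ≢ ce ; E₃ : ae ≢ de ; E₄ : be ≢ ce ; E₅ : be ≢ de ; E₆ : ce ≢ de

    module _ {a b c d : Subset n} (ab : Linear a b) (ac : Linear a c) (ad : Linear a d)
             (bc : Linear b c) (bd : Linear b d) (cd : Linear c d) where

      private

        o₂ = linear⇒≤1 ab
        U₂ = a ∪ b
        U₃ = U₂ ∪ c

        o₃ : ∣ U₂ ∩ c ∣ ≤ 2
        o₃ = ℕ.≤-trans (p⊆q⇒∣p∣≤∣q∣ sub) (ℕ.≤-trans (∣∪∣≤ (a ∩ c) (b ∩ c)) (ℕ.+-mono-≤ (linear⇒≤1 ac) (linear⇒≤1 bc)))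
          where
          sub : U₂ ∩ c ⊆ (a ∩ c) ∪ (b ∩ c)
          sub x∈ with x∈p∩q⁻ U₂ c x∈
          ... | x∈ab , x∈c with x∈p∪q⁻ a b x∈ab
          ...   | inj₁ x∈a = x∈p∪q⁺ (inj₁ (x∈p∩q⁺ (x∈a , x∈c)))
          ...   | inj₂ x∈b = x∈p∪q⁺ (inj₂ (x∈p∩q⁺ (x∈b , x∈c)))

        o₄ : ∣ U₃ ∩ d ∣ ≤ 3
        o₄ = ℕ.≤-trans (p⊆q⇒∣p∣≤∣q∣ sub) (ℕ.≤-trans (∣∪∣≤ ((a ∩ d) ∪ (b ∩ d)) (c ∩ d))
               (ℕ.+-mono-≤ (ℕ.≤-trans (∣∪∣≤ (a ∩ d) (b ∩ d)) (ℕ.+-mono-≤ (linear⇒≤1 ad) (linear⇒≤1 bd))) (linear⇒≤1 cd)))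
          where
          sub : U₃ ∩ d ⊆ ((a ∩ d) ∪ (b ∩ d)) ∪ (c ∩ d)
          sub x∈ with x∈p∩q⁻ U₃ d x∈
          ... | x∈abc , x∈d with x∈p∪q⁻ U₂ c x∈abc
          ...   | inj₂ x∈c = x∈p∪q⁺ (inj₂ (x∈p∩q⁺ (x∈c , x∈d)))
          ...   | inj₁ x∈ab with x∈p∪q⁻ a b x∈ab
          ...     | inj₁ x∈a = x∈p∪q⁺ (inj₁ (x∈p∪q⁺ (inj₁ (x∈p∩q⁺ (x∈a , x∈d)))))
          ...     | inj₂ x∈b = x∈p∪q⁺ (inj₁ (x∈p∪q⁺ (inj₂ (x∈p∩q⁺ (x∈b , x∈d)))))

        total : ∣ U₃ ∪ d ∣ + (∣ U₃ ∩ d ∣ + (∣ U₂ ∩ c ∣ + ∣ a ∩ b ∣)) ≡ ((∣ a ∣ + ∣ b ∣) + ∣ c ∣) + ∣ d ∣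
        total = begin
          ∣ U₃ ∪ d ∣ + (∣ U₃ ∩ d ∣ + (∣ U₂ ∩ c ∣ + ∣ a ∩ b ∣)) ≡⟨ ℕ.+-assoc (∣ U₃ ∪ d ∣) _ _ ⟨
          (∣ U₃ ∪ d ∣ + ∣ U₃ ∩ d ∣) + (∣ U₂ ∩ c ∣ + ∣ a ∩ b ∣) ≡⟨ cong (_+ (∣ U₂ ∩ c ∣ + ∣ a ∩ b ∣)) (∣∪∣+∣∩∣ U₃ d) ⟩
          (∣ U₃ ∣ + ∣ d ∣) + (∣ U₂ ∩ c ∣ + ∣ a ∩ b ∣)          ≡⟨ swap₁ (∣ U₃ ∣) (∣ d ∣) (∣ U₂ ∩ c ∣) (∣ a ∩ b ∣) ⟩
          ((∣ U₃ ∣ + ∣ U₂ ∩ c ∣) + ∣ a ∩ b ∣) + ∣ d ∣          ≡⟨ cong (λ z → (z + ∣ a ∩ b ∣) + ∣ d ∣) (∣∪∣+∣∩∣ U₂ c) ⟩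
          ((∣ U₂ ∣ + ∣ c ∣) + ∣ a ∩ b ∣) + ∣ d ∣               ≡⟨ cong (_+ ∣ d ∣) (swap₂ (∣ U₂ ∣) (∣ c ∣) (∣ a ∩ b ∣)) ⟩
          ((∣ U₂ ∣ + ∣ a ∩ b ∣) + ∣ c ∣) + ∣ d ∣               ≡⟨ cong (λ z → (z + ∣ c ∣) + ∣ d ∣) (∣∪∣+∣∩∣ a b) ⟩
          ((∣ a ∣ + ∣ b ∣) + ∣ c ∣) + ∣ d ∣                    ∎
          where
          open ≡-Reasoning
          swap₁ : ∀ w x y z → (w + x) + (y + z) ≡ ((w + y) + z) + x
          swap₁ = solve-∀
          swap₂ : ∀ x y z → (x + y) + z ≡ (x + z) + y
          swap₂ = solve-∀

      -- Four inequalities are given; any other coincidence would put one point on three of the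
      -- sets, and linearity turns it into one of these four.
      six-points : ∀ {xab xac xad xbc xbd xcd} → xab ∈ a → xab ∈ b → xac ∈ a → xac ∈ c → xad ∈ a → xad ∈ d →
        xbc ∈ b → xbc ∈ c → xbd ∈ b → xbd ∈ d → xcd ∈ c → xcd ∈ d →
        xac ≢ xbc → xad ≢ xbd → xad ≢ xcd → xbd ≢ xcd → Pasch a b c d
      six-points ab∈a ab∈b ac∈a ac∈c ad∈a ad∈d bc∈b bc∈c bd∈b bd∈d cd∈c cd∈d c₁ d₁ d₂ d₃ = record
          { ab∈A = ab∈a ; ab∈B = ab∈b ; ac∈A = ac∈a ; ac∈C = ac∈c ; ad∈A = ad∈a ; ad∈D = ad∈d
          ; bc∈B = bc∈b ; bc∈C = bc∈c ; bd∈B = bd∈b ; bd∈D = bd∈d ; cd∈C = cd∈c ; cd∈D = cd∈d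
          ; A₁ = λ { refl → c₁ (bc ab∈b ac∈c bc∈b bc∈c) }
          ; A₂ = λ { refl → d₁ (bd ab∈b ad∈d bd∈b bd∈d) }
          ; A₃ = λ { refl → d₂ (cd ac∈c ad∈d cd∈c cd∈d) }
          ; B₁ = λ { refl → c₁ (ac ac∈a ac∈c ab∈a bc∈c) }
          ; B₂ = λ { refl → d₁ (ad ad∈a ad∈d ab∈a bd∈d) }
          ; B₃ = λ { refl → d₃ (cd bc∈c bd∈d cd∈c cd∈d) }
          ; C₁ = c₁
          ; C₂ = λ { refl → d₂ (ad ad∈a ad∈d ac∈a cd∈d) }
          ; C₃ = λ { refl → d₃ (bd bd∈b bd∈d bc∈b cd∈d) }
          ; D₁ = d₁ ; D₂ = d₂ ; D₃ = d₃ }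

      -- Adding the sets one by one loses at most 1 + 2 + 3 vertices, and losing all six yields the
      -- six points of a Pasch. The sizes are arbitrary so that one of the sets can be a whole
      -- diamond.
      four-sets : ¬ Pasch a b c d → ((∣ a ∣ + ∣ b ∣) + ∣ c ∣) + ∣ d ∣ ≤ ∣ ((a ∪ b) ∪ c) ∪ d ∣ + 5
      four-sets ¬P with ((∣ a ∣ + ∣ b ∣) + ∣ c ∣) + ∣ d ∣ ℕ.≤? ∣ ((a ∪ b) ∪ c) ∪ d ∣ + 5
      ... | yes le = le
      ... | no ¬le = contradiction pasch ¬P
        where
        six : 6 ≤ ∣ U₃ ∩ d ∣ + (∣ U₂ ∩ c ∣ + ∣ a ∩ b ∣)
        six = ℕ.+-cancelˡ-≤ ∣ U₃ ∪ d ∣ _ _ (ℕ.≤-trans (ℕ.≤-reflexive (ℕ.+-suc ∣ U₃ ∪ d ∣ 5)) (ℕ.≤-trans (ℕ.≰⇒> ¬le) (ℕ.≤-reflexive (sym total))))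
        3≤ : 3 ≤ ∣ U₃ ∩ d ∣
        3≤ = ℕ.+-cancelʳ-≤ 3 3 _ (ℕ.≤-trans six (ℕ.+-monoʳ-≤ ∣ U₃ ∩ d ∣ (ℕ.+-mono-≤ o₃ o₂)))
        5≤ : 3 ≤ ∣ U₂ ∩ c ∣ + ∣ a ∩ b ∣
        5≤ = ℕ.+-cancelˡ-≤ 3 3 _ (ℕ.≤-trans six (ℕ.+-monoˡ-≤ (∣ U₂ ∩ c ∣ + ∣ a ∩ b ∣) o₄))
        2≤ : 2 ≤ ∣ U₂ ∩ c ∣
        2≤ = ℕ.+-cancelʳ-≤ 1 2 _ (ℕ.≤-trans 5≤ (ℕ.+-monoʳ-≤ ∣ U₂ ∩ c ∣ o₂))
        1≤ : 1 ≤ ∣ a ∩ b ∣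
        1≤ = ℕ.+-cancelˡ-≤ 2 1 _ (ℕ.≤-trans 5≤ (ℕ.+-monoˡ-≤ ∣ a ∩ b ∣ o₃))
        flip : ∀ (p q : Subset n) → ∣ p ∩ q ∣ ≤ ∣ q ∩ p ∣
        flip p q = p⊆q⇒∣p∣≤∣q∣ (λ x∈ → let x∈p , x∈q = x∈p∩q⁻ p q x∈ in x∈p∩q⁺ (x∈q , x∈p))
        pasch : Pasch a b c d
        pasch =
          let xab , xab∈ = pick 1≤
              _ , _ , ac∈c , ac∈a , bc∈c , bc∈b , c₁ = two-meets (linear-sym ac) (linear-sym bc) (ℕ.≤-trans 2≤ (flip U₂ c))
              _ , _ , _ , ad∈d , ad∈a , bd∈d , bd∈b , cd∈d , cd∈c , d₁ , d₂ , d₃ =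
                three-meets (linear-sym ad) (linear-sym bd) (linear-sym cd) (ℕ.≤-trans 3≤ (flip U₃ d))
          in six-points (proj₁ (x∈p∩q⁻ a b xab∈)) (proj₂ (x∈p∩q⁻ a b xab∈)) ac∈a ac∈c ad∈a ad∈d bc∈b bc∈c bd∈b bd∈d cd∈c cd∈d c₁ d₁ d₂ d₃

  abstract

    three-others : ∀ (i j : Fin 5) → ∃[ k ] ∃[ l ] ∃[ m ] (k ≢ i × k ≢ j) × (l ≢ i × l ≢ j × l ≢ k) × (m ≢ i × m ≢ j × m ≢ k × m ≢ l)
    three-others = from-yes (all? λ (i : Fin 5) → all? λ (j : Fin 5) → any? λ (k : Fin 5) → any? λ (l : Fin 5) → any? λ (m : Fin 5) →
      (¬? (k ≟ i) ×-dec ¬? (k ≟ j)) ×-dec (¬? (l ≟ i) ×-dec ¬? (l ≟ j) ×-dec ¬? (l ≟ k))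
        ×-dec (¬? (m ≟ i) ×-dec ¬? (m ≟ j) ×-dec ¬? (m ≟ k) ×-dec ¬? (m ≟ l)))

    two-others : ∀ (i j k : Fin 5) → ∃[ l ] ∃[ m ] (l ≢ i × l ≢ j × l ≢ k) × (m ≢ i × m ≢ j × m ≢ k × m ≢ l)
    two-others = from-yes (all? λ (i : Fin 5) → all? λ (j : Fin 5) → all? λ (k : Fin 5) → any? λ (l : Fin 5) → any? λ (m : Fin 5) →
      (¬? (l ≟ i) ×-dec ¬? (l ≟ j) ×-dec ¬? (l ≟ k)) ×-dec (¬? (m ≟ i) ×-dec ¬? (m ≟ j) ×-dec ¬? (m ≟ k) ×-dec ¬? (m ≟ l)))

  Distinct₄ : ∀ {A : Set} → A → A → A → A → Set
  Distinct₄ i j k l = (i ≢ j × i ≢ k × i ≢ l) × (j ≢ k × j ≢ l) × k ≢ l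

  Distinct₅ : ∀ {A : Set} → A → A → A → A → A → Set
  Distinct₅ i j k l m = (i ≢ j × i ≢ k × i ≢ l × i ≢ m) × (j ≢ k × j ≢ l × j ≢ m) × (k ≢ l × k ≢ m) × l ≢ m

  module _ {n r : ℕ} (A : Fin 5 → Subset n) (V : Subset n) (A⊆V : ∀ i → A i ⊆ V) (size : ∀ i → ∣ A i ∣ ≡ r)
    (linear : ∀ {i j} → i ≢ j → Linear (A i) (A j))
    (no-pasch : ∀ {i j k l} → Distinct₄ i j k l → ¬ Pasch (A i) (A j) (A k) (A l))
    (no-mitre : ∀ {i j k l m} → Distinct₅ i j k l m → ¬ Mitre (A i) (A j) (A k) (A l) (A m))
    (no-grid  : ∀ {i j k l m} → Distinct₅ i j k l m → ¬ Grid (A i) (A j) (A k) (A l) (A m)) where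

    private

      module Crowded (crowded : ∣ V ∣ + 8 ≤ (((r + r) + r) + r) + r) where

        -- The other four sets lose at most 5 of the 8 vertices, so this one loses at least 3.
        meets : ∀ {i j k l m} → Distinct₅ i j k l m → 3 ≤ ∣ A m ∩ (((A i ∪ A j) ∪ A k) ∪ A l) ∣
        meets {i} {j} {k} {l} {m} ((ij , ik , il , im) , (jk , jl , jm) , (kl , km) , lm) = ℕ.+-cancelˡ-≤ (∣ V ∣ + 5) 3 _ (begin
          (∣ V ∣ + 5) + 3                               ≡⟨ ℕ.+-assoc (∣ V ∣) 5 3 ⟩
          ∣ V ∣ + 8                                     ≤⟨ crowded ⟩
          (((r + r) + r) + r) + r                       ≡⟨ cong₂ _+_ (cong₂ _+_ (cong₂ _+_ (cong₂ _+_ (size i) (size j)) (size k)) (size l)) (size m) ⟨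
          (((∣ A i ∣ + ∣ A j ∣) + ∣ A k ∣) + ∣ A l ∣) + ∣ A m ∣
            ≤⟨ ℕ.+-monoˡ-≤ (∣ A m ∣) (four-sets (linear ij) (linear ik) (linear il) (linear jk) (linear jl) (linear kl)
                 (no-pasch ((ij , ik , il) , (jk , jl) , kl))) ⟩
          (∣ U ∣ + 5) + ∣ A m ∣                         ≡⟨ swap₁ (∣ U ∣) (∣ A m ∣) ⟩
          (∣ A m ∣ + ∣ U ∣) + 5                         ≡⟨ cong (_+ 5) (∣∪∣+∣∩∣ (A m) U) ⟨
          (∣ A m ∪ U ∣ + ∣ A m ∩ U ∣) + 5               ≤⟨ ℕ.+-monoˡ-≤ 5 (ℕ.+-monoˡ-≤ (∣ A m ∩ U ∣)
              (p⊆q⇒∣p∣≤∣q∣ (∪-least (A⊆V m) (∪-least (∪-least (∪-least (A⊆V i) (A⊆V j)) (A⊆V k)) (A⊆V l))))) ⟩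
          (∣ V ∣ + ∣ A m ∩ U ∣) + 5                     ≡⟨ swap₂ (∣ V ∣) (∣ A m ∩ U ∣) ⟩
          (∣ V ∣ + 5) + ∣ A m ∩ U ∣                     ∎)
          where
          open ≤-Reasoning
          U = ((A i ∪ A j) ∪ A k) ∪ A l
          swap₁ : ∀ x y → (x + 5) + y ≡ (y + x) + 5
          swap₁ = solve-∀
          swap₂ : ∀ x y → (x + y) + 5 ≡ (x + 5) + y
          swap₂ = solve-∀

        ∈-four : ∀ {i j k l m z} → z ∈ A m ∩ (((A i ∪ A j) ∪ A k) ∪ A l) →
                 z ∈ A m × ((z ∈ A i ⊎ z ∈ A j) ⊎ z ∈ A k ⊎ z ∈ A l)
        ∈-four {i} {j} {k} {l} {m} z∈ with x∈p∩q⁻ (A m) (((A i ∪ A j) ∪ A k) ∪ A l) z∈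
        ... | z∈m , z∈U with x∈p∪q⁻ ((A i ∪ A j) ∪ A k) (A l) z∈U
        ...   | inj₂ z∈l = z∈m , inj₂ (inj₂ z∈l)
        ...   | inj₁ z∈ijk with x∈p∪q⁻ (A i ∪ A j) (A k) z∈ijk
        ...     | inj₂ z∈k = z∈m , inj₂ (inj₁ z∈k)
        ...     | inj₁ z∈ij = z∈m , inj₁ (x∈p∪q⁻ (A i) (A j) z∈ij)

        -- All meetings of `A m` with the other four sets would be at `x` or `y`, against `meets`.
        no-two : ∀ {i j k l m} → Distinct₅ i j k l m → ∀ {x y} → x ∈ A m → x ∈ A i → x ∈ A j →
                 y ∈ A m → y ∈ A k → ¬ (∀ {z} → z ∈ A m → z ∈ A l → z ≡ x ⊎ z ≡ y)
        no-two {i} {j} {k} {l} {m} D@((ij , ik , il , im) , (jk , jl , jm) , (kl , km) , lm) {x} {y} xm xi xj ym yk zl =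
          ℕ.<⇒≱ (meets D) (covered-by-two x y cover)
          where
          cover : ∀ {z} → z ∈ A m ∩ (((A i ∪ A j) ∪ A k) ∪ A l) → z ≡ x ⊎ z ≡ y
          cover z∈ with ∈-four {i} {j} {k} {l} {m} z∈
          ... | zm , inj₁ (inj₁ zi) = inj₁ (linear im zi zm xi xm)
          ... | zm , inj₁ (inj₂ zj) = inj₁ (linear jm zj zm xj xm)
          ... | zm , inj₂ (inj₁ zk) = inj₂ (linear km zk zm yk ym)
          ... | zm , inj₂ (inj₂ zl′) = zl zm zl′

        three-points : ∀ {i j k l m} → Distinct₅ i j k l m → (∀ {z} → z ∈ A m → z ∉ A l) →
          ∃[ x ] ∃[ y ] ∃[ z ] x ∈ A m × x ∈ A i × y ∈ A m × y ∈ A j × z ∈ A m × z ∈ A k × x ≢ y × x ≢ z × y ≢ z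
        three-points {i} {j} {k} {l} {m} D@((ij , ik , il , im) , (jk , jl , jm) , (kl , km) , lm) skew =
          three-meets (linear (im ∘ sym)) (linear (jm ∘ sym)) (linear (km ∘ sym)) (ℕ.≤-trans (meets D) (p⊆q⇒∣p∣≤∣q∣ sub))
          where
          sub : A m ∩ (((A i ∪ A j) ∪ A k) ∪ A l) ⊆ A m ∩ ((A i ∪ A j) ∪ A k)
          sub z∈ with x∈p∩q⁻ (A m) (((A i ∪ A j) ∪ A k) ∪ A l) z∈
          ... | zm , zU with x∈p∪q⁻ ((A i ∪ A j) ∪ A k) (A l) zU
          ...   | inj₁ zijk = x∈p∩q⁺ (zm , zijk)
          ...   | inj₂ zl = contradiction zl (skew zm)

        Skew : Fin 5 → Fin 5 → Set
        Skew i j = ∀ {z} → z ∈ A i → z ∉ A j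

        skew-sym : ∀ {i j} → Skew i j → Skew j i
        skew-sym s zj zi = s zi zj

        meet? : ∀ i j → (∃[ x ] x ∈ A i × x ∈ A j) ⊎ Skew i j
        meet? i j with any? (λ x → x ∈? A i ×-dec x ∈? A j)
        ... | yes w = inj₁ w
        ... | no ¬w = inj₂ λ {z} zi zj → ¬w (z , zi , zj)

        -- A set of a skew pair must meet the remaining three in distinct points. Doing this for all
        -- four sets gives the eight points of a grid.
        two-skew-pairs : ∀ {i j k l m} → Distinct₅ i j k l m → Skew i j → Skew k l → Grid (A i) (A j) (A k) (A l) (A m)
        two-skew-pairs {i} {j} {k} {l} {m} ((ij , ik , il , im) , (jk , jl , jm) , (kl , km) , lm) sij skl
          with three-points {k} {l} {m} {j} {i} ((kl , km , jk ∘ sym , ik ∘ sym) , (lm , jl ∘ sym , il ∘ sym) , (jm ∘ sym , im ∘ sym) , ij ∘ sym) sij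
             | three-points {k} {l} {m} {i} {j} ((kl , km , ik ∘ sym , jk ∘ sym) , (lm , il ∘ sym , jl ∘ sym) , (im ∘ sym , jm ∘ sym) , ij) (skew-sym {i} {j} sij)
             | three-points {i} {j} {m} {l} {k} ((ij , im , il , ik) , (jm , jl , jk) , (lm ∘ sym , km ∘ sym) , kl ∘ sym) skl
             | three-points {i} {j} {m} {k} {l} ((ij , im , ik , il) , (jm , jk , jl) , (km ∘ sym , lm ∘ sym) , kl) (skew-sym {k} {l} skl)
        ... | ac , ad , ae , ac₁ , ac₂ , ad₁ , ad₂ , ae₁ , ae₂ , A₁ , A₂ , A₃
            | bc , bd , be , bc₁ , bc₂ , bd₁ , bd₂ , be₁ , be₂ , B₁ , B₂ , B₃
            | ca , cb , ce , ca₁ , ca₂ , cb₁ , cb₂ , ce₁ , ce₂ , C₁ , C₂ , C₃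
            | da , db , de , da₁ , da₂ , db₁ , db₂ , de₁ , de₂ , D₁ , D₂ , D₃
          with linear ik ac₁ ac₂ ca₂ ca₁ | linear jk bc₁ bc₂ cb₂ cb₁ | linear il ad₁ ad₂ da₂ da₁ | linear jl bd₁ bd₂ db₂ db₁
        ... | refl | refl | refl | refl = record
          { ac∈A = ac₁ ; ac∈C = ac₂ ; ad∈A = ad₁ ; ad∈D = ad₂ ; bc∈B = bc₁ ; bc∈C = bc₂ ; bd∈B = bd₁ ; bd∈D = bd₂
          ; ae∈A = ae₁ ; ae∈E = ae₂ ; be∈B = be₁ ; be∈E = be₂ ; ce∈C = ce₁ ; ce∈E = ce₂ ; de∈D = de₁ ; de∈E = de₂
          ; A₁ = A₁ ; A₂ = A₂ ; A₃ = A₃ ; B₁ = B₁ ; B₂ = B₂ ; B₃ = B₃ ; C₁ = C₁ ; C₂ = C₂ ; C₃ = C₃ ; D₁ = D₁ ; D₂ = D₂ ; D₃ = D₃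
          ; E₁ = λ { refl → sij ae₁ be₁ }
          ; E₂ = λ { refl → A₂ (linear ik ac₁ ac₂ ae₁ ce₁) }
          ; E₃ = λ { refl → A₃ (linear il ad₁ ad₂ ae₁ de₁) }
          ; E₄ = λ { refl → B₂ (linear jk bc₁ bc₂ be₁ ce₁) }
          ; E₅ = λ { refl → B₃ (linear jl bd₁ bd₂ be₁ de₁) }
          ; E₆ = λ { refl → skl ce₁ de₁ } }

        -- `A i` and `A j` each meet the other three in distinct points. If those three form a
        -- triangle, it is a Pasch together with `A i`; if they pass through one point, the five
        -- sets form a mitre.
        one-skew-pair : ∀ {i j k l m} → Distinct₅ i j k l m → Skew i j → ∀ {kl km lm} →
          kl ∈ A k → kl ∈ A l → km ∈ A k → km ∈ A m → lm ∈ A l → lm ∈ A m →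
          Pasch (A i) (A k) (A l) (A m) ⊎ Mitre (A k) (A l) (A m) (A i) (A j)
        one-skew-pair {i} {j} {k} {l} {m} ((ij , ik , il , im) , (jk , jl , jm) , (k≢l , k≢m) , l≢m) sij {kl} {km} {lm} kl₁ kl₂ km₁ km₂ lm₁ lm₂
          with three-points {k} {l} {m} {j} {i} ((k≢l , k≢m , jk ∘ sym , ik ∘ sym) , (l≢m , jl ∘ sym , il ∘ sym) , (jm ∘ sym , im ∘ sym) , ij ∘ sym) sij
             | three-points {k} {l} {m} {i} {j} ((k≢l , k≢m , ik ∘ sym , jk ∘ sym) , (l≢m , il ∘ sym , jl ∘ sym) , (im ∘ sym , jm ∘ sym) , ij) (skew-sym {i} {j} sij)
             | kl ≟ km
        ... | ik′ , il′ , im′ , ik₁ , ik₂ , il₁ , il₂ , im₁ , im₂ , I₁ , I₂ , I₃ | _ | no kl≢km = inj₁ (record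
          { ab∈A = ik₁ ; ab∈B = ik₂ ; ac∈A = il₁ ; ac∈C = il₂ ; ad∈A = im₁ ; ad∈D = im₂
          ; bc∈B = kl₁ ; bc∈C = kl₂ ; bd∈B = km₁ ; bd∈D = km₂ ; cd∈C = lm₁ ; cd∈D = lm₂
          ; A₁ = I₁ ; A₂ = I₂ ; A₃ = I₃
          ; B₁ = λ { refl → I₁ (linear il ik₁ kl₂ il₁ il₂) }
          ; B₂ = λ { refl → I₂ (linear im ik₁ km₂ im₁ im₂) }
          ; B₃ = kl≢km
          ; C₁ = λ { refl → I₁ (linear ik ik₁ ik₂ il₁ kl₁) }
          ; C₂ = λ { refl → I₃ (linear im il₁ lm₂ im₁ im₂) }
          ; C₃ = λ { refl → kl≢km (linear k≢m kl₁ lm₂ km₁ km₂) }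
          ; D₁ = λ { refl → I₂ (linear ik ik₁ ik₂ im₁ km₁) }
          ; D₂ = λ { refl → I₃ (linear il il₁ il₂ im₁ lm₁) }
          ; D₃ = λ { refl → kl≢km (linear k≢l kl₁ kl₂ km₁ lm₁) } })
        ... | ik′ , il′ , im′ , ik₁ , ik₂ , il₁ , il₂ , im₁ , im₂ , I₁ , I₂ , I₃
            | jk′ , jl′ , jm′ , jk₁ , jk₂ , jl₁ , jl₂ , jm₁ , jm₂ , J₁ , J₂ , J₃ | yes refl = inj₂ (record
          { q∈A = kl₁ ; q∈B = kl₂ ; q∈C = km₂
          ; a∈A = ik₂ ; a∈D = ik₁ ; b∈B = il₂ ; b∈D = il₁ ; c∈C = im₂ ; c∈D = im₁
          ; a′∈A = jk₂ ; a′∈E = jk₁ ; b′∈B = jl₂ ; b′∈E = jl₁ ; c′∈C = jm₂ ; c′∈E = jm₁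
          ; A₁ = λ { refl → I₁ (linear il ik₁ kl₂ il₁ il₂) }
          ; A₂ = λ { refl → J₁ (linear jl jk₁ kl₂ jl₁ jl₂) }
          ; A₃ = λ { refl → sij ik₁ jk₁ }
          ; B₁ = λ { refl → I₁ (linear ik ik₁ ik₂ il₁ kl₁) }
          ; B₂ = λ { refl → J₁ (linear jk jk₁ jk₂ jl₁ kl₁) }
          ; B₃ = λ { refl → sij il₁ jl₁ }
          ; C₁ = λ { refl → I₂ (linear ik ik₁ ik₂ im₁ kl₁) }
          ; C₂ = λ { refl → J₂ (linear jk jk₁ jk₂ jm₁ kl₁) }
          ; C₃ = λ { refl → sij im₁ jm₁ }
          ; D₁ = I₁ ; D₂ = I₂ ; D₃ = I₃ ; E₁ = J₁ ; E₂ = J₂ ; E₃ = J₃ })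

        -- As `q` already lies on three sets, a further coincidence on `A i` or `A j` would leave
        -- that set only two meeting points, which `no-two` forbids.
        concurrent : ∀ {i j k l m} → Distinct₅ i j k l m → (∀ {a b} → a ≢ b → ∃[ x ] x ∈ A a × x ∈ A b) →
          ∀ {q} → q ∈ A i → q ∈ A j → q ∈ A k → Pasch (A i) (A j) (A l) (A m)
        concurrent {i} {j} {k} {l} {m} ((ij , ik , il , im) , (jk , jl , jm) , (kl , km) , lm) meet {q} qi qj qk
          with meet il | meet im | meet jl | meet jm | meet lm
        ... | xil , il₁ , il₂ | xim , im₁ , im₂ | xjl , jl₁ , jl₂ | xjm , jm₁ , jm₂ | xlm , lm₁ , lm₂ = record
          { ab∈A = qi ; ab∈B = qj ; ac∈A = il₁ ; ac∈C = il₂ ; ad∈A = im₁ ; ad∈D = im₂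
          ; bc∈B = jl₁ ; bc∈C = jl₂ ; bd∈B = jm₁ ; bd∈D = jm₂ ; cd∈C = lm₁ ; cd∈D = lm₂
          ; A₁ = λ { refl → q∉l il₂ } ; A₂ = λ { refl → q∉m im₂ } ; A₃ = λ { refl → ¬ilm il₁ il₂ im₂ }
          ; B₁ = λ { refl → q∉l jl₂ } ; B₂ = λ { refl → q∉m jm₂ } ; B₃ = λ { refl → ¬jlm jl₁ jl₂ jm₂ }
          ; C₁ = λ { refl → q∉l (subst (_∈ A l) (linear ij il₁ jl₁ qi qj) il₂) }
          ; C₂ = λ { refl → ¬ilm il₁ il₂ lm₂ } ; C₃ = λ { refl → ¬jlm jl₁ jl₂ lm₂ }
          ; D₁ = λ { refl → q∉m (subst (_∈ A m) (linear ij im₁ jm₁ qi qj) im₂) }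
          ; D₂ = λ { refl → ¬ilm im₁ lm₁ im₂ } ; D₃ = λ { refl → ¬jlm jm₁ lm₁ jm₂ } }
          where
          q∉l : q ∉ A l
          q∉l ql = no-two {j} {k} {m} {l} {i} ((jk , jm , jl , ij ∘ sym) , (km , kl , ik ∘ sym) , (lm ∘ sym , im ∘ sym) , il ∘ sym)
            qi qj qk im₁ im₂ (λ zi zl → inj₁ (linear il zi zl qi ql))
          q∉m : q ∉ A m
          q∉m qm = no-two {j} {k} {l} {m} {i} ((jk , jl , jm , ij ∘ sym) , (kl , km , ik ∘ sym) , (lm , il ∘ sym) , im ∘ sym)
            qi qj qk il₁ il₂ (λ zi zm → inj₁ (linear im zi zm qi qm))
          ¬ilm : ∀ {z} → z ∈ A i → z ∈ A l → z ∉ A m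
          ¬ilm {z} zi zl zm = no-two {j} {k} {l} {m} {i} ((jk , jl , jm , ij ∘ sym) , (kl , km , ik ∘ sym) , (lm , il ∘ sym) , im ∘ sym)
            qi qj qk zi zl (λ wi wm → inj₂ (linear im wi wm zi zm))
          ¬jlm : ∀ {z} → z ∈ A j → z ∈ A l → z ∉ A m
          ¬jlm {z} zj zl zm = no-two {i} {k} {l} {m} {j} ((ik , il , im , ij) , (kl , km , jk ∘ sym) , (lm , jl ∘ sym) , jm ∘ sym)
            qj qi qk zj zl (λ wj wm → inj₂ (linear jm wj wm zj zm))

        -- The three sets outside the pair contain a second skew pair, which gives a grid, or meet
        -- pairwise, which gives a Pasch or a mitre.
        skew-case : ∀ {i j} → i ≢ j → Skew i j → ∀ {C : Set} → C
        skew-case {i} {j} i≢j sij with three-others i j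
        ... | k , l , m , (ki , kj) , (li , lj , lk) , (mi , mj , mk , ml) = by (meet? k l) (meet? k m) (meet? l m)
          where
          ik = ki ∘ sym
          jk = kj ∘ sym
          il = li ∘ sym
          jl = lj ∘ sym
          im = mi ∘ sym
          jm = mj ∘ sym
          kl = lk ∘ sym
          km = mk ∘ sym
          lm = ml ∘ sym
          by : _ → _ → _ → ∀ {C : Set} → C
          by (inj₂ s) _ _ = contradiction (two-skew-pairs D sij s) (no-grid D)
            where D = (i≢j , ik , il , im) , (jk , jl , jm) , (kl , km) , lm
          by _ (inj₂ s) _ = contradiction (two-skew-pairs D sij s) (no-grid D)
            where D = (i≢j , ik , im , il) , (jk , jm , jl) , (km , kl) , ml
          by _ _ (inj₂ s) = contradiction (two-skew-pairs D sij s) (no-grid D)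
            where D = (i≢j , il , im , ik) , (jl , jm , jk) , (lm , lk) , mk
          by (inj₁ (_ , kl₁ , kl₂)) (inj₁ (_ , km₁ , km₂)) (inj₁ (_ , lm₁ , lm₂))
            with one-skew-pair ((i≢j , ik , il , im) , (jk , jl , jm) , (kl , km) , lm) sij kl₁ kl₂ km₁ km₂ lm₁ lm₂
          ... | inj₁ P = contradiction P (no-pasch ((ik , il , im) , (kl , km) , lm))
          ... | inj₂ M = contradiction M (no-mitre ((kl , km , ki , kj) , (lm , li , lj) , (mi , mj) , i≢j))

        three-concurrent : (∀ {a b} → a ≢ b → ∃[ x ] x ∈ A a × x ∈ A b) → ∀ {i j k} → i ≢ j → i ≢ k → j ≢ k →
          ∀ {q} → q ∈ A i → q ∈ A j → q ∉ A k
        three-concurrent meet {i} {j} {k} ij ik jk qi qj qk with two-others i j k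
        ... | l , m , (li , lj , lk) , (mi , mj , mk , ml) = no-pasch ((ij , il , im) , (jl , jm) , lm)
          (concurrent {i} {j} {k} {l} {m} ((ij , ik , il , im) , (jk , jl , jm) , (kl , km) , lm) meet qi qj qk)
          where
          il = li ∘ sym
          jl = lj ∘ sym
          kl = lk ∘ sym
          im = mi ∘ sym
          jm = mj ∘ sym
          km = mk ∘ sym
          lm = ml ∘ sym

        general-position : (∀ {a b} → a ≢ b → ∃[ x ] x ∈ A a × x ∈ A b) → ∀ {i j k l} → Distinct₄ i j k l →
          Pasch (A i) (A j) (A k) (A l)
        general-position meet {i} {j} {k} {l} ((ij , ik , il) , (jk , jl) , kl)
          with meet ij | meet ik | meet il | meet jk | meet jl | meet kl
        ... | _ , ab₁ , ab₂ | _ , ac₁ , ac₂ | _ , ad₁ , ad₂ | _ , bc₁ , bc₂ | _ , bd₁ , bd₂ | _ , cd₁ , cd₂ = record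
            { ab∈A = ab₁ ; ab∈B = ab₂ ; ac∈A = ac₁ ; ac∈C = ac₂ ; ad∈A = ad₁ ; ad∈D = ad₂
            ; bc∈B = bc₁ ; bc∈C = bc₂ ; bd∈B = bd₁ ; bd∈D = bd₂ ; cd∈C = cd₁ ; cd∈D = cd₂
            ; A₁ = λ { refl → ijk ab₁ ab₂ ac₂ }
            ; A₂ = λ { refl → ijl ab₁ ab₂ ad₂ }
            ; A₃ = λ { refl → ikl ac₁ ac₂ ad₂ }
            ; B₁ = λ { refl → ijk ab₁ ab₂ bc₂ }
            ; B₂ = λ { refl → ijl ab₁ ab₂ bd₂ }
            ; B₃ = λ { refl → jkl bc₁ bc₂ bd₂ }
            ; C₁ = λ { refl → ijk ac₁ bc₁ ac₂ }
            ; C₂ = λ { refl → ikl ac₁ ac₂ cd₂ }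
            ; C₃ = λ { refl → jkl bc₁ bc₂ cd₂ }
            ; D₁ = λ { refl → ijl ad₁ bd₁ ad₂ }
            ; D₂ = λ { refl → ikl ad₁ cd₁ ad₂ }
            ; D₃ = λ { refl → jkl bd₁ cd₁ bd₂ } }
          where
          ijk : ∀ {q} → q ∈ A i → q ∈ A j → q ∉ A k
          ijk = three-concurrent meet ij ik jk
          ijl : ∀ {q} → q ∈ A i → q ∈ A j → q ∉ A l
          ijl = three-concurrent meet ij il jl
          ikl : ∀ {q} → q ∈ A i → q ∈ A k → q ∉ A l
          ikl = three-concurrent meet ik il kl
          jkl : ∀ {q} → q ∈ A j → q ∈ A k → q ∉ A l
          jkl = three-concurrent meet jk jl kl

        absurd : ∀ {C : Set} → C
        absurd = go (any? λ i → any? λ j → ¬? (i ≟ j) ×-dec ¬? (any? (λ x → x ∈? A i ×-dec x ∈? A j)))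
          where
          go : Dec (∃[ i ] ∃[ j ] i ≢ j × ¬ (∃[ x ] x ∈ A i × x ∈ A j)) → ∀ {C : Set} → C
          go (yes (i , j , i≢j , skew)) = skew-case i≢j (λ {z} zi zj → skew (z , zi , zj))
          go (no ¬skew) with three-others 0F 1F
          ... | k , l , m , (ki , kj) , (li , lj , lk) , _ = contradiction (general-position meet D) (no-pasch D)
            where
            meet : ∀ {a b} → a ≢ b → ∃[ x ] x ∈ A a × x ∈ A b
            meet {a} {b} a≢b with meet? a b
            ... | inj₁ w = w
            ... | inj₂ s = contradiction (a , b , a≢b , λ (x , xa , xb) → s xa xb) ¬skew
            D : Distinct₄ 0F 1F k l
            D = ((λ ()) , ki ∘ sym , li ∘ sym) , (kj ∘ sym , lj ∘ sym) , lk ∘ sym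

    five-sets : (((r + r) + r) + r) + r < ∣ V ∣ + 8
    five-sets with (((r + r) + r) + r) + r ℕ.<? ∣ V ∣ + 8
    ... | yes lt = lt
    ... | no ¬lt = Crowded.absurd (ℕ.≮⇒≥ ¬lt)

-- The r-graph of a rigid packing of diamonds is (5r - 8, 5)-free.

module DiamondGraphs where

  open import Defs
  open Packings
  open Pattern
  open FiveSets
  open import Data.Fin.Base as Fin using (Fin; zero; suc; splitAt; inject≤)
  open import Data.Fin.Patterns using (0F; 1F)
  open import Data.Fin.Properties as Fin using (_≟_; any?; inject≤-injective)
  open import Data.Fin.Subset using (Subset; ∣_∣; _∈_; _⊆_; _∪_; _∩_; ⁅_⁆; ⊥; ⊤)
  open import Data.Fin.Subset.Properties
    using (∣⊥∣≡0; ∉⊥; ∈⊤; p⊆q⇒∣p∣≤∣q∣; x∈p∪q⁺; x∈p∪q⁻; x∈p∩q⁺; x∈p∩q⁻; x∈⁅x⁆; ∣⁅x⁆∣≡1; x∈⁅y⁆⇒x≡y;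
           Empty-unique)
  open import Data.List.Base as List using (List; []; _∷_; length; allFin; cartesianProduct; lookup)
  import Data.List.Membership.Propositional as ∈ᴸ
  open import Data.List.Membership.Propositional.Properties using (∈-map⁻; ∈-lookup)
  open import Data.List.Properties using (length-map)
  open import Data.List.Relation.Unary.All as All using (All)
  import Data.List.Relation.Unary.All.Properties as All
  open import Data.List.Relation.Unary.AllPairs using ([]; _∷_)
  open import Data.List.Relation.Unary.Unique.Propositional using (Unique)
  import Data.List.Relation.Unary.Unique.Propositional.Properties as Unique
  open import Data.Nat.Base as ℕ using (ℕ; zero; suc; _+_; _*_; _∸_; _≤_; _<_; s≤s; z≤n)
  open import Data.Nat.Properties as ℕ using (module ≤-Reasoning)
  open import Data.Nat.Tactic.RingSolver using (solve-∀)
  open import Data.Product.Base using (∃-syntax; _×_; _,_; proj₁; proj₂)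
  open import Data.Product.Properties using (≡-dec)
  open import Data.Sum.Base using (_⊎_; inj₁; inj₂; [_,_]′)
  open import Function.Base using (_∘_)
  open import Function.Definitions using (Injective)
  open import Relation.Binary.PropositionalEquality hiding (J)
  open import Relation.Nullary using (¬_; Dec; yes; no; contradiction; ¬?)
  open import Relation.Nullary.Decidable using (_×-dec_)

  image : ∀ {m n} → (Fin m → Fin n) → Subset n
  image {zero}  f = ⊥
  image {suc m} f = ⁅ f zero ⁆ ∪ image (f ∘ suc)

  ∈-image⁺ : ∀ {m n} (f : Fin m → Fin n) i → f i ∈ image f
  ∈-image⁺ f zero    = x∈p∪q⁺ (inj₁ (x∈⁅x⁆ (f zero)))
  ∈-image⁺ f (suc i) = x∈p∪q⁺ (inj₂ (∈-image⁺ (f ∘ suc) i))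

  ∈-image⁻ : ∀ {m n} (f : Fin m → Fin n) {x} → x ∈ image f → ∃[ i ] f i ≡ x
  ∈-image⁻ {zero}  f x∈ = contradiction x∈ ∉⊥
  ∈-image⁻ {suc m} f x∈ with x∈p∪q⁻ ⁅ f zero ⁆ (image (f ∘ suc)) x∈
  ... | inj₁ x∈₁ = zero , sym (x∈⁅y⁆⇒x≡y (f zero) x∈₁)
  ... | inj₂ x∈₂ with ∈-image⁻ (f ∘ suc) x∈₂
  ...   | i , eq = suc i , eq

  ∣image∣ : ∀ {m n} (f : Fin m → Fin n) → Injective _≡_ _≡_ f → ∣ image f ∣ ≡ m
  ∣image∣ {zero}  {n} f inj = ∣⊥∣≡0 n
  ∣image∣ {suc m} {n} f inj = begin
    ∣ ⁅ f zero ⁆ ∪ I ∣                        ≡⟨ ℕ.+-identityʳ _ ⟨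
    ∣ ⁅ f zero ⁆ ∪ I ∣ + 0                    ≡⟨ cong (∣ ⁅ f zero ⁆ ∪ I ∣ +_) disjoint ⟨
    ∣ ⁅ f zero ⁆ ∪ I ∣ + ∣ ⁅ f zero ⁆ ∩ I ∣   ≡⟨ ∣∪∣+∣∩∣ ⁅ f zero ⁆ I ⟩
    ∣ ⁅ f zero ⁆ ∣ + ∣ I ∣                    ≡⟨ cong₂ _+_ (∣⁅x⁆∣≡1 (f zero)) (∣image∣ (f ∘ suc) (Fin.suc-injective ∘ inj)) ⟩
    suc m                                     ∎
    where
    open ≡-Reasoning
    I = image (f ∘ suc)
    disjoint : ∣ ⁅ f zero ⁆ ∩ I ∣ ≡ 0
    disjoint = trans (cong ∣_∣ (Empty-unique {p = ⁅ f zero ⁆ ∩ I} empty)) (∣⊥∣≡0 n)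
      where
      empty : ¬ (∃[ x ] x ∈ ⁅ f zero ⁆ ∩ I)
      empty (x , x∈) with x∈p∩q⁻ ⁅ f zero ⁆ I x∈
      ... | x∈₁ , x∈₂ with ∈-image⁻ (f ∘ suc) x∈₂
      ...   | i , eq = contradiction (inj (trans eq (x∈⁅y⁆⇒x≡y (f zero) x∈₁))) λ ()

  lookup-unique : ∀ {A : Set} {xs : List A} → Unique xs → ∀ i j → lookup xs i ≡ lookup xs j → i ≡ j
  lookup-unique (x∉ ∷ u) zero    zero    eq = refl
  lookup-unique (x∉ ∷ u) zero    (suc j) eq = contradiction eq (All.lookup x∉ (∈-lookup j))
  lookup-unique (x∉ ∷ u) (suc i) zero    eq = contradiction (sym eq) (All.lookup x∉ (∈-lookup i))
  lookup-unique (x∉ ∷ u) (suc i) (suc j) eq = cong suc (lookup-unique u i j eq)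

  subst-Fin-injective : ∀ {m n} (eq : m ≡ n) {i j} → subst Fin eq i ≡ subst Fin eq j → i ≡ j
  subst-Fin-injective refl e = e

  pad : ∀ {v n n′ M} {C : Claim v} → n ≤ n′ → Packing C n M → Packing C n′ M
  pad n≤n′ P = record
    { place     = λ B u → inject≤ (place B u) n≤n′
    ; injective = λ B eq → injective B (cancel eq)
    ; exclusive = λ j e e′ → exclusive j (cancel e) (cancel e′) }
    where
    open Packing P
    cancel : ∀ {x y} → inject≤ x n≤n′ ≡ inject≤ y n≤n′ → x ≡ y
    cancel {x} {y} = inject≤-injective n≤n′ n≤n′ x y

  module _ {v n n′ M : ℕ} {C : Claim v} (n≤n′ : n ≤ n′) {P : Packing C n M} where

    private

      cancel : ∀ {x y} → inject≤ x n≤n′ ≡ inject≤ y n≤n′ → x ≡ y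
      cancel {x} {y} = inject≤-injective n≤n′ n≤n′ x y

    pad-pasch : PaschRigid C P → PaschRigid C (pad n≤n′ P)
    pad-pasch rigid a b c d e₁ e₂ e₃ e₄ e₅ e₆ =
      rigid a b c d (cancel e₁) (cancel e₂) (cancel e₃) (cancel e₄) (cancel e₅) (cancel e₆)

    pad-mitre : MitreRigid C P → MitreRigid C (pad n≤n′ P)
    pad-mitre rigid a b c d e e₁ e₂ e₃ e₄ e₅ e₆ e₇ e₈ =
      rigid a b c d e (cancel e₁) (cancel e₂) (cancel e₃) (cancel e₄) (cancel e₅) (cancel e₆) (cancel e₇) (cancel e₈)

    pad-grid : GridRigid C P → GridRigid C (pad n≤n′ P)
    pad-grid rigid a b c d e e₁ e₂ e₃ e₄ e₅ e₆ e₇ e₈ =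
      rigid a b c d e (cancel e₁) (cancel e₂) (cancel e₃) (cancel e₄) (cancel e₅) (cancel e₆) (cancel e₇) (cancel e₈)

  module _ (d⁻ ℓ⁻ : ℕ) where

    private

      d r : ℕ
      d = suc d⁻
      r = 2 + d

    diamondClaim : Claim (patternSize d⁻ ℓ⁻)
    diamondClaim = record
      { J = λ u u′ → (u , u′) ∈ᴸ.∈ claimed d⁻ ℓ⁻
      ; J-sym = claimed-sym d⁻ ℓ⁻ ; J-irrefl = claimed-irrefl d⁻ ℓ⁻ }

    module _ {n M : ℕ} (P : Packing diamondClaim n M) (pasch-rigid : PaschRigid diamondClaim P)
             (mitre-rigid : MitreRigid diamondClaim P) (grid-rigid : GridRigid diamondClaim P) where

      open Packing P

      private

        K : Set
        K = Kind d⁻ ℓ⁻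

        On : Side → K → Set
        On = OnSide d⁻ ℓ⁻

        I : Set
        I = Fin M × Fin (S d⁻ ℓ⁻)

        _≟ᴵ_ : ∀ (i j : I) → Dec (i ≡ j)
        _≟ᴵ_ = ≡-dec _≟_ _≟_

        pt : I → K → Fin n
        pt (B , s) k = place B (vertex d⁻ ℓ⁻ s k)

        pt-kind : ∀ i {k k′} → pt i k ≡ pt i k′ → k ≡ k′
        pt-kind (B , s) eq = vertex-kind d⁻ ℓ⁻ (injective B eq)

        same-copy : ∀ {i j k₁ k₂ l₁ l₂} → k₁ ≢ k₂ → pt i k₁ ≡ pt j l₁ → pt i k₂ ≡ pt j l₂ → proj₁ i ≡ proj₁ j
        same-copy {B , s} {B′ , t} ne e₁ e₂ = exclusive (claimed⁺ d⁻ ℓ⁻ s ne) e₁ e₂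

        clique : ∀ {s k₁ k₂ k₃} → k₁ ≢ k₂ → k₁ ≢ k₃ → k₂ ≢ k₃ →
                 Clique₃ diamondClaim (vertex d⁻ ℓ⁻ s k₁) (vertex d⁻ ℓ⁻ s k₂) (vertex d⁻ ℓ⁻ s k₃)
        clique {s} a b c = clique₃ (claimed⁺ d⁻ ℓ⁻ s a) (claimed⁺ d⁻ ℓ⁻ s b) (claimed⁺ d⁻ ℓ⁻ s c)

        other-diamond : ∀ {B} {s t : Fin (S d⁻ ℓ⁻)} → _≢_ {A = I} (B , s) (B , t) → s ≢ t
        other-diamond ne refl = ne refl

        edge-diamond : ∀ {i j σ k₁ k₂ l₁ l₂} → i ≢ j → On σ k₁ → On σ k₂ → k₁ ≢ k₂ →
                       pt i k₁ ≡ pt j l₁ → pt i k₂ ≢ pt j l₂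
        edge-diamond {i} {j} i≢j o₁ o₂ ne e₁ e₂ = go i≢j (same-copy {i} {j} ne e₁ e₂) e₁ e₂
          where
          go : ∀ {i j l₁ l₂} → i ≢ j → proj₁ i ≡ proj₁ j → pt i _ ≡ pt j l₁ → pt i _ ≢ pt j l₂
          go {B , s} {_ , t} i≢j refl e₁ e₂ =
            edge∩diamond d⁻ ℓ⁻ (other-diamond i≢j) o₁ o₂ ne (injective B e₁) (injective B e₂)

        kind : Side → Fin r → K
        kind σ p = [ private-end , arm σ ]′ (splitAt 2 p)

        kind-on : ∀ σ p → On σ (kind σ p)
        kind-on σ p with splitAt 2 p
        ... | inj₁ _ = end
        ... | inj₂ _ = arm

        kind-injective : ∀ σ {p q} → kind σ p ≡ kind σ q → p ≡ q
        kind-injective σ {0F} {0F} eq = refl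
        kind-injective σ {1F} {1F} eq = refl
        kind-injective σ {0F} {1F} ()
        kind-injective σ {0F} {suc (suc _)} ()
        kind-injective σ {1F} {0F} ()
        kind-injective σ {1F} {suc (suc _)} ()
        kind-injective σ {suc (suc p)} {0F} ()
        kind-injective σ {suc (suc p)} {1F} ()
        kind-injective σ {suc (suc p)} {suc (suc q)} refl = refl

        kind-onto : ∀ {σ k} → On σ k → ∃[ p ] kind σ p ≡ k
        kind-onto (end {0F}) = 0F , refl
        kind-onto (end {1F}) = 1F , refl
        kind-onto (arm {i})  = suc (suc i) , refl

      abstract

        edge : I × Side → Subset n
        edge (i , σ) = image (pt i ∘ kind σ)

        ∣edge∣ : ∀ e → ∣ edge e ∣ ≡ r
        ∣edge∣ (i , σ) = ∣image∣ (pt i ∘ kind σ) (kind-injective σ ∘ pt-kind i)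

        ∈-edge⁺ : ∀ {i σ k} → On σ k → pt i k ∈ edge (i , σ)
        ∈-edge⁺ {i} {σ} o with kind-onto o
        ... | p , refl = ∈-image⁺ (pt i ∘ kind σ) p

        ∈-edge⁻ : ∀ {i σ x} → x ∈ edge (i , σ) → ∃[ k ] On σ k × pt i k ≡ x
        ∈-edge⁻ {i} {σ} x∈ with ∈-image⁻ (pt i ∘ kind σ) x∈
        ... | p , eq = kind σ p , kind-on σ p , eq

      private

        full : I → Subset n
        full i = edge (i , left) ∪ edge (i , right)

        ∈-full : ∀ {i x} → x ∈ full i → ∃[ k ] pt i k ≡ x
        ∈-full {i} x∈ with x∈p∪q⁻ (edge (i , left)) (edge (i , right)) x∈
        ... | inj₁ x∈′ = let k , _ , eq = ∈-edge⁻ x∈′ in k , eq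
        ... | inj₂ x∈′ = let k , _ , eq = ∈-edge⁻ x∈′ in k , eq

        edge⊆full : ∀ {i} σ → edge (i , σ) ⊆ full i
        edge⊆full left  x∈ = x∈p∪q⁺ (inj₁ x∈)
        edge⊆full right x∈ = x∈p∪q⁺ (inj₂ x∈)

        both-sides : ∀ {k} → On left k → On right k → k ≡ private-end 0F ⊎ k ≡ private-end 1F
        both-sides (end {0F}) _ = inj₁ refl
        both-sides (end {1F}) _ = inj₂ refl

        -- The two edges have only the private ends in common.
        ∣full∣ : ∀ i → r + r ≤ ∣ full i ∣ + 2
        ∣full∣ i = begin
          r + r                                              ≡⟨ cong₂ _+_ (∣edge∣ (i , left)) (∣edge∣ (i , right)) ⟨
          ∣ edge (i , left) ∣ + ∣ edge (i , right) ∣         ≡⟨ ∣∪∣+∣∩∣ (edge (i , left)) (edge (i , right)) ⟨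
          ∣ full i ∣ + ∣ edge (i , left) ∩ edge (i , right) ∣ ≤⟨ ℕ.+-monoʳ-≤ (∣ full i ∣)
              (covered-by-two (pt i (private-end 0F)) (pt i (private-end 1F)) cover) ⟩
          ∣ full i ∣ + 2                                     ∎
          where
          open ≤-Reasoning
          cover : ∀ {z} → z ∈ edge (i , left) ∩ edge (i , right) → z ≡ pt i (private-end 0F) ⊎ z ≡ pt i (private-end 1F)
          cover z∈ with x∈p∩q⁻ (edge (i , left)) (edge (i , right)) z∈
          ... | z∈₁ , z∈₂ with ∈-edge⁻ z∈₁ | ∈-edge⁻ z∈₂
          ...   | k , o , refl | k′ , o′ , eq with pt-kind i eq
          ...     | refl with both-sides o o′
          ...       | inj₁ refl = inj₁ refl
          ...       | inj₂ refl = inj₂ refl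

        -- Two common vertices would be a claimed pair of the first copy and force both diamonds
        -- into it; there `edge∩diamond` separates them.
        edge-linear : ∀ {i j σ} → i ≢ j → Linear (edge (i , σ)) (full j)
        edge-linear {i} {j} i≢j {x} {y} x∈i x∈j y∈i y∈j =
          let k₁ , o₁ , e₁ = ∈-edge⁻ x∈i ; k₂ , o₂ , e₂ = ∈-edge⁻ y∈i
              l₁ , f₁ = ∈-full x∈j ; l₂ , f₂ = ∈-full y∈j
          in decide o₁ o₂ e₁ e₂ f₁ f₂
          where
          decide : ∀ {k₁ k₂ l₁ l₂} → On _ k₁ → On _ k₂ → pt i k₁ ≡ x → pt i k₂ ≡ y → pt j l₁ ≡ x → pt j l₂ ≡ y → x ≡ y
          decide {k₁} {k₂} o₁ o₂ e₁ e₂ f₁ f₂ with x ≟ y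
          ... | yes x≡y = x≡y
          ... | no  x≢y = contradiction (trans e₂ (sym f₂))
            (edge-diamond {i} {j} i≢j o₁ o₂ (λ k≡ → x≢y (trans (sym e₁) (trans (cong (pt i) k≡) e₂))) (trans e₁ (sym f₁)))

        edges-linear : ∀ {i j σ τ} → i ≢ j → Linear (edge (i , σ)) (edge (j , τ))
        edges-linear {τ = τ} i≢j a b c e = edge-linear i≢j a (edge⊆full τ b) c (edge⊆full τ e)

      edge-injective : ∀ {e e′} → edge e ≡ edge e′ → e ≡ e′
      edge-injective {i , σ} {j , τ} eq with i ≟ᴵ j
      ... | no i≢j = contradiction (pt-kind i {private-end 0F} {private-end 1F} (edges-linear {i} {j} {σ} {τ} i≢j
          (∈-edge⁺ end) (subst (_ ∈_) eq (∈-edge⁺ end)) (∈-edge⁺ end) (subst (_ ∈_) eq (∈-edge⁺ end)))) λ ()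
      ... | yes refl = cong (i ,_) (sides σ τ (∈-edge⁻ (subst (pt i (arm σ zero) ∈_) eq (∈-edge⁺ arm))))
        where
        sides : ∀ σ τ → ∃[ k ] On τ k × pt i k ≡ pt i (arm σ zero) → σ ≡ τ
        sides σ τ (k , o , eq′) with pt-kind i eq′
        sides σ σ (_ , arm , eq′) | refl = refl

      private

        Within : I → Subset n → Set
        Within i A = ∀ {x} → x ∈ A → ∃[ k ] pt i k ≡ x

        edge-within : ∀ i σ → Within i (edge (i , σ))
        edge-within i σ x∈ = let k , _ , e = ∈-edge⁻ x∈ in k , e

        kinds≢ : ∀ i {k k′ x y} → pt i k ≡ x → pt i k′ ≡ y → x ≢ y → k ≢ k′
        kinds≢ i e e′ x≢y k≡k′ = x≢y (trans (sym e) (trans (cong (pt i) k≡k′) e′))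

        triple-clique : ∀ B {s k₁ k₂ k₃ x y z} → pt (B , s) k₁ ≡ x → pt (B , s) k₂ ≡ y → pt (B , s) k₃ ≡ z →
          x ≢ y → x ≢ z → y ≢ z → Clique₃ diamondClaim (vertex d⁻ ℓ⁻ s k₁) (vertex d⁻ ℓ⁻ s k₂) (vertex d⁻ ℓ⁻ s k₃)
        triple-clique B {s} e₁ e₂ e₃ xy xz yz =
          clique (kinds≢ (B , s) e₁ e₂ xy) (kinds≢ (B , s) e₁ e₃ xz) (kinds≢ (B , s) e₂ e₃ yz)

        triangle : ∀ {i j k σ τ υ x y z} → proj₁ i ≡ proj₁ k → proj₁ j ≡ proj₁ k → i ≢ j → j ≢ k → i ≢ k →
          x ∈ edge (i , σ) → x ∈ edge (j , τ) → y ∈ edge (i , σ) → y ∈ edge (k , υ) → z ∈ edge (j , τ) → z ∈ edge (k , υ) →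
          x ≢ y → x ≢ z → ∀ {C : Set} → C
        triangle {B , s} {_ , t} {_ , q} refl refl ij jk ik x∈i x∈j y∈i y∈k z∈j z∈k xy xz =
          let _ , o₁ , a₁ = ∈-edge⁻ x∈i ; _ , o₂ , a₂ = ∈-edge⁻ y∈i
              _ , p₁ , b₁ = ∈-edge⁻ x∈j ; _ , p₃ , b₃ = ∈-edge⁻ z∈j
              _ , r₂ , c₂ = ∈-edge⁻ y∈k ; _ , r₃ , c₃ = ∈-edge⁻ z∈k
          in contradiction (injective B (trans b₃ (sym c₃)))
               (no-triangle d⁻ ℓ⁻ (other-diamond ij) (other-diamond jk) (other-diamond ik) o₁ o₂ p₁ p₃ r₂ r₃
                 (kinds≢ (B , s) a₁ a₂ xy) (kinds≢ (B , t) b₁ b₃ xz)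
                 (injective B (trans a₁ (sym b₁))) (injective B (trans a₂ (sym c₂))))

        module _ {i j k l : I} {σ τ υ : Side} (jk : j ≢ k) (jl : j ≢ l) (kl : k ≢ l) where

          -- Rigidity puts the three edges into one copy, where they form a forbidden triangle. The
          -- first set is any subset of a diamond, so that the whole diamond is covered.
          no-pasch : ∀ {A} → Within i A → ¬ Pasch A (edge (j , σ)) (edge (k , τ)) (edge (l , υ))
          no-pasch inA p =
            let _ , a₁ = inA ab∈A ; _ , a₂ = inA ac∈A ; _ , a₃ = inA ad∈A
                _ , b₁ = edge-within j σ ab∈B ; _ , b₂ = edge-within j σ bc∈B ; _ , b₃ = edge-within j σ bd∈B
                _ , c₁ = edge-within k τ ac∈C ; _ , c₂ = edge-within k τ bc∈C ; _ , c₃ = edge-within k τ cd∈C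
                _ , d₁ = edge-within l υ ad∈D ; _ , d₂ = edge-within l υ bd∈D ; _ , d₃ = edge-within l υ cd∈D
                _ , jl≡ , kl≡ = pasch-rigid
                  (triple-clique (proj₁ i) a₁ a₂ a₃ A₁ A₂ A₃) (triple-clique (proj₁ j) b₁ b₂ b₃ B₁ B₂ B₃)
                  (triple-clique (proj₁ k) c₁ c₂ c₃ C₁ C₂ C₃) (triple-clique (proj₁ l) d₁ d₂ d₃ D₁ D₂ D₃)
                  (trans a₁ (sym b₁)) (trans a₂ (sym c₁)) (trans a₃ (sym d₁))
                  (trans b₂ (sym c₂)) (trans b₃ (sym d₂)) (trans c₃ (sym d₃))
            in triangle jl≡ kl≡ jk kl jl bc∈B bc∈C bd∈B bd∈D cd∈C cd∈D B₃ C₃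
            where open Pasch p

        -- In the single copy that rigidity yields, two of the concurrent edges and a transversal
        -- form a forbidden triangle.
        no-mitre : ∀ {i j k l m σ τ υ φ χ} → Distinct₅ i j k l m →
          ¬ Mitre (edge (i , σ)) (edge (j , τ)) (edge (k , υ)) (edge (l , φ)) (edge (m , χ))
        no-mitre {i} {j} {k} {l} {m} {σ} {τ} {υ} {φ} {χ} ((ij , ik , il , im) , (jk , jl , jm) , (kl , km) , lm) p =
          let _ , a₁ = edge-within i σ q∈A ; _ , a₂ = edge-within i σ a∈A ; _ , a₃ = edge-within i σ a′∈A
              _ , b₁ = edge-within j τ q∈B ; _ , b₂ = edge-within j τ b∈B ; _ , b₃ = edge-within j τ b′∈B
              _ , c₁ = edge-within k υ q∈C ; _ , c₂ = edge-within k υ c∈C ; _ , c₃ = edge-within k υ c′∈C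
              _ , d₁ = edge-within l φ a∈D ; _ , d₂ = edge-within l φ b∈D ; _ , d₃ = edge-within l φ c∈D
              _ , e₁ = edge-within m χ a′∈E ; _ , e₂ = edge-within m χ b′∈E ; _ , e₃ = edge-within m χ c′∈E
              ik≡ , jk≡ , lk≡ , _ = mitre-rigid
                (triple-clique (proj₁ i) a₁ a₂ a₃ A₁ A₂ A₃) (triple-clique (proj₁ j) b₁ b₂ b₃ B₁ B₂ B₃)
                (triple-clique (proj₁ k) c₁ c₂ c₃ C₁ C₂ C₃) (triple-clique (proj₁ l) d₁ d₂ d₃ D₁ D₂ D₃)
                (triple-clique (proj₁ m) e₁ e₂ e₃ E₁ E₂ E₃)
                (trans a₁ (sym c₁)) (trans b₁ (sym c₁))
                (trans a₂ (sym d₁)) (trans b₂ (sym d₂)) (trans c₂ (sym d₃))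
                (trans a₃ (sym e₁)) (trans b₃ (sym e₂)) (trans c₃ (sym e₃))
          in triangle (trans ik≡ (sym lk≡)) (trans jk≡ (sym lk≡)) ij jl il q∈A q∈B a∈A a∈D b∈B b∈D A₁ B₁
          where open Mitre p

        no-grid : ∀ {i j k l m σ τ υ φ χ} → Distinct₅ i j k l m →
          ¬ Grid (edge (i , σ)) (edge (j , τ)) (edge (k , υ)) (edge (l , φ)) (edge (m , χ))
        no-grid {i} {j} {k} {l} {m} {σ} {τ} {υ} {φ} {χ} ((ij , ik , il , im) , (jk , jl , jm) , (kl , km) , lm) p =
          let _ , a₁ = edge-within i σ ac∈A ; _ , a₂ = edge-within i σ ad∈A ; _ , a₃ = edge-within i σ ae∈A
              _ , b₁ = edge-within j τ bc∈B ; _ , b₂ = edge-within j τ bd∈B ; _ , b₃ = edge-within j τ be∈B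
              _ , c₁ = edge-within k υ ac∈C ; _ , c₂ = edge-within k υ bc∈C ; _ , c₃ = edge-within k υ ce∈C
              _ , d₁ = edge-within l φ ad∈D ; _ , d₂ = edge-within l φ bd∈D ; _ , d₃ = edge-within l φ de∈D
              _ , e₁ = edge-within m χ ae∈E ; _ , e₂ = edge-within m χ be∈E ; _ , e₃ = edge-within m χ ce∈E ; _ , e₄ = edge-within m χ de∈E
              im≡ , _ , km≡ , _ = grid-rigid
                (triple-clique (proj₁ i) a₁ a₂ a₃ A₁ A₂ A₃) (triple-clique (proj₁ j) b₁ b₂ b₃ B₁ B₂ B₃)
                (triple-clique (proj₁ k) c₁ c₂ c₃ C₁ C₂ C₃) (triple-clique (proj₁ l) d₁ d₂ d₃ D₁ D₂ D₃)
                (clique₄ (claimed⁺ d⁻ ℓ⁻ (proj₂ m) (kinds≢ m e₁ e₂ E₁)) (claimed⁺ d⁻ ℓ⁻ (proj₂ m) (kinds≢ m e₁ e₃ E₂))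
                  (claimed⁺ d⁻ ℓ⁻ (proj₂ m) (kinds≢ m e₁ e₄ E₃)) (claimed⁺ d⁻ ℓ⁻ (proj₂ m) (kinds≢ m e₂ e₃ E₄))
                  (claimed⁺ d⁻ ℓ⁻ (proj₂ m) (kinds≢ m e₂ e₄ E₅)) (claimed⁺ d⁻ ℓ⁻ (proj₂ m) (kinds≢ m e₃ e₄ E₆)))
                (trans a₁ (sym c₁)) (trans a₂ (sym d₁)) (trans b₁ (sym c₂)) (trans b₂ (sym d₂))
                (trans a₃ (sym e₁)) (trans b₃ (sym e₂)) (trans c₃ (sym e₃)) (trans d₃ (sym e₄))
          in triangle im≡ km≡ ik km im ac∈A ac∈C ae∈A ae∈E ce∈C ce∈E A₂ C₂
          where open Grid p

        full∩full : ∀ {i j} → i ≢ j → ∣ full i ∩ full j ∣ ≤ 2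
        full∩full {i} {j} i≢j = ℕ.≤-trans (p⊆q⇒∣p∣≤∣q∣ sub) (ℕ.≤-trans (∣∪∣≤ (E left ∩ full j) (E right ∩ full j))
          (ℕ.+-mono-≤ (linear⇒≤1 (edge-linear i≢j)) (linear⇒≤1 (edge-linear i≢j))))
          where
          E : Side → Subset n
          E σ = edge (i , σ)
          sub : full i ∩ full j ⊆ (E left ∩ full j) ∪ (E right ∩ full j)
          sub x∈ with x∈p∩q⁻ (full i) (full j) x∈
          ... | x∈i , x∈j with x∈p∪q⁻ (E left) (E right) x∈i
          ...   | inj₁ x∈l = x∈p∪q⁺ (inj₁ (x∈p∩q⁺ (x∈l , x∈j)))
          ...   | inj₂ x∈r = x∈p∪q⁺ (inj₂ (x∈p∩q⁺ (x∈r , x∈j)))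

        -- Their two common vertices put the first two diamonds into one copy, and the ends `z`, `w`
        -- pull the third into it; then `no-bridging` applies.
        bridging : ∀ {i j k σ x y z w} → i ≢ j → k ≢ i → k ≢ j → x ∈ full i → x ∈ full j → y ∈ full i → y ∈ full j → x ≢ y →
          z ∈ edge (k , σ) → z ∈ full i → w ∈ edge (k , σ) → w ∈ full j → z ≢ w → ∀ {C : Set} → C
        bridging {i} {j} {k} i≢j k≢i k≢j x∈i x∈j y∈i y∈j x≢y z∈k z∈i w∈k w∈j z≢w =
          let k₁ , a₁ = ∈-full x∈i ; k₂ , a₂ = ∈-full y∈i ; l₁ , b₁ = ∈-full x∈j ; l₂ , b₂ = ∈-full y∈j
              x₁ , o₁ , c₁ = ∈-edge⁻ z∈k ; x₂ , o₂ , c₂ = ∈-edge⁻ w∈k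
              y₁ , f₁ = ∈-full z∈i ; y₂ , f₂ = ∈-full w∈j
              ne = kinds≢ i a₁ a₂ x≢y ; ne′ = kinds≢ k c₁ c₂ z≢w
              ij = same-copy {i} {j} ne (trans a₁ (sym b₁)) (trans a₂ (sym b₂))
          in go i≢j k≢i k≢j ij ne (trans a₁ (sym b₁)) (trans a₂ (sym b₂)) o₁ o₂ ne′ (trans c₁ (sym f₁)) (trans c₂ (sym f₂))
          where
          go : ∀ {i j k σ k₁ k₂ l₁ l₂ x₁ x₂ y₁ y₂} → i ≢ j → k ≢ i → k ≢ j → proj₁ i ≡ proj₁ j →
            k₁ ≢ k₂ → pt i k₁ ≡ pt j l₁ → pt i k₂ ≡ pt j l₂ →
            On σ x₁ → On σ x₂ → x₁ ≢ x₂ → pt k x₁ ≡ pt i y₁ → pt k x₂ ≡ pt j y₂ → ∀ {C : Set} → C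
          go {B , s} {_ , t} {B′ , q} i≢j k≢i k≢j refl ne e₁ e₂ o₁ o₂ ne′ f₁ f₂
            with exclusive (claimed⁺ d⁻ ℓ⁻ q ne′) f₁ f₂
          ... | refl = contradiction (injective B f₂) (no-bridging d⁻ ℓ⁻ (other-diamond i≢j) (other-diamond k≢i) (other-diamond k≢j)
            ne (injective B e₁) (injective B e₂) o₁ o₂ ne′ (injective B f₁))

        module Five (e : Fin 5 → I) (σ : Fin 5 → Side) (distinct : ∀ {a b} → e a ≡ e b → σ a ≡ σ b → a ≡ b)
                    (V : Subset n) (E⊆V : ∀ a → edge (e a , σ a) ⊆ V) where

          private

            Enough : Set
            Enough = (((r + r) + r) + r) + r < ∣ V ∣ + 8

          opposite : ∀ {a b} → a ≢ b → e a ≡ e b → ∀ τ → τ ≡ σ a ⊎ τ ≡ σ b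
          opposite {a} {b} a≢b ea≡eb τ with σ a in σa | σ b in σb
          opposite a≢b ea≡eb left  | left  | _     = inj₁ refl
          opposite a≢b ea≡eb left  | right | left  = inj₂ refl
          opposite a≢b ea≡eb right | right | _     = inj₁ refl
          opposite a≢b ea≡eb right | left  | right = inj₂ refl
          opposite a≢b ea≡eb right | left  | left  = contradiction (distinct ea≡eb (trans σa (sym σb))) a≢b
          opposite a≢b ea≡eb left  | right | right = contradiction (distinct ea≡eb (trans σa (sym σb))) a≢b

          full⊆V : ∀ {a b} → a ≢ b → e a ≡ e b → full (e a) ⊆ V
          full⊆V {a} {b} a≢b ea≡eb = ∪-least (side left) (side right)
            where
            side : ∀ τ → edge (e a , τ) ⊆ V
            side τ x∈ with opposite a≢b ea≡eb τ
            ... | inj₁ refl = E⊆V a x∈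
            ... | inj₂ refl = E⊆V b (subst (λ i → _ ∈ edge (i , σ b)) ea≡eb x∈)

          third : ∀ {a b c} → a ≢ b → e a ≡ e b → c ≢ a → c ≢ b → e c ≢ e a
          third {a} {b} {c} a≢b ea≡eb c≢a c≢b ec≡ea with opposite a≢b ea≡eb (σ c)
          ... | inj₁ σ≡ = c≢a (distinct ec≡ea σ≡)
          ... | inj₂ σ≡ = c≢b (distinct (trans ec≡ea ea≡eb) σ≡)

          -- The diamond spans at least 2 r - 2 vertices and acts as one of the sets in `four-sets`,
          -- where at most 5 more are lost: 5 r - 7 remain.
          one-diamond : ∀ {i b c f} → full i ⊆ V → i ≢ e b → i ≢ e c → i ≢ e f → e b ≢ e c → e b ≢ e f → e c ≢ e f → Enough
          one-diamond {i} {b} {c} {f} D⊆V ib ic if bc bf cf = begin-strict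
            (((r + r) + r) + r) + r              ≤⟨ ℕ.+-monoˡ-≤ r (ℕ.+-monoˡ-≤ r (ℕ.+-monoˡ-≤ r (∣full∣ i))) ⟩
            (((D + 2) + r) + r) + r              ≡⟨ shift D r ⟩
            (((D + r) + r) + r) + 2              ≡⟨ cong (_+ 2) (cong₂ _+_ (cong₂ _+_ (cong (D +_) (∣edge∣ (e b , σ b))) (∣edge∣ (e c , σ c))) (∣edge∣ (e f , σ f))) ⟨
            (((D + ∣ B ∣) + ∣ C ∣) + ∣ F ∣) + 2  ≤⟨ ℕ.+-monoˡ-≤ 2 (four-sets (linear-sym (edge-linear (ib ∘ sym)))
               (linear-sym (edge-linear (ic ∘ sym))) (linear-sym (edge-linear (if ∘ sym))) (edges-linear bc) (edges-linear bf) (edges-linear cf)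
               (no-pasch bc bf cf (λ {x} → ∈-full {i} {x}))) ⟩
            (∣ ((full i ∪ B) ∪ C) ∪ F ∣ + 5) + 2 ≤⟨ ℕ.+-monoˡ-≤ 2 (ℕ.+-monoˡ-≤ 5 (p⊆q⇒∣p∣≤∣q∣
               (∪-least (∪-least (∪-least D⊆V (E⊆V b)) (E⊆V c)) (E⊆V f)))) ⟩
            (∣ V ∣ + 5) + 2                      ≡⟨ ℕ.+-assoc ∣ V ∣ 5 2 ⟩
            ∣ V ∣ + 7                            <⟨ ℕ.+-monoʳ-< ∣ V ∣ (ℕ.n<1+n 7) ⟩
            ∣ V ∣ + 8                            ∎
            where
            open ≤-Reasoning
            D = ∣ full i ∣
            B = edge (e b , σ b)
            C = edge (e c , σ c)
            F = edge (e f , σ f)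
            shift : ∀ x y → (((x + 2) + y) + y) + y ≡ (((x + y) + y) + y) + 2
            shift = solve-∀

          -- The diamonds lose 2 + 2 inside themselves, at most 2 to each other, and at most 2 to
          -- the fifth edge. If the last two losses total at most 3, then 5 r - 7 vertices remain;
          -- if they total 4, the edge bridges two diamonds with two common vertices.
          two-diamonds : ∀ {i j c} → full i ⊆ V → full j ⊆ V → i ≢ j → e c ≢ i → e c ≢ j → Enough
          two-diamonds {i} {j} {c} Di⊆V Dj⊆V ij ci cj with ∣ full i ∩ full j ∣ + ∣ C ∩ (full i ∪ full j) ∣ ℕ.≤? 3
            where C = edge (e c , σ c)
          ... | yes le = begin-strict
            (((r + r) + r) + r) + r             ≡⟨ assoc r ⟩
            ((r + r) + (r + r)) + r             ≤⟨ ℕ.+-mono-≤ (ℕ.+-mono-≤ (∣full∣ i) (∣full∣ j)) (ℕ.≤-reflexive (sym (∣edge∣ (e c , σ c)))) ⟩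
            ((∣ Di ∣ + 2) + (∣ Dj ∣ + 2)) + ∣ C ∣ ≡⟨ shift₁ (∣ Di ∣) (∣ Dj ∣) (∣ C ∣) ⟩
            (∣ C ∣ + (∣ Di ∣ + ∣ Dj ∣)) + 4      ≡⟨ cong (λ z → (∣ C ∣ + z) + 4) (∣∪∣+∣∩∣ Di Dj) ⟨
            (∣ C ∣ + (∣ U ∣ + ∣ Di ∩ Dj ∣)) + 4  ≡⟨ shift₂ (∣ C ∣) (∣ U ∣) (∣ Di ∩ Dj ∣) ⟩
            ((∣ C ∣ + ∣ U ∣) + ∣ Di ∩ Dj ∣) + 4  ≡⟨ cong (λ z → (z + ∣ Di ∩ Dj ∣) + 4) (∣∪∣+∣∩∣ C U) ⟨
            ((∣ C ∪ U ∣ + ∣ C ∩ U ∣) + ∣ Di ∩ Dj ∣) + 4 ≡⟨ shift₃ (∣ C ∪ U ∣) (∣ C ∩ U ∣) (∣ Di ∩ Dj ∣) ⟩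
            (∣ C ∪ U ∣ + (∣ Di ∩ Dj ∣ + ∣ C ∩ U ∣)) + 4 ≤⟨ ℕ.+-monoˡ-≤ 4 (ℕ.+-mono-≤ (p⊆q⇒∣p∣≤∣q∣ (∪-least (E⊆V c) (∪-least Di⊆V Dj⊆V))) le) ⟩
            (∣ V ∣ + 3) + 4                     ≡⟨ ℕ.+-assoc ∣ V ∣ 3 4 ⟩
            ∣ V ∣ + 7                           <⟨ ℕ.+-monoʳ-< ∣ V ∣ (ℕ.n<1+n 7) ⟩
            ∣ V ∣ + 8                           ∎
            where
            open ≤-Reasoning
            Di = full i
            Dj = full j
            C = edge (e c , σ c)
            U = Di ∪ Dj
            assoc : ∀ x → (((x + x) + x) + x) + x ≡ ((x + x) + (x + x)) + x
            assoc = solve-∀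
            shift₁ : ∀ x y z → ((x + 2) + (y + 2)) + z ≡ (z + (x + y)) + 4
            shift₁ = solve-∀
            shift₂ : ∀ x y z → (x + (y + z)) + 4 ≡ ((x + y) + z) + 4
            shift₂ = solve-∀
            shift₃ : ∀ x y z → ((x + y) + z) + 4 ≡ (x + (z + y)) + 4
            shift₃ = solve-∀
          ... | no ¬le =
            let x , x∈ = pick {p = Di ∩ Dj} (ℕ.≤-trans (ℕ.n≤1+n 1) two) ; y , y∈ , y≢x = another x two
                x∈i , x∈j = x∈p∩q⁻ Di Dj x∈ ; y∈i , y∈j = x∈p∩q⁻ Di Dj y∈
                _ , _ , z∈c , z∈i , w∈c , w∈j , z≢w = two-meets (edge-linear ci) (edge-linear cj) two′
            in bridging ij ci cj x∈i x∈j y∈i y∈j (y≢x ∘ sym) z∈c z∈i w∈c w∈j z≢w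
            where
            Di = full i
            Dj = full j
            C = edge (e c , σ c)
            split : C ∩ (Di ∪ Dj) ⊆ (C ∩ Di) ∪ (C ∩ Dj)
            split x∈ with x∈p∩q⁻ C (Di ∪ Dj) x∈
            ... | xc , xU with x∈p∪q⁻ Di Dj xU
            ...   | inj₁ xi = x∈p∪q⁺ (inj₁ (x∈p∩q⁺ (xc , xi)))
            ...   | inj₂ xj = x∈p∪q⁺ (inj₂ (x∈p∩q⁺ (xc , xj)))
            ≤2 : ∣ C ∩ (Di ∪ Dj) ∣ ≤ 2
            ≤2 = ℕ.≤-trans (p⊆q⇒∣p∣≤∣q∣ split) (ℕ.≤-trans (∣∪∣≤ (C ∩ Di) (C ∩ Dj))
                   (ℕ.+-mono-≤ (linear⇒≤1 (edge-linear ci)) (linear⇒≤1 (edge-linear cj))))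
            two : 2 ≤ ∣ Di ∩ Dj ∣
            two = ℕ.+-cancelʳ-≤ 2 2 _ (ℕ.≤-trans (ℕ.≰⇒> ¬le) (ℕ.+-monoʳ-≤ (∣ Di ∩ Dj ∣) ≤2))
            two′ : 2 ≤ ∣ C ∩ (Di ∪ Dj) ∣
            two′ = ℕ.+-cancelˡ-≤ 2 2 _ (ℕ.≤-trans (ℕ.≰⇒> ¬le) (ℕ.+-monoˡ-≤ (∣ C ∩ (Di ∪ Dj) ∣) (full∩full ij)))

          enough : Enough
          enough = go (any? λ a → any? λ b → ¬? (a ≟ b) ×-dec (e a ≟ᴵ e b))
            where
            pairs : ∀ {a b} → a ≢ b → e a ≡ e b →
              ∃[ k ] ∃[ l ] ∃[ m ] (k ≢ a × k ≢ b) × (l ≢ a × l ≢ b × l ≢ k) × (m ≢ a × m ≢ b × m ≢ k × m ≢ l) → Enough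
            pairs {a} a≢b ea≡eb (k , l , m , (ka , kb) , (la , lb , lk) , (ma , mb , mk , ml)) =
              decide (e k ≟ᴵ e l) (e k ≟ᴵ e m) (e l ≟ᴵ e m)
              where
              D⊆V = full⊆V a≢b ea≡eb
              k′ : e k ≢ e a
              k′ = third a≢b ea≡eb ka kb
              l′ : e l ≢ e a
              l′ = third a≢b ea≡eb la lb
              m′ : e m ≢ e a
              m′ = third a≢b ea≡eb ma mb
              decide : Dec (e k ≡ e l) → Dec (e k ≡ e m) → Dec (e l ≡ e m) → Enough
              decide (yes kl) _ _ = two-diamonds {e a} {e k} {m} D⊆V (full⊆V (lk ∘ sym) kl) (k′ ∘ sym) m′ (third (lk ∘ sym) kl mk ml)
              decide _ (yes km) _ = two-diamonds {e a} {e k} {l} D⊆V (full⊆V (mk ∘ sym) km) (k′ ∘ sym) l′ (third (mk ∘ sym) km lk (ml ∘ sym))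
              decide _ _ (yes lm) = two-diamonds {e a} {e l} {k} D⊆V (full⊆V (ml ∘ sym) lm) (l′ ∘ sym) k′ (third (ml ∘ sym) lm (lk ∘ sym) (mk ∘ sym))
              decide (no kl) (no km) (no lm) = one-diamond {e a} {k} {l} {m} D⊆V (k′ ∘ sym) (l′ ∘ sym) (m′ ∘ sym) kl km lm
            go : Dec (∃[ a ] ∃[ b ] a ≢ b × e a ≡ e b) → Enough
            go (yes (a , b , a≢b , ea≡eb)) = pairs a≢b ea≡eb (three-others a b)
            go (no ¬∃) = five-sets (λ a → edge (e a , σ a)) V E⊆V (λ a → ∣edge∣ (e a , σ a))
              (λ a≢b → edges-linear (sep a≢b))
              (λ {a} {b} {c} {f} ((ab , ac , af) , (bc , bf) , cf) → no-pasch (sep bc) (sep bf) (sep cf) (λ {x} → edge-within (e a) (σ a) {x}))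
              (λ D → no-mitre (sep₅ D)) (λ D → no-grid (sep₅ D))
              where
              sep : ∀ {a b} → a ≢ b → e a ≢ e b
              sep {a} {b} a≢b ea≡eb = ¬∃ (a , b , a≢b , ea≡eb)
              sep₅ : ∀ {a b c f g} → Distinct₅ a b c f g → Distinct₅ (e a) (e b) (e c) (e f) (e g)
              sep₅ ((ab , ac , af , ag) , (bc , bf , bg) , (cf , cg) , fg) =
                (sep ab , sep ac , sep af , sep ag) , (sep bc , sep bf , sep bg) , (sep cf , sep cg) , sep fg

        index : List (I × Side)
        index = cartesianProduct (cartesianProduct (allFin M) (allFin (S d⁻ ℓ⁻))) (left ∷ right ∷ [])

        index-unique : Unique index
        index-unique = Unique.cartesianProduct⁺ (Unique.cartesianProduct⁺ (Unique.allFin⁺ M) (Unique.allFin⁺ (S d⁻ ℓ⁻)))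
          (((λ ()) All.∷ All.[]) ∷ (All.[] ∷ []))

      diamondGraph : RGraph r n
      diamondGraph = record
        { vertices = ⊤ ; edges = List.map edge index ; distinct = Unique.map⁺ edge-injective index-unique
        ; uniform = All.map⁺ (All.universal ∣edge∣ index) ; within = All.universal (λ _ {_} _ → ∈⊤) _ }

      diamondGraph-size : numEdges diamondGraph ≡ (M * S d⁻ ℓ⁻) * 2
      diamondGraph-size = trans (length-map edge index) (trans (length-cartesianProductWith _,_ (cartesianProduct (allFin M) (allFin (S d⁻ ℓ⁻))) (left ∷ right ∷ []))
        (cong (_* 2) (trans (length-cartesianProductWith _,_ (allFin M) (allFin (S d⁻ ℓ⁻))) (cong₂ _*_ (length-allFin M) (length-allFin (S d⁻ ℓ⁻))))))

      diamondGraph-free : Free (5 * r ∸ 8) 5 diamondGraph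
      diamondGraph-free H (_ , E⊆) (five , small) =
        ℕ.<⇒≱ (Five.enough (proj₁ ∘ e) (proj₂ ∘ e) same (vertices H) e⊆) (begin
          ∣ vertices H ∣ + 8          ≤⟨ ℕ.+-monoˡ-≤ 8 small ⟩
          (5 * r ∸ 8) + 8             ≡⟨ ℕ.m∸n+n≡m (ℕ.≤-trans (ℕ.m≤m+n 8 7) (ℕ.*-monoʳ-≤ 5 {3} {r} (s≤s (s≤s (s≤s z≤n))))) ⟩
          5 * r                       ≡⟨ five-times r ⟩
          (((r + r) + r) + r) + r     ∎)
        where
        open ≤-Reasoning
        five-times : ∀ x → 5 * x ≡ (((x + x) + x) + x) + x
        five-times = solve-∀
        at : Fin 5 → Fin (length (edges H))
        at = subst Fin (sym five)
        source : ∀ a → ∃[ p ] p ∈ᴸ.∈ index × lookup (edges H) a ≡ edge p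
        source a = ∈-map⁻ edge (E⊆ (∈-lookup a))
        e : Fin 5 → I × Side
        e a = proj₁ (source (at a))
        e-edge : ∀ a → lookup (edges H) (at a) ≡ edge (e a)
        e-edge a = proj₂ (proj₂ (source (at a)))
        e⊆ : ∀ a → edge (proj₁ (e a) , proj₂ (e a)) ⊆ vertices H
        e⊆ a {x} x∈ = All.lookup (within H) (∈-lookup (at a)) (subst (x ∈_) (sym (e-edge a)) x∈)
        same : ∀ {a b} → proj₁ (e a) ≡ proj₁ (e b) → proj₂ (e a) ≡ proj₂ (e b) → a ≡ b
        same {a} {b} i≡ σ≡ = subst-Fin-injective (sym five) (lookup-unique (distinct H) (at a) (at b)
          (trans (e-edge a) (trans (cong edge (cong₂ _,_ i≡ σ≡)) (sym (e-edge b)))))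

-- Assembly of the dense free graphs.

module DenseGraphs where

  open import Defs
  open Packings
  open Residues
  open Lines
  open Lifting
  open Framing
  open Pattern
  open DiamondGraphs
  open import Data.Fin.Subset.Properties using (∣⊤∣≡n)
  open import Data.Integer.Base using (+_)
  open import Data.Nat.Base as ℕ using (ℕ; suc; _+_; _*_; _∸_; _^_; _!; _≤_; _<_; s≤s; z≤n)
  import Data.Nat.Properties as ℕ
  open import Data.Product.Base using (_,_)
  open import Relation.Binary.PropositionalEquality

  module _ (d⁻ ℓ⁻ γ c : ℕ) where

    private

      v : ℕ
      v = patternSize d⁻ ℓ⁻

    frameVertices frameCopies : ℕ
    frameVertices = framedVertices (claimed d⁻ ℓ⁻) (claimed-sym d⁻ ℓ⁻) (claimed-irrefl d⁻ ℓ⁻) γ c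
    frameCopies   = framedCopies (claimed d⁻ ℓ⁻) (claimed-sym d⁻ ℓ⁻) (claimed-irrefl d⁻ ℓ⁻) γ c

    abstract

      framePacking : Packing (diamondClaim d⁻ ℓ⁻) frameVertices frameCopies
      framePacking = framed (claimed d⁻ ℓ⁻) (claimed-sym d⁻ ℓ⁻) (claimed-irrefl d⁻ ℓ⁻) γ c
                       (framing (claimed d⁻ ℓ⁻) (claimed-sym d⁻ ℓ⁻) (claimed-irrefl d⁻ ℓ⁻) γ c)

      step exponent : ℕ
      step = slopeBound v !
      exponent = coordinates {v} {frameCopies}

      1≤step : 1 ≤ step
      1≤step = ℕ.>-nonZero⁻¹ (slopeBound v !) {{slopeBound v ℕ.!≢0}}

      1≤exponent : 1 ≤ exponent
      1≤exponent = s≤s z≤n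

    module _ (s : ℕ) where

      -- The lifting modulus at parameter s + 1, so that it exceeds 1. Successive periods differ by
      -- the constant `step`, which lets them follow every large n closely.
      period : ℕ
      period = suc (step * suc s)

    module _ (s : ℕ) where

      private

        C : Claim v
        C = diamondClaim d⁻ ℓ⁻

        N : ℕ
        N = modulus (slopeBound v) (suc s)

        1<N : 1 < N
        1<N = s≤s (ℕ.*-mono-≤ (ℕ.>-nonZero⁻¹ (slopeBound v !) {{slopeBound v ℕ.!≢0}}) (s≤s z≤n))

        U : Unramified v (+ N)
        U = modulus-unramified v (suc s)

        L : Lifting framePacking N (liftedVertices framePacking N) (liftedCopies framePacking N)
        L = lifting framePacking N

        module _ (n : ℕ) (fits : liftedVertices framePacking N ≤ n) where

          P : Packing C n (liftedCopies framePacking N)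
          P = pad fits (lift 1<N U L)

          pasch : PaschRigid C P
          pasch = pad-pasch fits {lift 1<N U L} (lift-pasch 1<N U L)

          mitre : MitreRigid C P
          mitre = pad-mitre fits {lift 1<N U L} (lift-mitre 1<N U L)

          grid : GridRigid C P
          grid = pad-grid fits {lift 1<N U L} (lift-grid 1<N U L)

          dense′ : FreeGraphSize (3 + d⁻) n (5 * (3 + d⁻) ∸ 8) 5 ((liftedCopies framePacking N * S d⁻ ℓ⁻) * 2)
          dense′ = diamondGraph d⁻ ℓ⁻ P pasch mitre grid , ∣⊤∣≡n n
            , diamondGraph-free d⁻ ℓ⁻ P pasch mitre grid , diamondGraph-size d⁻ ℓ⁻ P pasch mitre grid

      abstract

        dense : ∀ n → frameVertices * period s ^ exponent ≤ n →
          FreeGraphSize (3 + d⁻) n (5 * (3 + d⁻) ∸ 8) 5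
            ((frameCopies * (period s ^ exponent * period s ^ exponent) * S d⁻ ℓ⁻) * 2)
        dense = dense′

-- Sets of edges that span few vertices, and their removal.

module Bundles where

  open FiveSets
  open import Data.Fin.Base as Fin using (Fin; zero; suc)
  open import Data.Fin.Properties as Fin using (_≟_; any?)
  open import Data.Fin.Subset using (Subset; inside; ∣_∣; _∈_; _∉_; _⊆_; _∪_; _∩_; _─_; _-_; ⁅_⁆; ⊤)
  open import Data.Fin.Subset.Properties
    using (∣⊥∣≡0; ∈⊤; ∣p∣≤n; p⊆q⇒∣p∣≤∣q∣; x∈p∪q⁺; x∈p∪q⁻; x∈p∩q⁺; x∈p∩q⁻; x∈⁅x⁆; ∣⁅x⁆∣≡1; x∈⁅y⁆⇒x≡y;
           Empty-unique; _∈?_; _⊆?_; anySubset?; p─q⊆p; x∈p∧x∉q⇒x∈p─q; p∩q≢∅⇒∣p─q∣<∣p∣; x∈p⇒∣p-x∣<∣p∣;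
           x∈p∧x≢y⇒x∈p-y)
  open import Data.Nat.Base as ℕ using (ℕ; zero; suc; _+_; _*_; _≤_; _<_; s≤s; z≤n)
  open import Data.Nat.Properties as ℕ using (module ≤-Reasoning)
  open import Data.Nat.Tactic.RingSolver using (solve-∀)
  open import Data.Product.Base using (∃-syntax; _×_; _,_; proj₁; proj₂)
  open import Data.Sum.Base using (inj₁; inj₂)
  open import Data.Vec.Base using (_∷_; here; there; tabulate)
  open import Data.Vec.Properties using (lookup∘tabulate; lookup⇒[]=; []=⇒lookup)
  open import Function.Base using (_∘_)
  open import Relation.Binary.PropositionalEquality
  open import Relation.Nullary using (¬_; Dec; yes; no; contradiction; does)
  open import Relation.Nullary.Decidable using (_×-dec_; dec-true)
  open import Relation.Unary using (Decidable)

  module _ {n : ℕ} {P : Fin n → Set} (P? : Decidable P) where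

    abstract

      ⟪_⟫ : Subset n
      ⟪_⟫ = tabulate (does ∘ P?)

      ∈⟪⟫⁺ : ∀ {x} → P x → x ∈ ⟪_⟫
      ∈⟪⟫⁺ {x} px = lookup⇒[]= x ⟪_⟫ (trans (lookup∘tabulate (does ∘ P?) x) (dec-true (P? x) px))

      ∈⟪⟫⁻ : ∀ {x} → x ∈ ⟪_⟫ → P x
      ∈⟪⟫⁻ {x} x∈ = from (P? x) (trans (sym (lookup∘tabulate (does ∘ P?) x)) ([]=⇒lookup x∈))
        where
        from : (d : Dec (P x)) → does d ≡ inside → P x
        from (yes px) _ = px

  x∈p─q⇒x∉q : ∀ {n} (p q : Subset n) {x} → x ∈ p ─ q → x ∉ q
  x∈p─q⇒x∉q (_ ∷ p) (inside ∷ q) {zero} () here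
  x∈p─q⇒x∉q (_ ∷ p) (_ ∷ q) {suc x} (there x∈) (there x∈q) = x∈p─q⇒x∉q p q x∈ x∈q

  module _ {n : ℕ} where

    Disjoint : Subset n → Subset n → Set
    Disjoint p q = ∀ {x} → x ∈ p → x ∉ q

    ∣∩∣≡0 : ∀ {p q} → Disjoint p q → ∣ p ∩ q ∣ ≡ 0
    ∣∩∣≡0 {p} {q} dis = trans (cong ∣_∣ (Empty-unique {p = p ∩ q} λ (x , x∈) →
      let x∈p , x∈q = x∈p∩q⁻ p q x∈ in dis x∈p x∈q)) (∣⊥∣≡0 n)

    ∣∪∣-disjoint : ∀ {p q} → Disjoint p q → ∣ p ∪ q ∣ ≡ ∣ p ∣ + ∣ q ∣
    ∣∪∣-disjoint {p} {q} dis = trans (sym (ℕ.+-identityʳ _)) (trans (cong (∣ p ∪ q ∣ +_) (sym (∣∩∣≡0 dis))) (∣∪∣+∣∩∣ p q))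

    ∣∩∣-comm : ∀ (p q : Subset n) → ∣ p ∩ q ∣ ≤ ∣ q ∩ p ∣
    ∣∩∣-comm p q = p⊆q⇒∣p∣≤∣q∣ λ x∈ → let x∈p , x∈q = x∈p∩q⁻ p q x∈ in x∈p∩q⁺ (x∈q , x∈p)

    ∩-mono : ∀ {p p′ q q′ : Subset n} → p ⊆ p′ → q ⊆ q′ → p ∩ q ⊆ p′ ∩ q′
    ∩-mono {p} {p′} {q} {q′} s t x∈ = let x∈p , x∈q = x∈p∩q⁻ p q x∈ in x∈p∩q⁺ (s x∈p , t x∈q)

    ∣p∣≤∣q∣+∣p─q∣ : ∀ (p q : Subset n) → ∣ p ∣ ≤ ∣ q ∣ + ∣ p ─ q ∣
    ∣p∣≤∣q∣+∣p─q∣ p q = ℕ.≤-trans (p⊆q⇒∣p∣≤∣q∣ cover) (∣∪∣≤ q (p ─ q))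
      where
      cover : p ⊆ q ∪ (p ─ q)
      cover {x} x∈p with x ∈? q
      ... | yes x∈q = x∈p∪q⁺ (inj₁ x∈q)
      ... | no  x∉q = x∈p∪q⁺ (inj₂ (x∈p∧x∉q⇒x∈p─q x∈p x∉q))

    two-points⇒2≤ : ∀ {p : Subset n} {x y} → x ∈ p → y ∈ p → x ≢ y → 2 ≤ ∣ p ∣
    two-points⇒2≤ {p} {x} {y} x∈ y∈ x≢y = ℕ.≤-trans (s≤s (nonempty⇒0< (x∈p∧x≢y⇒x∈p-y y∈ (x≢y ∘ sym)))) (x∈p⇒∣p-x∣<∣p∣ x∈)

  module _ {m n : ℕ} (A : Fin m → Subset n) where

    abstract

      spread : Subset m → Subset n
      spread T = ⟪ (λ v → any? λ i → (i ∈? T) ×-dec (v ∈? A i)) ⟫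

      ∈-spread⁺ : ∀ {T i v} → i ∈ T → v ∈ A i → v ∈ spread T
      ∈-spread⁺ {T} i∈ v∈ = ∈⟪⟫⁺ (λ v → any? λ i → (i ∈? T) ×-dec (v ∈? A i)) (_ , i∈ , v∈)

      ∈-spread⁻ : ∀ {T v} → v ∈ spread T → ∃[ i ] i ∈ T × v ∈ A i
      ∈-spread⁻ {T} = ∈⟪⟫⁻ (λ v → any? λ i → (i ∈? T) ×-dec (v ∈? A i))

    spread-mono : ∀ {T T′} → T ⊆ T′ → spread T ⊆ spread T′
    spread-mono sub v∈ = let i , i∈ , v∈i = ∈-spread⁻ v∈ in ∈-spread⁺ (sub i∈) v∈i

    spread-⁅⁆ : ∀ i → spread ⁅ i ⁆ ⊆ A i
    spread-⁅⁆ i v∈ with ∈-spread⁻ v∈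
    ... | j , j∈ , v∈j with x∈⁅y⁆⇒x≡y i j∈
    ...   | refl = v∈j

    ⁅⁆-spread : ∀ i → A i ⊆ spread ⁅ i ⁆
    ⁅⁆-spread i = ∈-spread⁺ (x∈⁅x⁆ i)

    spread-∪ : ∀ T T′ → spread (T ∪ T′) ⊆ spread T ∪ spread T′
    spread-∪ T T′ v∈ with ∈-spread⁻ v∈
    ... | i , i∈ , v∈i with x∈p∪q⁻ T T′ i∈
    ...   | inj₁ i∈T  = x∈p∪q⁺ (inj₁ (∈-spread⁺ i∈T v∈i))
    ...   | inj₂ i∈T′ = x∈p∪q⁺ (inj₂ (∈-spread⁺ i∈T′ v∈i))

    few-meets : ∀ k {X} T → ∣ T ∣ ≤ k → (∀ {j} → j ∈ T → ∣ X ∩ A j ∣ ≤ 1) → ∣ X ∩ spread T ∣ ≤ k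
    few-meets k {X} T T≤k one with Fin.any? (_∈? T)
    ... | no ¬∃ = ℕ.≤-trans (ℕ.≤-reflexive (∣∩∣≡0 {p = X} {q = spread T} (λ _ v∈ → let j , j∈ , _ = ∈-spread⁻ v∈ in ¬∃ (j , j∈)))) z≤n
    few-meets zero    T T≤k one | yes (j , j∈) = contradiction T≤k (ℕ.<⇒≱ (nonempty⇒0< j∈))
    few-meets (suc k) {X} T T≤k one | yes (j , j∈) = ℕ.≤-trans (p⊆q⇒∣p∣≤∣q∣ cover)
      (ℕ.≤-trans (∣∪∣≤ (X ∩ A j) (X ∩ spread (T - j))) (ℕ.+-mono-≤ (one j∈)
        (few-meets k {X} (T - j) (ℕ.≤-pred (ℕ.≤-trans (x∈p⇒∣p-x∣<∣p∣ j∈) T≤k)) (λ i∈ → one (p─q⊆p T ⁅ j ⁆ i∈)))))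
      where
      cover : X ∩ spread T ⊆ (X ∩ A j) ∪ (X ∩ spread (T - j))
      cover v∈ with x∈p∩q⁻ X (spread T) v∈
      ... | vX , vT with ∈-spread⁻ vT
      ...   | i , i∈ , v∈i with i ≟ j
      ...     | yes refl = x∈p∪q⁺ (inj₁ (x∈p∩q⁺ (vX , v∈i)))
      ...     | no  i≢j  = x∈p∪q⁺ (inj₂ (x∈p∩q⁺ (vX , ∈-spread⁺ (x∈p∧x≢y⇒x∈p-y i∈ i≢j) v∈i)))

    module _ (r : ℕ) where

      -- `c` is a deficiency: `k` disjoint edges would span at least `c` more vertices. A (5r - 8,
      -- 5)-configuration is a `Bundle 5 8`.
      Bundle : (k c : ℕ) → Subset m → Set
      Bundle k c T = ∣ T ∣ ≡ k × ∣ spread T ∣ + c ≤ k * r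

      bundle? : ∀ k c → Decidable (Bundle k c)
      bundle? k c T = (∣ T ∣ ℕ.≟ k) ×-dec (∣ spread T ∣ + c ℕ.≤? k * r)

      -- Deficiencies add up, and each common vertex contributes one more.
      merge : ∀ {k k′ c c′ T T′} t → Bundle k c T → Bundle k′ c′ T′ → Disjoint T T′ →
              t ≤ ∣ spread T ∩ spread T′ ∣ → Bundle (k + k′) ((c + c′) + t) (T ∪ T′)
      merge {k} {k′} {c} {c′} {T} {T′} t (T≡ , V≤) (T′≡ , V′≤) dis t≤ =
        trans (∣∪∣-disjoint dis) (cong₂ _+_ T≡ T′≡) , (begin
          ∣ spread (T ∪ T′) ∣ + ((c + c′) + t)   ≤⟨ ℕ.+-mono-≤ (p⊆q⇒∣p∣≤∣q∣ (spread-∪ T T′)) (ℕ.+-monoʳ-≤ (c + c′) t≤) ⟩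
          ∣ V ∪ V′ ∣ + ((c + c′) + ∣ V ∩ V′ ∣)   ≡⟨ shift₁ (∣ V ∪ V′ ∣) (∣ V ∩ V′ ∣) c c′ ⟩
          (∣ V ∪ V′ ∣ + ∣ V ∩ V′ ∣) + (c + c′)   ≡⟨ cong (_+ (c + c′)) (∣∪∣+∣∩∣ V V′) ⟩
          (∣ V ∣ + ∣ V′ ∣) + (c + c′)            ≡⟨ shift₂ (∣ V ∣) (∣ V′ ∣) c c′ ⟩
          (∣ V ∣ + c) + (∣ V′ ∣ + c′)            ≤⟨ ℕ.+-mono-≤ V≤ V′≤ ⟩
          k * r + k′ * r                         ≡⟨ ℕ.*-distribʳ-+ r k k′ ⟨
          (k + k′) * r                           ∎)
        where
        open ≤-Reasoning
        V = spread T
        V′ = spread T′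
        shift₁ : ∀ x y c c′ → x + ((c + c′) + y) ≡ (x + y) + (c + c′)
        shift₁ = solve-∀
        shift₂ : ∀ x y c c′ → (x + y) + (c + c′) ≡ (x + c) + (y + c′)
        shift₂ = solve-∀

      module _ (size : ∀ i → ∣ A i ∣ ≡ r) where

        single : ∀ i → Bundle 1 0 ⁅ i ⁆
        single i = ∣⁅x⁆∣≡1 i , (begin
          ∣ spread ⁅ i ⁆ ∣ + 0  ≡⟨ ℕ.+-identityʳ _ ⟩
          ∣ spread ⁅ i ⁆ ∣      ≤⟨ p⊆q⇒∣p∣≤∣q∣ (spread-⁅⁆ i) ⟩
          ∣ A i ∣               ≡⟨ size i ⟩
          r                     ≡⟨ ℕ.+-identityʳ r ⟨
          1 * r                 ∎)
          where open ≤-Reasoning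

        add : ∀ {k c T i} t → Bundle k c T → i ∉ T → t ≤ ∣ spread T ∩ A i ∣ → Bundle (k + 1) ((c + 0) + t) (T ∪ ⁅ i ⁆)
        add {T = T} {i} t b i∉T t≤ = merge t b (single i) (λ x∈T x∈i → i∉T (subst (_∈ T) (x∈⁅y⁆⇒x≡y i x∈i) x∈T))
          (ℕ.≤-trans t≤ (p⊆q⇒∣p∣≤∣q∣ (∩-mono {p = spread T} {q = A i} (λ x → x) (⁅⁆-spread i))))

        -- Edge-disjoint tight bundles are vertex-disjoint, so deleting one costs at least one vertex of W.
        module _ (k c : ℕ) (0<r : 0 < r) where

          Separated : Subset m → Set
          Separated E = ∀ {T T′} → T ⊆ E → T′ ⊆ E → Bundle (suc k) c T → Bundle (suc k) c T′ →
                        Disjoint T T′ → Disjoint (spread T) (spread T′)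

          private

            clean′ : ∀ b W → ∣ W ∣ ≤ b → ∀ E → Separated E → (∀ {T} → T ⊆ E → Bundle (suc k) c T → spread T ⊆ W) →
                     ∃[ E′ ] E′ ⊆ E × ∣ E ∣ ≤ b * suc k + ∣ E′ ∣ × (∀ {T} → T ⊆ E′ → ¬ Bundle (suc k) c T)
            clean′ b W W≤b E sep inW with anySubset? (λ T → (T ⊆? E) ×-dec bundle? (suc k) c T)
            ... | no ¬∃ = E , (λ x → x) , ℕ.m≤n+m _ (b * suc k) , λ {T} T⊆E bun → ¬∃ (T , T⊆E , bun)
            ... | yes (T , T⊆E , bun) = remove b W≤b
              where
              i : ∃[ i ] i ∈ T
              i = pick (ℕ.≤-trans (s≤s z≤n) (ℕ.≤-reflexive (sym (proj₁ bun))))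
              v : ∃[ v ] v ∈ A (proj₁ i)
              v = pick (ℕ.≤-trans 0<r (ℕ.≤-reflexive (sym (size (proj₁ i)))))
              v∈T : proj₁ v ∈ spread T
              v∈T = ∈-spread⁺ (proj₂ i) (proj₂ v)
              v∈W : proj₁ v ∈ W
              v∈W = inW T⊆E bun v∈T
              E₁⊆E : E ─ T ⊆ E
              E₁⊆E = p─q⊆p E T
              remove : ∀ b → ∣ W ∣ ≤ b →
                ∃[ E′ ] E′ ⊆ E × ∣ E ∣ ≤ b * suc k + ∣ E′ ∣ × (∀ {T} → T ⊆ E′ → ¬ Bundle (suc k) c T)
              remove zero    W≤0 = contradiction W≤0 (ℕ.<⇒≱ (nonempty⇒0< v∈W))
              remove (suc b) W≤ = let E′ , E′⊆ , E₁≤ , none = rest in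
                E′ , (λ x → E₁⊆E (E′⊆ x)) , (begin
                  ∣ E ∣                          ≤⟨ ∣p∣≤∣q∣+∣p─q∣ E T ⟩
                  ∣ T ∣ + ∣ E ─ T ∣              ≤⟨ ℕ.+-mono-≤ (ℕ.≤-reflexive (proj₁ bun)) E₁≤ ⟩
                  suc k + (b * suc k + ∣ E′ ∣)   ≡⟨ ℕ.+-assoc (suc k) (b * suc k) (∣ E′ ∣) ⟨
                  suc b * suc k + ∣ E′ ∣         ∎) , none
                where
                open ≤-Reasoning
                rest = clean′ b (W ─ spread T)
                  (ℕ.≤-pred (ℕ.≤-trans (p∩q≢∅⇒∣p─q∣<∣p∣ W (spread T) (proj₁ v , x∈p∩q⁺ (v∈W , v∈T))) W≤))
                  (E ─ T) (λ s s′ → sep (λ x → E₁⊆E (s x)) (λ x → E₁⊆E (s′ x)))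
                  (λ {T′} T′⊆ bun′ {x} x∈ → x∈p∧x∉q⇒x∈p─q (inW (λ y → E₁⊆E (T′⊆ y)) bun′ x∈)
                    (sep (λ y → E₁⊆E (T′⊆ y)) T⊆E bun′ bun (λ y∈ → x∈p─q⇒x∉q E T (T′⊆ y∈)) x∈))

          clean : ∀ E → Separated E →
                  ∃[ E′ ] E′ ⊆ E × ∣ E ∣ ≤ n * suc k + ∣ E′ ∣ × (∀ {T} → T ⊆ E′ → ¬ Bundle (suc k) c T)
          clean E sep = clean′ n ⊤ (∣p∣≤n ⊤) E sep (λ _ _ _ → ∈⊤)

-- Counting the ordered pairs of vertices covered by a set of edges.

module PairCounting where

  open FiveSets
  open Bundles
  open import Data.Bool.Base using (true; false; if_then_else_)
  open import Data.Fin.Base using (Fin; zero; suc)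
  open import Data.Fin.Properties using (_≟_; any?)
  open import Data.Fin.Subset using (Subset; inside; outside; ∣_∣; _∈_; _∉_; _∪_; _∩_; ⁅_⁆; ⊥)
  open import Data.Fin.Subset.Properties
    using (∣⊥∣≡0; ∣p∣≤n; p⊆q⇒∣p∣≤∣q∣; x∈p∪q⁺; x∈p∪q⁻; x∈p∩q⁺; x∈p∩q⁻; x∈⁅x⁆; ∣⁅x⁆∣≡1; x∈⁅y⁆⇒x≡y; _∈?_;
           p─q⊆p; x∈p⇒∣p-x∣<∣p∣; x∈p∧x≢y⇒x∈p-y)
  open import Data.Nat.Base as ℕ using (ℕ; zero; suc; _+_; _*_; _∸_; _≤_; z≤n)
  open import Data.Nat.Properties as ℕ using (module ≤-Reasoning)
  open import Data.Nat.Tactic.RingSolver using (solve-∀)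
  open import Data.Product.Base using (∃-syntax; _×_; _,_; proj₁)
  open import Data.Sum.Base using (_⊎_; inj₁; inj₂)
  open import Data.Vec.Base using ([]; _∷_; lookup)
  open import Data.Vec.Properties using (lookup⇒[]=; []=⇒lookup)
  open import Function.Base using (_∘_)
  open import Relation.Binary.PropositionalEquality
  open import Relation.Nullary using (contradiction)
  open import Relation.Nullary.Decidable using (_×-dec_; ¬?)

  Σᶠ : ∀ {n} → (Fin n → ℕ) → ℕ
  Σᶠ {zero}  f = 0
  Σᶠ {suc n} f = f zero + Σᶠ (f ∘ suc)

  Σᶠ-mono : ∀ {n} {f g : Fin n → ℕ} → (∀ i → f i ≤ g i) → Σᶠ f ≤ Σᶠ g
  Σᶠ-mono {zero}  le = z≤n
  Σᶠ-mono {suc n} le = ℕ.+-mono-≤ (le zero) (Σᶠ-mono (le ∘ suc))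

  Σᶠ-+ : ∀ {n} (f g : Fin n → ℕ) → Σᶠ (λ i → f i + g i) ≡ Σᶠ f + Σᶠ g
  Σᶠ-+ {zero}  f g = refl
  Σᶠ-+ {suc n} f g = trans (cong (f zero + g zero +_) (Σᶠ-+ (f ∘ suc) (g ∘ suc)))
    (shift (f zero) (g zero) (Σᶠ (f ∘ suc)) (Σᶠ (g ∘ suc)))
    where
    shift : ∀ a b c d → (a + b) + (c + d) ≡ (a + c) + (b + d)
    shift = solve-∀

  Σᶠ-cong : ∀ {n} {f g : Fin n → ℕ} → (∀ i → f i ≡ g i) → Σᶠ f ≡ Σᶠ g
  Σᶠ-cong {zero}  eq = refl
  Σᶠ-cong {suc n} eq = cong₂ _+_ (eq zero) (Σᶠ-cong (eq ∘ suc))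

  Σᶠ-const : ∀ n c → Σᶠ {n} (λ _ → c) ≡ n * c
  Σᶠ-const zero    c = refl
  Σᶠ-const (suc n) c = cong (c +_) (Σᶠ-const n c)

  Σᶠ-indicator : ∀ {n} (s : Subset n) c → Σᶠ (λ u → if lookup s u then c else 0) ≡ ∣ s ∣ * c
  Σᶠ-indicator []            c = refl
  Σᶠ-indicator (inside  ∷ s) c = cong (c +_) (Σᶠ-indicator s c)
  Σᶠ-indicator (outside ∷ s) c = Σᶠ-indicator s c

  -- A set of ordered pairs, kept by rows so that its size is a sum of sizes of subsets.
  Rel : ℕ → Set
  Rel n = Fin n → Subset n

  module _ {n : ℕ} where

    infix 4 _⊑_
    _⊑_ : Rel n → Rel n → Set
    R ⊑ R′ = ∀ {u v} → v ∈ R u → v ∈ R′ u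

    infixr 6 _⊔_ _⊓_
    _⊔_ _⊓_ : Rel n → Rel n → Rel n
    (R ⊔ R′) u = R u ∪ R′ u
    (R ⊓ R′) u = R u ∩ R′ u

    abstract

      ‖_‖ : Rel n → ℕ
      ‖ R ‖ = Σᶠ (λ u → ∣ R u ∣)

      ‖‖-mono : ∀ {R R′} → R ⊑ R′ → ‖ R ‖ ≤ ‖ R′ ‖
      ‖‖-mono {R} {R′} sub = Σᶠ-mono λ u → p⊆q⇒∣p∣≤∣q∣ {p = R u} {q = R′ u} (sub {u})

      ‖⊔‖+‖⊓‖ : ∀ R R′ → ‖ R ⊔ R′ ‖ + ‖ R ⊓ R′ ‖ ≡ ‖ R ‖ + ‖ R′ ‖
      ‖⊔‖+‖⊓‖ R R′ = trans (sym (Σᶠ-+ (λ u → ∣ R u ∪ R′ u ∣) (λ u → ∣ R u ∩ R′ u ∣)))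
        (trans (Σᶠ-cong λ u → ∣∪∣+∣∩∣ (R u) (R′ u)) (Σᶠ-+ (λ u → ∣ R u ∣) (λ u → ∣ R′ u ∣)))

      ‖‖≤n² : ∀ R → ‖ R ‖ ≤ n * n
      ‖‖≤n² R = ℕ.≤-trans (Σᶠ-mono λ u → ∣p∣≤n (R u)) (ℕ.≤-reflexive (Σᶠ-const n n))

      ‖‖≡0 : ∀ {R} → (∀ {u v} → v ∉ R u) → ‖ R ‖ ≡ 0
      ‖‖≡0 {R} empty = trans (Σᶠ-cong λ u → ℕ.n≤0⇒n≡0 (row u)) (trans (Σᶠ-const n 0) (ℕ.*-zeroʳ n))
        where
        row : ∀ u → ∣ R u ∣ ≤ 0
        row u = ℕ.≤-trans (p⊆q⇒∣p∣≤∣q∣ {q = ⊥} (λ v∈ → contradiction v∈ empty)) (ℕ.≤-reflexive (∣⊥∣≡0 n))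

    within : Subset n → Rel n
    within s u = ⟪ (λ v → (u ∈? s) ×-dec (v ∈? s) ×-dec ¬? (u ≟ v)) ⟫

    ∈-within⁺ : ∀ {s u v} → u ∈ s → v ∈ s → u ≢ v → v ∈ within s u
    ∈-within⁺ {s} {u} u∈ v∈ u≢v = ∈⟪⟫⁺ (λ v → (u ∈? s) ×-dec (v ∈? s) ×-dec ¬? (u ≟ v)) (u∈ , v∈ , u≢v)

    ∈-within⁻ : ∀ {s u v} → v ∈ within s u → u ∈ s × v ∈ s × u ≢ v
    ∈-within⁻ {s} {u} = ∈⟪⟫⁻ (λ v → (u ∈? s) ×-dec (v ∈? s) ×-dec ¬? (u ≟ v))

    abstract

      ‖within‖ : ∀ s → ‖ within s ‖ ≡ ∣ s ∣ * (∣ s ∣ ∸ 1)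
      ‖within‖ s = trans (Σᶠ-cong row) (Σᶠ-indicator s (∣ s ∣ ∸ 1))
        where
        member : ∀ u → u ∈ s → ∣ within s u ∣ ≡ ∣ s ∣ ∸ 1
        member u u∈ = trans
          (ℕ.≤-antisym
            (p⊆q⇒∣p∣≤∣q∣ λ v∈ → let _ , v∈s , ne = ∈-within⁻ v∈ in x∈p∧x≢y⇒x∈p-y v∈s (ne ∘ sym))
            (p⊆q⇒∣p∣≤∣q∣ λ v∈ → ∈-within⁺ u∈ (p─q⊆p s ⁅ u ⁆ v∈) (λ { refl → x∉p-x s v∈ })))
          (sym (cong (_∸ 1) (ℕ.≤-antisym (∣p∣≤1+∣p-x∣ s u) (x∈p⇒∣p-x∣<∣p∣ u∈))))
        row : ∀ u → ∣ within s u ∣ ≡ (if lookup s u then ∣ s ∣ ∸ 1 else 0)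
        row u with lookup s u in eq
        ... | true  = member u (lookup⇒[]= u s eq)
        ... | false = ℕ.n≤0⇒n≡0 (ℕ.≤-trans (p⊆q⇒∣p∣≤∣q∣ {q = ⊥} λ v∈ →
          contradiction (trans (sym ([]=⇒lookup (proj₁ (∈-within⁻ v∈)))) eq) λ ()) (ℕ.≤-reflexive (∣⊥∣≡0 n)))

    ‖within‖≤2 : ∀ {s} → ∣ s ∣ ≤ 2 → ‖ within s ‖ ≤ 2
    ‖within‖≤2 {s} s≤2 = ℕ.≤-trans (ℕ.≤-reflexive (‖within‖ s)) (ℕ.*-mono-≤ s≤2 (ℕ.∸-monoˡ-≤ 1 s≤2))

    ∣⁅⁆∪⁅⁆∣ : ∀ {u v : Fin n} → u ≢ v → ∣ ⁅ u ⁆ ∪ ⁅ v ⁆ ∣ ≡ 2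
    ∣⁅⁆∪⁅⁆∣ {u} {v} u≢v = trans (∣∪∣-disjoint λ x∈u x∈v → u≢v (trans (sym (x∈⁅y⁆⇒x≡y u x∈u)) (x∈⁅y⁆⇒x≡y v x∈v)))
      (cong₂ _+_ (∣⁅x⁆∣≡1 u) (∣⁅x⁆∣≡1 v))

    couple : Fin n → Fin n → Rel n
    couple u v = within (⁅ u ⁆ ∪ ⁅ v ⁆)

    ‖couple‖ : ∀ {u v} → u ≢ v → ‖ couple u v ‖ ≡ 2
    ‖couple‖ u≢v = trans (‖within‖ _) (cong (λ k → k * (k ∸ 1)) (∣⁅⁆∪⁅⁆∣ u≢v))

    ∈-couple : ∀ {u v x y} → y ∈ couple u v x → (x ≡ u × y ≡ v) ⊎ (x ≡ v × y ≡ u)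
    ∈-couple {u} {v} y∈ =
      let x∈ , y∈′ , x≢y = ∈-within⁻ y∈ in sort (x∈p∪q⁻ ⁅ u ⁆ ⁅ v ⁆ x∈) (x∈p∪q⁻ ⁅ u ⁆ ⁅ v ⁆ y∈′) x≢y
      where
      sort : ∀ {x y} → x ∈ ⁅ u ⁆ ⊎ x ∈ ⁅ v ⁆ → y ∈ ⁅ u ⁆ ⊎ y ∈ ⁅ v ⁆ → x ≢ y → (x ≡ u × y ≡ v) ⊎ (x ≡ v × y ≡ u)
      sort (inj₁ a) (inj₁ b) ne = contradiction (trans (x∈⁅y⁆⇒x≡y u a) (sym (x∈⁅y⁆⇒x≡y u b))) ne
      sort (inj₁ a) (inj₂ b) ne = inj₁ (x∈⁅y⁆⇒x≡y u a , x∈⁅y⁆⇒x≡y v b)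
      sort (inj₂ a) (inj₁ b) ne = inj₂ (x∈⁅y⁆⇒x≡y v a , x∈⁅y⁆⇒x≡y u b)
      sort (inj₂ a) (inj₂ b) ne = contradiction (trans (x∈⁅y⁆⇒x≡y v a) (sym (x∈⁅y⁆⇒x≡y v b))) ne

    ‖⊔‖-disjoint : ∀ {R R′} → (∀ {u v} → v ∈ R u → v ∉ R′ u) → ‖ R ‖ + ‖ R′ ‖ ≤ ‖ R ⊔ R′ ‖
    ‖⊔‖-disjoint {R} {R′} dis = ℕ.≤-reflexive (trans (sym (‖⊔‖+‖⊓‖ R R′)) (trans (cong (‖ R ⊔ R′ ‖ +_)
      (‖‖≡0 {R ⊓ R′} λ {u} v∈ → let a , b = x∈p∩q⁻ (R u) (R′ u) v∈ in dis a b)) (ℕ.+-identityʳ _)))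

  module _ {m n : ℕ} (A : Fin m → Subset n) where

    abstract

      cover : Subset m → Rel n
      cover T u = ⟪ (λ v → ¬? (u ≟ v) ×-dec (any? λ i → (i ∈? T) ×-dec (u ∈? A i) ×-dec (v ∈? A i))) ⟫

      ∈-cover⁺ : ∀ {T i u v} → u ≢ v → i ∈ T → u ∈ A i → v ∈ A i → v ∈ cover T u
      ∈-cover⁺ {T} {u = u} ne i∈ u∈ v∈ = ∈⟪⟫⁺ (λ v → ¬? (u ≟ v) ×-dec (any? λ i → (i ∈? T) ×-dec (u ∈? A i) ×-dec (v ∈? A i)))
        (ne , _ , i∈ , u∈ , v∈)

      ∈-cover⁻ : ∀ {T u v} → v ∈ cover T u → u ≢ v × ∃[ i ] i ∈ T × u ∈ A i × v ∈ A i
      ∈-cover⁻ {T} {u} = ∈⟪⟫⁻ (λ v → ¬? (u ≟ v) ×-dec (any? λ i → (i ∈? T) ×-dec (u ∈? A i) ×-dec (v ∈? A i)))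

    module _ (r : ℕ) (size : ∀ i → ∣ A i ∣ ≡ r) where

      -- `c` bounds the ordered pairs by which `R` falls short of `k` edges with no common pair.
      Count : (k c : ℕ) → Rel n → Set
      Count k c R = k * (r * (r ∸ 1)) ≤ ‖ R ‖ + c

      private

        ‖edge‖ : ∀ i → ‖ within (A i) ‖ ≡ r * (r ∸ 1)
        ‖edge‖ i = trans (‖within‖ (A i)) (cong (λ k → k * (k ∸ 1)) (size i))

        cover-add : ∀ T i → cover T ⊔ within (A i) ⊑ cover (T ∪ ⁅ i ⁆)
        cover-add T i {u} v∈ with x∈p∪q⁻ (cover T u) (within (A i) u) v∈
        ... | inj₁ v∈T = let ne , j , j∈ , uj , vj = ∈-cover⁻ v∈T in ∈-cover⁺ ne (x∈p∪q⁺ (inj₁ j∈)) uj vj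
        ... | inj₂ v∈i = let ui , vi , ne = ∈-within⁻ v∈i in ∈-cover⁺ ne (x∈p∪q⁺ (inj₂ (x∈⁅x⁆ i))) ui vi

        count-add′ : ∀ {k c T i} t → Count k c (cover T) → ‖ cover T ⊓ within (A i) ‖ ≤ t →
                     Count (k + 1) (c + t) (cover (T ∪ ⁅ i ⁆))
        count-add′ {k} {c} {T} {i} t count small = begin
          (k + 1) * q                                     ≡⟨ shift₁ k q ⟩
          k * q + q                                       ≤⟨ ℕ.+-mono-≤ count (ℕ.≤-reflexive (sym (‖edge‖ i))) ⟩
          (‖ cover T ‖ + c) + ‖ within (A i) ‖            ≡⟨ shift₂ (‖ cover T ‖) (‖ within (A i) ‖) c ⟩
          (‖ cover T ‖ + ‖ within (A i) ‖) + c            ≡⟨ cong (_+ c) (‖⊔‖+‖⊓‖ (cover T) (within (A i))) ⟨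
          (‖ cover T ⊔ within (A i) ‖ + ‖ cover T ⊓ within (A i) ‖) + c
                                                          ≤⟨ ℕ.+-monoˡ-≤ c (ℕ.+-mono-≤ (‖‖-mono {R = cover T ⊔ within (A i)} (cover-add T i)) small) ⟩
          (‖ cover (T ∪ ⁅ i ⁆) ‖ + t) + c                 ≡⟨ shift₃ (‖ cover (T ∪ ⁅ i ⁆) ‖) t c ⟩
          ‖ cover (T ∪ ⁅ i ⁆) ‖ + (c + t)                 ∎
          where
          open ≤-Reasoning
          q = r * (r ∸ 1)
          shift₁ : ∀ x y → (x + 1) * y ≡ x * y + y
          shift₁ = solve-∀
          shift₂ : ∀ x y z → (x + z) + y ≡ (x + y) + z
          shift₂ = solve-∀
          shift₃ : ∀ x y z → (x + y) + z ≡ x + (z + y)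
          shift₃ = solve-∀

      count-single : ∀ i → Count 1 0 (cover ⁅ i ⁆)
      count-single i = begin
        1 * (r * (r ∸ 1))     ≡⟨ ℕ.*-identityˡ _ ⟩
        r * (r ∸ 1)           ≡⟨ ‖edge‖ i ⟨
        ‖ within (A i) ‖      ≤⟨ ‖‖-mono {R = within (A i)} (λ v∈ → let u∈ , v∈′ , ne = ∈-within⁻ v∈ in ∈-cover⁺ ne (x∈⁅x⁆ i) u∈ v∈′) ⟩
        ‖ cover ⁅ i ⁆ ‖       ≡⟨ ℕ.+-identityʳ _ ⟨
        ‖ cover ⁅ i ⁆ ‖ + 0   ∎
        where open ≤-Reasoning

      -- Pairs counted twice lie in an intersection of at most two vertices, so at most two ordered
      -- pairs are lost.
      count-add : ∀ {k c T i} → Count k c (cover T) → ∣ spread A T ∩ A i ∣ ≤ 2 → Count (k + 1) (c + 2) (cover (T ∪ ⁅ i ⁆))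
      count-add {k} {c} {T} {i} count small = count-add′ {k} {c} {T} {i} 2 count
        (ℕ.≤-trans (‖‖-mono {R = cover T ⊓ within (A i)} sub) (‖within‖≤2 small))
        where
        sub : cover T ⊓ within (A i) ⊑ within (spread A T ∩ A i)
        sub {u} v∈ = let v∈₁ , v∈₂ = x∈p∩q⁻ (cover T u) (within (A i) u) v∈
                         ne , j , j∈ , uj , vj = ∈-cover⁻ v∈₁ ; ui , vi , _ = ∈-within⁻ v∈₂
                     in ∈-within⁺ (x∈p∩q⁺ (∈-spread⁺ A j∈ uj , ui)) (x∈p∩q⁺ (∈-spread⁺ A j∈ vj , vi)) ne

      count-add-skew : ∀ {k c T i} → Count k c (cover T) → (∀ {j} → j ∈ T → ∣ A j ∩ A i ∣ ≤ 1) → Count (k + 1) (c + 0) (cover (T ∪ ⁅ i ⁆))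
      count-add-skew {k} {c} {T} {i} count skew = count-add′ {k} {c} {T} {i} 0 count (ℕ.≤-reflexive (‖‖≡0 {R = cover T ⊓ within (A i)} λ {u} v∈ →
        let v∈₁ , v∈₂ = x∈p∩q⁻ (cover T u) (within (A i) u) v∈
            ne , j , j∈ , uj , vj = ∈-cover⁻ v∈₁ ; ui , vi , _ = ∈-within⁻ v∈₂
        in ne (≤1⇒linear (skew j∈) uj ui vj vi)))

      -- An uncovered pair, taken in both orders, pays back two.
      count-couple : ∀ {k c T u v} → Count k (2 + c) (cover T) → u ≢ v → (∀ {i} → i ∈ T → u ∈ A i → v ∉ A i) →
                     Count k c (cover T ⊔ couple u v)
      count-couple {k} {c} {T} {u} {v} count u≢v apart = begin
        k * (r * (r ∸ 1))                  ≤⟨ count ⟩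
        ‖ cover T ‖ + (2 + c)              ≡⟨ ℕ.+-assoc (‖ cover T ‖) 2 c ⟨
        (‖ cover T ‖ + 2) + c              ≡⟨ cong (λ z → (‖ cover T ‖ + z) + c) (‖couple‖ u≢v) ⟨
        (‖ cover T ‖ + ‖ couple u v ‖) + c ≤⟨ ℕ.+-monoˡ-≤ c (‖⊔‖-disjoint {R = cover T} {R′ = couple u v} dis) ⟩
        ‖ cover T ⊔ couple u v ‖ + c       ∎
        where
        open ≤-Reasoning
        dis : ∀ {x y} → y ∈ cover T x → y ∉ couple u v x
        dis y∈ y∈′ with ∈-cover⁻ y∈ | ∈-couple y∈′
        ... | _ , i , i∈ , xi , yi | inj₁ (refl , refl) = apart i∈ xi yi
        ... | _ , i , i∈ , xi , yi | inj₂ (refl , refl) = apart i∈ yi xi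

-- The upper bound by charging pairs to groups of edges.

module UpperBound where

  open FiveSets
  open Bundles
  open PairCounting
  open import Data.Fin.Base using (Fin; zero; suc)
  open import Data.Fin.Properties using (_≟_; any?)
  open import Data.Fin.Subset using (Subset; ∣_∣; _∈_; _∉_; _⊆_; _∪_; _∩_; _─_; _-_; ⁅_⁆; ⊥; ⊤; Nonempty)
  open import Data.Fin.Subset.Properties
    using (∉⊥; ∣p∣≤n; ∣⊤∣≡n; p⊆q⇒∣p∣≤∣q∣; x∈p∪q⁺; x∈p∪q⁻; x∈p∩q⁺; x∈p∩q⁻; x∈⁅x⁆; ∣⁅x⁆∣≡1; x∈⁅y⁆⇒x≡y; _∈?_;
           p─q⊆p; x∈p∧x∉q⇒x∈p─q; p∩q≢∅⇒∣p─q∣<∣p∣; x∈p⇒∣p-x∣<∣p∣; x∈p∧x≢y⇒x∈p-y)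
  open import Data.Nat.Base as ℕ using (ℕ; zero; suc; _+_; _*_; _∸_; _≤_; _<_; s≤s; z≤n)
  open import Data.Nat.Properties as ℕ using (module ≤-Reasoning)
  open import Data.Nat.Tactic.RingSolver using (solve-∀)
  open import Data.Product.Base using (∃; ∃-syntax; _×_; _,_; proj₁; proj₂)
  open import Data.Sum.Base using (_⊎_; inj₁; inj₂; [_,_]′)
  open import Function.Base using (_∘_)
  open import Relation.Binary.PropositionalEquality
  open import Relation.Nullary using (¬_; Dec; yes; no; contradiction)
  open import Relation.Nullary.Decidable using (_×-dec_; ¬?; map′; decidable-stable)

  module _ {n : ℕ} where

    saturated : ∀ {S T : Subset n} → ∣ S ∣ ≤ 2 → 2 ≤ ∣ T ∣ → T ⊆ S → S ⊆ T
    saturated {S} {T} S≤2 2≤T T⊆S {u} u∈S with u ∈? T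
    ... | yes u∈T = u∈T
    ... | no  u∉T = contradiction (ℕ.≤-trans 2≤T (p⊆q⇒∣p∣≤∣q∣ {p = T} {q = S - u} λ x∈ → x∈p∧x≢y⇒x∈p-y (T⊆S x∈) λ { refl → u∉T x∈ }))
                                  (ℕ.<⇒≱ (ℕ.<-≤-trans (x∈p⇒∣p-x∣<∣p∣ u∈S) S≤2))

    abstract

      escape : ∀ (p q : Subset n) → ∣ p ∩ q ∣ < ∣ p ∣ → ∃[ x ] x ∈ p × x ∉ q
      escape p q small with any? (λ x → (x ∈? p) ×-dec ¬? (x ∈? q))
      ... | yes w = w
      ... | no ¬w = contradiction (p⊆q⇒∣p∣≤∣q∣ {p = p} {q = p ∩ q} λ {x} x∈ → x∈p∩q⁺ (x∈ , decidable-stable (x ∈? q) λ x∉ → ¬w (x , x∈ , x∉))) (ℕ.<⇒≱ small)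

    ∈-snoc⁻ : ∀ {T : Subset n} {i x} → x ∈ T ∪ ⁅ i ⁆ → x ∈ T ⊎ x ≡ i
    ∈-snoc⁻ {T} {i} x∈ = [ inj₁ , inj₂ ∘ x∈⁅y⁆⇒x≡y i ]′ (x∈p∪q⁻ T ⁅ i ⁆ x∈)

    ∈-snoc : ∀ {T : Subset n} {i} → i ∈ T ∪ ⁅ i ⁆
    ∈-snoc {i = i} = x∈p∪q⁺ (inj₂ (x∈⁅x⁆ i))

    ∈-keep : ∀ {T U : Subset n} {x} → x ∈ T → x ∈ T ∪ U
    ∈-keep x∈ = x∈p∪q⁺ (inj₁ x∈)

    snoc⊆ : ∀ {T U : Subset n} {i} → T ⊆ U → i ∈ U → T ∪ ⁅ i ⁆ ⊆ U
    snoc⊆ {T} {U} T⊆U i∈U x∈ with ∈-snoc⁻ {T = T} x∈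
    ... | inj₁ x∈T  = T⊆U x∈T
    ... | inj₂ refl = i∈U

    single⊆ : ∀ {U : Subset n} {i} → i ∈ U → ⁅ i ⁆ ⊆ U
    single⊆ {i = i} i∈U x∈ with x∈⁅y⁆⇒x≡y i x∈
    ... | refl = i∈U

    pair₁ : ∀ {e f : Fin n} → e ∈ ⁅ e ⁆ ∪ ⁅ f ⁆
    pair₁ {e} = ∈-keep (x∈⁅x⁆ e)

    trio : Fin n → Fin n → Fin n → Subset n
    trio e f g = (⁅ e ⁆ ∪ ⁅ f ⁆) ∪ ⁅ g ⁆

    trio₁ : ∀ {e f g} → e ∈ trio e f g
    trio₁ = ∈-keep pair₁

    trio₂ : ∀ {e f g} → f ∈ trio e f g
    trio₂ = ∈-keep ∈-snoc

    trio₃ : ∀ {e f g} → g ∈ trio e f g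
    trio₃ = ∈-snoc

    ∈-trio : ∀ {e f g x} → x ∈ trio e f g → x ≡ e ⊎ x ≡ f ⊎ x ≡ g
    ∈-trio {e} {f} {g} x∈ with ∈-snoc⁻ {T = ⁅ e ⁆ ∪ ⁅ f ⁆} x∈
    ... | inj₂ x≡g = inj₂ (inj₂ x≡g)
    ... | inj₁ x∈′ with ∈-snoc⁻ {T = ⁅ e ⁆} x∈′
    ...   | inj₂ x≡f = inj₂ (inj₁ x≡f)
    ...   | inj₁ x∈e = inj₁ (x∈⁅y⁆⇒x≡y e x∈e)

  module _ {m n r : ℕ} (A : Fin m → Subset n) (size : ∀ i → ∣ A i ∣ ≡ r) (3≤r : 3 ≤ r)
           (no₅ : ∀ {T} → ¬ Bundle A r 5 8 T) where

    private

      B : ℕ → ℕ → Subset m → Set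
      B = Bundle A r

      infix 4 _~_
      _~_ : Fin m → Fin m → Set
      e ~ f = 2 ≤ ∣ A e ∩ A f ∣

      ~-sym : ∀ {e f} → e ~ f → f ~ e
      ~-sym {e} {f} e~f = ℕ.≤-trans e~f (∣∩∣-comm (A e) (A f))

      meets : ∀ {T : Subset m} {X Y : Subset n} {t} → X ⊆ spread A T → t ≤ ∣ X ∩ Y ∣ → t ≤ ∣ spread A T ∩ Y ∣
      meets {T} {X} {Y} X⊆ t≤ = ℕ.≤-trans t≤ (p⊆q⇒∣p∣≤∣q∣ {p = X ∩ Y} {q = spread A T ∩ Y} (∩-mono {p = X} {q = Y} X⊆ (λ x → x)))

      edge⊆ : ∀ {T i} → i ∈ T → A i ⊆ spread A T
      edge⊆ i∈ = ∈-spread⁺ A i∈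

      edges⊆ : ∀ {T i j} → i ∈ T → j ∈ T → A i ∪ A j ⊆ spread A T
      edges⊆ i∈ j∈ = ∪-least (edge⊆ i∈) (edge⊆ j∈)

      pair : ∀ {e f} → e ≢ f → e ~ f → B 2 2 (⁅ e ⁆ ∪ ⁅ f ⁆)
      pair {e} {f} e≢f e~f = add A r size 2 (single A r size e) (λ f∈ → e≢f (sym (x∈⁅y⁆⇒x≡y e f∈)))
        (meets {⁅ e ⁆} (edge⊆ (x∈⁅x⁆ e)) e~f)

      record Path (e f g : Fin m) : Set where
        constructor path
        field
          e≢f : e ≢ f
          f≢g : f ≢ g
          e≢g : e ≢ g
          e~f : e ~ f
          f~g : f ~ g

      path? : ∀ e f g → Dec (Path e f g)
      path? e f g = map′ (λ (a , b , c , d , h) → path a b c d h) (λ (path a b c d h) → a , b , c , d , h)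
        (¬? (e ≟ f) ×-dec ¬? (f ≟ g) ×-dec ¬? (e ≟ g) ×-dec (2 ℕ.≤? _) ×-dec (2 ℕ.≤? _))

      not-in-pair : ∀ {e f g} → Path e f g → g ∉ ⁅ e ⁆ ∪ ⁅ f ⁆
      not-in-pair {e} P g∈ with ∈-snoc⁻ {T = ⁅ e ⁆} g∈
      ... | inj₁ g∈e  = Path.e≢g P (sym (x∈⁅y⁆⇒x≡y e g∈e))
      ... | inj₂ refl = Path.f≢g P refl

      path-bundle : ∀ {e f g} → Path e f g → B 3 4 (trio e f g)
      path-bundle {e} {f} P = add A r size 2 (pair e≢f e~f) (not-in-pair P) (meets {⁅ e ⁆ ∪ ⁅ f ⁆} (edge⊆ ∈-snoc) f~g)
        where open Path P

      0<r : 0 < r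
      0<r = ℕ.≤-trans (s≤s z≤n) 3≤r

      -- The first bundle and an edge of the second through a common vertex: five edges of
      -- deficiency 7 + 1.
      sep₄ : Separated A r size 3 7 0<r ⊤
      sep₄ _ _ b b′ dis v∈ v∈′ = let i , i∈ , v∈i = ∈-spread⁻ A v∈′ in
        no₅ (add A r size 1 b (λ i∈T → dis i∈T i∈) (nonempty⇒0< (x∈p∩q⁺ (v∈ , v∈i))))

      -- Together they are four edges of deficiency 3 + 3 + 1 = 7.
      sep₂ : ∀ {G} → (∀ {T} → T ⊆ G → ¬ B 4 7 T) → Separated A r size 1 3 0<r G
      sep₂ no₄ {T} {T′} T⊆ T′⊆ b b′ dis v∈ v∈′ = no₄ (∪-least T⊆ T′⊆) (merge A r 1 b b′ dis (nonempty⇒0< (x∈p∩q⁺ (v∈ , v∈′))))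

      -- Otherwise the edge shares at most two vertices with the union of the other two, which would
      -- then keep deficiency 5 - 2 = 3.
      partner : ∀ {T i} → (∀ {T′} → T′ ⊆ T → ¬ B 2 3 T′) → B 3 5 T → i ∈ T → ∃[ j ] j ∈ T × i ≢ j × i ~ j
      partner {T} {i} no₂ (T≡3 , V≤) i∈ with any? (λ j → (j ∈? T) ×-dec ¬? (i ≟ j) ×-dec (2 ℕ.≤? ∣ A i ∩ A j ∣))
      ... | yes w = w
      ... | no ¬w = contradiction (T′≡2 , V′≤) (no₂ (p─q⊆p T ⁅ i ⁆))
        where
        T′ = T - i
        V′ = spread A T′
        T′≡2 : ∣ T′ ∣ ≡ 2
        T′≡2 = ℕ.suc-injective (trans (ℕ.≤-antisym (x∈p⇒∣p-x∣<∣p∣ i∈) (∣p∣≤1+∣p-x∣ T i)) T≡3)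
        few : ∣ A i ∩ V′ ∣ ≤ 2
        few = few-meets A 2 {A i} T′ (ℕ.≤-reflexive T′≡2) λ {j} j∈ →
          ℕ.≤-pred (ℕ.≰⇒> λ i~j → ¬w (j , p─q⊆p T ⁅ i ⁆ j∈ , (λ { refl → x∉p-x T j∈ }) , i~j))
        V′≤ : ∣ V′ ∣ + 3 ≤ 2 * r
        V′≤ = ℕ.+-cancelˡ-≤ (r + 2) _ _ (begin
          (r + 2) + (∣ V′ ∣ + 3)                      ≡⟨ shift₁ r (∣ V′ ∣) ⟩
          (r + ∣ V′ ∣) + 5                            ≡⟨ cong (λ k → (k + ∣ V′ ∣) + 5) (size i) ⟨
          (∣ A i ∣ + ∣ V′ ∣) + 5                      ≡⟨ cong (_+ 5) (∣∪∣+∣∩∣ (A i) V′) ⟨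
          (∣ A i ∪ V′ ∣ + ∣ A i ∩ V′ ∣) + 5           ≤⟨ ℕ.+-monoˡ-≤ 5 (ℕ.+-mono-≤ (p⊆q⇒∣p∣≤∣q∣ {p = A i ∪ V′} {q = spread A T} (∪-least (edge⊆ i∈) (spread-mono A (p─q⊆p T ⁅ i ⁆)))) few) ⟩
          (∣ spread A T ∣ + 2) + 5                    ≡⟨ shift₂ (∣ spread A T ∣) ⟩
          (∣ spread A T ∣ + 5) + 2                    ≤⟨ ℕ.+-monoˡ-≤ 2 V≤ ⟩
          3 * r + 2                                   ≡⟨ shift₃ r ⟩
          (r + 2) + 2 * r                             ∎)
          where
          open ≤-Reasoning
          shift₁ : ∀ x y → (x + 2) + (y + 3) ≡ (x + y) + 5
          shift₁ = solve-∀
          shift₂ : ∀ x → (x + 2) + 5 ≡ (x + 5) + 2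
          shift₂ = solve-∀
          shift₃ : ∀ x → 3 * x + 2 ≡ (x + 2) + 2 * x
          shift₃ = solve-∀

      -- The first bundle, with the edge of the second at the common vertex and its `partner`, makes
      -- five edges of deficiency 5 + 2 + 1.
      sep₃ : ∀ {G} → (∀ {T} → T ⊆ G → ¬ B 2 3 T) → Separated A r size 2 5 0<r G
      sep₃ no₂ {T} {T′} T⊆ T′⊆ b b′ dis v∈ v∈′ =
        let i , i∈ , v∈i = ∈-spread⁻ A v∈′
            j , j∈ , i≢j , i~j = partner (λ s → no₂ (λ x → T′⊆ (s x))) b′ i∈
        in no₅ (merge A r 1 b (pair i≢j i~j) (λ x∈T x∈ij → dis x∈T (snoc⊆ (single⊆ i∈) j∈ x∈ij))
             (nonempty⇒0< (x∈p∩q⁺ (v∈ , edge⊆ pair₁ v∈i))))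

      -- The order is forced: `sep₂` needs the bundles of four to be gone, and `sep₃` those of two.
      -- The price is 4 + 2 + 3 edges per vertex.
      cleaned : ∃[ G ] m ≤ 9 * n + ∣ G ∣ × (∀ {T} → T ⊆ G → ¬ B 4 7 T) × (∀ {T} → T ⊆ G → ¬ B 2 3 T) × (∀ {T} → T ⊆ G → ¬ B 3 5 T)
      cleaned =
        let G₁ , _    , le₁ , no₄ = clean A r size 3 7 0<r ⊤ sep₄
            G₂ , G₂⊆ , le₂ , no₂ = clean A r size 1 3 0<r G₁ (sep₂ no₄)
            G₃ , G₃⊆ , le₃ , no₃ = clean A r size 2 5 0<r G₂ (sep₃ no₂)
        in G₃ , (begin
          m                                            ≡⟨ ∣⊤∣≡n m ⟨
          ∣ ⊤ {m} ∣                                    ≤⟨ le₁ ⟩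
          n * 4 + ∣ G₁ ∣                               ≤⟨ ℕ.+-monoʳ-≤ (n * 4) (ℕ.≤-trans le₂ (ℕ.+-monoʳ-≤ (n * 2) le₃)) ⟩
          n * 4 + (n * 2 + (n * 3 + ∣ G₃ ∣))           ≡⟨ shift n (∣ G₃ ∣) ⟩
          9 * n + ∣ G₃ ∣                               ∎)
          , (λ s → no₄ (λ x → G₂⊆ (G₃⊆ (s x)))) , (λ s → no₂ (λ x → G₃⊆ (s x))) , no₃
        where
        open ≤-Reasoning
        shift : ∀ x y → x * 4 + (x * 2 + (x * 3 + y)) ≡ 9 * x + y
        shift = solve-∀

      module Cleaned (G : Subset m) (no₄ : ∀ {T} → T ⊆ G → ¬ B 4 7 T) (no₂ : ∀ {T} → T ⊆ G → ¬ B 2 3 T)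
                     (no₃ : ∀ {T} → T ⊆ G → ¬ B 3 5 T) (ρ : ℕ) (ρ≡ : suc ρ ≡ r * (r ∸ 1)) where

        few₁ : ∀ {e f} → e ∈ G → f ∈ G → e ≢ f → ∣ spread A ⁅ e ⁆ ∩ A f ∣ ≤ 2
        few₁ {e} e∈ f∈ e≢f = ℕ.≤-pred (ℕ.≰⇒> λ 3≤ → no₂ (snoc⊆ (single⊆ e∈) f∈)
          (add A r size 3 (single A r size e) (λ f∈e → e≢f (sym (x∈⁅y⁆⇒x≡y e f∈e))) 3≤))

        few₂ : ∀ {T g} → B 2 2 T → T ⊆ G → g ∈ G → g ∉ T → ∣ spread A T ∩ A g ∣ ≤ 2
        few₂ b T⊆ g∈ g∉ = ℕ.≤-pred (ℕ.≰⇒> λ 3≤ → no₃ (snoc⊆ T⊆ g∈) (add A r size 3 b g∉ 3≤))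

        few₃ : ∀ {T g} → B 3 4 T → T ⊆ G → g ∈ G → g ∉ T → ∣ spread A T ∩ A g ∣ ≤ 2
        few₃ b T⊆ g∈ g∉ = ℕ.≤-pred (ℕ.≰⇒> λ 3≤ → no₄ (snoc⊆ T⊆ g∈) (add A r size 3 b g∉ 3≤))

        few₄ : ∀ {T g} → B 4 6 T → g ∉ T → ∣ spread A T ∩ A g ∣ ≤ 1
        few₄ b g∉ = ℕ.≤-pred (ℕ.≰⇒> λ 2≤ → no₅ (add A r size 2 b g∉ 2≤))

        -- Says that no edge of `G` outside `E` contains a pair that `E` can claim.
        record Closed (E : Subset m) : Set where
          field
            adjacent : ∀ {e f} → e ∈ E → f ∈ G → e ~ f → f ∈ E
            spanned  : ∀ {e f g h} → Path e f g → e ∈ E → f ∈ E → g ∈ E → h ∈ G → 2 ≤ ∣ A h ∩ (A e ∪ A f) ∣ → h ∈ E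

        open Closed

        -- The second form admits an uncovered pair between adjacent edges. The third edge of the
        -- path belongs to it because two competing paths are refuted by counting all three edges of
        -- one of them.
        data Claimed (E : Subset m) (u v : Fin n) : Set where
          in-edge : ∀ {e} → e ∈ E → u ≢ v → u ∈ A e → v ∈ A e → Claimed E u v
          in-path : ∀ {e f g} → Path e f g → e ∈ E → f ∈ E → g ∈ E → u ≢ v → u ∈ A e ∪ A f → v ∈ A e ∪ A f → Claimed E u v

        claimed-mono : ∀ {E E′ u v} → E ⊆ E′ → Claimed E u v → Claimed E′ u v
        claimed-mono s (in-edge e∈ ne u∈ v∈) = in-edge (s e∈) ne u∈ v∈
        claimed-mono s (in-path P e∈ f∈ g∈ ne u∈ v∈) = in-path P (s e∈) (s f∈) (s g∈) ne u∈ v∈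

        -- If a single edge holds the pair on either side, closedness decides. For two paths, three
        -- edges of one and two of the other have deficiency 4 + 2 + 2.
        claimed-exclusive : ∀ {Γ E u v} → Γ ⊆ G → E ⊆ G → Closed Γ → Closed E → Disjoint Γ E → Claimed Γ u v → ¬ Claimed E u v
        claimed-exclusive Γ⊆ E⊆ cΓ cE dis (in-edge e∈ ne ue ve) (in-edge f∈ _ uf vf) =
          dis (adjacent cΓ e∈ (E⊆ f∈) (two-points⇒2≤ (x∈p∩q⁺ (ue , uf)) (x∈p∩q⁺ (ve , vf)) ne)) f∈
        claimed-exclusive Γ⊆ E⊆ cΓ cE dis (in-edge h∈ ne uh vh) (in-path P a∈ b∈ c∈ _ uab vab) =
          dis h∈ (spanned cE P a∈ b∈ c∈ (Γ⊆ h∈) (two-points⇒2≤ (x∈p∩q⁺ (uh , uab)) (x∈p∩q⁺ (vh , vab)) ne))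
        claimed-exclusive Γ⊆ E⊆ cΓ cE dis (in-path P e∈ f∈ g∈ ne uef vef) (in-edge h∈ _ uh vh) =
          dis (spanned cΓ P e∈ f∈ g∈ (E⊆ h∈) (two-points⇒2≤ (x∈p∩q⁺ (uh , uef)) (x∈p∩q⁺ (vh , vef)) ne)) h∈
        claimed-exclusive Γ⊆ E⊆ cΓ cE dis (in-path P e∈ f∈ g∈ ne uef vef) (in-path Q a∈ b∈ c∈ _ uab vab) =
          no₅ (merge A r 2 (path-bundle P) (pair (Path.e≢f Q) (Path.e~f Q))
            (λ x∈Γ x∈E → dis (snoc⊆ (snoc⊆ (single⊆ e∈) f∈) g∈ x∈Γ) (snoc⊆ (single⊆ a∈) b∈ x∈E))
            (two-points⇒2≤ (x∈p∩q⁺ (edges⊆ trio₁ trio₂ uef , edges⊆ pair₁ ∈-snoc uab))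
                           (x∈p∩q⁺ (edges⊆ trio₁ trio₂ vef , edges⊆ pair₁ ∈-snoc vab)) ne))

        -- `apart` is what keeps E ─ Γ closed under `spanned`; for `adjacent`, the symmetry of `~`
        -- does this.
        record Group (E Γ : Subset m) : Set where
          field
            Γ⊆E     : Γ ⊆ E
            some    : Nonempty Γ
            closed  : Closed Γ
            apart   : ∀ {a b c h} → Path a b c → a ∈ E ─ Γ → b ∈ E ─ Γ → c ∈ E ─ Γ → h ∈ Γ → ¬ (2 ≤ ∣ A h ∩ (A a ∪ A b) ∣)
            R       : Rel n
            claimed : ∀ {u v} → v ∈ R u → Claimed Γ u v
            count   : ∣ Γ ∣ * ρ ≤ ‖ R ‖

        -- As r (r - 1) = ρ + 1, a group may fall short by one ordered pair per edge.
        enough : ∀ {k c R} (Γ : Subset m) → ∣ Γ ∣ ≡ k → Count A r size k c R → c ≤ k → ∣ Γ ∣ * ρ ≤ ‖ R ‖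
        enough {k} {c} {R} Γ refl count c≤k = ℕ.+-cancelʳ-≤ k _ _ (begin
          k * ρ + k              ≡⟨ ℕ.+-comm (k * ρ) k ⟩
          k + k * ρ              ≡⟨ ℕ.*-suc k ρ ⟨
          k * suc ρ              ≡⟨ cong (k *_) ρ≡ ⟩
          k * (r * (r ∸ 1))      ≤⟨ count ⟩
          ‖ R ‖ + c              ≤⟨ ℕ.+-monoʳ-≤ ‖ R ‖ c≤k ⟩
          ‖ R ‖ + k              ∎)
          where open ≤-Reasoning

        cover-claimed : ∀ {Γ u v} → v ∈ cover A Γ u → Claimed Γ u v
        cover-claimed v∈ = let ne , _ , i∈ , ui , vi = ∈-cover⁻ A v∈ in in-edge i∈ ne ui vi

        -- An edge outside that met a path twice would, with its neighbour, complete the path to five edges on 5 r − 8 vertices.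
        partner-apart : ∀ {E Γ : Subset m} → (∀ {h} → h ∈ Γ → ∃[ h′ ] h′ ∈ Γ × h ≢ h′ × h ~ h′) → ∀ {a b c h} → Path a b c →
          a ∈ E ─ Γ → b ∈ E ─ Γ → c ∈ E ─ Γ → h ∈ Γ → ¬ (2 ≤ ∣ A h ∩ (A a ∪ A b) ∣)
        partner-apart {E} {Γ} partners {a} {b} {c} {h} P a∈ b∈ c∈ h∈ 2≤ =
          let h′ , h′∈ , h≢h′ , h~h′ = partners h∈ in
          no₅ (add A r size 2 (add A r size 2 (path-bundle P) (out h∈) (meets {T} (edges⊆ trio₁ trio₂) (ℕ.≤-trans 2≤ (∣∩∣-comm (A h) (A a ∪ A b)))))
            (λ h′∈′ → [ out h′∈ , h≢h′ ∘ sym ]′ (∈-snoc⁻ {T = T} h′∈′)) (meets {T ∪ ⁅ h ⁆} (edge⊆ ∈-snoc) h~h′))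
          where
          T = trio a b c
          T⊆ : T ⊆ E ─ Γ
          T⊆ = snoc⊆ (snoc⊆ (single⊆ a∈) b∈) c∈
          out : ∀ {x} → x ∈ Γ → x ∉ T
          out x∈ x∈T = x∈p─q⇒x∉q E Γ (T⊆ x∈T) x∈

        module OfPath {E : Subset m} (E⊆G : E ⊆ G) (cE : Closed E) {e f g : Fin m} (P : Path e f g) (e∈ : e ∈ E) (f∈ : f ∈ E) (g∈ : g ∈ E) where

          open Path P

          T : Subset m
          T = trio e f g

          T⊆E : T ⊆ E
          T⊆E = snoc⊆ (snoc⊆ (single⊆ e∈) f∈) g∈

          T⊆G : T ⊆ G
          T⊆G x∈ = E⊆G (T⊆E x∈)

          few-g : ∣ spread A (⁅ e ⁆ ∪ ⁅ f ⁆) ∩ A g ∣ ≤ 2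
          few-g = few₂ (pair e≢f e~f) (λ x∈ → T⊆G (∈-keep x∈)) (E⊆G g∈) (not-in-pair P)

          count₂ : Count A r size 2 2 (cover A (⁅ e ⁆ ∪ ⁅ f ⁆))
          count₂ = count-add A r size {1} {0} {⁅ e ⁆} {f} (count-single A r size e) (few₁ (E⊆G e∈) (E⊆G f∈) e≢f)

          count₃ : Count A r size 3 4 (cover A T)
          count₃ = count-add A r size {2} {2} {⁅ e ⁆ ∪ ⁅ f ⁆} {g} count₂ few-g

          few-ef : ∣ A e ∩ A f ∣ < r
          few-ef = ℕ.<-≤-trans (s≤s (ℕ.≤-trans (p⊆q⇒∣p∣≤∣q∣ {p = A e ∩ A f} {q = spread A ⁅ e ⁆ ∩ A f} (∩-mono {p = A e} {q = A f} (⁅⁆-spread A e) (λ x → x))) (few₁ (E⊆G e∈) (E⊆G f∈) e≢f))) 3≤r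

          u-escape : ∃[ u ] u ∈ A e × u ∉ A f
          u-escape = escape (A e) (A f) (ℕ.<-≤-trans few-ef (ℕ.≤-reflexive (sym (size e))))

          v-escape : ∃[ v ] v ∈ A f × v ∉ A e
          v-escape = escape (A f) (A e) (ℕ.<-≤-trans (ℕ.≤-<-trans (∣∩∣-comm (A f) (A e)) few-ef) (ℕ.≤-reflexive (sym (size f))))

          u v : Fin n
          u = proj₁ u-escape
          v = proj₁ v-escape

          u∈e : u ∈ A e
          u∈e = proj₁ (proj₂ u-escape)

          u∉f : u ∉ A f
          u∉f = proj₂ (proj₂ u-escape)

          v∈f : v ∈ A f
          v∈f = proj₁ (proj₂ v-escape)

          v∉e : v ∉ A e
          v∉e = proj₂ (proj₂ v-escape)

          u≢v : u ≢ v
          u≢v u≡v = v∉e (subst (_∈ A e) u≡v u∈e)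

          -- `A g` has at most two vertices in common with `A e ∪ A f` and two already with `A f`;
          -- so within that union it stays inside `A f` and misses `u`.
          uv-apart : ∀ {i} → i ∈ T → u ∈ A i → v ∉ A i
          uv-apart i∈ ui vi with ∈-trio i∈
          ... | inj₁ refl = v∉e vi
          ... | inj₂ (inj₁ refl) = u∉f ui
          ... | inj₂ (inj₂ refl) = u∉f (proj₁ (x∈p∩q⁻ (A f) (A g) (saturated {S = spread A (⁅ e ⁆ ∪ ⁅ f ⁆) ∩ A g} {T = A f ∩ A g} few-g f~g
            (∩-mono {p = A f} {q = A g} (edge⊆ ∈-snoc) (λ x → x)) (x∈p∩q⁺ (edge⊆ pair₁ u∈e , ui)))))

          partners : ∀ {Γ : Subset m} → T ⊆ Γ → ∀ {h} → h ∈ T → ∃[ h′ ] h′ ∈ Γ × h ≢ h′ × h ~ h′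
          partners T⊆Γ h∈ with ∈-trio h∈
          ... | inj₁ refl = f , T⊆Γ trio₂ , e≢f , e~f
          ... | inj₂ (inj₁ refl) = e , T⊆Γ trio₁ , e≢f ∘ sym , ~-sym e~f
          ... | inj₂ (inj₂ refl) = f , T⊆Γ trio₂ , f≢g ∘ sym , ~-sym f~g

          couple-claimed : ∀ {Γ x y} → T ⊆ Γ → y ∈ (cover A Γ ⊔ couple u v) x → Claimed Γ x y
          couple-claimed {Γ} {x} {y} T⊆Γ y∈ =
            [ cover-claimed , (λ y∈′ → on-couple (∈-couple {u = u} {v = v} {x = x} {y = y} y∈′)) ]′ (x∈p∪q⁻ (cover A Γ x) (couple u v x) y∈)
            where
            on-couple : (x ≡ u × y ≡ v) ⊎ (x ≡ v × y ≡ u) → Claimed Γ x y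
            on-couple (inj₁ (refl , refl)) = in-path P (T⊆Γ trio₁) (T⊆Γ trio₂) (T⊆Γ trio₃) u≢v (x∈p∪q⁺ (inj₁ u∈e)) (x∈p∪q⁺ (inj₂ v∈f))
            on-couple (inj₂ (refl , refl)) = in-path P (T⊆Γ trio₁) (T⊆Γ trio₂) (T⊆Γ trio₃) (u≢v ∘ sym) (x∈p∪q⁺ (inj₂ v∈f)) (x∈p∪q⁺ (inj₁ u∈e))

          -- Three edges lose 2 + 2 ordered pairs and the couple returns 2, leaving a loss of 2 ≤ 3.
          path-alone : (∀ {x k} → x ∈ T → k ∈ G → x ~ k → k ∈ T) →
            (∀ {a b c k} → Path a b c → a ∈ T → b ∈ T → c ∈ T → k ∈ G → 2 ≤ ∣ A k ∩ (A a ∪ A b) ∣ → k ∈ T) → Group E T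
          path-alone adj span = record
            { Γ⊆E = T⊆E ; some = e , trio₁ ; closed = record { adjacent = adj ; spanned = span }
            ; apart = partner-apart (partners (λ x → x))
            ; R = cover A T ⊔ couple u v ; claimed = couple-claimed (λ x → x)
            ; count = enough T (proj₁ (path-bundle P)) (count-couple A r size {3} {2} {T} count₃ u≢v uv-apart) (s≤s (s≤s z≤n)) }

          module _ {k : Fin m} (k∈ : k ∈ E) (k∉T : k ∉ T) (2≤ : 2 ≤ ∣ spread A T ∩ A k ∣) where

            Γ : Subset m
            Γ = T ∪ ⁅ k ⁆

            bundle₄ : B 4 6 Γ
            bundle₄ = add A r size 2 (path-bundle P) k∉T 2≤

            few-k : ∣ spread A T ∩ A k ∣ ≤ 2
            few-k = few₃ (path-bundle P) T⊆G (E⊆G k∈) k∉T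

            -- An outside edge meeting the group twice would complete five edges of deficiency 6 +
            -- 2. So four edges of deficiency 6 are closed automatically.
            absorbs : ∀ {X l} → X ⊆ spread A Γ → 2 ≤ ∣ X ∩ A l ∣ → l ∈ Γ
            absorbs {X} {l} X⊆ 2≤′ = decidable-stable (l ∈? Γ) λ l∉ → ℕ.<⇒≱ (meets {Γ} X⊆ 2≤′) (few₄ bundle₄ l∉)

            closed₄ : Closed Γ
            closed₄ = record
              { adjacent = λ x∈ _ x~l → absorbs (edge⊆ x∈) x~l
              ; spanned = λ {a} {b} {_} {h} _ a∈ b∈ _ _ 2≤′ → absorbs (edges⊆ a∈ b∈) (ℕ.≤-trans 2≤′ (∣∩∣-comm (A h) (A a ∪ A b))) }

            module _ {x : Fin m} (x∈T : x ∈ T) (x~k : x ~ k) where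

              -- The loss is 2 + 2 + 2 less the couple, 4 ≤ 4. The couple stays uncovered because
              -- `k` meets the trio only inside `A x`, which does not contain both `u` and `v`.
              adjacent-fourth : Group E Γ
              adjacent-fourth = record
                { Γ⊆E = snoc⊆ T⊆E k∈ ; some = e , ∈-keep trio₁ ; closed = closed₄
                ; apart = partner-apart λ h∈ → [ partners ∈-keep , (λ { refl → x , ∈-keep x∈T , (λ { refl → k∉T x∈T }) , ~-sym x~k }) ]′ (∈-snoc⁻ {T = T} h∈)
                ; R = cover A Γ ⊔ couple u v ; claimed = couple-claimed ∈-keep
                ; count = enough Γ (proj₁ bundle₄)
                    (count-couple A r size {4} {4} {Γ} (count-add A r size {3} {4} {T} {k} count₃ few-k) u≢v uv-apart₄) ℕ.≤-refl }
                where
                on-x : ∀ {w} → w ∈ spread A T → w ∈ A k → w ∈ A x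
                on-x w∈T w∈k = proj₁ (x∈p∩q⁻ (A x) (A k) (saturated {S = spread A T ∩ A k} {T = A x ∩ A k} few-k x~k
                  (∩-mono {p = A x} {q = A k} (edge⊆ x∈T) (λ z → z)) (x∈p∩q⁺ (w∈T , w∈k))))
                uv-apart₄ : ∀ {i} → i ∈ Γ → u ∈ A i → v ∉ A i
                uv-apart₄ i∈ ui vi with ∈-snoc⁻ {T = T} i∈
                ... | inj₁ i∈T  = uv-apart i∈T ui vi
                ... | inj₂ refl = uv-apart x∈T (on-x (edge⊆ trio₁ u∈e) ui) (on-x (edge⊆ trio₂ v∈f) vi)

            -- Here `k` may contain the couple, so that nothing is returned; but it is adjacent to
            -- no edge of the trio and adds no loss: 4 ≤ 4.
            skew-fourth : (∀ {x} → x ∈ T → ¬ x ~ k) → 2 ≤ ∣ A k ∩ (A e ∪ A f) ∣ → Group E Γ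
            skew-fourth skew 2≤ef = record
              { Γ⊆E = snoc⊆ T⊆E k∈ ; some = e , ∈-keep trio₁ ; closed = closed₄
              ; apart = apart′
              ; R = cover A Γ ; claimed = cover-claimed
              ; count = enough Γ (proj₁ bundle₄) (count-add-skew A r size {3} {4} {T} {k} count₃ (λ j∈ → ℕ.≤-pred (ℕ.≰⇒> (skew j∈)))) ℕ.≤-refl }
              where
              k∉ef : k ∉ ⁅ e ⁆ ∪ ⁅ f ⁆
              k∉ef k∈ef = k∉T (∈-keep k∈ef)
              apart′ : ∀ {a b c h} → Path a b c → a ∈ E ─ Γ → b ∈ E ─ Γ → c ∈ E ─ Γ → h ∈ Γ → ¬ (2 ≤ ∣ A h ∩ (A a ∪ A b) ∣)
              apart′ {a} {b} {c} {h} Q a∈ b∈ c∈ h∈ 2≤′ with ∈-snoc⁻ {T = T} h∈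
              ... | inj₁ h∈T  = partner-apart {E} {T} (partners (λ x → x)) Q (shrink a∈) (shrink b∈) (shrink c∈) h∈T 2≤′
                where
                shrink : ∀ {x} → x ∈ E ─ Γ → x ∈ E ─ T
                shrink x∈ = x∈p∧x∉q⇒x∈p─q (p─q⊆p E Γ x∈) (λ x∈T → x∈p─q⇒x∉q E Γ x∈ (∈-keep x∈T))
              -- `k` has no partner in the group, so `partner-apart` does not apply. Instead e, f, k
              -- have deficiency 2 + 2, a and b have 2, and two vertices are shared.
              ... | inj₂ refl = no₅ (merge A r 2
                  (add A r size 2 (pair e≢f e~f) k∉ef (meets {⁅ e ⁆ ∪ ⁅ f ⁆} (edges⊆ pair₁ ∈-snoc) (ℕ.≤-trans 2≤ef (∣∩∣-comm (A k) (A e ∪ A f)))))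
                  (pair (Path.e≢f Q) (Path.e~f Q))
                  (λ x∈ x∈ab → x∈p─q⇒x∉q E Γ (snoc⊆ (single⊆ a∈) b∈ x∈ab) (snoc⊆ (snoc⊆ (single⊆ (∈-keep trio₁)) (∈-keep trio₂)) ∈-snoc x∈))
                  (ℕ.≤-trans 2≤′ (p⊆q⇒∣p∣≤∣q∣ {p = A k ∩ (A a ∪ A b)} {q = spread A ((⁅ e ⁆ ∪ ⁅ f ⁆) ∪ ⁅ k ⁆) ∩ spread A (⁅ a ⁆ ∪ ⁅ b ⁆)} (∩-mono {p = A k} {q = A a ∪ A b} (edge⊆ ∈-snoc) (edges⊆ pair₁ ∈-snoc)))))

        module _ {E : Subset m} (E⊆G : E ⊆ G) (cE : Closed E) where

          private

            InE : Fin m → Fin m → Fin m → Set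
            InE e f g = Path e f g × e ∈ E × f ∈ E × g ∈ E

            inE? : ∀ e f g → Dec (InE e f g)
            inE? e f g = path? e f g ×-dec (e ∈? E) ×-dec (f ∈? E) ×-dec (g ∈? E)

            Fourth : (e f g k x : Fin m) → Set
            Fourth e f g k x = InE e f g × k ∈ G × k ∉ trio e f g × x ∈ trio e f g × x ~ k

            Skew : (e f g k : Fin m) → Set
            Skew e f g k = InE e f g × k ∈ G × k ∉ trio e f g × 2 ≤ ∣ A k ∩ (A e ∪ A f) ∣

            Pair : (e f : Fin m) → Set
            Pair e f = e ∈ E × f ∈ E × e ≢ f × e ~ f

          lone : ¬ (∃[ e ] ∃[ f ] Pair e f) → ∀ {e} → e ∈ E → Group E ⁅ e ⁆
          lone none {e} e∈ = record
            { Γ⊆E = single⊆ e∈ ; some = e , x∈⁅x⁆ e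
            ; closed = record
              { adjacent = λ {x} {l} x∈ l∈ x~l → decidable-stable (l ∈? ⁅ e ⁆) λ l∉ →
                  none (x , l , single⊆ e∈ x∈ , adjacent cE (single⊆ e∈ x∈) l∈ x~l , (λ { refl → l∉ x∈ }) , x~l)
              ; spanned = λ {a} {b} P a∈ b∈ _ _ _ → contradiction (a , b , single⊆ e∈ a∈ , single⊆ e∈ b∈ , Path.e≢f P , Path.e~f P) none }
            ; apart = λ {a} {b} P a∈ b∈ _ _ _ → none (a , b , p─q⊆p E ⁅ e ⁆ a∈ , p─q⊆p E ⁅ e ⁆ b∈ , Path.e≢f P , Path.e~f P)
            ; R = cover A ⁅ e ⁆ ; claimed = cover-claimed ; count = enough ⁅ e ⁆ (∣⁅x⁆∣≡1 e) (count-single A r size e) z≤n }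

          couple-alone : ¬ (∃[ e ] ∃[ f ] ∃[ g ] InE e f g) → ∀ {e f} → Pair e f → Group E (⁅ e ⁆ ∪ ⁅ f ⁆)
          couple-alone none {e} {f} (e∈ , f∈ , e≢f , e~f) = record
            { Γ⊆E = Γ⊆E ; some = e , pair₁
            ; closed = record
              { adjacent = λ {x} {l} x∈ l∈ x~l → decidable-stable (l ∈? Γ) λ l∉ → extend x∈ (adjacent cE (Γ⊆E x∈) l∈ x~l) l∉ x~l
              ; spanned = λ {a} {b} {c} P a∈ b∈ c∈ _ _ → contradiction (a , b , c , P , Γ⊆E a∈ , Γ⊆E b∈ , Γ⊆E c∈) none }
            ; apart = λ {a} {b} {c} P a∈ b∈ c∈ _ _ → none (a , b , c , P , p─q⊆p E Γ a∈ , p─q⊆p E Γ b∈ , p─q⊆p E Γ c∈)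
            ; R = cover A Γ ; claimed = cover-claimed
            ; count = enough Γ (proj₁ (pair e≢f e~f))
                (count-add A r size {1} {0} {⁅ e ⁆} {f} (count-single A r size e) (few₁ (E⊆G e∈) (E⊆G f∈) e≢f)) ℕ.≤-refl }
            where
            Γ : Subset m
            Γ = ⁅ e ⁆ ∪ ⁅ f ⁆
            Γ⊆E : Γ ⊆ E
            Γ⊆E = snoc⊆ (single⊆ e∈) f∈
            extend : ∀ {x l} → x ∈ Γ → l ∈ E → l ∉ Γ → ¬ x ~ l
            extend {x} {l} x∈ l∈ l∉ x~l with ∈-snoc⁻ {T = ⁅ e ⁆} x∈
            ... | inj₂ refl = none (l , f , e , path (λ { refl → l∉ ∈-snoc }) (e≢f ∘ sym) (λ { refl → l∉ pair₁ }) (~-sym x~l) (~-sym e~f) , l∈ , f∈ , e∈)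
            ... | inj₁ x∈e with x∈⁅y⁆⇒x≡y e x∈e
            ...   | refl = none (l , e , f , path (λ { refl → l∉ pair₁ }) e≢f (λ { refl → l∉ ∈-snoc }) (~-sym x~l) e~f , l∈ , e∈ , f∈)

          -- The order of the searches matters: a skew fourth edge is taken only when no path has an
          -- adjacent fourth edge, and a path stands alone only when it has neither.
          find-group : Nonempty E → ∃ (Group E)
          find-group (e₀ , e₀∈) = first (any? λ e → any? λ f → any? λ g → any? λ k → any? λ x →
              inE? e f g ×-dec (k ∈? G) ×-dec ¬? (k ∈? trio e f g) ×-dec (x ∈? trio e f g) ×-dec (2 ℕ.≤? ∣ A x ∩ A k ∣))
            where
            fourth : Dec (∃[ e ] ∃[ f ] Pair e f) → ¬ (∃[ e ] ∃[ f ] ∃[ g ] InE e f g) → ∃ (Group E)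
            fourth (yes (_ , _ , p)) none = _ , couple-alone none p
            fourth (no ¬p)           none = _ , lone ¬p e₀∈
            third : Dec (∃[ e ] ∃[ f ] ∃[ g ] InE e f g) → ¬ (∃[ e ] ∃[ f ] ∃[ g ] ∃[ k ] ∃[ x ] Fourth e f g k x) →
                    ¬ (∃[ e ] ∃[ f ] ∃[ g ] ∃[ k ] Skew e f g k) → ∃ (Group E)
            third (no ¬p) _ _ = fourth (any? λ e → any? λ f → (e ∈? E) ×-dec (f ∈? E) ×-dec ¬? (e ≟ f) ×-dec (2 ℕ.≤? ∣ A e ∩ A f ∣)) ¬p
            third (yes (e , f , g , P , e∈ , f∈ , g∈)) ¬fourth ¬skew = T , path-alone adj span
              where
              open OfPath E⊆G cE P e∈ f∈ g∈
              adj : ∀ {x k} → x ∈ T → k ∈ G → x ~ k → k ∈ T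
              adj {x} {k} x∈ k∈ x~k = decidable-stable (k ∈? T) λ k∉ → ¬fourth (e , f , g , k , x , (P , e∈ , f∈ , g∈) , k∈ , k∉ , x∈ , x~k)
              span : ∀ {a b c k} → Path a b c → a ∈ T → b ∈ T → c ∈ T → k ∈ G → 2 ≤ ∣ A k ∩ (A a ∪ A b) ∣ → k ∈ T
              span {a} {b} {c} {k} Q a∈ b∈ c∈ k∈ 2≤ = decidable-stable (k ∈? T) λ k∉ →
                ¬skew (a , b , c , k , (Q , T⊆E a∈ , T⊆E b∈ , T⊆E c∈) , k∈ ,
                  (λ k∈′ → k∉ (snoc⊆ (snoc⊆ (single⊆ a∈) b∈) c∈ k∈′)) , 2≤)
            second : Dec (∃[ e ] ∃[ f ] ∃[ g ] ∃[ k ] Skew e f g k) → ¬ (∃[ e ] ∃[ f ] ∃[ g ] ∃[ k ] ∃[ x ] Fourth e f g k x) → ∃ (Group E)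
            second (no ¬skew) ¬fourth = third (any? λ e → any? λ f → any? λ g → inE? e f g) ¬fourth ¬skew
            second (yes (e , f , g , k , (P , e∈ , f∈ , g∈) , k∈ , k∉ , 2≤)) ¬fourth =
              _ , skew-fourth (spanned cE P e∈ f∈ g∈ k∈ 2≤) k∉
                (meets {T} {A e ∪ A f} {A k} (edges⊆ trio₁ trio₂) (ℕ.≤-trans 2≤ (∣∩∣-comm (A k) (A e ∪ A f))))
                (λ {x} x∈ x~k → ¬fourth (e , f , g , k , x , (P , e∈ , f∈ , g∈) , k∈ , k∉ , x∈ , x~k)) 2≤
              where open OfPath E⊆G cE P e∈ f∈ g∈
            first : Dec (∃[ e ] ∃[ f ] ∃[ g ] ∃[ k ] ∃[ x ] Fourth e f g k x) → ∃ (Group E)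
            first (no ¬fourth) = second (any? λ e → any? λ f → any? λ g → any? λ k →
              inE? e f g ×-dec (k ∈? G) ×-dec ¬? (k ∈? trio e f g) ×-dec (2 ℕ.≤? ∣ A k ∩ (A e ∪ A f) ∣)) ¬fourth
            first (yes (e , f , g , k , x , (P , e∈ , f∈ , g∈) , k∈ , k∉ , x∈ , x~k)) =
              _ , adjacent-fourth (adjacent cE (T⊆E x∈) k∈ x~k) k∉ (meets {T} {A x} {A k} (edge⊆ x∈) x~k) x∈ x~k
              where open OfPath E⊆G cE P e∈ f∈ g∈

        Charged : Subset m → Set
        Charged E = ∃[ R ] ∣ E ∣ * ρ ≤ ‖ R ‖ × (∀ {u v} → v ∈ R u → Claimed E u v)

        join : ∀ {E Γ} → E ⊆ G → Closed E → Group E Γ → (Closed (E ─ Γ) → Charged (E ─ Γ)) → Charged E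
        join {E} {Γ} E⊆G cE group rest = combine (rest cE′)
          where
          open Group group
          E′ : Subset m
          E′ = E ─ Γ
          E′⊆E : E′ ⊆ E
          E′⊆E = p─q⊆p E Γ
          cE′ : Closed E′
          cE′ = record
            { adjacent = λ {e} {f} e∈ f∈ e~f → x∈p∧x∉q⇒x∈p─q (adjacent cE (E′⊆E e∈) f∈ e~f)
                (λ f∈Γ → x∈p─q⇒x∉q E Γ e∈ (adjacent closed f∈Γ (E⊆G (E′⊆E e∈)) (~-sym e~f)))
            ; spanned = λ P a∈ b∈ c∈ h∈ 2≤ → x∈p∧x∉q⇒x∈p─q (spanned cE P (E′⊆E a∈) (E′⊆E b∈) (E′⊆E c∈) h∈ 2≤)
                (λ h∈Γ → apart P a∈ b∈ c∈ h∈Γ 2≤) }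
          combine : Charged E′ → Charged E
          combine (R′ , count′ , claimed′) = R ⊔ R′ , (begin
              ∣ E ∣ * ρ                 ≤⟨ ℕ.*-monoˡ-≤ ρ (∣p∣≤∣q∣+∣p─q∣ E Γ) ⟩
              (∣ Γ ∣ + ∣ E′ ∣) * ρ      ≡⟨ ℕ.*-distribʳ-+ ρ (∣ Γ ∣) (∣ E′ ∣) ⟩
              ∣ Γ ∣ * ρ + ∣ E′ ∣ * ρ    ≤⟨ ℕ.+-mono-≤ count count′ ⟩
              ‖ R ‖ + ‖ R′ ‖            ≤⟨ ‖⊔‖-disjoint {R = R} {R′ = R′} (λ v∈ v∈′ →
                claimed-exclusive (λ x∈ → E⊆G (Γ⊆E x∈)) (λ x∈ → E⊆G (E′⊆E x∈)) closed cE′ (λ x∈Γ x∈E′ → x∈p─q⇒x∉q E Γ x∈E′ x∈Γ) (claimed v∈) (claimed′ v∈′)) ⟩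
              ‖ R ⊔ R′ ‖                ∎)
            , λ {u} {v} v∈ → [ (λ x → claimed-mono Γ⊆E (claimed x)) , (λ x → claimed-mono E′⊆E (claimed′ x)) ]′ (x∈p∪q⁻ (R u) (R′ u) v∈)
            where open ≤-Reasoning

        charge : ∀ b E → ∣ E ∣ ≤ b → E ⊆ G → Closed E → Charged E
        charge b E E≤b E⊆G cE = go (any? (_∈? E)) b E≤b
          where
          go : Dec (Nonempty E) → ∀ b → ∣ E ∣ ≤ b → Charged E
          go (no ¬e) _ _ = (λ _ → ⊥) , ℕ.≤-trans (ℕ.*-monoˡ-≤ ρ (ℕ.≤-reflexive E≡0)) z≤n , λ v∈ → contradiction v∈ ∉⊥
            where
            E≡0 : ∣ E ∣ ≡ 0
            E≡0 = ℕ.n≤0⇒n≡0 (ℕ.≮⇒≥ λ 0< → ¬e (pick 0<))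
          go (yes (e , e∈)) zero E≤0 = contradiction E≤0 (ℕ.<⇒≱ (nonempty⇒0< e∈))
          go (yes ne) (suc b) E≤ = let Γ , group = find-group E⊆G cE ne ; i , i∈ = Group.some group in
            join E⊆G cE group (charge b (E ─ Γ)
              (ℕ.≤-pred (ℕ.≤-trans (p∩q≢∅⇒∣p─q∣<∣p∣ E Γ (i , x∈p∩q⁺ (Group.Γ⊆E group i∈ , i∈))) E≤)) (λ x∈ → E⊆G (p─q⊆p E Γ x∈)))

        charged : ∣ G ∣ * ρ ≤ n * n
        charged = let R , count , _ = charge m G (∣p∣≤n G) (λ x → x) (record { adjacent = λ _ f∈ _ → f∈ ; spanned = λ _ _ _ _ h∈ _ → h∈ })
                  in ℕ.≤-trans count (‖‖≤n² R)

    upper-bound : ∀ ρ → suc ρ ≡ r * (r ∸ 1) → m * ρ ≤ n * n + 9 * n * ρ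
    upper-bound ρ ρ≡ = let G , m≤ , no₄ , no₂ , no₃ = cleaned in begin
      m * ρ                    ≤⟨ ℕ.*-monoˡ-≤ ρ m≤ ⟩
      (9 * n + ∣ G ∣) * ρ      ≡⟨ ℕ.*-distribʳ-+ ρ (9 * n) (∣ G ∣) ⟩
      9 * n * ρ + ∣ G ∣ * ρ    ≤⟨ ℕ.+-monoʳ-≤ (9 * n * ρ) (Cleaned.charged G no₄ no₂ no₃ ρ ρ≡) ⟩
      9 * n * ρ + n * n        ≡⟨ ℕ.+-comm (9 * n * ρ) (n * n) ⟩
      n * n + 9 * n * ρ        ∎
      where open ≤-Reasoning

-- The upper bound for free r-graphs.

module FreeGraphs where

  open import Defs
  open FiveSets
  open Bundles
  open UpperBound
  open DiamondGraphs using (lookup-unique)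
  open import Data.Fin.Base as Fin using (Fin; zero; suc)
  import Data.Fin.Properties as Fin
  open import Data.Fin.Subset using (Subset; inside; outside; ∣_∣; _∈_; _⊆_)
  open import Data.List.Base using (List; []; _∷_; length; lookup; map)
  open import Data.List.Membership.Propositional.Properties using (∈-lookup; ∈-map⁻)
  open import Data.List.Properties using (length-map)
  open import Data.List.Relation.Binary.Subset.Propositional renaming (_⊆_ to _⊆ᴸ_)
  open import Data.List.Relation.Unary.All as All using (All; []; _∷_)
  import Data.List.Relation.Unary.All.Properties as All
  open import Data.List.Relation.Unary.AllPairs using ([]; _∷_)
  open import Data.List.Relation.Unary.Unique.Propositional using (Unique)
  import Data.List.Relation.Unary.Unique.Propositional.Properties as Unique
  open import Data.Nat.Base as ℕ using (ℕ; zero; suc; _+_; _*_; _∸_; _≤_)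
  import Data.Nat.Properties as ℕ
  open import Data.Product.Base using (_,_)
  open import Data.Vec.Base using ([]; _∷_; here; there)
  open import Relation.Binary.PropositionalEquality
  open import Relation.Nullary using (¬_)

  elements : ∀ {m} → Subset m → List (Fin m)
  elements []            = []
  elements (inside  ∷ p) = zero ∷ map suc (elements p)
  elements (outside ∷ p) = map suc (elements p)

  length-elements : ∀ {m} (p : Subset m) → length (elements p) ≡ ∣ p ∣
  length-elements []            = refl
  length-elements (inside  ∷ p) = cong suc (trans (length-map suc (elements p)) (length-elements p))
  length-elements (outside ∷ p) = trans (length-map suc (elements p)) (length-elements p)

  elements-unique : ∀ {m} (p : Subset m) → Unique (elements p)
  elements-unique []            = []
  elements-unique (inside  ∷ p) = All.map⁺ (All.universal (λ _ ()) (elements p)) ∷ Unique.map⁺ Fin.suc-injective (elements-unique p)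
  elements-unique (outside ∷ p) = Unique.map⁺ Fin.suc-injective (elements-unique p)

  elements-∈ : ∀ {m} (p : Subset m) → All (_∈ p) (elements p)
  elements-∈ []            = []
  elements-∈ (inside  ∷ p) = here ∷ All.map⁺ (All.map there (elements-∈ p))
  elements-∈ (outside ∷ p) = All.map⁺ (All.map there (elements-∈ p))

  free-size-bound : ∀ {r n} (G : RGraph r n) → 3 ≤ r → Free (5 * r ∸ 8) 5 G → ∀ ρ → suc ρ ≡ r * (r ∸ 1) →
                    numEdges G * ρ ≤ n * n + 9 * n * ρ
  free-size-bound {r} {n} G 3≤r free ρ ρ≡ = upper-bound A size 3≤r no₅ ρ ρ≡
    where
    A : Fin (numEdges G) → Subset n
    A = lookup (edges G)
    size : ∀ i → ∣ A i ∣ ≡ r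
    size i = All.lookup (uniform G) (∈-lookup i)
    no₅ : ∀ {T} → ¬ Bundle A r 5 8 T
    no₅ {T} (five , few) = free H (V⊆ , E⊆) (trans (length-map A (elements T)) (trans (length-elements T) five) , ℕ.m+n≤o⇒m≤o∸n (∣ spread A T ∣) few)
      where
      V⊆ : spread A T ⊆ vertices G
      V⊆ v∈ = let i , _ , v∈i = ∈-spread⁻ A v∈ in All.lookup (within G) (∈-lookup i) v∈i
      H : RGraph r n
      H = record
        { vertices = spread A T ; edges = map A (elements T)
        ; distinct = Unique.map⁺ (λ {i} {j} → lookup-unique (distinct G) i j) (elements-unique T)
        ; uniform = All.map⁺ (All.universal size (elements T))
        ; within = All.map⁺ (All.map (λ i∈ {_} v∈ → ∈-spread⁺ A i∈ v∈) (elements-∈ T)) }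
      E⊆ : edges H ⊆ᴸ edges G
      E⊆ {e} e∈ with ∈-map⁻ A {y = e} e∈
      ... | i , _ , refl = ∈-lookup i

-- Estimates for the density of the construction.

module LowerBound where

  open import Defs
  open Framing
  open Pattern
  open DenseGraphs
  open import Data.List.Base using (length)
  open import Data.Nat.Base as ℕ using (ℕ; zero; suc; _+_; _*_; _∸_; _^_; _!; _≤_; _<_; s≤s; z≤n)
  open import Data.Nat.Properties as ℕ using (module ≤-Reasoning)
  open import Data.Nat.Tactic.RingSolver using (solve-∀)
  open import Data.Product.Base using (∃-syntax; _×_; _,_)
  open import Relation.Binary.PropositionalEquality
  open import Relation.Nullary using (yes; no; contradiction)

  -- (1 + a / N)^t (1 − t a / N) ≤ 1, multiplied out
  bernoulli : ∀ t N a → (N + a) ^ t * N ≤ N ^ t * N + (t * a) * (N + a) ^ t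
  bernoulli zero    N a = ℕ.≤-reflexive (sym (ℕ.+-identityʳ _))
  bernoulli (suc t) N a = begin
    ((N + a) * Y) * N                                       ≡⟨ ℕ.*-assoc (N + a) Y N ⟩
    (N + a) * (Y * N)                                       ≤⟨ ℕ.*-monoʳ-≤ (N + a) (bernoulli t N a) ⟩
    (N + a) * (X * N + (t * a) * Y)                         ≡⟨ shift₁ N a X Y t ⟩
    (N * X) * N + (a * (N * X) + (t * a) * ((N + a) * Y))   ≤⟨ ℕ.+-monoʳ-≤ ((N * X) * N) (ℕ.+-monoˡ-≤ ((t * a) * ((N + a) * Y))
        (ℕ.*-monoʳ-≤ a (ℕ.*-mono-≤ (ℕ.m≤m+n N a) (ℕ.^-monoˡ-≤ t (ℕ.m≤m+n N a))))) ⟩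
    (N * X) * N + (a * ((N + a) * Y) + (t * a) * ((N + a) * Y)) ≡⟨ shift₂ N a X Y t ⟩
    (N * X) * N + (suc t * a) * ((N + a) * Y)               ∎
    where
    open ≤-Reasoning
    X = N ^ t
    Y = (N + a) ^ t
    shift₁ : ∀ N a X Y t → (N + a) * (X * N + (t * a) * Y) ≡ (N * X) * N + (a * (N * X) + (t * a) * ((N + a) * Y))
    shift₁ = solve-∀
    shift₂ : ∀ N a X Y t → (N * X) * N + (a * ((N + a) * Y) + (t * a) * ((N + a) * Y)) ≡ (N * X) * N + (suc t * a) * ((N + a) * Y)
    shift₂ = solve-∀

  -- Bernoulli's inequality with t a / N at most 1 / (K + 1).
  slow-growth : ∀ K t N a → 0 < N → suc K * (t * a) ≤ N → K * (N + a) ^ t ≤ suc K * N ^ t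
  slow-growth K t N a 0<N big = ℕ.*-cancelʳ-≤ (K * Y) (suc K * X) N {{ℕ.>-nonZero 0<N}} (ℕ.+-cancelʳ-≤ (N * Y) _ _ (begin
    (K * Y) * N + N * Y                     ≡⟨ shift₁ K Y N ⟩
    suc K * (Y * N)                         ≤⟨ ℕ.*-monoʳ-≤ (suc K) (bernoulli t N a) ⟩
    suc K * (X * N + (t * a) * Y)           ≡⟨ shift₂ (suc K) X N (t * a) Y ⟩
    (suc K * X) * N + (suc K * (t * a)) * Y ≤⟨ ℕ.+-monoʳ-≤ ((suc K * X) * N) (ℕ.*-monoˡ-≤ Y big) ⟩
    (suc K * X) * N + N * Y                 ∎))
    where
    open ≤-Reasoning
    X = N ^ t
    Y = (N + a) ^ t
    shift₁ : ∀ K Y N → (K * Y) * N + N * Y ≡ suc K * (Y * N)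
    shift₁ = solve-∀
    shift₂ : ∀ k X N z Y → k * (X * N + z * Y) ≡ (k * X) * N + (k * z) * Y
    shift₂ = solve-∀

  last-below : ∀ (h : ℕ → ℕ) {n} j s → h s ≤ n → n < h (s + j) → ∃[ s′ ] s ≤ s′ × h s′ ≤ n × n < h (suc s′)
  last-below h zero s low high = contradiction (ℕ.<-≤-trans high (ℕ.≤-trans (ℕ.≤-reflexive (cong h (ℕ.+-identityʳ s))) low)) (ℕ.<-irrefl refl)
  last-below h {n} (suc j) s low high with n ℕ.<? h (suc s)
  ... | yes n< = s , ℕ.≤-refl , low , n<
  ... | no  n≮ = let s′ , s≤ , rest = last-below h j (suc s) (ℕ.≮⇒≥ n≮) (subst (λ z → n < h z) (ℕ.+-suc s j) high)
                 in s′ , ℕ.≤-trans (ℕ.n≤1+n s) s≤ , rest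

  -- M₁ / n₁² = g⁻ R / (g E) for the framed packing, cleared of denominators.
  frame-ratio : ∀ g⁻ R X E → ((g⁻ * suc g⁻) * R) * ((X * X) * E) * (suc g⁻ * E) ≡ (g⁻ * R) * ((suc g⁻ * (X * E)) * (suc g⁻ * (X * E)))
  frame-ratio = solve-∀

  -- Each of the quotients g⁻ / g, R L / E and s / L is at least K / (K + 1).
  three-losses : ∀ {K g⁻ R L E s} (M₁ n₁ : ℕ) → E ≡ suc (R * L) → K ≤ R * L → K ≤ g⁻ → K * L ≤ s * suc K →
    M₁ * (suc g⁻ * E) ≡ (g⁻ * R) * (n₁ * n₁) → (K * K * K) * (n₁ * n₁) ≤ (s * M₁) * (suc K * suc K * suc K)
  three-losses {K} {g⁻} {R} {L} {E} {s} M₁ n₁ refl K≤RL K≤g⁻ loss ratio = ℕ.*-cancelʳ-≤ _ _ (suc g⁻ * E) (begin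
    (K * K * K) * (n₁ * n₁) * (suc g⁻ * E)                     ≡⟨ shift₁ K (n₁ * n₁) (suc g⁻) E ⟩
    K * ((K * suc g⁻) * ((n₁ * n₁) * (K * E)))                 ≤⟨ ℕ.*-monoʳ-≤ K (ℕ.*-mono-≤ g-loss (ℕ.*-monoʳ-≤ (n₁ * n₁) E-loss)) ⟩
    K * ((suc K * g⁻) * ((n₁ * n₁) * (suc K * (R * L))))       ≡⟨ shift₂ K (suc K) g⁻ (n₁ * n₁) R L ⟩
    (K * L) * ((suc K * suc K) * ((g⁻ * R) * (n₁ * n₁)))       ≤⟨ ℕ.*-monoˡ-≤ ((suc K * suc K) * ((g⁻ * R) * (n₁ * n₁))) loss ⟩
    (s * suc K) * ((suc K * suc K) * ((g⁻ * R) * (n₁ * n₁)))   ≡⟨ cong (λ z → (s * suc K) * ((suc K * suc K) * z)) ratio ⟨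
    (s * suc K) * ((suc K * suc K) * (M₁ * (suc g⁻ * E)))      ≡⟨ shift₃ s (suc K) M₁ (suc g⁻ * E) ⟩
    (s * M₁) * (suc K * suc K * suc K) * (suc g⁻ * E)          ∎)
    where
    open ≤-Reasoning
    g-loss : K * suc g⁻ ≤ suc K * g⁻
    g-loss = ℕ.≤-trans (ℕ.≤-reflexive (ℕ.*-suc K g⁻)) (ℕ.+-monoˡ-≤ (K * g⁻) K≤g⁻)
    E-loss : K * suc (R * L) ≤ suc K * (R * L)
    E-loss = ℕ.≤-trans (ℕ.≤-reflexive (ℕ.*-suc K (R * L))) (ℕ.+-monoˡ-≤ (K * (R * L)) K≤RL)
    shift₁ : ∀ K n g E → (K * K * K) * n * (g * E) ≡ K * ((K * g) * (n * (K * E)))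
    shift₁ = solve-∀
    shift₂ : ∀ K k g n R L → K * ((k * g) * (n * (k * (R * L)))) ≡ (K * L) * ((k * k) * ((g * R) * n))
    shift₂ = solve-∀
    shift₃ : ∀ s k M z → (s * k) * ((k * k) * (M * z)) ≡ (s * M) * (k * k * k) * z
    shift₃ = solve-∀

  module _ (d⁻ K : ℕ) where

    private

      d ℓ⁻ ℓ cells⁻ cells ρ r : ℕ
      d = suc d⁻
      cells⁻ = d⁻ + d⁻ * d
      cells = d * d
      -- Makes the cross pairs at most one K-th of the other claimed pairs.
      ℓ⁻ = K * cells
      ℓ = suc ℓ⁻
      r = 3 + d⁻
      -- r² - r - 1 as (r - 2) + (r - 1)², free of subtraction.
      ρ = suc d⁻ + (2 + d⁻) * (2 + d⁻)

      Q L : ℕ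
      Q = ℓ ^ cells⁻
      L = length (claimed d⁻ ℓ⁻)

      g⁻ₖ Rₖ Eₖ : ℕ
      g⁻ₖ = g⁻ (claimed d⁻ ℓ⁻) (claimed-sym d⁻ ℓ⁻) (claimed-irrefl d⁻ ℓ⁻) K K
      Rₖ = R (claimed d⁻ ℓ⁻) (claimed-sym d⁻ ℓ⁻) (claimed-irrefl d⁻ ℓ⁻) K K
      Eₖ = E (claimed d⁻ ℓ⁻) (claimed-sym d⁻ ℓ⁻) (claimed-irrefl d⁻ ℓ⁻) K K

      M₁ n₁ : ℕ
      M₁ = frameCopies d⁻ ℓ⁻ K K
      n₁ = frameVertices d⁻ ℓ⁻ K K

      L≡ : L ≡ (ℓ * Q) * 2 * ρ + (cells * Q) * 2
      L≡ = trans (length-claimed d⁻ ℓ⁻) (shift d⁻ (ℓ * Q) (cells * Q))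
        where
        shift : ∀ x s c → s * (2 + (2 * (suc x + suc x) + (2 * (suc x + suc x) + (suc x * x + suc x * x)))) + (c + c)
                          ≡ s * 2 * (suc x + (2 + x) * (2 + x)) + c * 2
        shift = solve-∀

      1≤Q : 1 ≤ Q
      1≤Q = ℕ.>-nonZero⁻¹ Q {{ℕ.m^n≢0 ℓ cells⁻}}

      1≤L : 1 ≤ L
      1≤L = ℕ.≤-trans (ℕ.*-mono-≤ {1} {(ℓ * Q) * 2} {1} {ρ} (ℕ.*-mono-≤ {1} {ℓ * Q} {1} {2} (ℕ.*-mono-≤ {1} {ℓ} {1} {Q} (s≤s z≤n) 1≤Q) (s≤s z≤n)) (s≤s z≤n))
              (ℕ.≤-trans (ℕ.m≤m+n _ ((cells * Q) * 2)) (ℕ.≤-reflexive (sym L≡)))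

      K≤ : ∀ v → K ≤ v ! * K
      K≤ v = ℕ.m≤n*m K (v !) {{v ℕ.!≢0}}

      K≤RL : K ≤ Rₖ * L
      K≤RL = ℕ.≤-trans (K≤ (suc g⁻ₖ)) (ℕ.≤-trans (ℕ.≤-reflexive (sym (ℕ.*-identityʳ Rₖ))) (ℕ.*-monoʳ-≤ Rₖ 1≤L))

      claims-loss : K * L ≤ ((ℓ * Q) * 2 * ρ) * suc K
      claims-loss = begin
        K * L                                                        ≡⟨ cong (K *_) L≡ ⟩
        K * ((ℓ * Q) * 2 * ρ + (cells * Q) * 2)                      ≡⟨ shift₁ K ((ℓ * Q) * 2 * ρ) cells Q ⟩
        K * ((ℓ * Q) * 2 * ρ) + ((K * cells) * Q) * 2                ≤⟨ ℕ.+-monoʳ-≤ (K * ((ℓ * Q) * 2 * ρ)) (ℕ.≤-trans (ℕ.*-monoˡ-≤ 2 (ℕ.*-monoˡ-≤ Q (ℕ.n≤1+n ℓ⁻)))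
                                                                          (ℕ.m≤m*n ((ℓ * Q) * 2) ρ)) ⟩
        K * ((ℓ * Q) * 2 * ρ) + (ℓ * Q) * 2 * ρ                      ≡⟨ shift₂ K ((ℓ * Q) * 2 * ρ) ⟩
        ((ℓ * Q) * 2 * ρ) * suc K                                    ∎
        where
        open ≤-Reasoning
        shift₁ : ∀ k a c q → k * (a + (c * q) * 2) ≡ k * a + ((k * c) * q) * 2
        shift₁ = solve-∀
        shift₂ : ∀ k a → k * a + a ≡ a * suc k
        shift₂ = solve-∀

      frame-loss : (K * K * K) * (n₁ * n₁) ≤ (((ℓ * Q) * 2 * ρ) * M₁) * (suc K * suc K * suc K)
      frame-loss = three-losses {K} {g⁻ₖ} {Rₖ} {L} {Eₖ} {(ℓ * Q) * 2 * ρ} M₁ n₁ refl K≤RL (K≤ (patternSize d⁻ ℓ⁻)) claims-loss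
        (frame-ratio g⁻ₖ Rₖ (Eₖ ^ (suc g⁻ₖ * suc g⁻ₖ)) Eₖ)

      1≤n₁ : 1 ≤ n₁
      1≤n₁ = ℕ.*-mono-≤ {1} {suc g⁻ₖ} {1} {Eₖ ^ (suc g⁻ₖ * suc g⁻ₖ) * Eₖ} (s≤s z≤n)
        (ℕ.*-mono-≤ {1} {Eₖ ^ (suc g⁻ₖ * suc g⁻ₖ)} {1} {Eₖ} (ℕ.>-nonZero⁻¹ _ {{ℕ.m^n≢0 Eₖ (suc g⁻ₖ * suc g⁻ₖ)}}) (s≤s z≤n))

      a T s₀ : ℕ
      a = step d⁻ ℓ⁻ K K
      T = exponent d⁻ ℓ⁻ K K
      -- From here on, passing to the next period raises N^(2T) by a factor of at most (K + 1) / K.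
      s₀ = suc K * (T + T)

      N : ℕ → ℕ
      N = period d⁻ ℓ⁻ K K

      height : ℕ → ℕ
      height s = n₁ * N s ^ T

      N-suc : ∀ s → N (suc s) ≡ N s + a
      N-suc s = cong suc (trans (ℕ.*-suc a (suc s)) (ℕ.+-comm a (a * suc s)))

      period-loss : ∀ s → s₀ ≤ s → K * (N (suc s) ^ T * N (suc s) ^ T) ≤ suc K * (N s ^ T * N s ^ T)
      period-loss s s₀≤s = begin
        K * (N (suc s) ^ T * N (suc s) ^ T)   ≡⟨ cong (K *_) (ℕ.^-distribˡ-+-* (N (suc s)) T T) ⟨
        K * N (suc s) ^ (T + T)               ≡⟨ cong (λ z → K * z ^ (T + T)) (N-suc s) ⟩
        K * (N s + a) ^ (T + T)               ≤⟨ slow-growth K (T + T) (N s) a (s≤s z≤n) big ⟩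
        suc K * N s ^ (T + T)                 ≡⟨ cong (suc K *_) (ℕ.^-distribˡ-+-* (N s) T T) ⟩
        suc K * (N s ^ T * N s ^ T)           ∎
        where
        open ≤-Reasoning
        big : suc K * ((T + T) * a) ≤ N s
        big = begin
          suc K * ((T + T) * a)   ≡⟨ ℕ.*-assoc (suc K) (T + T) a ⟨
          s₀ * a                  ≤⟨ ℕ.*-monoˡ-≤ a (ℕ.≤-trans s₀≤s (ℕ.n≤1+n s)) ⟩
          suc s * a               ≡⟨ ℕ.*-comm (suc s) a ⟩
          a * suc s               ≤⟨ ℕ.n≤1+n (a * suc s) ⟩
          N s                     ∎

      unbounded : ∀ s → s < height s
      unbounded s = begin-strict
        s             <⟨ ℕ.n<1+n s ⟩
        suc s         ≤⟨ ℕ.m≤n*m (suc s) a {{ℕ.>-nonZero (1≤step d⁻ ℓ⁻ K K)}} ⟩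
        a * suc s     ≤⟨ ℕ.n≤1+n (a * suc s) ⟩
        N s           ≡⟨ ℕ.*-identityʳ (N s) ⟨
        N s ^ 1       ≤⟨ ℕ.^-monoʳ-≤ (N s) (1≤exponent d⁻ ℓ⁻ K K) ⟩
        N s ^ T       ≤⟨ ℕ.m≤n*m (N s ^ T) n₁ {{ℕ.>-nonZero 1≤n₁}} ⟩
        height s      ∎
        where open ≤-Reasoning

    -- Four factors K / (K + 1): three from the framed packing, and one because `n` lies between two
    -- consecutive heights.
    lower-bound : ∃[ N₀ ] (∀ n → N₀ ≤ n → ∃[ m ] FreeGraphSize (3 + d⁻) n (5 * (3 + d⁻) ∸ 8) 5 m ×
      (K * K * K * K) * (n * n) ≤ (m * (suc d⁻ + (2 + d⁻) * (2 + d⁻))) * (suc K * suc K * suc K * suc K))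
    lower-bound = height s₀ , λ n large → from n (last-below height n s₀ large (ℕ.≤-<-trans (ℕ.m≤n+m n s₀) (unbounded (s₀ + n))))
      where
      from : ∀ n → ∃[ s ] s₀ ≤ s × height s ≤ n × n < height (suc s) → ∃[ m ] FreeGraphSize r n (5 * r ∸ 8) 5 m ×
               (K * K * K * K) * (n * n) ≤ (m * ρ) * (suc K * suc K * suc K * suc K)
      from n (s , s₀≤s , fits , n<) = _ , dense d⁻ ℓ⁻ K K s n fits , (begin
        (K * K * K * K) * (n * n)                                     ≤⟨ ℕ.*-monoʳ-≤ (K * K * K * K) (ℕ.*-mono-≤ (ℕ.<⇒≤ n<) (ℕ.<⇒≤ n<)) ⟩
        (K * K * K * K) * ((n₁ * Y′) * (n₁ * Y′))                     ≡⟨ shift₁ K n₁ Y′ ⟩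
        ((K * K * K) * (n₁ * n₁)) * (K * (Y′ * Y′))                   ≤⟨ ℕ.*-mono-≤ frame-loss (period-loss s s₀≤s) ⟩
        ((((ℓ * Q) * 2 * ρ) * M₁) * (k * k * k)) * (k * (Y * Y))      ≡⟨ shift₂ (ℓ * Q) ρ M₁ k Y ⟩
        ((((M₁ * (Y * Y)) * (ℓ * Q)) * 2) * ρ) * (k * k * k * k)      ∎)
        where
        open ≤-Reasoning
        k = suc K
        Y = N s ^ T
        Y′ = N (suc s) ^ T
        shift₁ : ∀ k n y → (k * k * k * k) * ((n * y) * (n * y)) ≡ ((k * k * k) * (n * n)) * (k * (y * y))
        shift₁ = solve-∀
        shift₂ : ∀ s p m k y → (((s * 2 * p) * m) * (k * k * k)) * (k * (y * y)) ≡ ((((m * (y * y)) * s) * 2) * p) * (k * k * k * k)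
        shift₂ = solve-∀

-- From the two bounds to convergence.

module Limit where

  open import Defs
  open FreeGraphs
  open LowerBound
  open import Data.Integer.Base as ℤ using (ℤ; +_; -[1+_]; +[1+_]; +0; _⊖_)
  import Data.Integer.Properties as ℤ
  open import Data.Nat.Base as ℕ using (ℕ; suc; _+_; _*_; _∸_; _^_; _≤_; _<_; _≥_; _⊔_; s≤s; z≤n; NonZero)
  open import Data.Nat.Properties as ℕ using (module ≤-Reasoning)
  open import Data.Nat.Tactic.RingSolver using (solve-∀)
  open import Data.Product.Base using (∃-syntax; _×_; _,_; proj₁; proj₂)
  open import Data.Rational.Base as ℚ using (ℚ; mkℚ; 0ℚ; _/_; *<*; toℚᵘ)
  import Data.Rational.Properties as ℚ
  open import Data.Rational.Unnormalised.Base as ℚᵘ using (ℚᵘ; mkℚᵘ; *<*; _≃_)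
  import Data.Rational.Unnormalised.Properties as ℚᵘ
  open import Data.Sum.Base using (inj₁; inj₂)
  open import Relation.Binary.PropositionalEquality

  ∣⊖∣*-≤ : ∀ a b k c → a * k ≤ b * k + c → b * k ≤ a * k + c → ℤ.∣ a ⊖ b ∣ * k ≤ c
  ∣⊖∣*-≤ a b k c a≤ b≤ with ℕ.≤-total a b
  ... | inj₁ le = ℕ.≤-trans (ℕ.≤-reflexive (trans (cong (_* k) (ℤ.∣⊖∣-≤ le)) (ℕ.*-distribʳ-∸ k b a))) (ℕ.m≤n+o⇒m∸n≤o (b * k) (a * k) b≤)
  ... | inj₂ ge = ℕ.≤-trans (ℕ.≤-reflexive (trans (cong (_* k) (trans (ℤ.∣m⊖n∣≡∣n⊖m∣ a b) (ℤ.∣⊖∣-≤ ge))) (ℕ.*-distribʳ-∸ k a b))) (ℕ.m≤n+o⇒m∸n≤o (a * k) (b * k) a≤)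

  -- The distance is |m ρ - z| / (z ρ), at most 1 / (k ρ) for the denominator k of `ε`. As ρ ≥ 2,
  -- this is less than 1 / k, which is at most `ε`.
  close : ∀ m z ρ .{{_ : NonZero z}} .{{_ : NonZero ρ}} ε → 0ℚ ℚ.< ε → 2 ≤ ρ →
          (m * ρ) * ℚ.↧ₙ ε ≤ z * ℚ.↧ₙ ε + z → z * ℚ.↧ₙ ε ≤ (m * ρ) * ℚ.↧ₙ ε + z →
          ℚ.∣ (+ m / z) ℚ.- (+ 1 / ρ) ∣ ℚ.< ε
  close m z ρ (mkℚ +0 q _) (*<* (ℤ.+<+ ())) _ _ _
  close m z ρ (mkℚ -[1+ p ] q _) (*<* ()) _ _ _
  close m (suc z⁻) (suc ρ⁻) ε@(mkℚ +[1+ p ] q _) _ 2≤ρ above below =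
    ℚ.toℚᵘ-cancel-< (ℚᵘ.<-respˡ-≃ (ℚᵘ.≃-sym value) (*<* (subst₂ ℤ._<_ (ℤ.pos-* ℤ.∣ num ∣ k) (ℤ.pos-* (suc p) (z * ρ)) (ℤ.+<+ small))))
    where
    z ρ k : ℕ
    z = suc z⁻
    ρ = suc ρ⁻
    k = suc q
    num : ℤ
    num = (+ m ℤ.* + ρ) ℤ.+ (ℤ.- (+ 1)) ℤ.* + z
    value : toℚᵘ (ℚ.∣ (+ m / z) ℚ.- (+ 1 / ρ) ∣) ≃ ℚᵘ.∣ mkℚᵘ (+ m) z⁻ ℚᵘ.- mkℚᵘ (+ 1) ρ⁻ ∣
    value = ℚᵘ.≃-trans (ℚ.toℚᵘ-homo-∣-∣ ((+ m / z) ℚ.- (+ 1 / ρ))) (ℚᵘ.∣-∣-cong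
      (ℚᵘ.≃-trans (ℚ.toℚᵘ-homo-+ (+ m / z) (ℚ.- (+ 1 / ρ))) (ℚᵘ.+-cong (ℚ.toℚᵘ-fromℚᵘ (mkℚᵘ (+ m) z⁻))
        (ℚᵘ.≃-trans (ℚ.toℚᵘ-homo‿- (+ 1 / ρ)) (ℚᵘ.-‿cong (ℚ.toℚᵘ-fromℚᵘ (mkℚᵘ (+ 1) ρ⁻)))))))
    num≡ : num ≡ (m * ρ) ⊖ z
    num≡ = trans (cong₂ ℤ._+_ (sym (ℤ.pos-* m ρ)) (ℤ.-1*i≡-i (+ z))) (ℤ.m-n≡m⊖n (m * ρ) z)
    small : ℤ.∣ num ∣ * k < suc p * (z * ρ)
    small = begin-strict
      ℤ.∣ num ∣ * k           ≡⟨ cong (λ i → ℤ.∣ i ∣ * k) num≡ ⟩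
      ℤ.∣ (m * ρ) ⊖ z ∣ * k   ≤⟨ ∣⊖∣*-≤ (m * ρ) z k z above below ⟩
      z                       <⟨ ℕ.m<m*n z ρ 2≤ρ ⟩
      z * ρ                   ≤⟨ ℕ.m≤n*m (z * ρ) (suc p) ⟩
      suc p * (z * ρ)         ∎
      where open ≤-Reasoning

  -- (k − 1) (K + 1)⁴ ≤ k K⁴ for K = 4 k
  four-losses : ∀ j → j * (suc (4 * suc j) * suc (4 * suc j) * suc (4 * suc j) * suc (4 * suc j)) ≤
                      suc j * ((4 * suc j) * (4 * suc j) * (4 * suc j) * (4 * suc j))
  four-losses j = ℕ.≤-trans (ℕ.m≤m+n _ (160 * j * j * j + 560 * j * j + 655 * j + 256)) (ℕ.≤-reflexive (sym (expand j)))
    where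
    expand : ∀ j → (1 + j) * ((4 * (1 + j)) * (4 * (1 + j)) * (4 * (1 + j)) * (4 * (1 + j))) ≡
                   j * ((1 + 4 * (1 + j)) * (1 + 4 * (1 + j)) * (1 + 4 * (1 + j)) * (1 + 4 * (1 + j))) + (160 * j * j * j + 560 * j * j + 655 * j + 256)
    expand = solve-∀

  module _ (d⁻ : ℕ) (F : ℕ → ℕ)
           (maximal : ∀ n → IsMaximum (FreeGraphSize (3 + d⁻) n (5 * (3 + d⁻) ∸ 8) 5) (F n)) where

    private

      r ρ : ℕ
      r = 3 + d⁻
      ρ = suc d⁻ + (2 + d⁻) * (2 + d⁻)

      -- The linear error term 9 n ρ k is at most n² from n = 9 ρ k on.
      above : ∀ k n → 9 * ρ * k ≤ n → (F n * ρ) * k ≤ (n * n) * k + n * n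
      above k n large with proj₁ (maximal n)
      ... | G , _ , free , size = begin
        (F n * ρ) * k                    ≡⟨ cong (λ m → (m * ρ) * k) size ⟨
        (numEdges G * ρ) * k             ≤⟨ ℕ.*-monoˡ-≤ k (free-size-bound G (s≤s (s≤s (s≤s z≤n))) free ρ refl) ⟩
        (n * n + 9 * n * ρ) * k          ≡⟨ shift n ρ k ⟩
        (n * n) * k + n * (9 * ρ * k)    ≤⟨ ℕ.+-monoʳ-≤ ((n * n) * k) (ℕ.*-monoʳ-≤ n large) ⟩
        (n * n) * k + n * n              ∎
        where
        open ≤-Reasoning
        shift : ∀ n p k → (n * n + 9 * n * p) * k ≡ (n * n) * k + n * (9 * p * k)
        shift = solve-∀

      below : ∀ k → ∃[ N₀ ] (∀ n → N₀ ≤ n → (n * n) * suc k ≤ (F n * ρ) * suc k + n * n)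
      below j = let N₀ , graphs = lower-bound d⁻ K in N₀ , λ n large → from n (graphs n large)
        where
        K k⁴ : ℕ
        K = 4 * suc j
        k⁴ = suc K * suc K * suc K * suc K
        from : ∀ n → ∃[ m ] FreeGraphSize r n (5 * r ∸ 8) 5 m × (K * K * K * K) * (n * n) ≤ (m * ρ) * k⁴ →
               (n * n) * suc j ≤ (F n * ρ) * suc j + n * n
        from n (m , free , dense) = begin
          (n * n) * suc j                   ≡⟨ ℕ.*-suc (n * n) j ⟩
          n * n + (n * n) * j               ≡⟨ ℕ.+-comm (n * n) ((n * n) * j) ⟩
          (n * n) * j + n * n               ≤⟨ ℕ.+-monoˡ-≤ (n * n) (ℕ.*-cancelʳ-≤ ((n * n) * j) ((F n * ρ) * suc j) k⁴ chain) ⟩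
          (F n * ρ) * suc j + n * n         ∎
          where
          open ≤-Reasoning
          shift₁ : ∀ z j k → (z * j) * k ≡ z * (j * k)
          shift₁ = solve-∀
          shift₂ : ∀ z j k → z * (j * k) ≡ j * (k * z)
          shift₂ = solve-∀
          shift₃ : ∀ m p j k → j * ((m * p) * k) ≡ ((m * p) * j) * k
          shift₃ = solve-∀
          chain : ((n * n) * j) * k⁴ ≤ ((F n * ρ) * suc j) * k⁴
          chain = begin
            ((n * n) * j) * k⁴                      ≡⟨ shift₁ (n * n) j k⁴ ⟩
            (n * n) * (j * k⁴)                      ≤⟨ ℕ.*-monoʳ-≤ (n * n) (four-losses j) ⟩
            (n * n) * (suc j * (K * K * K * K))     ≡⟨ shift₂ (n * n) (suc j) (K * K * K * K) ⟩
            suc j * ((K * K * K * K) * (n * n))     ≤⟨ ℕ.*-monoʳ-≤ (suc j) dense ⟩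
            suc j * ((m * ρ) * k⁴)                  ≡⟨ shift₃ m ρ (suc j) k⁴ ⟩
            ((m * ρ) * suc j) * k⁴                  ≤⟨ ℕ.*-monoˡ-≤ k⁴ (ℕ.*-monoˡ-≤ (suc j) (ℕ.*-monoˡ-≤ ρ
                                                         (proj₂ (maximal n) free))) ⟩
            ((F n * ρ) * suc j) * k⁴                ∎

      r²-r-1 : r ^ 2 ∸ r ∸ 1 ≡ ρ
      r²-r-1 = trans (cong (λ z → z ∸ r ∸ 1) (square d⁻)) (cong (_∸ 1) (ℕ.m+n∸m≡n r (suc ρ)))
        where
        square : ∀ x → (3 + x) * ((3 + x) * 1) ≡ (3 + x) + (1 + ((1 + x) + (2 + x) * (2 + x)))
        square = solve-∀

      2≤ρ : 2 ≤ ρ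
      2≤ρ = ℕ.≤-trans (ℕ.m≤m+n 2 2) (ℕ.≤-trans (ℕ.*-mono-≤ {2} {2 + d⁻} {2} {2 + d⁻} (s≤s (s≤s z≤n)) (s≤s (s≤s z≤n))) (ℕ.m≤n+m _ (suc d⁻)))

    limit : ∀ (r≥3 : 3 + d⁻ ≥ 3) → (λ n → F n /[ n ]²) ConvergesTo
              ((+ 1 / ((3 + d⁻) ^ 2 ∸ (3 + d⁻) ∸ 1)) {{r²-r-1≢0 r≥3}})
    limit r≥3 ε 0<ε =
      let N₀ , low = below (ℚ.denominator-1 ε)
          k = ℚ.↧ₙ ε
      in N₀ ⊔ (9 * ρ * k) , λ n n≥ →
        let square : n ^ 2 ≡ n * n
            square = cong (n *_) (ℕ.*-identityʳ n)
        in close (F n) (n ^ 2) (r ^ 2 ∸ r ∸ 1) {{ℕ.m^n≢0 n 2}} {{r²-r-1≢0 r≥3}} ε 0<ε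
          (subst (2 ≤_) (sym r²-r-1) 2≤ρ)
          (subst₂ (λ p z → (F n * p) * k ≤ z * k + z) (sym r²-r-1) (sym square) (above k n (ℕ.≤-trans (ℕ.m≤n⊔m N₀ (9 * ρ * k)) n≥)))
          (subst₂ (λ p z → z * k ≤ (F n * p) * k + z) (sym r²-r-1) (sym square) (low n (ℕ.≤-trans (ℕ.m≤m⊔n N₀ (9 * ρ * k)) n≥)))

  -- Stated for an arbitrary maximum F: the search that computes f⁽ r ⁾ must not be unfolded.
  maximum-limit : ∀ {r d⁻} → r ≡ 3 + d⁻ → (F : ℕ → ℕ) → (∀ n → IsMaximum (FreeGraphSize r n (5 * r ∸ 8) 5) (F n)) →
    ∀ (r≥3 : r ≥ 3) → (λ n → F n /[ n ]²) ConvergesTo ((+ 1 / (r ^ 2 ∸ r ∸ 1)) {{r²-r-1≢0 r≥3}})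
  maximum-limit {d⁻ = d⁻} refl F maximal r≥3 = limit d⁻ F maximal r≥3

open import Defs
open import Data.Integer.Base using (+_)
open import Data.Nat.Base using (ℕ; _*_; _∸_; _^_; _≥_)
open import Data.Nat.Properties using (m+[n∸m]≡n)
open import Data.Product.Base using (proj₂)
open import Data.Rational.Base using (_/_)
open import Relation.Binary.PropositionalEquality using (sym)
open Limit using (maximum-limit)

theorem1p1 : ∀ (r : ℕ) (r≥3 : r ≥ 3) →
    (λ n → f⁽ r ⁾ n (5 * r ∸ 8) 5 /[ n ]²) ConvergesTo
    ((+ 1 / (r ^ 2 ∸ r ∸ 1)) {{r²-r-1≢0 r≥3}})
theorem1p1 r r≥3 = maximum-limit (sym (m+[n∸m]≡n r≥3)) (λ n → f⁽ r ⁾ n (5 * r ∸ 8) 5)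
  (λ n → proj₂ (maxFreeGraphSize r n (5 * r ∸ 8) 5)) r≥3
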